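{- Let $\lambda$ be a partition and let $n\ge|\lambda|$. Let $\mu^{(1)},\dots,\mu^{(r)}$ be the partitions $\mu$ of $|\lambda|$ with $\mu<\lambda$ strictly in dominance order, listed in any fixed order. Let $D$ be the determinant of the $(r+1)\times(r+1)$ matrix whose first row is $$\big(m_\lambda[X],\,m_{\mu^{(1)}}[X],\dots,m_{\mu^{(r)}}[X]\big)$$ and whose row $s+1$ ($1\le s\le r$) is $$\big(\langle m_\lambda[X]\rangle_{\lambda',\mu^{(s)\prime}},\,\langle m_{\mu^{(1)}}[X]\rangle_{\lambda',\mu^{(s)\prime}},\dots,\langle m_{\mu^{(r)}}[X]\rangle_{\lambda',\mu^{(s)\prime}}\big).$$ Then $$J_\lambda(X;q,t)=\frac{c_\lambda(q,t)}{u_\lambda(t,q)}\,D.$$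
   Context: $X=x_1+\cdots+x_n$ and $m_\mu[X]$ is the monomial symmetric polynomial in $x_1,\dots,x_n$. $J_\lambda(X;q,t)$ is Macdonald's integral form of the Macdonald polynomial. Dominance order: for $|\lambda|=|\mu|$, $\lambda\le\mu$ iff $\lambda_1+\cdots+\lambda_i\le\mu_1+\cdots+\mu_i$ for all $i$; $\mu'$ denotes the conjugate partition. For $\beta\in\mathbb{N}^n$, $[|\beta|]_{t,q}=t^{\beta_1}q^{n-1}+t^{\beta_2}q^{n-2}+\cdots+t^{\beta_n}$. Divided differences on polynomials in $x_1,\dots,x_{2n}$: $\partial_i f=(f-\sigma_if)/(x_i-x_{i+1})$, $\sigma_i$ exchanging $x_i,x_{i+1}$; $\partial_{\omega}=(\partial_{2n-1})(\partial_{2n-2}\partial_{2n-1})\cdots(\partial_1\partial_2\cdots\partial_{2n-1})$. Scalar product $\langle f,g\rangle=\partial_\omega(fg)$. For $I\in\mathbb{Z}^{2n}$, $\bar x^I=(-x_1)^{I_1}\cdots(-x_{2n})^{I_{2n}}$; $\rho=(0,1,\dots,2n-1)$; for $\alpha\in\mathbb{N}^n$, $\alpha'=(0,\dots,0,\alpha_1,\dots,\alpha_n)\in\mathbb{N}^{2n}$ ($n$ zeros). For a symmetric polynomial $f$ in $x_1,\dots,x_n$ (viewed as a polynomial in $x_1,\dots,x_{2n}$) and partitions $\kappa,\nu$ with at most $n$ parts, $\langle f\rangle_{\kappa\nu}=\sum_\alpha\langle\bar x^{\rho-\alpha'},f\rangle\big([|\kappa|]_{t,q}-[|\alpha|]_{t,q}\big)$,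 summed over the distinct permutations $\alpha\in\mathbb{N}^n$ of $\nu$. $u_\lambda(t,q)=\prod_{\mu<\lambda}\big([|\lambda'|]_{t,q}-[|\mu'|]_{t,q}\big)$ over partitions $\mu$ of $|\lambda|$ strictly dominated by $\lambda$. $c_\lambda(q,t)=\prod_{(i,j)\in\lambda}\big(1-q^{\lambda_i-j}t^{\lambda'_j-i+1}\big)$, product over cells $(i,j)$ of the diagram of $\lambda$. -}

module Defs where

open import Data.Nat as ℕ using (ℕ; zero; suc; _≤_; _<_; _∸_; _⊔_; _≡ᵇ_)
open import Data.Integer as ℤ using (ℤ; +_; -[1+_]; +0)
open import Data.List as L using (List; []; _∷_; _++_; map; concatMap; foldr; upTo; length; filter; filterᵇ; take)
open import Data.Nat.ListAction using (sum)
open import Data.List.Relation.Unary.All using (All)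
open import Data.Vec as V using (Vec; []; _∷_)
open import Data.Vec.Properties using (≡-dec)
open import Data.Fin using (toℕ)
open import Data.Product using (Σ; ∃; _×_; _,_)
open import Data.Bool using (Bool; true; false; if_then_else_; _∧_)
open import Data.Unit using (⊤)
open import Relation.Nullary using (¬_)
open import Relation.Nullary.Decidable using (⌊_⌋)
open import Relation.Binary.PropositionalEquality using (_≡_)

-- Laurent polynomials in the variables q, t, x_1, ..., x_{2n} over ℤ.
-- Exponent vector: position 0 = q, position 1 = t, position (1+i) = x_i
-- (1 ≤ i ≤ 2n).  A polynomial is a finite formal sum of terms
-- (exponent , coefficient); equality is equality of all coefficients.

record Exp (n : ℕ) : Set where
  constructor mkE
  field vec : Vec ℤ (2 ℕ.+ (n ℕ.+ n))
open Exp public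

Poly : ℕ → Set
Poly n = List (Exp n × ℤ)

zeroExp : ∀ {n} → Exp n
zeroExp = mkE (V.replicate _ +0)

getV : ∀ {k} → ℕ → Vec ℤ k → ℤ
getV _ [] = +0
getV zero (a ∷ v) = a
getV (suc j) (a ∷ v) = getV j v

setV : ∀ {k} → ℕ → ℤ → Vec ℤ k → Vec ℤ k
setV _ _ [] = []
setV zero b (a ∷ v) = b ∷ v
setV (suc j) b (a ∷ v) = a ∷ setV j b v

getE : ∀ {n} → ℕ → Exp n → ℤ
getE j e = getV j (vec e)

setE : ∀ {n} → ℕ → ℤ → Exp n → Exp n
setE j b e = mkE (setV j b (vec e))

sumZ : List ℤ → ℤ
sumZ = foldr ℤ._+_ +0

coeff : ∀ {n} → Poly n → Exp n → ℤ
coeff p e = sumZ (map (λ { (e′ , c) → if ⌊ ≡-dec ℤ._≟_ (vec e′) (vec e) ⌋ then c else +0 }) p)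

infix 4 _≈P_
_≈P_ : ∀ {n} → Poly n → Poly n → Set
p ≈P r = ∀ e → coeff p e ≡ coeff r e

mono : ∀ {n} → Exp n → ℤ → Poly n
mono e c = (e , c) ∷ []

cst : ∀ {n} → ℤ → Poly n
cst c = mono zeroExp c

0P 1P : ∀ {n} → Poly n
0P = []
1P = cst (+ 1)

infixl 6 _+P_ _-P_
infixl 7 _*P_

_+P_ : ∀ {n} → Poly n → Poly n → Poly n
p +P r = p ++ r

negP : ∀ {n} → Poly n → Poly n
negP = map (λ { (e , c) → (e , ℤ.- c) })

_-P_ : ∀ {n} → Poly n → Poly n → Poly n
p -P r = p ++ negP r

_*P_ : ∀ {n} → Poly n → Poly n → Poly n
p *P r = concatMap (λ { (e , c) → map (λ { (e′ , c′) → (mkE (V.zipWith ℤ._+_ (vec e) (vec e′)) , c ℤ.* c′) }) r }) p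

sumP : ∀ {n} → List (Poly n) → Poly n
sumP = foldr _+P_ 0P

prodP : ∀ {n} → List (Poly n) → Poly n
prodP = foldr _*P_ 1P

negOnePow : ℕ → ℤ
negOnePow zero = + 1
negOnePow (suc k) = ℤ.- negOnePow k

varP : ∀ {n} → ℕ → Poly n
varP j = mono (setE j (+ 1) zeroExp) (+ 1)

qP tP : ∀ {n} → Poly n
qP = varP 0
tP = varP 1

xP : ∀ {n} → ℕ → Poly n
xP i = varP (suc i)

qt : ∀ {n} → ℕ → ℕ → Poly n
qt a b = mono (setE 0 (+ a) (setE 1 (+ b) zeroExp)) (+ 1)

oneTo : ℕ → List ℕ
oneTo k = map suc (upTo k)

-- Divided differences  ∂_i f = (f - σ_i f)/(x_i - x_{i+1})  (1 ≤ i ≤ 2n-1),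
-- written out on (Laurent) monomials:  with a, b the exponents of x_i, x_{i+1},
--   (x_i^a x_{i+1}^b - x_i^b x_{i+1}^a)/(x_i - x_{i+1})
--     =  Σ_{k=0}^{a-b-1} x_i^{a-1-k} x_{i+1}^{b+k}      if a > b,
--     =  0                                             if a = b,
--     = -Σ_{k=0}^{b-a-1} x_i^{b-1-k} x_{i+1}^{a+k}      if a < b.

ddAux : ∀ {n} → ℕ → Exp n → ℤ → ℤ → ℤ → ℤ → Poly n
ddAux i e c a b (+ zero) = []
ddAux i e c a b (+ suc m) =
  map (λ k → (setE (suc i) (a ℤ.- + 1 ℤ.- + k) (setE (suc (suc i)) (b ℤ.+ + k) e) , c)) (upTo (suc m))
ddAux i e c a b -[1+ m ] =
  map (λ k → (setE (suc i) (b ℤ.- + 1 ℤ.- + k) (setE (suc (suc i)) (a ℤ.+ + k) e) , ℤ.- c)) (upTo (suc m))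

ddMono : ∀ {n} → ℕ → Exp n × ℤ → Poly n
ddMono i (e , c) = ddAux i e c (getE (suc i) e) (getE (suc (suc i)) e) (getE (suc i) e ℤ.- getE (suc (suc i)) e)

∂ : ∀ {n} → ℕ → Poly n → Poly n
∂ i p = concatMap (ddMono i) p

chainA : (n : ℕ) → ℕ → Poly n → Poly n
chainA n k f = foldr ∂ f (map (k ℕ.+_) (upTo ((n ℕ.+ n) ∸ k)))

∂ω : (n : ℕ) → Poly n → Poly n
∂ω n f = foldr (chainA n) f (map (λ j → (n ℕ.+ n ∸ 1) ∸ j) (upTo (n ℕ.+ n ∸ 1)))

scal : (n : ℕ) → Poly n → Poly n → Poly n
scal n f g = ∂ω n (f *P g)

Decr : List ℕ → Set
Decr [] = ⊤
Decr (a ∷ []) = ⊤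
Decr (a ∷ b ∷ l) = b ≤ a × Decr (b ∷ l)

IsPartition : List ℕ → Set
IsPartition l = Decr l × All (0 <_) l

size : List ℕ → ℕ
size = sum

conjAt : List ℕ → ℕ → ℕ
conjAt l j = length (filter (j ℕ.≤?_) l)

conj : List ℕ → List ℕ
conj l = map (conjAt l) (oneTo (foldr _⊔_ 0 l))

_⊴_ : List ℕ → List ℕ → Set
μ ⊴ l = ∀ i → sum (take i μ) ≤ sum (take i l)

_◁_ : List ℕ → List ℕ → Set
μ ◁ l = μ ⊴ l × ¬ (μ ≡ l)

StrictlyBelow : List ℕ → List ℕ → Set
StrictlyBelow la mu = IsPartition mu × size mu ≡ size la × mu ◁ la

pad : (n : ℕ) → List ℕ → Vec ℕ n
pad zero _ = []
pad (suc n) [] = 0 ∷ pad n []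
pad (suc n) (a ∷ l) = a ∷ pad n l

vecsBelow : (k B : ℕ) → List (Vec ℕ k)
vecsBelow zero B = [] ∷ []
vecsBelow (suc k) B = concatMap (λ a → map (a ∷_) (vecsBelow k B)) (upTo (suc B))

countV : ∀ {k} → ℕ → Vec ℕ k → ℕ
countV v w = length (filterᵇ (v ≡ᵇ_) (V.toList w))

allB : List Bool → Bool
allB = foldr _∧_ true

isPermOf : ∀ {k} → ℕ → Vec ℕ k → Vec ℕ k → Bool
isPermOf B ν β = allB (map (λ v → countV v β ≡ᵇ countV v ν) (upTo (suc B)))

perms : ∀ {k} → Vec ℕ k → List (Vec ℕ k)
perms {k} ν = filterᵇ (isPermOf B ν) (vecsBelow k B)
  where B = V.sum ν

-- Monomial symmetric polynomial m_μ[X] in x_1, ..., x_n (inside x_1..x_{2n})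

xMono : (n : ℕ) → Vec ℕ n → Poly n
xMono n α = mono (mkE (+0 ∷ +0 ∷ (V.map +_ α V.++ V.replicate n +0))) (+ 1)

mSym : (n : ℕ) → List ℕ → Poly n
mSym n mu = sumP (map (xMono n) (perms (pad n mu)))

brk : ∀ {n k} → Vec ℕ k → Poly n
brk [] = 0P
brk {k = suc k} (b ∷ bs) = qt k b +P brk bs

-- x̄^I = (-x_1)^{I_1} ⋯ (-x_{2n})^{I_{2n}}
xbar : (n : ℕ) → Vec ℤ (n ℕ.+ n) → Poly n
xbar n I = mono (mkE (+0 ∷ +0 ∷ I)) (negOnePow ℤ.∣ V.foldr _ ℤ._+_ +0 I ∣)

rhoMinus : (n : ℕ) → Vec ℕ n → Vec ℤ (n ℕ.+ n)
rhoMinus n α = V.zipWith ℤ._-_ (V.tabulate (λ j → + toℕ j)) (V.map +_ (V.replicate n 0 V.++ α))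

angle : (n : ℕ) → Poly n → List ℕ → List ℕ → Poly n
angle n f κ ν = sumP (map (λ α → scal n (xbar n (rhoMinus n α)) f *P (brk (pad n κ) -P brk α)) (perms (pad n ν)))

uPoly : (n : ℕ) → List ℕ → List (List ℕ) → Poly n
uPoly n la ms = prodP (map (λ mu → brk (pad n (conj la)) -P brk (pad n (conj mu))) ms)

cFactors : (n : ℕ) → List ℕ → ℕ → List ℕ → List (Poly n)
cFactors n la i [] = []
cFactors n la i (a ∷ rest) =
  map (λ j → 1P -P qt (a ∸ j) (suc (conjAt la j) ∸ i)) (oneTo a) ++ cFactors n la (suc i) rest

cPoly : (n : ℕ) → List ℕ → Poly n
cPoly n la = prodP (cFactors n la 1 la)

deleteAt : ∀ {A : Set} → ℕ → List A → List A
deleteAt _ [] = []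
deleteAt zero (a ∷ l) = l
deleteAt (suc j) (a ∷ l) = a ∷ deleteAt j l

indexed : ∀ {A : Set} → ℕ → List A → List (ℕ × A)
indexed j [] = []
indexed j (a ∷ l) = (j , a) ∷ indexed (suc j) l

detN : ∀ {n} → ℕ → List (List (Poly n)) → Poly n
detN zero _ = 1P
detN (suc k) [] = 1P
detN (suc k) (r ∷ rs) =
  sumP (map (λ { (j , a) → cst (negOnePow j) *P a *P detN k (map (deleteAt j) rs) }) (indexed 0 r))

det : ∀ {n} → List (List (Poly n)) → Poly n
det M = detN (length M) M

Dmat : (n : ℕ) → List ℕ → List (List ℕ) → List (List (Poly n))
Dmat n la ms = map (mSym n) cols ∷ map (λ mu → map (λ c → angle n (mSym n c) (conj la) (conj mu)) cols) ms
  where cols = la ∷ ms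

Ddet : (n : ℕ) → List ℕ → List (List ℕ) → Poly n
Ddet n la ms = det (Dmat n la ms)

-- Macdonald's integral form J_λ(x_1,…,x_n;q,t) = c_λ(q,t) P_λ, where P_λ is
-- characterised (Macdonald, Ch. VI (4.7)) by
--   (a) P_λ = m_λ + Σ_{μ<λ} u_{λμ} m_μ, and
--   (b) D_n^1 P_λ = (Σ_i q^{λ_i} t^{n-i}) P_λ,
-- with D_n^1 = Σ_i A_i T_{q,x_i}, A_i = Π_{j≠i} (t x_i - x_j)/(x_i - x_j).
-- Condition (b) is stated after multiplication by the Vandermonde
-- V = Π_{1≤i<j≤n} (x_i - x_j), using V · A_i = Π_{j≠i}(t x_i - x_j) · V_i,
-- V_i = (-1)^{i-1} Π_{j<k, j,k≠i} (x_j - x_k).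

pairsIn : ℕ → List (ℕ × ℕ)
pairsIn n = concatMap (λ i → map (λ j → (i , j)) (map (i ℕ.+_) (oneTo (n ∸ i)))) (oneTo n)

vandermonde : (n : ℕ) → Poly n
vandermonde n = prodP (map (λ { (i , j) → xP i -P xP j }) (pairsIn n))

Vi : (n : ℕ) → ℕ → Poly n
Vi n i = cst (negOnePow (i ∸ 1)) *P
  prodP (map (λ { (j , k) → xP j -P xP k })
             (filterᵇ (λ { (j , k) → Data.Bool.not (j ≡ᵇ i) ∧ Data.Bool.not (k ≡ᵇ i) }) (pairsIn n)))

numAi : (n : ℕ) → ℕ → Poly n
numAi n i = prodP (map (λ j → tP *P xP i -P xP j) (filterᵇ (λ j → Data.Bool.not (j ≡ᵇ i)) (oneTo n)))

-- T_{q,x_i}: x_i ↦ q x_i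
Tq : ∀ {n} → ℕ → Poly n → Poly n
Tq i = map (λ { (e , c) → (setE 0 (getE 0 e ℤ.+ getE (suc i) e) e , c) })

eigenvalue : (n : ℕ) → List ℕ → Poly n
eigenvalue n la = sumP (map (λ { (i , a) → qt a (n ∸ suc i) }) (indexed 0 (V.toList (pad n la))))

XFree : ∀ {n} → Poly n → Set
XFree p = All (λ { (e , c) → ∀ j → getE (suc (suc j)) e ≡ +0 }) p

IsIntegralMacdonald : (n : ℕ) → List ℕ → Poly n → Set
IsIntegralMacdonald n la J =
  (Σ (List (List ℕ × Poly n)) λ L →
      All (λ { (mu , a) → StrictlyBelow la mu × XFree a }) L
    × J ≈P cPoly n la *P mSym n la +P sumP (map (λ { (mu , a) → a *P mSym n mu }) L))
  × sumP (map (λ i → numAi n i *P Vi n i *P Tq i J) (oneTo n))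
      ≈P eigenvalue n la *P vandermonde n *P J

{-# OPTIONS --safe #-}
-- The map f ↦ ⟨x̄^{ρ-α'}, f⟩ is a sign times ψ(x^ρ y^{n+ρ-α} f), where ψ reads off the sign of an exponent list that
-- fills the staircase.  If J is an eigenvector of D = Σᵢ Aᵢ T_{q,xᵢ}, then also of the operator D⁻ with q, t inverted.
-- The kernel ∏(xᵢ - yⱼ) exchanges D⁻ in x with its analogue in y with q and t swapped; antisymmetrising twice turns
-- this into Σ_α ⟨x̄^{ρ-α'}, J⟩ ([|λ'|] - [|α|]) = 0 over the permutations α of each ν', so every row of the matrix below
-- the first annihilates the vector of monomial coefficients of J.  Comparing sums of squares of exponents shows that
-- the entry at (ν, μ) vanishes unless 2 Σ (n-i) μᵢ + Σ μᵢ² grows strictly from ν to μ or ν = μ, where it equals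
-- [|λ'|] - [|μ'|].  Hence the minor of the first entry is u_λ, and Cramer's rule gives the formula.
module Submission where

open import Defs
open import Algebra.Bundles using (CommutativeRing)
open import Algebra.Structures using (IsCommutativeRing)
import Algebra.Solver.Ring
open import Algebra.Solver.Ring.AlmostCommutativeRing using (fromCommutativeRing; _-Raw-AlmostCommutative⟶_)
open import Data.Bool using (Bool; true; false; not; _∧_; if_then_else_)
open import Data.Empty using (⊥; ⊥-elim)
open import Data.Fin as Fin using (Fin; toℕ)
open import Data.Integer as Z using (ℤ; +_; -[1+_]; +0; -1ℤ)
import Data.Integer.Properties as ZP
open import Data.List as L using (List; []; _∷_; _++_; map; concatMap; foldr; length; upTo; applyUpTo; replicate)
open import Data.List.Membership.Propositional using (_∈_)
import Data.List.Membership.Propositional.Properties as MemP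
import Data.List.Properties as LP
open import Data.List.Relation.Binary.Permutation.Propositional as Perm using (_↭_)
import Data.List.Relation.Binary.Permutation.Propositional.Properties as PermP
open import Data.List.Relation.Unary.All as All using (All; []; _∷_)
import Data.List.Relation.Unary.All.Properties as AllP
open import Data.List.Relation.Unary.AllPairs as AllPairs using (AllPairs; []; _∷_)
import Data.List.Relation.Unary.AllPairs.Properties as AllPairsP
open import Data.List.Relation.Unary.Any using (here; there)
open import Data.List.Relation.Unary.Linked as Linked using (Linked; []; [-]; _∷_)
import Data.List.Relation.Unary.Linked.Properties as LinkedP
open import Data.List.Relation.Unary.Unique.Propositional using (Unique)
import Data.List.Relation.Unary.Unique.Propositional.Properties as UniqueP
open import Data.Maybe using (Maybe; just; nothing)
open import Data.Nat as N using (ℕ; zero; suc; s≤s; z≤n; _≤_; _!)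
open import Data.Nat.ListAction using (sum)
import Data.Nat.ListAction.Properties as SumP
import Data.Nat.Properties as NP
open import Data.Product using (∃; _×_; _,_; proj₁; proj₂)
open import Data.Sum as Sum using (_⊎_; inj₁; inj₂)
open import Data.Unit using (⊤; tt)
open import Data.Vec as V using (Vec; []; _∷_; toList)
import Data.Vec.Properties as VP
open import Function using (_∘_; id; case_of_)
open import Level using (0ℓ)
open import Relation.Binary.Definitions using (tri<; tri≈; tri>)
open import Relation.Binary.PropositionalEquality as P using (_≡_; _≢_; cong; cong₂; subst; module ≡-Reasoning) renaming (trans to infixr 1 _∙_)
open import Relation.Nullary using (¬_; Dec; yes; no)
open import Relation.Nullary.Decidable using (⌊_⌋; T?)

-- The obstacle is division: the Aᵢ have denominators, while polynomials here are formal sums. Every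
-- identity is stated after multiplication by a common multiple, which is shown to be no zero
-- divisor and then cancelled. What keeps this manageable is that Δ Aᵢ is Δ with t xᵢ in place of
-- xᵢ. Inverting q and t is needed because the test polynomials in y have the exponents n - αᵢ: only
-- t⁻¹ turns them into a multiple of [|α|]. That J is an eigenvector of D⁻ follows from commutation.
-- In D D⁻ - D⁻ D the terms with i ≠ j cancel, those with i = j form a multiplication operator, and
-- it is zero because it kills 1. So D⁻ J is an eigenvector of D with the eigenvalue of J, and
-- comparing leading terms leaves only a multiple of J. The kernel is never expanded. Times the
-- Vandermonde products of both alphabets it is the Vandermonde product in all 2n variables, which
-- reproduces antisymmetric polynomials under ψ. Antisymmetric objects are compared through one
-- fact: 2n distinct nonnegative integers with the sum of 0, ..., 2n - 1 are these numbers.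

module IntegerIdentities where
 open import Data.Integer.Solver using (module +-*-Solver)
 open +-*-Solver

 ring1 = solve 3 (λ c x y → :- c :* x :+ :- y := :- (c :* x :+ y)) P.refl
 ring2 = solve 5 (λ c x y u v → c :* (x :+ y) :+ (u :+ v) := (c :* x :+ u) :+ (c :* y :+ v)) P.refl
 ring3 = solve 4 (λ c k x u → c :* (k :* x) :+ k :* u := k :* (c :* x :+ u)) P.refl
 ring4 = solve 4 (λ k c x u → k :* c :* x :+ k :* u := k :* (c :* x :+ u)) P.refl
 ring5 = solve 4 (λ c x d u → c :* x :+ (d :* x :+ u) := (c :* con (+ 1) :+ d) :* x :+ u) P.refl
 ring6 = solve 5 (λ c x d u y → c :* y :+ (d :* x :+ u) := (c :* con +0 :+ d) :* x :+ (c :* y :+ u)) P.refl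
 ring7 = solve 2 (λ i k → i :+ k :+ :- k := i) P.refl
 ring8 = solve 3 (λ x y s → x :+ (y :+ s) := y :+ (x :+ s)) P.refl
 ring9 = solve 3 (λ x y s → x :* (y :* s) := y :* (x :* s)) P.refl
 ring10 = solve 2 (λ y z → z :- y := :- (y :- z)) P.refl
 ring11 = solve 4 (λ s a b c → :- s :* a :* (b :* c) := :- (s :* b :* (a :* c))) P.refl
 ring12 = solve 2 (λ k x → k :* x :+ x := (con (+ 1) :+ k) :* x) P.refl
 ring15 = solve 4 (λ k a x y → (k :+ a) :+ (x :+ y) := (k :+ x) :+ (a :+ y)) P.refl
 ring16 = solve 4 (λ k a x y → (k :- a) :+ (x :- y) := (k :+ x) :- (a :+ y)) P.refl
 ring17 = solve 5 (λ k a x y z → (k :+ a) :* (k :+ a) :+ (x :+ (con (+ 2) :* y :+ z)) := (k :* k :+ x) :+ (con (+ 2) :* (k :* a :+ y) :+ (a :* a :+ z))) P.refl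
 ring18 = solve 5 (λ k a x y z → (k :- a) :* (k :- a) :+ (x :+ (z :- con (+ 2) :* y)) := (k :* k :+ x) :+ ((a :* a :+ z) :- con (+ 2) :* (k :* a :+ y))) P.refl
 ring19 = solve 4 (λ k a l s → (k :* a :+ l :* a) :+ ((k :+ con (+ 1)) :+ l :- con (+ 1)) :* s := (k :+ (con (+ 1) :+ l) :- con (+ 1)) :* (a :+ s)) P.refl
 ring20 = solve 5 (λ k a y l x → k :* a :+ (y :+ ((k :+ con (+ 1)) :+ l) :* x) := (k :* a :+ y) :+ (k :+ (con (+ 1) :+ l)) :* x) P.refl
 ring21 = solve 7 (λ x y w s w' s' i → (x :+ y) :+ (((w :+ w) :+ s) :+ ((w' :+ w') :+ s')) := ((x :+ (con (+ 2) :* w :+ s)) :+ (y :+ (s' :- con (+ 2) :* i))) :+ con (+ 2) :* (i :+ w')) P.refl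
 ring22 = solve 2 (λ x y → (con (+ 1) :+ x) :- (con (+ 1) :+ y) := x :- y) P.refl
 ring23 = solve 3 (λ x y s → (x :+ y :- s) :+ s := x :+ y) P.refl
 ring24 = solve 4 (λ x y d s → (x :+ d) :+ (y :- s) := (x :+ y :- s) :+ d) P.refl
 ring25 = solve 3 (λ c x s → c :* x :+ c :* s := c :* (con (+ 1) :* x :+ s)) P.refl
 ring26 = solve 3 (λ a b c → con (+ 1) :* (a :- b) :+ (b :- c) := a :- c) P.refl
 ring27 = solve 2 (λ c s → :- c :* s := c :* (:- con (+ 1) :* s)) P.refl
 ring28 = solve 1 (λ a → a :- con +0 := a) P.refl
 ring29 = solve 2 (λ a b → a :- (a :- b) := b) P.refl
 ring30 = solve 2 (λ a b → b :+ (a :- b) := a) P.refl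
 ring31 = solve 2 (λ a j → con (+ 1) :+ (a :- con (+ 1) :- j) := a :- j) P.refl
 ring32 = solve 2 (λ b j → con (+ 1) :+ (b :+ j) := b :+ (con (+ 1) :+ j)) P.refl
 ring33 = solve 2 (λ a j → a :- con (+ 1) :- j := a :- (con (+ 1) :+ j)) P.refl
 ring34 = solve 2 (λ a b → :- con (+ 1) :* (a :- b) := b :- a) P.refl
 ring35 = solve 1 (λ x → :- x :* :- x := x :* x) P.refl
 ring36 = solve 3 (λ a s w → a :+ (s :+ (a :+ con (+ 1) :+ w)) := a :+ s :+ (a :+ (con (+ 1) :+ w))) P.refl
 ring37 = solve 3 (λ s w d → s :+ (w :+ d) := s :+ (con +0 :+ w) :+ d) P.refl
 ring38 = solve 3 (λ s x y → s :* :- x :* y := :- (s :* x :* y)) P.refl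
 ring39 = solve 5 (λ q s a r b → q :+ r :+ s :* (a :+ b) := (q :+ s :* a) :+ (r :+ s :* b)) P.refl
 ring40 = solve 3 (λ q s x → q :+ s :* x :+ :- s :* x := q) P.refl
 ring41 = solve 3 (λ q x y → q :+ x :+ y := q :+ y :+ x) P.refl
 ring42 = solve 2 (λ q d → q := :- d :+ (q :+ con (+ 1) :* d)) P.refl
 ring43 = solve 2 (λ t d → t :+ con (+ 1) :* d := d :+ t) P.refl
 ring44 = solve 2 (λ d x → x := d :+ (:- d :+ x)) P.refl
 ring45 = solve 2 (λ s c → s :* (c :* s) := c :* (s :* s)) P.refl
 ring46 = solve 1 (λ k → con (+ 1) :* (con (+ 1) :* k) := k :* con (+ 1)) P.refl
 ring47 = solve 3 (λ x k y → x :* (k :* y) := y :* (x :* k)) P.refl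
 ring48 = solve 4 (λ a b x y → a :+ b :+ (x :+ y) := a :+ x :+ (b :+ y)) P.refl
 ring49 = solve 3 (λ k m a → k :+ (m :- a) := (m :+ k) :- a) P.refl
 ring50 = solve 1 (λ x → (con (+ 1) :- (con (+ 1) :+ x)) :+ con +0 := :- x) P.refl
 ring51 = solve 1 (λ x → (con (+ 1) :- (con (+ 1) :+ x)) :+ con (+ 1) := con (+ 1) :- x) P.refl
 ring52 = solve 2 (λ i x → (con (+ 1) :- ((con (+ 1) :+ i) :+ x)) :+ x := :- i) P.refl
 ring53 = solve 1 (λ x → :- x :+ con (+ 1) := con (+ 1) :- x) P.refl
 ring54 = solve 1 (λ x → :- con (+ 1) :+ (con (+ 1) :- x) := :- x) P.refl
 ring55 = solve 1 (λ x → :- con (+ 1) :* x :+ con +0 := :- x) P.refl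
 ring56 = solve 2 (λ x y → con +0 :+ :- con (+ 1) :* (x :- y) := :- x :+ y) P.refl
 ring57 = solve 3 (λ x y d → (x :+ d) :+ (y :- d) := x :+ y) P.refl
 ring58 = solve 3 (λ x y d → (x :+ (y :- d)) :+ d := x :+ y) P.refl
 ring59 = solve 2 (λ s e → s :* e :* s := s :* s :* e) P.refl

module NaturalIdentities where
 open import Data.Nat.Solver using (module +-*-Solver)
 open +-*-Solver

 ring13 = solve 3 (λ a b c → a :+ (b :+ c) := b :+ (a :+ c)) P.refl
 ring14 = solve 4 (λ s k a w → s :+ (k :* (s :+ a) :+ w) := s :+ k :* s :+ (k :* a :+ w)) P.refl

open IntegerIdentities
open NaturalIdentities

-- Laurent polynomials as a commutative ring

module Polynomials where
 open P using (refl; sym; trans)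

 private variable n : ℕ

 +ˡ : ∀ x {y z : ℤ} → y ≡ z → x Z.+ y ≡ x Z.+ z
 +ˡ x = cong (λ y → x Z.+ y)

 infixl 6 _⊕_
 _⊕_ : Exp n → Exp n → Exp n
 e ⊕ e' = mkE (V.zipWith Z._+_ (vec e) (vec e'))

 ⊕-comm : (e e' : Exp n) → e ⊕ e' ≡ e' ⊕ e
 ⊕-comm e e' = cong mkE (VP.zipWith-comm ZP.+-comm (vec e) (vec e'))

 ⊕-assoc : (a b c : Exp n) → (a ⊕ b) ⊕ c ≡ a ⊕ (b ⊕ c)
 ⊕-assoc a b c = cong mkE (VP.zipWith-assoc ZP.+-assoc (vec a) (vec b) (vec c))

 ⊕-identityˡ : (e : Exp n) → zeroExp ⊕ e ≡ e
 ⊕-identityˡ e = cong mkE (VP.zipWith-identityˡ ZP.+-identityˡ (vec e))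

 -- The pairing of a polynomial with an arbitrary function of exponents. Every operation on formal
 -- sums turns into an identity between such pairings, so terms never have to be sorted or
 -- collected.
 lin : (Exp n → ℤ) → Poly n → ℤ
 lin f [] = +0
 lin f ((e , c) ∷ p) = c Z.* f e Z.+ lin f p

 lin-cong : {f g : Exp n → ℤ} → (∀ e → f e ≡ g e) → (p : Poly n) → lin f p ≡ lin g p
 lin-cong h [] = refl
 lin-cong h ((e , c) ∷ p) = cong₂ Z._+_ (cong (c Z.*_) (h e)) (lin-cong h p)

 lin-++ : (f : Exp n → ℤ) (p r : Poly n) → lin f (p ++ r) ≡ lin f p Z.+ lin f r
 lin-++ f [] r = sym (ZP.+-identityˡ _)
 lin-++ f ((e , c) ∷ p) r = +ˡ (c Z.* f e) (lin-++ f p r) ∙ sym (ZP.+-assoc (c Z.* f e) (lin f p) (lin f r))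

 lin-neg : (f : Exp n → ℤ) (p : Poly n) → lin f (negP p) ≡ Z.- lin f p
 lin-neg f [] = refl
 lin-neg f ((e , c) ∷ p) = +ˡ (Z.- c Z.* f e) (lin-neg f p) ∙ ring1 c (f e) (lin f p)

 lin-0 : (p : Poly n) → lin (λ _ → +0) p ≡ +0
 lin-0 [] = refl
 lin-0 ((e , c) ∷ p) = cong₂ Z._+_ (ZP.*-zeroʳ c) (lin-0 p)

 lin-add : (f g : Exp n → ℤ) (p : Poly n) → lin (λ e → f e Z.+ g e) p ≡ lin f p Z.+ lin g p
 lin-add f g [] = refl
 lin-add f g ((e , c) ∷ p) = +ˡ (c Z.* (f e Z.+ g e)) (lin-add f g p) ∙ ring2 c (f e) (g e) (lin f p) (lin g p)

 lin-scale : (k : ℤ) (f : Exp n → ℤ) (p : Poly n) → lin (λ e → k Z.* f e) p ≡ k Z.* lin f p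
 lin-scale k f [] = sym (ZP.*-zeroʳ k)
 lin-scale k f ((e , c) ∷ p) = +ˡ (c Z.* (k Z.* f e)) (lin-scale k f p) ∙ ring3 c k (f e) (lin f p)

 lin-swap : ∀ {m} (F : Exp n → Exp m → ℤ) (p : Poly n) (r : Poly m) →
   lin (λ e → lin (F e) r) p ≡ lin (λ e' → lin (λ e → F e e') p) r
 lin-swap F [] r = sym (lin-0 r)
 lin-swap F ((e , c) ∷ p) r = begin
   c Z.* lin (F e) r Z.+ lin (λ e → lin (F e) r) p
     ≡⟨ cong₂ Z._+_ (sym (lin-scale c (F e) r)) (lin-swap F p r) ⟩
   lin (λ e' → c Z.* F e e') r Z.+ lin (λ e' → lin (λ e → F e e') p) r
     ≡⟨ sym (lin-add _ _ r) ⟩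
   lin (λ e' → c Z.* F e e' Z.+ lin (λ e → F e e') p) r ∎
   where open ≡-Reasoning

 opaque
   mapE : (Exp n → Exp n) → Poly n → Poly n
   mapE φ = map (λ { (e , c) → (φ e , c) })

   lin-mapE : (φ : Exp n → Exp n) (f : Exp n → ℤ) (p : Poly n) → lin f (mapE φ p) ≡ lin (f ∘ φ) p
   lin-mapE φ f [] = refl
   lin-mapE φ f ((e , c) ∷ p) = +ˡ (c Z.* f (φ e)) (lin-mapE φ f p)
   mapE-mono : (φ : Exp n → Exp n) (e : Exp n) (c : ℤ) → mapE φ ((e , c) ∷ []) ≡ (φ e , c) ∷ []
   mapE-mono φ e c = refl

 infixr 7 _·P_
 _·P_ : ℤ → Poly n → Poly n
 k ·P p = map (λ { (e , c) → (e , k Z.* c) }) p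

 lin-· : (k : ℤ) (f : Exp n → ℤ) (p : Poly n) → lin f (k ·P p) ≡ k Z.* lin f p
 lin-· k f [] = sym (ZP.*-zeroʳ k)
 lin-· k f ((e , c) ∷ p) = +ˡ (k Z.* c Z.* f e) (lin-· k f p) ∙ ring4 k c (f e) (lin f p)

 opaque
   bind : (Exp n → Poly n) → Poly n → Poly n
   bind g = concatMap (λ { (e , c) → c ·P g e })

   lin-bind : (g : Exp n → Poly n) (f : Exp n → ℤ) (p : Poly n) → lin f (bind g p) ≡ lin (λ e → lin f (g e)) p
   lin-bind g f [] = refl
   lin-bind g f ((e , c) ∷ p) = lin-++ f (c ·P g e) (bind g p) ∙ cong₂ Z._+_ (lin-· c f (g e)) (lin-bind g f p)

 lin-* : (f : Exp n → ℤ) (p r : Poly n) → lin f (p *P r) ≡ lin (λ e → lin (λ e' → f (e ⊕ e')) r) p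
 lin-* f [] r = refl
 lin-* f ((e , c) ∷ p) r = lin-++ f (map (λ { (e' , c') → (mkE (V.zipWith Z._+_ (vec e) (vec e')) , c Z.* c') }) r) (p *P r) ∙ cong₂ Z._+_ (row r) (lin-* f p r)
   where
   row : ∀ r → lin f (map (λ { (e' , c') → (mkE (V.zipWith Z._+_ (vec e) (vec e')) , c Z.* c') }) r) ≡ c Z.* lin (λ e' → f (e ⊕ e')) r
   row [] = sym (ZP.*-zeroʳ c)
   row ((e' , c') ∷ r) = +ˡ (c Z.* c' Z.* f (e ⊕ e')) (row r) ∙ ring4 c c' (f (e ⊕ e')) _

 lin-mono : (f : Exp n → ℤ) (e : Exp n) (c : ℤ) → lin f (mono e c) ≡ c Z.* f e
 lin-mono f e c = ZP.+-identityʳ _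

 infix 4 _≋_
 -- Testing against all functions, not only against coefficients, makes it immediate that the
 -- operations respect equality; `coeffs⇒≋` shows that nothing is lost. The wrapper record lets p
 -- and r be inferred from a proof.
 record _≋_ (p r : Poly n) : Set where
   constructor mk≋
   field app : ∀ f → lin f p ≡ lin f r
 open _≋_ public

 _≟E_ : (e e' : Exp n) → Dec (e ≡ e')
 mkE v ≟E mkE w with VP.≡-dec Z._≟_ v w
 ... | yes eq = yes (cong mkE eq)
 ... | no ne = no (λ { refl → ne refl })

 δE : Exp n → Exp n → ℤ
 δE e e' = if ⌊ VP.≡-dec Z._≟_ (vec e') (vec e) ⌋ then + 1 else +0

 δE-refl : (e : Exp n) → δE e e ≡ + 1
 δE-refl e with VP.≡-dec Z._≟_ (vec e) (vec e)
 ... | yes _ = refl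
 ... | no ne = ⊥-elim (ne refl)

 δE-≢ : {e e' : Exp n} → e ≢ e' → δE e e' ≡ +0
 δE-≢ {e = e} {e'} ne with VP.≡-dec Z._≟_ (vec e') (vec e)
 ... | yes eq = ⊥-elim (ne (cong mkE (sym eq)))
 ... | no _ = refl

 coeff-lin : (p : Poly n) (e : Exp n) → coeff p e ≡ lin (δE e) p
 coeff-lin [] e = refl
 coeff-lin ((e' , c) ∷ p) e = cong₂ Z._+_ (aux ⌊ VP.≡-dec Z._≟_ (vec e') (vec e) ⌋) (coeff-lin p e)
   where aux : ∀ b → (if b then c else +0) ≡ c Z.* (if b then + 1 else +0)
         aux true = sym (ZP.*-identityʳ c)
         aux false = sym (ZP.*-zeroʳ c)

 without : Exp n → Poly n → Poly n
 without e [] = []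
 without e ((e' , c) ∷ p) with e ≟E e'
 ... | yes _ = without e p
 ... | no _ = (e' , c) ∷ without e p

 length-without : (e : Exp n) (p : Poly n) → length (without e p) N.≤ length p
 length-without e [] = z≤n
 length-without e ((e' , c) ∷ p) with e ≟E e'
 ... | yes _ = NP.m≤n⇒m≤1+n (length-without e p)
 ... | no _ = s≤s (length-without e p)

 lin-without : (f : Exp n → ℤ) (e : Exp n) (p : Poly n) → lin f p ≡ lin (δE e) p Z.* f e Z.+ lin f (without e p)
 lin-without f e [] = refl
 lin-without f e ((e' , c) ∷ p) with e ≟E e'
 ... | yes refl = +ˡ (c Z.* f e) (lin-without f e p) ∙
     aux c (f e) _ _ ∙ cong (λ z → (c Z.* z Z.+ lin (δE e) p) Z.* f e Z.+ lin f (without e p)) (sym (δE-refl e))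
   where aux = ring5
 ... | no ne = +ˡ (c Z.* f e') (lin-without f e p) ∙
     aux c (f e) _ _ (f e') ∙ cong (λ z → (c Z.* z Z.+ lin (δE e) p) Z.* f e Z.+ (c Z.* f e' Z.+ lin f (without e p))) (sym (δE-≢ ne))
   where aux = ring6

 -- The terms that share the exponent of the first one have total coefficient zero, so all of them
 -- can be removed without changing any pairing. What remains still has zero coefficients and is
 -- shorter; k makes the recursion structural.
 zero-coeffs : (k : ℕ) (p : Poly n) → length p N.≤ k → (∀ e → lin (δE e) p ≡ +0) → ∀ f → lin f p ≡ +0
 zero-coeffs k [] _ h f = refl
 zero-coeffs (suc k) p@((e , c) ∷ p') (s≤s l) h f = begin
   lin f p ≡⟨ lin-without f e p ⟩
   lin (δE e) p Z.* f e Z.+ lin f (without e p) ≡⟨ cong (λ z → z Z.* f e Z.+ lin f (without e p)) (h e) ⟩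
   +0 Z.+ lin f (without e p) ≡⟨ ZP.+-identityˡ _ ⟩
   lin f (without e p) ≡⟨ zero-coeffs k (without e p) shorter vanish f ⟩
   +0 ∎
   where
   open ≡-Reasoning
   shorter : length (without e p) N.≤ k
   shorter with e ≟E e
   ... | yes _ = NP.≤-trans (length-without e p') l
   ... | no ne = ⊥-elim (ne refl)
   vanish : ∀ e' → lin (δE e') (without e p) ≡ +0
   vanish e' with lin-without (δE e') e p
   ... | eq rewrite h e | h e' = sym (eq ∙ ZP.+-identityˡ _)

 coeffs⇒≋ : {p r : Poly n} → (∀ e → lin (δE e) p ≡ lin (δE e) r) → p ≋ r
 coeffs⇒≋ {p = p} {r} h .app f = ZP.i-j≡0⇒i≡j _ _ (begin
   lin f p Z.- lin f r ≡⟨ sym (diff f) ⟩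
   lin f (p -P r) ≡⟨ zero-coeffs _ (p -P r) NP.≤-refl (λ e → diff (δE e) ∙ ZP.i≡j⇒i-j≡0 (h e)) f ⟩
   +0 ∎)
   where
   open ≡-Reasoning
   diff : ∀ f → lin f (p -P r) ≡ lin f p Z.- lin f r
   diff f = lin-++ f p (negP r) ∙ +ˡ (lin f p) (lin-neg f r)

 ≈P⇒≋ : {p r : Poly n} → p ≈P r → p ≋ r
 ≈P⇒≋ {p = p} {r} h = coeffs⇒≋ (λ e → sym (coeff-lin p e) ∙ h e ∙ coeff-lin r e)

 ≋⇒≈P : {p r : Poly n} → p ≋ r → p ≈P r
 ≋⇒≈P {p = p} {r} h e = coeff-lin p e ∙ app h (δE e) ∙ sym (coeff-lin r e)

 ≋-refl : {p : Poly n} → p ≋ p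
 ≋-refl .app f = refl

 ≋-sym : {p r : Poly n} → p ≋ r → r ≋ p
 ≋-sym h .app f = sym (app h f)

 ≋-trans : {p r s : Poly n} → p ≋ r → r ≋ s → p ≋ s
 ≋-trans h k .app f = app h f ∙ app k f

 mapE-cong : (φ : Exp n → Exp n) {p r : Poly n} → p ≋ r → mapE φ p ≋ mapE φ r
 mapE-cong φ {p} {r} h .app f = lin-mapE φ f p ∙ app h _ ∙ sym (lin-mapE φ f r)

 bind-cong : {g h : Exp n → Poly n} {p r : Poly n} → (∀ e → g e ≋ h e) → p ≋ r → bind g p ≋ bind h r
 bind-cong {g = g} {h} {p} {r} gh pr .app f = lin-bind g f p ∙
   app pr _ ∙ lin-cong (λ e → app (gh e) f) r ∙ sym (lin-bind h f r)

 +P-cong : {p p' r r' : Poly n} → p ≋ p' → r ≋ r' → p +P r ≋ p' +P r'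
 +P-cong {p = p} {p'} {r} {r'} a b .app f = lin-++ f p r ∙ cong₂ Z._+_ (app a f) (app b f) ∙ sym (lin-++ f p' r')

 negP-cong : {p r : Poly n} → p ≋ r → negP p ≋ negP r
 negP-cong {p = p} {r} a .app f = lin-neg f p ∙ (cong Z.-_ (app a f)) ∙ sym (lin-neg f r)

 *P-cong : {p p' r r' : Poly n} → p ≋ p' → r ≋ r' → p *P r ≋ p' *P r'
 *P-cong {p = p} {p'} {r} {r'} a b .app f = lin-* f p r ∙
   app a _ ∙ lin-cong (λ e → app b _) p' ∙ sym (lin-* f p' r')

 *P-comm : (p r : Poly n) → p *P r ≋ r *P p
 *P-comm p r .app f = begin
   lin f (p *P r) ≡⟨ lin-* f p r ⟩
   lin (λ e → lin (λ e' → f (e ⊕ e')) r) p ≡⟨ lin-swap (λ e e' → f (e ⊕ e')) p r ⟩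
   lin (λ e' → lin (λ e → f (e ⊕ e')) p) r ≡⟨ lin-cong (λ e' → lin-cong (λ e → cong f (⊕-comm e e')) p) r ⟩
   lin (λ e' → lin (λ e → f (e' ⊕ e)) p) r ≡⟨ sym (lin-* f r p) ⟩
   lin f (r *P p) ∎
   where open ≡-Reasoning

 *P-assoc : (p r s : Poly n) → (p *P r) *P s ≋ p *P (r *P s)
 *P-assoc p r s .app f = begin
   lin f ((p *P r) *P s) ≡⟨ lin-* f (p *P r) s ⟩
   lin (λ e → lin (λ e″ → f (e ⊕ e″)) s) (p *P r) ≡⟨ lin-* _ p r ⟩
   lin (λ e → lin (λ e' → lin (λ e″ → f ((e ⊕ e') ⊕ e″)) s) r) p
     ≡⟨ lin-cong (λ e → lin-cong (λ e' → lin-cong (λ e″ → cong f (⊕-assoc e e' e″)) s) r ∙ sym (lin-* _ r s)) p ⟩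
   lin (λ e → lin (λ e' → f (e ⊕ e')) (r *P s)) p ≡⟨ sym (lin-* f p (r *P s)) ⟩
   lin f (p *P (r *P s)) ∎
   where open ≡-Reasoning

 *P-identityˡ : (p : Poly n) → 1P *P p ≋ p
 *P-identityˡ p .app f = lin-* f 1P p ∙ ZP.+-identityʳ _ ∙ ZP.*-identityˡ _ ∙
   lin-cong (λ e → cong f (⊕-identityˡ e)) p

 *P-distribˡ : (p r s : Poly n) → p *P (r +P s) ≋ p *P r +P p *P s
 *P-distribˡ p r s .app f = begin
   lin f (p *P (r +P s)) ≡⟨ lin-* f p (r +P s) ⟩
   lin (λ e → lin (λ e' → f (e ⊕ e')) (r +P s)) p ≡⟨ lin-cong (λ e → lin-++ _ r s) p ⟩
   lin (λ e → lin (λ e' → f (e ⊕ e')) r Z.+ lin (λ e' → f (e ⊕ e')) s) p ≡⟨ lin-add _ _ p ⟩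
   _ ≡⟨ sym (cong₂ Z._+_ (lin-* f p r) (lin-* f p s)) ⟩
   lin f (p *P r) Z.+ lin f (p *P s) ≡⟨ sym (lin-++ f (p *P r) (p *P s)) ⟩
   lin f (p *P r +P p *P s) ∎
   where open ≡-Reasoning

 +P-comm : (p r : Poly n) → p +P r ≋ r +P p
 +P-comm p r .app f = lin-++ f p r ∙ ZP.+-comm (lin f p) _ ∙ sym (lin-++ f r p)

 +P-assoc : (p r s : Poly n) → (p +P r) +P s ≋ p +P (r +P s)
 +P-assoc p r s .app f = lin-++ f (p +P r) s ∙ cong (Z._+ lin f s) (lin-++ f p r) ∙
   ZP.+-assoc (lin f p) _ _ ∙ +ˡ (lin f p) (sym (lin-++ f r s)) ∙ sym (lin-++ f p (r +P s))

 +P-inverseʳ : (p : Poly n) → p +P negP p ≋ 0P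
 +P-inverseʳ p .app f = lin-++ f p (negP p) ∙ +ˡ (lin f p) (lin-neg f p) ∙ ZP.+-inverseʳ (lin f p)

 -- The ring operations are sealed so that unification treats them as constructors.
 opaque
   addP mulP : Poly n → Poly n → Poly n
   addP = _+P_
   mulP = _*P_
   oppP : Poly n → Poly n
   oppP = negP

 opaque
   unfolding addP

   addP-def : (p r : Poly n) → addP p r ≡ p +P r
   addP-def p r = refl
   mulP-def : (p r : Poly n) → mulP p r ≡ p *P r
   mulP-def p r = refl
   oppP-def : (p : Poly n) → oppP p ≡ negP p
   oppP-def p = refl

   lin-addP : (f : Exp n → ℤ) (p r : Poly n) → lin f (addP p r) ≡ lin f p Z.+ lin f r
   lin-addP = lin-++
   lin-oppP : (f : Exp n → ℤ) (p : Poly n) → lin f (oppP p) ≡ Z.- lin f p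
   lin-oppP = lin-neg
   lin-mulP : (f : Exp n → ℤ) (p r : Poly n) → lin f (mulP p r) ≡ lin (λ e → lin (λ e' → f (e ⊕ e')) r) p
   lin-mulP = lin-*

   isCommutativeRing-P : IsCommutativeRing (_≋_ {n}) addP mulP oppP 0P 1P
   isCommutativeRing-P = record
     { isRing = record
       { +-isAbelianGroup = record
         { isGroup = record
           { isMonoid = record
             { isSemigroup = record
               { isMagma = record
                 { isEquivalence = record { refl = ≋-refl ; sym = ≋-sym ; trans = ≋-trans }
                 ; ∙-cong = +P-cong }
               ; assoc = +P-assoc }
             ; identity = (λ p → ≋-refl) , (λ p → ≋-trans (+P-comm p 0P) ≋-refl) }
           ; inverse = (λ p → ≋-trans (+P-comm (negP p) p) (+P-inverseʳ p)) , +P-inverseʳ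
           ; ⁻¹-cong = negP-cong }
         ; comm = +P-comm }
       ; *-cong = *P-cong
       ; *-assoc = *P-assoc
       ; *-identity = *P-identityˡ , (λ p → ≋-trans (*P-comm p 1P) (*P-identityˡ p))
       ; distrib = *P-distribˡ , (λ s p r → ≋-trans (*P-comm (p +P r) s)
           (≋-trans (*P-distribˡ s p r) (+P-cong (*P-comm s p) (*P-comm s r)))) }
     ; *-comm = *P-comm }

 PR : ℕ → CommutativeRing 0ℓ 0ℓ
 PR n = record { Carrier = Poly n ; isCommutativeRing = isCommutativeRing-P }

 opaque
   unfolding addP

   cst-+ : (a b : ℤ) → cst {n} (a Z.+ b) ≋ addP (cst a) (cst b)
   cst-+ a b .app f = lin-mono f _ (a Z.+ b) ∙ ZP.*-distribʳ-+ _ a b ∙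
     +ˡ (a Z.* f zeroExp) (sym (lin-mono f _ b))

   cst-* : (a b : ℤ) → cst {n} (a Z.* b) ≋ mulP (cst a) (cst b)
   cst-* a b .app f = lin-mono f _ (a Z.* b) ∙ sym (lin-mono f (zeroExp ⊕ zeroExp) (a Z.* b) ∙
      cong (λ e → a Z.* b Z.* f e) (⊕-identityˡ zeroExp))

   cst-neg : (a : ℤ) → cst {n} (Z.- a) ≋ oppP (cst a)
   cst-neg a = ≋-refl

   mono-* : (e e' : Exp n) (c c' : ℤ) → mulP (mono e c) (mono e' c') ≋ mono (e ⊕ e') (c Z.* c')
   mono-* e e' c c' = ≋-refl

 cst-0 : cst {n} +0 ≋ 0P
 cst-0 .app f = lin-mono f zeroExp +0 ∙ ZP.*-zeroˡ (f zeroExp)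

-- Divided differences and interpolation over a commutative ring

module RingIdentities where
 -- The ring solver takes its coefficients from ℤ through this map, since it has to compare
 -- coefficients.
 record IntegerMap (R : CommutativeRing 0ℓ 0ℓ) : Set where
   open CommutativeRing R
   field
     ι : ℤ → Carrier
     ι-+ : ∀ a b → ι (a Z.+ b) ≈ ι a + ι b
     ι-* : ∀ a b → ι (a Z.* b) ≈ ι a * ι b
     ι-neg : ∀ a → ι (Z.- a) ≈ - ι a
     ι-0 : ι +0 ≈ 0#
     ι-1 : ι (+ 1) ≈ 1#

 module RingTheory (R : CommutativeRing 0ℓ 0ℓ) (im : IntegerMap R) where
   open CommutativeRing R renaming (Carrier to C) public
   open IntegerMap im
   open import Algebra.Properties.CommutativeSemigroup *-commutativeSemigroup using (x∙yz≈y∙xz) public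
   open import Relation.Binary.Reasoning.Setoid setoid
   open import Algebra.Properties.Ring ring using (-0#≈0#) public

   private
     integers : CommutativeRing.rawRing ZP.+-*-commutativeRing -Raw-AlmostCommutative⟶ fromCommutativeRing R
     integers = record { ⟦_⟧ = ι ; +-homo = ι-+ ; *-homo = ι-* ; -‿homo = ι-neg ; 0-homo = ι-0 ; 1-homo = ι-1 }

     _coeff≟_ : ∀ a b → Maybe (ι a ≈ ι b)
     a coeff≟ b with a Z.≟ b
     ... | yes P.refl = just refl
     ... | no _ = nothing

   open Algebra.Solver.Ring (CommutativeRing.rawRing ZP.+-*-commutativeRing) (fromCommutativeRing R) integers _coeff≟_
     renaming (solve to solveR) public hiding (⟦_⟧; normalise; normalise-con)

   Π : List C → C
   Π = foldr _*_ 1#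

   -- A sum over the positions of a list, each with the entries before and after it: p carries the
   -- sign, and p ++ s is the list with the entry removed. Interpolation sums and expansions of
   -- determinants both have this shape.
   Σs : {A : Set} → (List A → A → List A → C) → List A → C
   Σs F [] = 0#
   Σs F (x ∷ xs) = F [] x xs + Σs (λ p → F (x ∷ p)) xs

   sgn : {A : Set} → List A → C
   sgn [] = 1#
   sgn (_ ∷ p) = - sgn p

   pairProd : {A : Set} → (A → A → C) → List A → C
   pairProd F [] = 1#
   pairProd F (x ∷ xs) = Π (map (F x) xs) * pairProd F xs

   minus : C → C → C
   minus w z = w - z

   vdm : List C → C
   vdm = pairProd minus

   -- Not a zero divisor. In place of fractions, identities are multiplied by regular elements,
   -- which `cancelR` removes again.
   Regular : C → Set
   Regular s = ∀ r → s * r ≈ 0# → r ≈ 0#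

   sub-zero : ∀ {a b} → a ≈ b → a - b ≈ 0#
   sub-zero {a} {b} h = trans (+-congʳ h) (-‿inverseʳ b)

   zero-sub : ∀ {a b} → a - b ≈ 0# → a ≈ b
   zero-sub {a} {b} h = trans (solveR 2 (λ a b → a := a :- b :+ b) refl a b) (trans (+-congʳ h) (+-identityˡ b))

   cancelR : ∀ {s a b} → Regular s → s * a ≈ s * b → a ≈ b
   cancelR {s} {a} {b} reg h = zero-sub (reg _ (trans (solveR 3 (λ s a b → s :* (a :- b) := s :* a :- s :* b) refl s a b) (sub-zero h)))

   regular-* : ∀ {s u} → Regular s → Regular u → Regular (s * u)
   regular-* rs ru r h = ru r (rs _ (trans (sym (*-assoc _ _ r)) h))

   regular-≈ : ∀ {s u} → s ≈ u → Regular s → Regular u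
   regular-≈ e rs r h = rs r (trans (*-congʳ e) h)

   regular-1 : Regular 1#
   regular-1 r h = trans (sym (*-identityˡ r)) h

   regular-neg : ∀ {s} → Regular s → Regular (- s)
   regular-neg {s} rs r h = rs r (trans (solveR 2 (λ s r → s :* r := :- (:- s :* r)) refl s r) (trans (-‿cong h) -0#≈0#))

   regular-unit : ∀ {s u} → u * s ≈ 1# → Regular s
   regular-unit {s} {u} h r e = trans (sym (*-identityˡ r)) (trans (*-congʳ (sym h)) (trans (*-assoc u s r) (trans (*-congˡ e) (zeroʳ u))))

   Π-++ : (xs ys : List C) → Π (xs ++ ys) ≈ Π xs * Π ys
   Π-++ [] ys = sym (*-identityˡ _)
   Π-++ (x ∷ xs) ys = trans (*-congˡ (Π-++ xs ys)) (sym (*-assoc x _ _))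

   Π-cong : {A : Set} {f g : A → C} (xs : List A) → (∀ x → f x ≈ g x) → Π (map f xs) ≈ Π (map g xs)
   Π-cong [] h = refl
   Π-cong (x ∷ xs) h = *-cong (h x) (Π-cong xs h)

   Π-* : {A : Set} (f g : A → C) (xs : List A) → Π (map (λ x → f x * g x) xs) ≈ Π (map f xs) * Π (map g xs)
   Π-* f g [] = sym (*-identityˡ _)
   Π-* f g (x ∷ xs) = trans (*-congˡ (Π-* f g xs))
     (solveR 4 (λ a b c d → (a :* b) :* (c :* d) := (a :* c) :* (b :* d)) refl (f x) (g x) _ _)

   Π-split : {A : Set} (g : A → C) (p : List A) (z : A) (s : List A) → Π (map g (p ++ z ∷ s)) ≈ g z * Π (map g (p ++ s))
   Π-split g [] z s = refl
   Π-split g (x ∷ p) z s = trans (*-congˡ (Π-split g p z s)) (x∙yz≈y∙xz (g x) (g z) _)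

   Σs-cong : {A : Set} {F G : List A → A → List A → C} (xs : List A) →
     (∀ p z s → p ++ z ∷ s ≡ xs → F p z s ≈ G p z s) → Σs F xs ≈ Σs G xs
   Σs-cong [] h = refl
   Σs-cong (x ∷ xs) h = +-cong (h [] x xs P.refl) (Σs-cong xs (λ p z s e → h (x ∷ p) z s (cong (x ∷_) e)))

   Σs-+ : {A : Set} (F G : List A → A → List A → C) (xs : List A) →
     Σs (λ p z s → F p z s + G p z s) xs ≈ Σs F xs + Σs G xs
   Σs-+ F G [] = sym (+-identityˡ _)
   Σs-+ F G (x ∷ xs) = trans (+-congˡ (Σs-+ (λ p → F (x ∷ p)) (λ p → G (x ∷ p)) xs))
     (solveR 4 (λ a b c d → (a :+ b) :+ (c :+ d) := (a :+ c) :+ (b :+ d)) refl (F [] x xs) (G [] x xs) _ _)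

   Σs-*ˡ : {A : Set} (k : C) (F : List A → A → List A → C) (xs : List A) → Σs (λ p z s → k * F p z s) xs ≈ k * Σs F xs
   Σs-*ˡ k F [] = sym (zeroʳ k)
   Σs-*ˡ k F (x ∷ xs) = trans (+-congˡ (Σs-*ˡ k (λ p → F (x ∷ p)) xs)) (sym (distribˡ k _ _))

   Σs-map : {A B : Set} (g : A → B) (F : List B → B → List B → C) (xs : List A) →
     Σs F (map g xs) ≈ Σs (λ p z s → F (map g p) (g z) (map g s)) xs
   Σs-map g F [] = refl
   Σs-map g F (x ∷ xs) = +-congˡ (Σs-map g (λ p → F (g x ∷ p)) xs)

   ΣL : {A : Set} → List A → (A → C) → C
   ΣL xs f = foldr _+_ 0# (map f xs)

   ΣL-cong : {A : Set} {f g : A → C} (xs : List A) → (∀ x → f x ≈ g x) → ΣL xs f ≈ ΣL xs g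
   ΣL-cong [] h = refl
   ΣL-cong (x ∷ xs) h = +-cong (h x) (ΣL-cong xs h)

   ΣL-+ : {A : Set} (f g : A → C) (xs : List A) → ΣL xs (λ x → f x + g x) ≈ ΣL xs f + ΣL xs g
   ΣL-+ f g [] = sym (+-identityˡ _)
   ΣL-+ f g (x ∷ xs) = trans (+-congˡ (ΣL-+ f g xs))
     (solveR 4 (λ a b c d → (a :+ b) :+ (c :+ d) := (a :+ c) :+ (b :+ d)) refl (f x) (g x) _ _)

   ΣL-*ˡ : {A : Set} (k : C) (f : A → C) (xs : List A) → ΣL xs (λ x → k * f x) ≈ k * ΣL xs f
   ΣL-*ˡ k f [] = sym (zeroʳ k)
   ΣL-*ˡ k f (x ∷ xs) = trans (+-congˡ (ΣL-*ˡ k f xs)) (sym (distribˡ k _ _))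

   ΣL-*ʳ : {A : Set} (k : C) (f : A → C) (xs : List A) → ΣL xs (λ x → f x * k) ≈ ΣL xs f * k
   ΣL-*ʳ k f xs = trans (ΣL-cong xs (λ x → *-comm (f x) k)) (trans (ΣL-*ˡ k f xs) (*-comm k _))

   ΣL-0 : {A : Set} (xs : List A) → ΣL xs (λ _ → 0#) ≈ 0#
   ΣL-0 [] = refl
   ΣL-0 (x ∷ xs) = trans (+-identityˡ _) (ΣL-0 xs)

   ΣL-swap : {A B : Set} (F : A → B → C) (xs : List A) (ys : List B) →
     ΣL xs (λ x → ΣL ys (F x)) ≈ ΣL ys (λ y → ΣL xs (λ x → F x y))
   ΣL-swap F [] ys = sym (ΣL-0 ys)
   ΣL-swap F (x ∷ xs) ys = trans (+-congˡ (ΣL-swap F xs ys)) (sym (ΣL-+ (F x) _ ys))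

   Σs-mid : {A : Set} (f : A → C) (xs : List A) → Σs (λ _ z _ → f z) xs ≈ ΣL xs f
   Σs-mid f [] = refl
   Σs-mid f (x ∷ xs) = +-congˡ (Σs-mid f xs)

   Πdiff : C → List C → C
   Πdiff w xs = Π (map (minus w) xs)

   -- V(z₀,…,z_N) times the divided difference f[z₀,…,z_N]
   hdiff : (C → C) → List C → C
   hdiff f = Σs (λ p z s → sgn p * (f z * vdm (p ++ s)))

   -- The recursion (a - b) f[a, b, ...] = f[a, ...] - f[b, ...], multiplied by the Vandermonde
   -- product of all nodes. The two coefficients are the factors of that product that the smaller
   -- ones lack.
   hdiff-rec : (f : C → C) (a b : C) (zs : List C) →
     hdiff f (a ∷ b ∷ zs) ≈ Πdiff b zs * hdiff f (a ∷ zs) - Πdiff a zs * hdiff f (b ∷ zs)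
   hdiff-rec f a b zs = begin
     1# * (f a * (B * V)) + (- 1# * (f b * (A * V)) + Σs (λ p z s → - - sgn p * (f z * vdm (a ∷ b ∷ p ++ s))) zs)
       ≈⟨ +-congˡ (+-congˡ tail) ⟩
     1# * (f a * (B * V)) + (- 1# * (f b * (A * V)) + (B * SA + - A * SB))
       ≈⟨ solveR 8 (λ fa fb A B V SA SB I → I :* (fa :* (B :* V)) :+ (:- I :* (fb :* (A :* V)) :+ (B :* SA :+ (:- A) :* SB))
            := B :* (I :* (fa :* V) :+ SA) :- A :* (I :* (fb :* V) :+ SB)) refl (f a) (f b) A B V SA SB 1# ⟩
     B * (1# * (f a * V) + SA) - A * (1# * (f b * V) + SB) ∎
     where
     A = Πdiff a zs
     B = Πdiff b zs
     V = vdm zs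
     FA = λ (w : C) (p : List C) (z : C) (s : List C) → - sgn p * (f z * vdm (w ∷ p ++ s))
     SA = Σs (FA a) zs
     SB = Σs (FA b) zs
     tail : Σs (λ p z s → - - sgn p * (f z * vdm (a ∷ b ∷ p ++ s))) zs ≈ B * SA + - A * SB
     tail = trans (Σs-cong zs term) (trans (Σs-+ _ _ zs) (+-cong (Σs-*ˡ B (FA a) zs) (Σs-*ˡ (- A) (FA b) zs)))
       where
       term : ∀ p z s → p ++ z ∷ s ≡ zs → - - sgn p * (f z * vdm (a ∷ b ∷ p ++ s)) ≈ B * FA a p z s + - A * FA b p z s
       term p z s P.refl = trans (solveR 8 (λ sp fz a b z pa pb v →
              :- (:- sp) :* (fz :* (((a :- b) :* pa) :* (pb :* v))) := ((b :- z) :* pb) :* (:- sp :* (fz :* (pa :* v))) :+ :- ((a :- z) :* pa) :* (:- sp :* (fz :* (pb :* v)))) refl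
              (sgn p) (f z) a b z (Πdiff a (p ++ s)) (Πdiff b (p ++ s)) (vdm (p ++ s)))
         (sym (+-cong (*-congʳ (Π-split (minus b) p z s)) (*-congʳ (-‿cong (Π-split (minus a) p z s)))))

   -- Write a z - b as a (z - z₀) + (a z₀ - b). The factor z - z₀ removes the node z₀ from a divided
   -- difference, and `Πdiff z₀ zs` is the quotient of the two Vandermonde products.
   hdiff-linear : (f : C → C) (a b z₀ : C) (zs : List C) →
     hdiff (λ z → (a * z - b) * f z) (z₀ ∷ zs) ≈ (a * Πdiff z₀ zs) * hdiff f zs + (a * z₀ - b) * hdiff f (z₀ ∷ zs)
   hdiff-linear f a b z₀ zs = begin
     1# * (((a * z₀ - b) * f z₀) * V) + Σs (λ p z s → - sgn p * (((a * z - b) * f z) * vdm (z₀ ∷ p ++ s))) zs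
       ≈⟨ +-congˡ (trans (Σs-cong zs term) (trans (Σs-+ _ _ zs) (+-cong (Σs-*ˡ (a * A) F₁ zs) (Σs-*ˡ (a * z₀ - b) F₂ zs)))) ⟩
     1# * (((a * z₀ - b) * f z₀) * V) + ((a * A) * hdiff f zs + (a * z₀ - b) * Σs F₂ zs)
       ≈⟨ solveR 6 (λ I l fz v X Y → I :* ((l :* fz) :* v) :+ (X :+ l :* Y) := X :+ l :* (I :* (fz :* v) :+ Y)) refl 1# (a * z₀ - b) (f z₀) V _ _ ⟩
     (a * A) * hdiff f zs + (a * z₀ - b) * hdiff f (z₀ ∷ zs) ∎
     where
     A = Πdiff z₀ zs
     V = vdm zs
     F₁ = λ (p : List C) (z : C) (s : List C) → sgn p * (f z * vdm (p ++ s))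
     F₂ = λ (p : List C) (z : C) (s : List C) → - sgn p * (f z * vdm (z₀ ∷ p ++ s))
     term : ∀ p z s → p ++ z ∷ s ≡ zs →
       - sgn p * (((a * z - b) * f z) * vdm (z₀ ∷ p ++ s)) ≈ (a * A) * F₁ p z s + (a * z₀ - b) * F₂ p z s
     term p z s P.refl = trans (solveR 8 (λ sp fz a b z y pa v →
         :- sp :* (((a :* z :- b) :* fz) :* (pa :* v)) := (a :* ((y :- z) :* pa)) :* (sp :* (fz :* v)) :+ (a :* y :- b) :* (:- sp :* (fz :* (pa :* v)))) refl
         (sgn p) (f z) a b z z₀ (Πdiff z₀ (p ++ s)) (vdm (p ++ s)))
       (+-congʳ (*-congʳ (*-congˡ (sym (Π-split (minus z₀) p z s)))))

   hdiff-one : (a b : C) (zs : List C) → hdiff (λ _ → 1#) (a ∷ b ∷ zs) ≈ 0#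
   hdiff-one a b [] = trans (+-congˡ (+-identityʳ _)) (trans (+-congˡ (solveR 2 (λ x y → :- x :* y := :- (x :* y)) refl 1# _)) (-‿inverseʳ _))
   hdiff-one a b (c ∷ zs) = trans (hdiff-rec _ a b (c ∷ zs)) (trans (+-cong (*-congˡ (hdiff-one a c zs)) (-‿cong (*-congˡ (hdiff-one b c zs))))
     (trans (+-cong (zeroʳ _) (trans (-‿cong (zeroʳ _)) -0#≈0#)) (+-identityˡ _)))

   linProd : List (C × C) → C → C
   linProd fs z = Π (map (λ { (a , b) → a * z - b }) fs)

   -- A divided difference of order above the degree is zero, because by `hdiff-linear` a linear
   -- factor costs at most one node.
   hdiff-low : (fs : List (C × C)) (zs : List C) → suc (length fs) N.< length zs → hdiff (linProd fs) zs ≈ 0#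
   hdiff-low [] (a ∷ b ∷ zs) l = hdiff-one a b zs
   hdiff-low [] (a ∷ []) (s≤s ())
   hdiff-low ((a , b) ∷ fs) (z₀ ∷ zs) (s≤s l) = trans (hdiff-linear (linProd fs) a b z₀ zs)
     (trans (+-cong (*-congˡ (hdiff-low fs zs l)) (*-congˡ (hdiff-low fs (z₀ ∷ zs) (NP.m≤n⇒m≤1+n l))))
       (trans (+-cong (zeroʳ _) (zeroʳ _)) (+-identityˡ _)))

   -- When the order equals the degree, the leading coefficient survives: the second summand of
   -- `hdiff-linear` has one node too many and vanishes by `hdiff-low`.
   hdiff-top : (fs : List (C × C)) (zs : List C) → suc (length fs) ≡ length zs → hdiff (linProd fs) zs ≈ Π (map proj₁ fs) * vdm zs
   hdiff-top [] (z ∷ []) _ = trans (+-identityʳ _) (*-congˡ refl)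
   hdiff-top ((a , b) ∷ fs) (z₀ ∷ zs) l = trans (hdiff-linear (linProd fs) a b z₀ zs)
     (trans (+-cong (*-congˡ (hdiff-top fs zs l')) (*-congˡ (hdiff-low fs (z₀ ∷ zs) (s≤s (NP.≤-reflexive l')))))
       (trans (+-congˡ (zeroʳ _)) (trans (+-identityʳ _) (solveR 4 (λ a A p v → (a :* A) :* (p :* v) := (a :* p) :* (A :* v)) refl a _ _ _))))
     where l' = NP.suc-injective l

   -- Lagrange interpolation of ∏ (aₘ z - zₘ) at the nodes zₘ together with the extra node 0.
   lagrange : (ws : List (C × C)) → Regular (Πdiff 0# (map proj₂ ws)) →
     Σs (λ { p (a , z) s → (a - 1#) * (sgn p * (linProd (p ++ s) z * vdm (map proj₂ (p ++ s)))) }) ws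
       ≈ (Π (map proj₁ ws) - 1#) * vdm (map proj₂ ws)
   lagrange ws reg = cancelR reg (begin
     Z * K ≈⟨ sym (trans (+-identityˡ _) refl) ⟩
     0# + Z * K ≈⟨ +-congʳ (sym (-‿inverseʳ (Z * V))) ⟩
     (Z * V - Z * V) + Z * K ≈⟨ solveR 2 (λ x y → (x :- x) :+ y := (x :+ y) :- x) refl (Z * V) (Z * K) ⟩
     (Z * V + Z * K) - Z * V ≈⟨ +-congʳ main ⟩
     Π (map proj₁ ws) * (Z * V) - Z * V ≈⟨ solveR 3 (λ p z v → p :* (z :* v) :- z :* v := z :* (p :* v :- v)) refl _ Z V ⟩
     Z * (Π (map proj₁ ws) * V - V) ≈⟨ *-congˡ (+-congˡ (-‿cong (sym (*-identityˡ V)))) ⟩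
     Z * (Π (map proj₁ ws) * V - 1# * V) ≈⟨ *-congˡ (solveR 3 (λ p i v → p :* v :- i :* v := (p :- i) :* v) refl _ 1# V) ⟩
     Z * ((Π (map proj₁ ws) - 1#) * V) ∎)
     where
     zs = map proj₂ ws
     Z = Πdiff 0# zs
     V = vdm zs
     G : List (C × C) → (C × C) → List (C × C) → C
     G p (a , z) s = (a - 1#) * (sgn p * (linProd (p ++ s) z * vdm (map proj₂ (p ++ s))))
     K = Σs (λ { p (a , z) s → (a - 1#) * (sgn p * (linProd (p ++ s) z * vdm (map proj₂ (p ++ s)))) }) ws
     at0 : ∀ ws → linProd ws 0# ≈ Πdiff 0# (map proj₂ ws)
     at0 [] = refl
     at0 ((a , b) ∷ ws) = *-cong (+-congʳ (zeroʳ a)) (at0 ws)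
     sgn-map : ∀ (p : List (C × C)) → sgn (map proj₂ p) ≈ sgn p
     sgn-map [] = refl
     sgn-map (x ∷ p) = -‿cong (sgn-map p)
     term : ∀ p w s → p ++ w ∷ s ≡ ws →
       - sgn (map proj₂ p) * (linProd ws (proj₂ w) * vdm (0# ∷ map proj₂ p ++ map proj₂ s)) ≈ Z * G p w s
     term p (a , z) s P.refl = begin
       - sgn (map proj₂ p) * (linProd (p ++ (a , z) ∷ s) z * (Πdiff 0# (map proj₂ p ++ map proj₂ s) * vdm (map proj₂ p ++ map proj₂ s)))
         ≈⟨ *-cong (-‿cong (sgn-map p)) (*-cong (Π-split (λ { (a , b) → a * z - b }) p (a , z) s)
              (reflexive (cong (λ l → Πdiff 0# l * vdm l) (P.sym (LP.map-++ proj₂ p s))))) ⟩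
       - sgn p * (((a * z - z) * linProd (p ++ s) z) * (Z' * V'))
         ≈⟨ *-congˡ (*-congʳ (*-congʳ (+-congˡ (-‿cong (sym (*-identityˡ z)))))) ⟩
       - sgn p * (((a * z - 1# * z) * linProd (p ++ s) z) * (Z' * V'))
         ≈⟨ solveR 7 (λ sp a z i l zz v → :- sp :* (((a :* z :- i :* z) :* l) :* (zz :* v)) := (:- z :* zz) :* ((a :- i) :* (sp :* (l :* v)))) refl
              (sgn p) a z 1# (linProd (p ++ s) z) Z' V' ⟩
       (- z * Z') * G p (a , z) s ≈⟨ *-congʳ (sym (trans (reflexive (cong Π (P.sym (LP.map-∘ (p ++ (a , z) ∷ s)))))
             (trans (Π-split (λ w → 0# - proj₂ w) p (a , z) s) (*-cong (+-identityˡ _) (reflexive (cong Π (LP.map-∘ (p ++ s)))))))) ⟩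
       Z * G p (a , z) s ∎
       where Z' = Πdiff 0# (map proj₂ (p ++ s))
             V' = vdm (map proj₂ (p ++ s))
     -- The node 0 contributes Z, the value of the product there, times V. At a node zₘ the factor
     -- with index m is (aₘ - 1) zₘ, and zₘ is absorbed into Z, so Z can be cancelled. There is one
     -- factor fewer than nodes, as `hdiff-top` requires.
     main : Z * V + Z * K ≈ Π (map proj₁ ws) * (Z * V)
     main = begin
       Z * V + Z * K ≈⟨ +-cong (sym (trans (*-identityˡ _) (*-congʳ (at0 ws)))) (sym (trans (Σs-map proj₂ _ ws) (trans (Σs-cong ws term) (Σs-*ˡ Z G ws)))) ⟩
       hdiff (linProd ws) (0# ∷ zs) ≈⟨ hdiff-top ws (0# ∷ zs) (cong suc (P.sym (LP.length-map proj₂ ws))) ⟩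
       Π (map proj₁ ws) * (Z * V) ∎

-- Antisymmetric functions of lists of integers

module AntisymmetricFunctions where
 open P using (refl; sym; trans; subst₂)

 open import Algebra.Properties.AbelianGroup ZP.+-0-abelianGroup using () renaming (∙-cancelˡ to +ℤ-cancelˡ)
 open Polynomials using (+ˡ)

 neg-self : ∀ {x} → x ≡ Z.- x → x ≡ +0
 neg-self {+0} _ = refl
 neg-self {+ suc _} ()
 neg-self { -[1+ _ ]} ()

 +-cancelʳ-≤ : ∀ k {i j} → i Z.+ k Z.≤ j Z.+ k → i Z.≤ j
 +-cancelʳ-≤ k {i} {j} h = subst₂ Z._≤_ (ring7 i k) (ring7 j k) (ZP.+-monoˡ-≤ (Z.- k) h)

 Anti : ℕ → (List ℤ → ℤ) → Set
 Anti N a = ∀ xs y z zs → length (xs ++ y ∷ z ∷ zs) ≡ N → a (xs ++ y ∷ z ∷ zs) ≡ Z.- a (xs ++ z ∷ y ∷ zs)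

 anti-tail : ∀ {N a} x → Anti (suc N) a → Anti N (λ L → a (x ∷ L))
 anti-tail x h xs y z zs l = h (x ∷ xs) y z zs (cong suc l)

 -- Comparing two antisymmetric functions avoids the sign of a permutation: at each exchange of
 -- neighbours both sides change sign, so equality is transported. The zero function and multiples
 -- of `sg` serve as b.
 anti-↭ : ∀ {N a b xs ys} → Anti N a → Anti N b → xs ↭ ys → length xs ≡ N → a xs ≡ b xs → a ys ≡ b ys
 anti-↭ ha hb Perm.refl l e = e
 anti-↭ {a = a} {b} ha hb (Perm.prep x p) refl e = anti-↭ {a = λ L → a (x ∷ L)} {λ L → b (x ∷ L)} (anti-tail {a = a} x ha) (anti-tail {a = b} x hb) p refl e
 anti-↭ {a = a} {b} ha hb (Perm.swap {xs} x y p) refl e =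
   anti-↭ {a = λ L → a (y ∷ x ∷ L)} {λ L → b (y ∷ x ∷ L)}
     (λ us u v vs l → ha (y ∷ x ∷ us) u v vs (cong (suc ∘ suc) l)) (λ us u v vs l → hb (y ∷ x ∷ us) u v vs (cong (suc ∘ suc) l)) p refl
     (ha [] y x xs refl ∙ (cong Z.-_ e) ∙ sym (hb [] y x xs refl))
 anti-↭ ha hb (Perm.trans p q) l e = anti-↭ ha hb q (sym (PermP.↭-length p) ∙ l) (anti-↭ ha hb p l e)

 Repeats : List ℤ → Set
 Repeats L = ∃ λ xs → ∃ λ y → ∃ λ ys → L ↭ xs ++ y ∷ y ∷ ys

 anti-repeats : ∀ {N a L} → Anti N a → length L ≡ N → Repeats L → a L ≡ +0
 anti-repeats {a = a} ha l (xs , y , ys , p) = anti-↭ {b = λ _ → +0} ha (λ _ _ _ _ _ → refl) (Perm.↭-sym p) len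
     (neg-self (ha xs y y ys len))
   where len = sym (PermP.↭-length p) ∙ l

 iv : ℤ → ℕ → List ℤ
 iv a zero = []
 iv a (suc m) = a ∷ iv (a Z.+ + 1) m

 length-iv : ∀ a m → length (iv a m) ≡ m
 length-iv a zero = refl
 length-iv a (suc m) = cong suc (length-iv _ m)

 Σℤ : List ℤ → ℤ
 Σℤ = foldr Z._+_ +0

 Σℤ-↭ : ∀ {xs ys} → xs ↭ ys → Σℤ xs ≡ Σℤ ys
 Σℤ-↭ Perm.refl = refl
 Σℤ-↭ (Perm.prep x p) = +ˡ x (Σℤ-↭ p)
 Σℤ-↭ (Perm.swap x y p) = cong (λ s → x Z.+ (y Z.+ s)) (Σℤ-↭ p) ∙ ring8 x y _
 Σℤ-↭ (Perm.trans p q) = Σℤ-↭ p ∙ Σℤ-↭ q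

 Increasing : List ℤ → Set
 Increasing = AllPairs Z._<_

 <⇒+1≤ : ∀ {x y} → x Z.< y → x Z.+ + 1 Z.≤ y
 <⇒+1≤ {x} l = subst (Z._≤ _) (ZP.+-comm (+ 1) x) (ZP.i<j⇒suc[i]≤j l)

 increasing-bound : ∀ a M → Increasing M → All (a Z.≤_) M → Σℤ (iv a (length M)) Z.≤ Σℤ M
 increasing-bound a [] _ _ = ZP.≤-refl
 increasing-bound a (x ∷ M) (h ∷ inc) (a≤x ∷ _) = ZP.+-mono-≤ a≤x
   (increasing-bound (a Z.+ + 1) M inc (All.map (λ x<y → ZP.≤-trans (ZP.+-monoˡ-≤ (+ 1) a≤x) (<⇒+1≤ x<y)) h))

 -- A strictly increasing list with entries at least a exceeds a, a + 1, ... entry by entry, so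
 -- equal sums leave no room in any entry.
 increasing-minimal : ∀ a M → Increasing M → All (a Z.≤_) M → Σℤ M ≡ Σℤ (iv a (length M)) → M ≡ iv a (length M)
 increasing-minimal a [] _ _ _ = refl
 increasing-minimal a (x ∷ M) (h ∷ inc) (a≤x ∷ _) e = cong₂ _∷_ x≡a (increasing-minimal (a Z.+ + 1) M inc lower
     (+ℤ-cancelˡ a (Σℤ M) (Σℤ (iv (a Z.+ + 1) (length M))) (cong (Z._+ Σℤ M) (sym x≡a) ∙ e)))
   where
   lower = All.map (λ x<y → ZP.≤-trans (ZP.+-monoˡ-≤ (+ 1) a≤x) (<⇒+1≤ x<y)) h
   x≡a : x ≡ a
   x≡a = ZP.≤-antisym (+-cancelʳ-≤ (Σℤ M)
     (ZP.≤-trans (ZP.≤-reflexive e) (ZP.+-monoʳ-≤ a (increasing-bound (a Z.+ + 1) M inc lower)))) a≤x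

 insertBelow : ∀ {y} x M → y Z.≤ x → Linked Z._≤_ (y ∷ M) → ∃ λ M' → Linked Z._≤_ (y ∷ M') × M' ↭ x ∷ M
 insertBelow x [] y≤x _ = x ∷ [] , y≤x ∷ [-] , Perm.refl
 insertBelow x (z ∷ M) y≤x (y≤z ∷ s) with ZP.≤-total x z
 ... | inj₁ x≤z = x ∷ z ∷ M , y≤x ∷ x≤z ∷ s , Perm.refl
 ... | inj₂ z≤x with insertBelow x M z≤x s
 ...   | M' , s' , p = z ∷ M' , y≤z ∷ s' , Perm.trans (Perm.prep z p) (Perm.swap z x Perm.refl)

 sorting : ∀ L → ∃ λ M → Linked Z._≤_ M × M ↭ L
 sorting [] = [] , [] , Perm.refl
 sorting (x ∷ L) with sorting L
 ... | [] , _ , p = x ∷ [] , [-] , Perm.prep x p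
 ... | z ∷ M , s , p with ZP.≤-total x z
 ...   | inj₁ x≤z = x ∷ z ∷ M , x≤z ∷ s , Perm.prep x p
 ...   | inj₂ z≤x with insertBelow x M z≤x s
 ...     | M' , s' , q = z ∷ M' , s' , Perm.trans (Perm.trans (Perm.prep z q) (Perm.swap z x Perm.refl)) (Perm.prep x p)

 sort : List ℤ → List ℤ
 sort L = proj₁ (sorting L)

 sort-↗ : ∀ L → Linked Z._≤_ (sort L)
 sort-↗ L = proj₁ (proj₂ (sorting L))

 sort-↭ : ∀ L → sort L ↭ L
 sort-↭ L = proj₂ (proj₂ (sorting L))

 sorted-cases : ∀ {M} → Linked Z._≤_ M → (∃ λ xs → ∃ λ y → ∃ λ ys → M ≡ xs ++ y ∷ y ∷ ys) ⊎ Linked Z._<_ M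
 sorted-cases [] = inj₂ []
 sorted-cases [-] = inj₂ [-]
 sorted-cases {x ∷ y ∷ M} (x≤y ∷ s) with x Z.≟ y | sorted-cases s
 ... | yes refl | _ = inj₁ ([] , x , M , refl)
 ... | no x≢y | inj₁ (xs , w , ys , e) = inj₁ (x ∷ xs , w , ys , cong (x ∷_) e)
 ... | no x≢y | inj₂ l = inj₂ (ZP.≤∧≢⇒< x≤y x≢y ∷ l)

 Staircase : ℕ → List ℤ → Set
 Staircase N L = length L ≡ N × All (+0 Z.≤_) L × Σℤ L ≡ Σℤ (iv +0 N)

 -- After sorting, either two neighbours agree or the list is strictly increasing. In the second
 -- case its sum is the least possible for distinct nonnegative entries, which forces 0, ..., N - 1.
 staircase-cases : ∀ {N L} → Staircase N L → L ↭ iv +0 N ⊎ Repeats L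
 staircase-cases {L = L} (refl , nonneg , total) with sorted-cases (sort-↗ L)
 ... | inj₁ (xs , y , ys , e) = inj₂ (xs , y , ys , Perm.↭-trans (Perm.↭-sym (sort-↭ L)) (Perm.↭-reflexive e))
 ... | inj₂ l = inj₁ (Perm.↭-trans p (Perm.↭-reflexive (minimal ∙ cong (iv +0) (PermP.↭-length (sort-↭ L)))))
   where
   p = Perm.↭-sym (sort-↭ L)
   minimal : sort L ≡ iv +0 (length (sort L))
   minimal = increasing-minimal +0 (sort L) (LinkedP.Linked⇒AllPairs ZP.<-trans l) (PermP.All-resp-↭ p nonneg)
     (Σℤ-↭ (sort-↭ L) ∙ total ∙ cong (Σℤ ∘ iv +0) (sym (PermP.↭-length (sort-↭ L))))

 -- On staircase lists an antisymmetric function is determined by one value. The evaluation of ∂_ω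
 -- and the coefficients of Vandermonde products are both obtained in this way.
 anti-unique : ∀ {N a b L} → Anti N a → Anti N b → Staircase N L → a (iv +0 N) ≡ b (iv +0 N) → a L ≡ b L
 anti-unique {N} {a} {b} {L} ha hb st@(len , _) e with staircase-cases st
 ... | inj₁ p = anti-↭ ha hb (Perm.↭-sym p) (length-iv +0 N) e
 ... | inj₂ r = anti-repeats ha len r ∙ sym (anti-repeats hb len r)

 sign : ℤ → ℤ
 sign +0 = +0
 sign (+ suc _) = + 1
 sign -[1+ _ ] = Z.- + 1

 sign-neg : ∀ x → sign (Z.- x) ≡ Z.- sign x
 sign-neg +0 = refl
 sign-neg (+ suc _) = refl
 sign-neg -[1+ _ ] = refl

 sign-pos : ∀ {x y} → x Z.< y → sign (y Z.- x) ≡ + 1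
 sign-pos {x} {y} l with y Z.- x | subst (Z._< y Z.- x) (ZP.+-inverseʳ x) (ZP.+-monoˡ-< (Z.- x) l)
 ... | + suc _ | _ = refl
 ... | +0 | Z.+<+ ()

 signs : ℤ → List ℤ → ℤ
 signs a [] = + 1
 signs a (b ∷ L) = sign (b Z.- a) Z.* signs a L

 -- The sign of the product of L_j - L_i over i < j: the sign of the permutation that sorts L, and 0
 -- if an entry repeats.
 sg : List ℤ → ℤ
 sg [] = + 1
 sg (a ∷ L) = signs a L Z.* sg L

 signs-swap : ∀ a xs y z zs → signs a (xs ++ y ∷ z ∷ zs) ≡ signs a (xs ++ z ∷ y ∷ zs)
 signs-swap a [] y z zs = ring9 (sign (y Z.- a)) (sign (z Z.- a)) _
 signs-swap a (x ∷ xs) y z zs = cong (sign (x Z.- a) Z.*_) (signs-swap a xs y z zs)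

 sg-swap : ∀ xs y z zs → sg (xs ++ y ∷ z ∷ zs) ≡ Z.- sg (xs ++ z ∷ y ∷ zs)
 sg-swap [] y z zs = cong (λ s → s Z.* signs y zs Z.* (signs z zs Z.* sg zs))
     (cong sign (flip y z) ∙ sign-neg (y Z.- z)) ∙ aux (sign (y Z.- z)) (signs y zs) (signs z zs) (sg zs)
   where
   flip = ring10
   aux = ring11
 sg-swap (x ∷ xs) y z zs = cong₂ Z._*_ (signs-swap x xs y z zs) (sg-swap xs y z zs) ∙ sym (ZP.neg-distribʳ-* (signs x (xs ++ z ∷ y ∷ zs)) (sg (xs ++ z ∷ y ∷ zs)))

 sg-anti : ∀ N → Anti N sg
 sg-anti N xs y z zs _ = sg-swap xs y z zs

 signs-above : ∀ a L → All (a Z.<_) L → signs a L ≡ + 1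
 signs-above a [] _ = refl
 signs-above a (b ∷ L) (l ∷ h) = cong₂ Z._*_ (sign-pos l) (signs-above a L h)

 sg-increasing : ∀ {L} → Increasing L → sg L ≡ + 1
 sg-increasing [] = refl
 sg-increasing (h ∷ inc) = cong₂ Z._*_ (signs-above _ _ h) (sg-increasing inc)

 iv-lower : ∀ a b m → a Z.≤ b → All (a Z.≤_) (iv b m)
 iv-lower a b zero _ = []
 iv-lower a b (suc m) l = l ∷ iv-lower a (b Z.+ + 1) m (ZP.≤-trans l (ZP.i≤i+j b (+ 1)))

 iv-increasing : ∀ a m → Increasing (iv a m)
 iv-increasing a zero = []
 iv-increasing a (suc m) = All.map (λ l → ZP.suc[i]≤j⇒i<j (subst (Z._≤ _) (ZP.+-comm a (+ 1)) l)) (iv-lower (a Z.+ + 1) (a Z.+ + 1) m ZP.≤-refl)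
   ∷ iv-increasing (a Z.+ + 1) m

 sg-iv : ∀ a m → sg (iv a m) ≡ + 1
 sg-iv a m = sg-increasing (iv-increasing a m)

 sg-↭ : ∀ {N L} → Staircase N L → sg L ≢ +0 → L ↭ iv +0 N
 sg-↭ {N} st ne with staircase-cases st
 ... | inj₁ p = p
 ... | inj₂ r = ⊥-elim (ne (anti-repeats (sg-anti N) (proj₁ st) r))

 swapL : ℕ → List ℤ → List ℤ
 swapL zero (a ∷ b ∷ l) = b ∷ a ∷ l
 swapL (suc k) (a ∷ l) = a ∷ swapL k l
 swapL _ l = l

 hd : ℤ → (List ℤ → ℤ) → List ℤ → ℤ
 hd g B [] = +0
 hd g B (h ∷ t) with h Z.≟ g
 ... | yes _ = B t
 ... | no _ = +0

 -- The indicator of γ among lists of its length, built from `hd` so that `orbit-sum` can strip one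
 -- entry of γ at a time.
 eqL : List ℤ → List ℤ → ℤ
 eqL [] _ = + 1
 eqL (g ∷ γ) = hd g (eqL γ)

 -- A functional on ℤ-valued functions of lists that is invariant under exchanging adjacent
 -- entries and concentrated on the rearrangements of γ weighs all of them equally.
 record Symmetric (m : ℕ) (γ : List ℤ) (μ : (List ℤ → ℤ) → ℤ) : Set where
   field
     add : ∀ B B' → μ (λ L → B L Z.+ B' L) ≡ μ B Z.+ μ B'
     swap : ∀ B k → suc k N.< m → μ B ≡ μ (B ∘ swapL k)
     on : ∀ B B' → (∀ L → L ↭ γ → B L ≡ B' L) → μ B ≡ μ B'

 pos : ℕ → ℤ → List ℤ → ℤ
 pos zero g = hd g (λ _ → + 1)
 pos (suc k) g [] = +0
 pos (suc k) g (h ∷ t) = pos k g t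

 ind : ℤ → ℤ → ℤ
 ind g h with h Z.≟ g
 ... | yes _ = + 1
 ... | no _ = +0

 hd-ind : ∀ g h t → hd g (λ _ → + 1) (h ∷ t) ≡ ind g h
 hd-ind g h t with h Z.≟ g
 ... | yes _ = refl
 ... | no _ = refl

 count : ℕ → ℤ → List ℤ → ℤ
 count zero g L = +0
 count (suc m) g [] = +0
 count (suc m) g (h ∷ t) = ind g h Z.+ count m g t

 count-suc : ∀ m g L → count (suc m) g L ≡ count m g L Z.+ pos m g L
 count-suc zero g [] = refl
 count-suc zero g (h ∷ t) = ZP.+-comm (ind g h) +0 ∙ +ˡ +0 (sym (hd-ind g h t))
 count-suc (suc m) g [] = refl
 count-suc (suc m) g (h ∷ t) = +ˡ (ind g h) (count-suc m g t) ∙ sym (ZP.+-assoc (ind g h) _ _)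

 count-↭ : ∀ g {L M} → L ↭ M → count (length L) g L ≡ count (length M) g M
 count-↭ g Perm.refl = refl
 count-↭ g (Perm.prep x p) = +ˡ (ind g x) (count-↭ g p)
 count-↭ g (Perm.swap {xs} {ys} x y p) = +ˡ X (+ˡ Y (count-↭ g p)) ∙ aux X Y _
   where X = ind g x
         Y = ind g y
         aux = ring8
 count-↭ g (Perm.trans p q) = count-↭ g p ∙ count-↭ g q

 count-absent : ∀ m g L → All (g ≢_) L → count m g L ≡ +0
 count-absent zero g L _ = refl
 count-absent (suc m) g [] _ = refl
 count-absent (suc m) g (h ∷ t) (ne ∷ a) with h Z.≟ g
 ... | yes e = ⊥-elim (ne (sym e))
 ... | no _ = ZP.+-identityˡ _ ∙ count-absent m g t a

 hd-self : ∀ g B t → hd g B (g ∷ t) ≡ B t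
 hd-self g B t with g Z.≟ g
 ... | yes _ = refl
 ... | no ne = ⊥-elim (ne refl)

 symmetric-tail : ∀ {m g γ μ} → Symmetric (suc m) (g ∷ γ) μ → Symmetric m γ (μ ∘ hd g)
 symmetric-tail {m} {g} {γ} {μ} S = record
   { add = λ B B' → on _ _ (λ L _ → hd-add B B' L) ∙ add (hd g B) (hd g B')
   ; swap = λ B k l → swap (hd g B) (suc k) (s≤s l) ∙ on _ _ (λ L _ → hd-swap B k L)
   ; on = λ B B' h → on _ _ (λ L p → hd-on B B' h L p) }
   where
   open Symmetric S
   hd-add : ∀ B B' L → hd g (λ L → B L Z.+ B' L) L ≡ hd g B L Z.+ hd g B' L
   hd-add B B' [] = refl
   hd-add B B' (x ∷ L) with x Z.≟ g
   ... | yes _ = refl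
   ... | no _ = refl
   hd-swap : ∀ B k L → hd g B (swapL (suc k) L) ≡ hd g (B ∘ swapL k) L
   hd-swap B k [] = refl
   hd-swap B k (x ∷ L) with x Z.≟ g
   ... | yes _ = refl
   ... | no _ = refl
   hd-on : ∀ B B' → (∀ L → L ↭ γ → B L ≡ B' L) → ∀ L → L ↭ g ∷ γ → hd g B L ≡ hd g B' L
   hd-on B B' h [] p = refl
   hd-on B B' h (x ∷ L) p with x Z.≟ g
   ... | yes refl = h L (PermP.drop-∷ p)
   ... | no _ = refl

 -- A rearrangement of g ∷ γ contains g at exactly one place, and by invariance every place weighs
 -- as much as the first. So the constant 1 weighs m + 1 times as much as the lists that start with
 -- g, and their tails are the same situation for γ.
 orbit-sum : ∀ γ {μ} → Unique γ → Symmetric (length γ) γ μ → μ (λ _ → + 1) ≡ + (length γ !) Z.* μ (eqL γ)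
 orbit-sum [] {μ} _ S = on _ _ (λ L _ → refl) ∙ sym (ZP.*-identityˡ _)
   where open Symmetric S
 orbit-sum (g ∷ γ) {μ} (ne ∷ u) S = begin
   μ (λ _ → + 1) ≡⟨ on _ _ (λ L p → sym (once L p)) ⟩
   μ (count (suc m) g) ≡⟨ total (suc m) NP.≤-refl ⟩
   + suc m Z.* μ (hd g (λ _ → + 1)) ≡⟨ cong (+ suc m Z.*_) (orbit-sum γ u (symmetric-tail S)) ⟩
   + suc m Z.* (+ (m !) Z.* μ (eqL (g ∷ γ))) ≡⟨ sym (ZP.*-assoc (+ suc m) (+ (m !)) _) ⟩
   (+ suc m Z.* + (m !)) Z.* μ (eqL (g ∷ γ)) ≡⟨ cong (Z._* μ (eqL (g ∷ γ))) (sym (ZP.pos-* (suc m) (m !))) ⟩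
   + (suc m !) Z.* μ (eqL (g ∷ γ)) ∎
   where
   open ≡-Reasoning
   open Symmetric S
   m = length γ
   once : ∀ L → L ↭ g ∷ γ → count (suc m) g L ≡ + 1
   once L p = cong (λ k → count k g L) (sym (PermP.↭-length p)) ∙ count-↭ g p ∙
     cong₂ Z._+_ (sym (hd-ind g g γ) ∙ hd-self g (λ _ → + 1) γ) (count-absent m g γ ne)
   pos-swap : ∀ k L → suc k N.< length L → pos (suc k) g L ≡ pos k g (swapL k L)
   pos-swap zero (a ∷ b ∷ L) _ with b Z.≟ g
   ... | yes _ = refl
   ... | no _ = refl
   pos-swap (suc k) (a ∷ L) (s≤s l) = pos-swap k L l
   pos-swap zero (a ∷ []) (s≤s ())
   pos-μ : ∀ k → k N.< suc m → μ (pos k g) ≡ μ (hd g (λ _ → + 1))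
   pos-μ zero _ = refl
   pos-μ (suc k) l = on _ _ (λ L p → pos-swap k L (subst (suc k N.<_) (sym (PermP.↭-length p)) l)) ∙
     sym (swap (pos k g) k l) ∙ pos-μ k (NP.<-trans (NP.n<1+n k) l)
   total : ∀ k → k N.≤ suc m → μ (count k g) ≡ + k Z.* μ (hd g (λ _ → + 1))
   total zero _ = cancel (sym (add (λ _ → +0) (λ _ → +0)))
     where cancel : ∀ {x} → x Z.+ x ≡ x → x ≡ +0
           cancel {x} e = +ℤ-cancelˡ x x +0 (e ∙ sym (ZP.+-identityʳ x))
   total (suc k) l = begin
     μ (count (suc k) g) ≡⟨ on _ _ (λ L _ → count-suc k g L) ⟩
     μ (λ L → count k g L Z.+ pos k g L) ≡⟨ add _ _ ⟩
     μ (count k g) Z.+ μ (pos k g) ≡⟨ cong₂ Z._+_ (total k (NP.<⇒≤ l)) (pos-μ k l) ⟩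
     + k Z.* x Z.+ x ≡⟨ aux (+ k) x ⟩
     (+ 1 Z.+ + k) Z.* x ∎
     where x = μ (hd g (λ _ → + 1))
           aux = ring12

-- Permutations, dominance and the exponents attached to partitions

module Partitions where
 open Data.Bool using (T; _∧_)
 open import Data.Nat using (_+_; _*_; _∸_; _⊔_; _<_; _≥_; _≡ᵇ_)
 open L using (reverse; take; drop; filter; filterᵇ; cartesianProductWith)
 open P using (refl; sym; trans)

 open import Algebra.Properties.AbelianGroup ZP.+-0-abelianGroup using (∙-cancelˡ)
 open Polynomials using (+ˡ)
 open AntisymmetricFunctions using (iv; Σℤ; Σℤ-↭; sg; sg-swap; sg-↭; sg-iv; Staircase; iv-increasing; signs; sign; sign-pos; length-iv)

 countL : ℕ → List ℕ → ℕ
 countL v l = length (filterᵇ (v ≡ᵇ_) l)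

 countL-∷ : ∀ v x l → countL v (x ∷ l) ≡ countL v (x ∷ []) + countL v l
 countL-∷ v x l with v ≡ᵇ x
 ... | true = refl
 ... | false = refl

 countL-↭ : ∀ v {l m} → l ↭ m → countL v l ≡ countL v m
 countL-↭ v Perm.refl = refl
 countL-↭ v (Perm.prep {xs} {ys} x p) = countL-∷ v x xs ∙ cong (λ c → countL v (x ∷ []) + c) (countL-↭ v p) ∙ sym (countL-∷ v x ys)
 countL-↭ v (Perm.swap {xs} {ys} x y p) = two x y xs ∙ (aux (countL v (x ∷ [])) (countL v (y ∷ [])) (countL v xs) ∙
     cong (λ c → countL v (y ∷ []) + (countL v (x ∷ []) + c)) (countL-↭ v p)) ∙ sym (two y x ys)
   where
   two : ∀ x y l → countL v (x ∷ y ∷ l) ≡ countL v (x ∷ []) + (countL v (y ∷ []) + countL v l)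
   two x y l = countL-∷ v x (y ∷ l) ∙ cong (λ c → countL v (x ∷ []) + c) (countL-∷ v y l)
   aux = ring13
 countL-↭ v (Perm.trans p q) = countL-↭ v p ∙ countL-↭ v q

 ≡ᵇ-refl : ∀ v → (v ≡ᵇ v) ≡ true
 ≡ᵇ-refl zero = refl
 ≡ᵇ-refl (suc v) = ≡ᵇ-refl v

 count-self : ∀ v l → countL v (v ∷ l) ≡ suc (countL v l)
 count-self v l rewrite ≡ᵇ-refl v = refl

 count-mem : ∀ v m {c} → countL v m ≡ suc c → v ∈ m
 count-mem v (y ∷ m) e with v ≡ᵇ y in eq
 ... | true = here (NP.≡ᵇ⇒≡ v y (subst T (sym eq) tt))
 ... | false = there (count-mem v m e)

 count-∷ : ∀ v x {l m} → countL v (x ∷ l) ≡ countL v (x ∷ m) → countL v l ≡ countL v m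
 count-∷ v x e with v ≡ᵇ x
 ... | true = NP.suc-injective e
 ... | false = e

 counts⇒↭ : ∀ l m → (∀ v → countL v l ≡ countL v m) → l ↭ m
 counts⇒↭ [] [] h = Perm.refl
 counts⇒↭ [] (y ∷ m) h with () ← (h y ∙ count-self y m)
 counts⇒↭ (x ∷ l) m h with MemP.∈-∃++ (count-mem x m (sym (h x) ∙ count-self x l))
 ... | p , s , refl = Perm.↭-trans (Perm.prep x (counts⇒↭ l (p ++ s) (λ v → count-∷ v x (h v ∙ countL-↭ v (PermP.shift x p s))))) (Perm.↭-sym (PermP.shift x p s))

 product-concatMap : ∀ {A B : Set} (f : ℕ → A → B) xs ys → concatMap (λ a → map (f a) ys) xs ≡ cartesianProductWith f xs ys
 product-concatMap f [] ys = refl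
 product-concatMap f (x ∷ xs) ys = cong (map (f x) ys ++_) (product-concatMap f xs ys)

 vecsBelow-unique : ∀ k B → Unique (vecsBelow k B)
 vecsBelow-unique zero B = [] ∷ []
 vecsBelow-unique (suc k) B = subst Unique (sym (product-concatMap _∷_ (upTo (suc B)) (vecsBelow k B)))
   (UniqueP.cartesianProductWith⁺ _∷_ (λ { refl → refl , refl }) (UniqueP.upTo⁺ (suc B)) (vecsBelow-unique k B))

 ∈-vecsBelow⁺ : ∀ {k} B (α : Vec ℕ k) → All (_≤ B) (toList α) → α ∈ vecsBelow k B
 ∈-vecsBelow⁺ B [] _ = here refl
 ∈-vecsBelow⁺ {suc k} B (a ∷ α) (l ∷ h) = subst (a ∷ α ∈_) (sym (product-concatMap _∷_ (upTo (suc B)) (vecsBelow k B)))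
   (MemP.∈-cartesianProductWith⁺ _∷_ (MemP.∈-upTo⁺ (s≤s l)) (∈-vecsBelow⁺ B α h))

 ∈-vecsBelow⁻ : ∀ {k} B (α : Vec ℕ k) → α ∈ vecsBelow k B → All (_≤ B) (toList α)
 ∈-vecsBelow⁻ B [] _ = []
 ∈-vecsBelow⁻ {suc k} B (a ∷ α) m with MemP.∈-cartesianProductWith⁻ _∷_ (upTo (suc B)) (vecsBelow k B) (subst (a ∷ α ∈_) (product-concatMap _∷_ (upTo (suc B)) (vecsBelow k B)) m)
 ... | _ , _ , ma , mα , refl = NP.≤-pred (MemP.∈-upTo⁻ ma) ∷ ∈-vecsBelow⁻ B α mα

 allB⁻ : ∀ (f : ℕ → Bool) l → T (allB (map f l)) → All (T ∘ f) l
 allB⁻ f [] _ = []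
 allB⁻ f (a ∷ l) h with f a in eq
 ... | true = subst T (sym eq) tt ∷ allB⁻ f l h

 allB⁺ : ∀ (f : ℕ → Bool) l → (∀ v → T (f v)) → T (allB (map f l))
 allB⁺ f [] _ = tt
 allB⁺ f (a ∷ l) h with f a | h a
 ... | true | _ = allB⁺ f l h

 ≤-sum : ∀ {k} (ν : Vec ℕ k) → All (_≤ V.sum ν) (toList ν)
 ≤-sum [] = []
 ≤-sum (a ∷ ν) = NP.m≤m+n a _ ∷ All.map (λ l → NP.≤-trans l (NP.m≤n+m _ a)) (≤-sum ν)

 count-above : ∀ v B l → All (_≤ B) l → B < v → countL v l ≡ 0
 count-above v B [] _ _ = refl
 count-above v B (a ∷ l) (h ∷ hs) b with v ≡ᵇ a in eq
 ... | true = ⊥-elim (NP.<⇒≱ b (subst (_≤ B) (sym (NP.≡ᵇ⇒≡ v a (subst T (sym eq) tt))) h))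
 ... | false = count-above v B l hs b

 ∈-perms⁻ : ∀ {k} {ν α : Vec ℕ k} → α ∈ perms ν → toList α ↭ toList ν
 ∈-perms⁻ {k} {ν} {α} m with MemP.∈-filter⁻ (T? ∘ isPermOf (V.sum ν) ν) {xs = vecsBelow k (V.sum ν)} m
 ... | below , is = counts⇒↭ (toList α) (toList ν) same
   where
   B = V.sum ν
   same : ∀ v → countL v (toList α) ≡ countL v (toList ν)
   same v with v N.≤? B
   ... | yes l = NP.≡ᵇ⇒≡ _ _ (All.lookup (allB⁻ _ (upTo (suc B)) is) (MemP.∈-upTo⁺ (s≤s l)))
   -- A value above B occurs on neither side: the entries of α are bounded by the enumeration, those
   -- of ν by their sum.
   ... | no ¬l = count-above v B _ (∈-vecsBelow⁻ B α below) (NP.≰⇒> ¬l) ∙ sym (count-above v B _ (≤-sum ν) (NP.≰⇒> ¬l))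

 ∈-perms⁺ : ∀ {k} {ν α : Vec ℕ k} → toList α ↭ toList ν → α ∈ perms ν
 ∈-perms⁺ {k} {ν} {α} p = MemP.∈-filter⁺ (T? ∘ isPermOf B ν) (∈-vecsBelow⁺ B α (PermP.All-resp-↭ (Perm.↭-sym p) (≤-sum ν)))
   (allB⁺ _ (upTo (suc B)) (λ v → NP.≡⇒≡ᵇ _ _ (countL-↭ v p)))
   where B = V.sum ν

 perms-unique : ∀ {k} (ν : Vec ℕ k) → Unique (perms ν)
 perms-unique {k} ν = UniqueP.filter⁺ (T? ∘ isPermOf (V.sum ν) ν) (vecsBelow-unique k (V.sum ν))

 unique-mid : ∀ {A : Set} (p : List A) {x s} → Unique (p ++ x ∷ s) → All (x ≢_) (p ++ s) × Unique (p ++ s)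
 unique-mid [] (h ∷ u) = h , u
 unique-mid (y ∷ p) (h ∷ u) with AllP.++⁻ p h | unique-mid p u
 ... | hp , hx ∷ hs | n , v = (hx ∘ sym) ∷ n , AllP.++⁺ hp hs ∷ v

 ∈-mid⁻ : ∀ {A : Set} {a x : A} p {s} → a ∈ p ++ x ∷ s → x ≡ a ⊎ a ∈ p ++ s
 ∈-mid⁻ [] (here e) = inj₁ (sym e)
 ∈-mid⁻ [] (there m) = inj₂ m
 ∈-mid⁻ (y ∷ p) (here e) = inj₂ (here e)
 ∈-mid⁻ (y ∷ p) (there m) = Sum.map₂ there (∈-mid⁻ p m)

 unique-set-↭ : ∀ {A : Set} {l m : List A} → Unique l → Unique m → (∀ {a} → a ∈ l → a ∈ m) → (∀ {a} → a ∈ m → a ∈ l) → l ↭ m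
 unique-set-↭ {l = []} {[]} _ _ _ _ = Perm.refl
 unique-set-↭ {l = []} {y ∷ m} _ _ _ g with () ← g (here refl)
 unique-set-↭ {l = x ∷ l} {m} (u ∷ us) um f g with MemP.∈-∃++ (f (here refl))
 ... | p , s , refl = Perm.trans (Perm.prep x (unique-set-↭ us (proj₂ (unique-mid p um)) into back)) (Perm.↭-sym (PermP.shift x p s))
   where
   into : ∀ {a} → a ∈ l → a ∈ p ++ s
   into m' with ∈-mid⁻ p (f (there m'))
   ... | inj₁ e = ⊥-elim (All.lookup u m' e)
   ... | inj₂ k = k
   back : ∀ {a} → a ∈ p ++ s → a ∈ l
   back m' with g (PermP.∈-resp-↭ (Perm.↭-sym (PermP.shift x p s)) (there m'))
   ... | here e = ⊥-elim (All.lookup (proj₁ (unique-mid p um)) m' (sym e))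
   ... | there k = k

 -- Meant for exchanges of neighbours, which map the list of all rearrangements of a vector into
 -- itself; sums over that list are therefore symmetric.
 involution-↭ : ∀ {A : Set} (f : A → A) → (∀ a → f (f a) ≡ a) → ∀ {l} → Unique l → (∀ {a} → a ∈ l → f a ∈ l) → map f l ↭ l
 involution-↭ f ff {l} u closed = unique-set-↭ (UniqueP.map⁺ (λ {a} {b} e → sym (ff a) ∙ cong f e ∙ ff b) u) u to (λ {z} m → subst (_∈ map f l) (ff z) (MemP.∈-map⁺ f (closed m)))
   where to : ∀ {z} → z ∈ map f l → z ∈ l
         to m with MemP.∈-map⁻ f m
         ... | a , ma , refl = closed ma

 Sorted : List ℕ → Set
 Sorted = AllPairs _≥_

 decr-sorted : ∀ l → Decr l → Sorted l
 decr-sorted [] _ = []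
 decr-sorted (a ∷ []) _ = [] ∷ []
 decr-sorted (a ∷ b ∷ l) (b≤a , d) with decr-sorted (b ∷ l) d
 ... | s@(h ∷ _) = (b≤a ∷ All.map (λ x → NP.≤-trans x b≤a) h) ∷ s

 -- For n entries this is the sum of (n - i) aᵢ. By `psum-wN` it is also the total of the sums of
 -- all proper prefixes, which are what dominance compares; hence it grows strictly in dominance
 -- order.
 wN : List ℕ → ℕ
 wN [] = 0
 wN (a ∷ l) = length l * a + wN l

 psum : ℕ → List ℕ → ℕ
 psum s [] = 0
 psum s (a ∷ l) = s + psum (s + a) l

 psum-wN : ∀ s l → psum s l ≡ length l * s + wN l
 psum-wN s [] = refl
 psum-wN s (a ∷ l) = cong (λ x → s + x) (psum-wN (s + a) l) ∙ ring14 s (length l) a (wN l)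

 -- Dominance with offsets s and s' that hold the entries already removed, so that the relation
 -- passes to tails.
 Leads : ℕ → List ℕ → ℕ → List ℕ → Set
 Leads s l s' m = ∀ j → s + sum (take j l) ≤ s' + sum (take j m)

 leads-0 : ∀ {s l s' m} → Leads s l s' m → s ≤ s'
 leads-0 {s} {l} {s'} h = P.subst₂ _≤_ (NP.+-identityʳ s) (NP.+-identityʳ s') (h 0)

 leads-tail : ∀ {s a l s' b m} → Leads s (a ∷ l) s' (b ∷ m) → Leads (s + a) l (s' + b) m
 leads-tail {s} {a} {l} {s'} {b} {m} h j = P.subst₂ _≤_ (sym (NP.+-assoc s a _)) (sym (NP.+-assoc s' b _)) (h (suc j))

 psum-≤ : ∀ {s s'} l m → length l ≡ length m → Leads s l s' m → psum s l ≤ psum s' m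
 psum-≤ [] [] _ h = z≤n
 psum-≤ {s} {s'} (a ∷ l) (b ∷ m) e h = NP.+-mono-≤ (leads-0 {s} {a ∷ l} {s'} {b ∷ m} h) (psum-≤ l m (NP.suc-injective e) (leads-tail {s} {a} {l} {s'} {b} {m} h))

 +-≡-split : ∀ {a b c d} → a ≤ c → b ≤ d → a + b ≡ c + d → a ≡ c × b ≡ d
 +-≡-split {a} {b} {c} {d} p q e with NP.m≤n⇒m<n∨m≡n p
 ... | inj₁ l = ⊥-elim (NP.<⇒≢ (NP.+-mono-<-≤ l q) e)
 ... | inj₂ refl = refl , NP.+-cancelˡ-≡ a b d e

 -- Prefix sums that are comparable term by term and have the same total agree in every term. The
 -- last entry belongs to no proper prefix, hence the separate hypothesis on the sums of the lists.
 psum-≡ : ∀ {s s'} l m → length l ≡ length m → Leads s l s' m → s + sum l ≡ s' + sum m → psum s l ≡ psum s' m → s ≡ s' × l ≡ m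
 psum-≡ {s} {s'} [] [] _ _ e _ = P.subst₂ _≡_ (NP.+-identityʳ s) (NP.+-identityʳ s') e , refl
 psum-≡ {s} {s'} (a ∷ l) (b ∷ m) len h e e' with +-≡-split (leads-0 {s} {a ∷ l} {s'} {b ∷ m} h) (psum-≤ l m (NP.suc-injective len) (leads-tail {s} {a} {l} {s'} {b} {m} h)) e'
 ... | refl , t with psum-≡ l m (NP.suc-injective len) (leads-tail {s} {a} {l} {s'} {b} {m} h) (NP.+-assoc s a _ ∙ e ∙ sym (NP.+-assoc s b _)) t
 ...   | f , refl with NP.+-cancelˡ-≡ s a b f
 ...     | refl = refl , refl

 wN-≤ : ∀ l m → length l ≡ length m → Leads 0 l 0 m → wN l ≤ wN m
 wN-≤ l m e h = P.subst₂ _≤_ (start l) (start m) (psum-≤ l m e h)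
   where start : ∀ l → psum 0 l ≡ wN l
         start l = psum-wN 0 l ∙ cong (λ x → x + wN l) (NP.*-zeroʳ (length l))

 wN-≡ : ∀ l m → length l ≡ length m → Leads 0 l 0 m → sum l ≡ sum m → wN l ≡ wN m → l ≡ m
 wN-≡ l m e h t w = proj₂ (psum-≡ l m e h t (start l ∙ w ∙ sym (start m)))
   where start : ∀ l → psum 0 l ≡ wN l
         start l = psum-wN 0 l ∙ cong (λ x → x + wN l) (NP.*-zeroʳ (length l))

 sum-take-sorted : ∀ k a m → Sorted (a ∷ m) → sum (take k m) ≤ sum (take k (a ∷ m))
 sum-take-sorted zero a m _ = z≤n
 sum-take-sorted (suc k) a [] _ = z≤n
 sum-take-sorted (suc k) a (b ∷ m) ((h ∷ _) ∷ s) = NP.+-mono-≤ h (sum-take-sorted k b m s)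

 sum-take-mono : ∀ j k m → j ≤ k → sum (take j m) ≤ sum (take k m)
 sum-take-mono zero k m _ = z≤n
 sum-take-mono (suc j) (suc k) [] _ = z≤n
 sum-take-mono (suc j) (suc k) (a ∷ m) (s≤s l) = NP.+-monoʳ-≤ a (sum-take-mono j k m l)

 sum-mid : ∀ p x s → sum (p ++ x ∷ s) ≡ x + sum (p ++ s)
 sum-mid p x s = SumP.sum-↭ (PermP.shift x p s)

 length-mid : ∀ {A : Set} (p : List A) x s → length (p ++ x ∷ s) ≡ suc (length (p ++ s))
 length-mid [] x s = refl
 length-mid (_ ∷ p) x s = cong suc (length-mid p x s)

 split-++ : ∀ {A : Set} (ys zs p : List A) x s → ys ++ zs ≡ p ++ x ∷ s →
   (∃ λ y₁ → ∃ λ y₂ → ys ≡ y₁ ++ x ∷ y₂ × (y₁ ++ y₂) ++ zs ≡ p ++ s) ⊎ (∃ λ z → ys ++ z ≡ p ++ s)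
 split-++ [] zs p x s e = inj₂ (p ++ s , refl)
 split-++ (y ∷ ys) zs [] x s e with LP.∷-injective e
 ... | refl , e' = inj₁ ([] , ys , refl , e')
 split-++ (y ∷ ys) zs (w ∷ p) x s e with LP.∷-injective e
 ... | refl , e' with split-++ ys zs p x s e'
 ...   | inj₁ (y₁ , y₂ , refl , e″) = inj₁ (y ∷ y₁ , y₂ , refl , cong (y ∷_) e″)
 ...   | inj₂ (z , e″) = inj₂ (z , cong (y ∷_) e″)

 -- The largest entry a lies in ys or in zs. In the first case it is removed from both sides; in the
 -- second, ys is drawn from the tail of m, and the first entries of a sorted list only gain when a
 -- is put in front.
 sum-≤-take : ∀ {m} → Sorted m → ∀ ys zs → ys ++ zs ↭ m → sum ys ≤ sum (take (length ys) m)
 sum-≤-take [] ys zs p with ys | PermP.↭-empty-inv p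
 ... | [] | _ = z≤n
 sum-≤-take {a ∷ m} s@(_ ∷ sm) ys zs p with MemP.∈-∃++ (PermP.∈-resp-↭ (Perm.↭-sym p) (here refl))
 ... | pre , suf , e with split-++ ys zs pre a suf e | PermP.drop-∷ (Perm.↭-trans (Perm.↭-sym (PermP.shift a pre suf)) (Perm.↭-trans (Perm.↭-reflexive (sym e)) p))
 ...   | inj₁ (y₁ , y₂ , refl , e') | q = P.subst₂ _≤_ (sym (sum-mid y₁ a y₂)) (cong (λ k → sum (take k (a ∷ m))) (sym (length-mid y₁ a y₂)))
           (NP.+-monoʳ-≤ a (sum-≤-take sm (y₁ ++ y₂) zs (Perm.↭-trans (Perm.↭-reflexive e') q)))
 ...   | inj₂ (z , e') | q = NP.≤-trans (sum-≤-take sm ys z (Perm.↭-trans (Perm.↭-reflexive e') q)) (sum-take-sorted (length ys) a m s)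

 sorted-leads : ∀ {b m} → Sorted m → b ↭ m → Leads 0 b 0 m
 sorted-leads {b} {m} s p j = NP.≤-trans (sum-≤-take s (take j b) (drop j b) (Perm.↭-trans (Perm.↭-reflexive (LP.take++drop≡id j b)) p))
   (sum-take-mono _ j m (subst (_≤ j) (sym (LP.length-take j b)) (NP.m⊓n≤m j (length b))))

 rearrange : ∀ {b m} → Sorted m → b ↭ m → wN b ≤ wN m
 rearrange {b} {m} s p = wN-≤ b m (PermP.↭-length p) (sorted-leads s p)

 rearrange-≡ : ∀ {b m} → Sorted m → b ↭ m → wN b ≡ wN m → b ≡ m
 rearrange-≡ {b} {m} s p = wN-≡ b m (PermP.↭-length p) (sorted-leads s p) (SumP.sum-↭ p)

 sorted-unique : ∀ {b m} → Sorted b → Sorted m → b ↭ m → b ≡ m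
 sorted-unique s s' p = rearrange-≡ s' p (NP.≤-antisym (rearrange s' p) (rearrange s (Perm.↭-sym p)))

 length≤sum : ∀ {l} → All (0 <_) l → length l ≤ sum l
 length≤sum [] = z≤n
 length≤sum (h ∷ hs) = NP.+-mono-≤ h (length≤sum hs)

 padL : ℕ → List ℕ → List ℕ
 padL n l = toList (pad n l)

 pad-zeros : ∀ n l → length l ≤ n → ∃ λ k → padL n l ≡ l ++ replicate k 0
 pad-zeros zero [] _ = 0 , refl
 pad-zeros (suc n) [] _ with pad-zeros n [] z≤n
 ... | k , e = suc k , cong (0 ∷_) e
 pad-zeros (suc n) (a ∷ l) (s≤s h) with pad-zeros n l h
 ... | k , e = k , cong (a ∷_) e

 -- The bound d ≤ n makes room for the partition and for its conjugate in n entries, so padding to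
 -- length n loses nothing.
 record Part (n d : ℕ) (l : List ℕ) : Set where
   field
     partition : IsPartition l
     weight : size l ≡ d
     fits : d ≤ n

 module PartP {n d l} (p : Part n d l) where
   open Part p
   len : length l ≤ n
   len = NP.≤-trans (length≤sum (proj₂ partition)) (subst (_≤ n) (sym weight) fits)
   padded : ∃ λ k → padL n l ≡ l ++ replicate k 0
   padded = pad-zeros n l len
   sum-zeros : ∀ k → sum (replicate k 0) ≡ 0
   sum-zeros zero = refl
   sum-zeros (suc k) = sum-zeros k
   sum-pad : sum (padL n l) ≡ d
   sum-pad = cong sum (proj₂ padded) ∙ SumP.sum-++ l _ ∙ cong (λ x → sum l + x) (sum-zeros (proj₁ padded)) ∙ NP.+-identityʳ _ ∙ weight
   sorted : Sorted (padL n l)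
   sorted = subst Sorted (sym (proj₂ padded)) (AllPairsP.++⁺ (decr-sorted l (proj₁ partition)) (zeros (proj₁ padded)) (All.tabulate (λ _ → AllP.replicate⁺ (proj₁ padded) z≤n)))
     where zeros : ∀ k → Sorted (replicate k 0)
           zeros zero = []
           zeros (suc k) = AllP.replicate⁺ k z≤n ∷ zeros k
   bounded : All (_≤ n) (padL n l)
   bounded = All.map (λ h → NP.≤-trans h (subst (_≤ n) (sym (sum-toList (pad n l) ∙ sum-pad)) fits)) (≤-sum (pad n l))
     where sum-toList : ∀ {k} (v : Vec ℕ k) → V.sum v ≡ sum (toList v)
           sum-toList [] = refl
           sum-toList (a ∷ v) = cong (λ x → a + x) (sum-toList v)
   sum-take-pad : ∀ j → sum (take j (padL n l)) ≡ sum (take j l)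
   sum-take-pad j = cong (sum ∘ take j) (proj₂ padded) ∙ go j l (proj₁ padded)
     where go : ∀ j l k → sum (take j (l ++ replicate k 0)) ≡ sum (take j l)
           go zero l k = refl
           go (suc j) [] zero = refl
           go (suc j) [] (suc k) = go j [] k ∙ cong sum (LP.take-[] j)
           go (suc j) (a ∷ l) k = cong (λ x → a + x) (go j l k)

 pad-injective : ∀ n {l m} → length l ≤ n → length m ≤ n → All (0 <_) l → All (0 <_) m → pad n l ≡ pad n m → l ≡ m
 pad-injective zero {[]} {[]} _ _ _ _ _ = refl
 pad-injective (suc n) {[]} {[]} _ _ _ _ _ = refl
 pad-injective (suc n) {[]} {suc b ∷ m} _ _ _ _ ()
 pad-injective (suc n) {[]} {zero ∷ m} _ _ _ (() ∷ _) _
 pad-injective (suc n) {suc a ∷ l} {[]} _ _ _ _ ()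
 pad-injective (suc n) {zero ∷ l} {[]} _ _ (() ∷ _) _ _
 pad-injective (suc n) {a ∷ l} {b ∷ m} (s≤s p) (s≤s q) (_ ∷ h) (_ ∷ h') e with VP.∷-injective e
 ... | refl , e' = cong (a ∷_) (pad-injective n p q h h' e')

 toList-≡ : ∀ {k} {α β : Vec ℕ k} → toList α ≡ toList β → α ≡ β
 toList-≡ {k} {α} {β} e = sym (VP.cast-is-id refl α) ∙ VP.toList-injective refl α β e

 length-toList : ∀ {A : Set} {k} (v : Vec A k) → length (toList v) ≡ k
 length-toList [] = refl
 length-toList (a ∷ v) = cong suc (length-toList v)

 pad-≡ : ∀ {n d l m} → Part n d l → Part n d m → padL n l ≡ padL n m → l ≡ m
 pad-≡ {n} p q e = pad-injective n (PartP.len p) (PartP.len q) (proj₂ (Part.partition p)) (proj₂ (Part.partition q)) (toList-≡ e)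

 below-wN : ∀ {n d la mu} → Part n d la → Part n d mu → mu ◁ la → wN (padL n mu) < wN (padL n la)
 below-wN {n} {d} {la} {mu} p q (dom , ne) = NP.≤∧≢⇒< (wN-≤ _ _ len leads) (λ e → ne (pad-≡ q p (wN-≡ _ _ len leads (PartP.sum-pad q ∙ sym (PartP.sum-pad p)) e)))
   where
   len = length-toList (pad n mu) ∙ sym (length-toList (pad n la))
   leads : Leads 0 (padL n mu) 0 (padL n la)
   leads j = P.subst₂ _≤_ (sym (PartP.sum-take-pad q j)) (sym (PartP.sum-take-pad p j)) (dom j)

 -- For k = 0 and k = n these are the two halves of the exponent of x̄^(ρ-α') times x^β: β is added
 -- to the first half of ρ, and α is subtracted from the second.
 up dn : ℕ → List ℕ → List ℤ
 up k [] = []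
 up k (b ∷ l) = + (k + b) ∷ up (suc k) l
 dn k [] = []
 dn k (a ∷ l) = (+ k Z.- + a) ∷ dn (suc k) l

 up-snoc : ∀ k l x → up k (l ++ x ∷ []) ≡ up k l ++ + (k + length l + x) ∷ []
 up-snoc k [] x = cong (λ m → + (m + x) ∷ []) (sym (NP.+-identityʳ k))
 up-snoc k (a ∷ l) x = cong (+ (k + a) ∷_) (up-snoc (suc k) l x ∙ cong (λ m → up (suc k) l ++ + (m + x) ∷ []) (sym (NP.+-suc k (length l))))

 length-up : ∀ k l → length (up k l) ≡ length l
 length-up k [] = refl
 length-up k (a ∷ l) = cong suc (length-up (suc k) l)

 length-dn : ∀ k l → length (dn k l) ≡ length l
 length-dn k [] = refl
 length-dn k (a ∷ l) = cong suc (length-dn (suc k) l)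

 iv-snoc : ∀ k w → iv (+ k) (suc w) ≡ iv (+ k) w ++ + (k + w) ∷ []
 iv-snoc k zero = cong (λ m → + m ∷ []) (sym (NP.+-identityʳ k))
 iv-snoc k (suc w) = cong (+ k ∷_) (cong (λ m → iv m (suc w)) (cong +_ (NP.+-comm k 1)) ∙ iv-snoc (suc k) w ∙
   cong₂ (λ m x → iv m w ++ + x ∷ []) (cong +_ (NP.+-comm 1 k)) (sym (NP.+-suc k w)))

 iv-++ : ∀ k w w' → iv (+ k) (w + w') ≡ iv (+ k) w ++ iv (+ (k + w)) w'
 iv-++ k zero w' = cong (λ m → iv (+ m) w') (sym (NP.+-identityʳ k))
 iv-++ k (suc w) w' = cong (+ k ∷_) (cong (λ m → iv (+ m) (w + w')) (NP.+-comm k 1) ∙ iv-++ (suc k) w w' ∙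
   cong₂ (λ m x → iv (+ m) w ++ iv (+ x) w') (NP.+-comm 1 k) (sym (NP.+-suc k w)))

 iv-< : ∀ k w → All (Z._< + (k + w)) (iv (+ k) w)
 iv-< k zero = []
 iv-< k (suc w) = Z.+<+ (NP.m<m+n k (s≤s z≤n)) ∷ subst (λ m → All (Z._< + m) (iv (+ (k + 1)) w)) (cong (_+ w) (NP.+-comm k 1) ∙ sym (NP.+-suc k w)) (iv-< (k + 1) w)

 square : ℤ → ℤ
 square x = x Z.* x

 Σ² : List ℤ → ℤ
 Σ² L = Σℤ (map square L)

 Σℤ-++ : ∀ xs ys → Σℤ (xs ++ ys) ≡ Σℤ xs Z.+ Σℤ ys
 Σℤ-++ [] ys = sym (ZP.+-identityˡ _)
 Σℤ-++ (x ∷ xs) ys = +ˡ x (Σℤ-++ xs ys) ∙ sym (ZP.+-assoc x (Σℤ xs) (Σℤ ys))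

 Σ-up : ∀ k l → Σℤ (up k l) ≡ Σℤ (iv (+ k) (length l)) Z.+ + sum l
 Σ-up k [] = refl
 Σ-up k (a ∷ l) = +ˡ (+ (k + a)) (Σ-up (suc k) l) ∙ cong (λ m → + (k + a) Z.+ (Σℤ (iv (+ m) (length l)) Z.+ + sum l)) (NP.+-comm 1 k) ∙
   ring15 (+ k) (+ a) (Σℤ (iv (+ (k + 1)) (length l))) (+ sum l)

 Σ-dn : ∀ k l → Σℤ (dn k l) ≡ Σℤ (iv (+ k) (length l)) Z.- + sum l
 Σ-dn k [] = refl
 Σ-dn k (a ∷ l) = +ˡ (+ k Z.- + a) (Σ-dn (suc k) l) ∙ cong (λ m → (+ k Z.- + a) Z.+ (Σℤ (iv (+ m) (length l)) Z.- + sum l)) (NP.+-comm 1 k) ∙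
   ring16 (+ k) (+ a) (Σℤ (iv (+ (k + 1)) (length l))) (+ sum l)

 sq : List ℕ → ℕ
 sq [] = 0
 sq (a ∷ l) = a * a + sq l

 iN : ℤ → List ℕ → ℤ
 iN k [] = +0
 iN k (b ∷ l) = k Z.* + b Z.+ iN (k Z.+ + 1) l

 Σ²-up : ∀ k l → Σ² (up k l) ≡ Σ² (iv (+ k) (length l)) Z.+ (+ 2 Z.* iN (+ k) l Z.+ + sq l)
 Σ²-up k [] = refl
 Σ²-up k (a ∷ l) = +ˡ (square (+ (k + a))) (Σ²-up (suc k) l) ∙ cong (λ m → square (+ (k + a)) Z.+ (Σ² (iv (+ m) (length l)) Z.+ (+ 2 Z.* iN (+ m) l Z.+ + sq l))) (NP.+-comm 1 k) ∙
   ring17 (+ k) (+ a) (Σ² (iv (+ (k + 1)) (length l))) (iN (+ (k + 1)) l) (+ sq l) ∙ cong (λ z → (square (+ k) Z.+ Σ² (iv (+ (k + 1)) (length l))) Z.+ (+ 2 Z.* (+ k Z.* + a Z.+ iN (+ (k + 1)) l) Z.+ (z Z.+ + sq l))) (sym (ZP.pos-* a a))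

 Σ²-dn : ∀ k l → Σ² (dn k l) ≡ Σ² (iv (+ k) (length l)) Z.+ (+ sq l Z.- + 2 Z.* iN (+ k) l)
 Σ²-dn k [] = refl
 Σ²-dn k (a ∷ l) = +ˡ (square (+ k Z.- + a)) (Σ²-dn (suc k) l) ∙ cong (λ m → square (+ k Z.- + a) Z.+ (Σ² (iv (+ m) (length l)) Z.+ (+ sq l Z.- + 2 Z.* iN (+ m) l))) (NP.+-comm 1 k) ∙
   ring18 (+ k) (+ a) (Σ² (iv (+ (k + 1)) (length l))) (iN (+ (k + 1)) l) (+ sq l) ∙ cong (λ z → (square (+ k) Z.+ Σ² (iv (+ (k + 1)) (length l))) Z.+ ((z Z.+ + sq l) Z.- + 2 Z.* (+ k Z.* + a Z.+ iN (+ (k + 1)) l))) (sym (ZP.pos-* a a))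

 iN-wN : ∀ k l → iN k l Z.+ + wN l ≡ (k Z.+ + length l Z.- + 1) Z.* + sum l
 iN-wN k [] = sym (ZP.*-zeroʳ (k Z.+ +0 Z.- + 1))
 iN-wN k (a ∷ l) = cong (λ z → (k Z.* + a Z.+ iN (k Z.+ + 1) l) Z.+ (z Z.+ + wN l)) (ZP.pos-* (length l) a) ∙ aux₁ (k Z.* + a) (iN (k Z.+ + 1) l) (+ length l Z.* + a) (+ wN l) ∙
   +ˡ (k Z.* + a Z.+ + length l Z.* + a) (iN-wN (k Z.+ + 1) l) ∙ aux₂ k (+ a) (+ length l) (+ sum l)
   where aux₁ = ring15
         aux₂ = ring19

 iN-snoc : ∀ k l x → iN k (l ++ x ∷ []) ≡ iN k l Z.+ (k Z.+ + length l) Z.* + x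
 iN-snoc k [] x = ZP.+-comm (k Z.* + x) +0 ∙ cong (λ z → +0 Z.+ z Z.* + x) (sym (ZP.+-identityʳ k))
 iN-snoc k (a ∷ l) x = +ˡ (k Z.* + a) (iN-snoc (k Z.+ + 1) l x) ∙ ring20 k (+ a) (iN (k Z.+ + 1) l) (+ length l) (+ x)

 iN-reverse : ∀ l → iN +0 (reverse l) ≡ + wN l
 iN-reverse [] = refl
 iN-reverse (a ∷ l) = cong (iN +0) (LP.unfold-reverse a l) ∙ iN-snoc +0 (reverse l) a ∙ cong₂ (λ x k → x Z.+ (+0 Z.+ + k) Z.* + a) (iN-reverse l) (LP.length-reverse l) ∙
   cong (λ z → + wN l Z.+ z Z.* + a) (ZP.+-identityˡ (+ length l)) ∙ cong (λ z → + wN l Z.+ z) (sym (ZP.pos-* (length l) a)) ∙ ZP.+-comm (+ wN l) (+ (length l * a))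

 sq-↭ : ∀ {l m} → l ↭ m → sq l ≡ sq m
 sq-↭ Perm.refl = refl
 sq-↭ (Perm.prep x p) = cong (λ z → x * x + z) (sq-↭ p)
 sq-↭ (Perm.swap x y p) = cong (λ z → x * x + (y * y + z)) (sq-↭ p) ∙ ring13 (x * x) (y * y) _
 sq-↭ (Perm.trans p q) = sq-↭ p ∙ sq-↭ q

 stat : List ℕ → ℕ
 stat l = 2 * wN l + sq l

 -- Comparing sums of squares: if the exponents fill the staircase, the statistics of the two factors are complementary.
 stat-sum : ∀ n b a → length b ≡ n → length a ≡ n → sum b ≡ sum a → up 0 (reverse b) ++ dn n a ↭ iv +0 (n + n) →
   + (stat b + stat a) ≡ + 2 Z.* ((+ n Z.+ + n Z.- + 1) Z.* + sum a)
 stat-sum n b a lb la s p = ∙-cancelˡ (Σ² (iv +0 (n + n))) _ _ (cong₂ Z._+_ whole (cong₂ (λ x y → + (x + y)) (cong (_+ sq b) (two (wN b))) (cong (_+ sq a) (two (wN a)))) ∙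
   aux (Σ² (iv +0 n)) (Σ² (iv (+ n) n)) (+ wN b) (+ sq b) (+ wN a) (+ sq a) (iN (+ n) a) ∙
     cong₂ (λ x y → x Z.+ + 2 Z.* y) total (iN-wN (+ n) a ∙ cong (λ m → (+ n Z.+ + m Z.- + 1) Z.* + sum a) la))
   where
   two : ∀ m → 2 * m ≡ m + m
   two m = cong (λ z → m + z) (NP.+-identityʳ m)
   total : (Σ² (iv +0 n) Z.+ (+ 2 Z.* + wN b Z.+ + sq b)) Z.+ (Σ² (iv (+ n) n) Z.+ (+ sq a Z.- + 2 Z.* iN (+ n) a)) ≡ Σ² (iv +0 (n + n))
   total = cong₂ Z._+_
       (sym (Σ²-up 0 (reverse b) ∙ cong₂ (λ m z → Σ² (iv +0 m) Z.+ z) (LP.length-reverse b ∙ lb) (cong₂ (λ z w → + 2 Z.* z Z.+ + w) (iN-reverse b) (sq-↭ (PermP.↭-reverse b)))))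
       (sym (Σ²-dn n a ∙ cong (λ m → Σ² (iv (+ n) m) Z.+ (+ sq a Z.- + 2 Z.* iN (+ n) a)) la)) ∙
     sym (Σℤ-++ (map square (up 0 (reverse b))) _) ∙ cong Σℤ (sym (LP.map-++ square (up 0 (reverse b)) (dn n a))) ∙ Σℤ-↭ (PermP.map⁺ square p)
   whole : Σ² (iv +0 (n + n)) ≡ Σ² (iv +0 n) Z.+ Σ² (iv (+ n) n)
   whole = sym (sym (Σℤ-++ (map square (iv +0 n)) _) ∙ cong Σℤ (sym (LP.map-++ square (iv +0 n) (iv (+ n) n)) ∙ cong (map square) (sym (iv-++ 0 n n))))
   aux = ring21

 conjAt-above : ∀ l k → All (_≤ k) l → conjAt l (suc k) ≡ 0
 conjAt-above l k h = cong length (LP.filter-none (suc k N.≤?_) (All.map (λ a≤k k<a → NP.<⇒≱ k<a a≤k) h))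

 conjAt-cons-≤ : ∀ a l j → j ≤ a → conjAt (a ∷ l) j ≡ suc (conjAt l j)
 conjAt-cons-≤ a l j h = cong length (LP.filter-accept (j N.≤?_) h)

 conjAt-cons-> : ∀ a l j → a < j → conjAt (a ∷ l) j ≡ conjAt l j
 conjAt-cons-> a l j h = cong length (LP.filter-reject (j N.≤?_) (NP.<⇒≱ h))

 -- the legs of the columns k + 1, …, k + w of a diagram with r rows, as seen from below
 legs : ℕ → ℕ → ℕ → List ℕ → List ℤ
 legs r k zero l = []
 legs r k (suc w) l = (+ (r + k) Z.- + conjAt l (suc k)) ∷ legs r (suc k) w l

 length-legs : ∀ r k w l → length (legs r k w l) ≡ w
 length-legs r k zero l = refl
 length-legs r k (suc w) l = cong suc (length-legs r (suc k) w l)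

 legs-++ : ∀ r k w w' l → legs r k (w + w') l ≡ legs r k w l ++ legs r (k + w) w' l
 legs-++ r k zero w' l = cong (λ m → legs r m w' l) (sym (NP.+-identityʳ k))
 legs-++ r k (suc w) w' l = cong ((+ (r + k) Z.- + conjAt l (suc k)) ∷_) (legs-++ r (suc k) w w' l ∙ cong (λ m → legs r (suc k) w l ++ legs r m w' l) (sym (NP.+-suc k w)))

 legs-above : ∀ r k w l → All (_≤ k) l → legs r k w l ≡ iv (+ (r + k)) w
 legs-above r k zero l h = refl
 legs-above r k (suc w) l h = cong₂ _∷_ (cong (λ c → + (r + k) Z.- + c) (conjAt-above l k h) ∙ ZP.+-identityʳ (+ (r + k)))
   (legs-above r (suc k) w l (All.map NP.m≤n⇒m≤1+n h) ∙ cong (λ m → iv (+ m) w) (NP.+-suc r k ∙ NP.+-comm 1 (r + k)))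

 legs-row : ∀ r k w a l → k + w ≤ a → legs (suc r) k w (a ∷ l) ≡ legs r k w l
 legs-row r k zero a l h = refl
 legs-row r k (suc w) a l h = cong₂ _∷_ (cong (λ c → + (suc r + k) Z.- + c) (conjAt-cons-≤ a l (suc k) (NP.≤-trans (NP.m<m+n k (s≤s z≤n)) h)) ∙ ring22 (+ (r + k)) (+ conjAt l (suc k)))
   (legs-row r (suc k) w a l (subst (_≤ a) (NP.+-suc k w) h))

 sg-move : ∀ p x q s → sg (p ++ x ∷ q ++ s) ≡ negOnePow (length q) Z.* sg (p ++ q ++ x ∷ s)
 sg-move p x [] s = sym (ZP.*-identityˡ _)
 sg-move p x (y ∷ q) s = sg-swap p x y (q ++ s) ∙ cong (λ z → Z.- sg z) (sym (LP.++-assoc p (y ∷ []) (x ∷ q ++ s))) ∙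
   (cong Z.-_ (sg-move (p ++ y ∷ []) x q s)) ∙ cong (λ z → Z.- (negOnePow (length q) Z.* sg z)) (LP.++-assoc p (y ∷ []) (q ++ x ∷ s)) ∙
     ZP.neg-distribˡ-* (negOnePow (length q)) (sg (p ++ y ∷ q ++ x ∷ s))

 signs-snoc : ∀ a L x → a Z.< x → signs a (L ++ x ∷ []) ≡ signs a L
 signs-snoc a [] x h = cong (Z._* + 1) (sign-pos h)
 signs-snoc a (b ∷ L) x h = cong (sign (b Z.- a) Z.*_) (signs-snoc a L x h)

 sg-snoc : ∀ L x → All (Z._< x) L → sg (L ++ x ∷ []) ≡ sg L
 sg-snoc [] x _ = refl
 sg-snoc (a ∷ L) x (h ∷ hs) = cong₂ Z._*_ (signs-snoc a L x h) (sg-snoc L x hs)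

 negOnePow-+ : ∀ a b → negOnePow (a + b) ≡ negOnePow a Z.* negOnePow b
 negOnePow-+ zero b = sym (ZP.*-identityˡ (negOnePow b))
 negOnePow-+ (suc a) b = (cong Z.-_ (negOnePow-+ a b)) ∙ ZP.neg-distribˡ-* (negOnePow a) (negOnePow b)

 -- Adding a first row of length a moves the new largest beta-number past the legs of the first a columns.
 diagram : ∀ m l → Sorted l → All (_≤ m) l → let D = up 0 (reverse l) ++ legs (length l) 0 m l in
   D ↭ iv +0 (length l + m) × sg D ≡ negOnePow (sum l)
 diagram m [] _ _ = Perm.↭-reflexive e , (cong sg e ∙ sg-iv +0 m)
   where e = legs-above 0 0 m [] []
 diagram m (a ∷ l) (h ∷ s) (a≤m ∷ b) with diagram m l s b
 ... | perm , sgn = Perm.↭-trans (Perm.↭-reflexive new) (Perm.↭-trans (subst (Γ ++ R ∷ Λ ++ S ↭_) (sym old) (PermP.++⁺ˡ Γ (Perm.↭-sym (PermP.shift R Λ S)))) (subst (_↭ iv +0 (suc r + m)) refl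
       (Perm.↭-trans (PermP.++⁺ʳ (+ (r + m) ∷ []) perm) (Perm.↭-reflexive (sym (iv-snoc 0 (r + m)))))))
   , (cong sg new ∙ sg-move Γ R Λ S ∙ cong₂ Z._*_ (cong negOnePow (length-legs r 0 a l))
       (cong sg (sym old) ∙ sg-snoc _ _ (PermP.All-resp-↭ (Perm.↭-sym perm) (iv-< 0 (r + m))) ∙ sgn) ∙ sym (negOnePow-+ a (sum l)))
   where
   r = length l
   w = m ∸ a
   Γ = up 0 (reverse l)
   R = + (r + a)
   Λ = legs r 0 a l
   S = iv (+ suc (r + a)) w
   a+w : a + w ≡ m
   a+w = NP.m+[n∸m]≡n a≤m
   new : up 0 (reverse (a ∷ l)) ++ legs (suc r) 0 m (a ∷ l) ≡ Γ ++ R ∷ Λ ++ S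
   new = cong₂ _++_ (cong (up 0) (LP.unfold-reverse a l) ∙ up-snoc 0 (reverse l) a ∙ cong (λ k → Γ ++ + (k + a) ∷ []) (LP.length-reverse l))
       (cong (λ k → legs (suc r) 0 k (a ∷ l)) (sym a+w) ∙ legs-++ (suc r) 0 a w (a ∷ l) ∙ cong₂ _++_ (legs-row r 0 a a l NP.≤-refl) (legs-above (suc r) a w (a ∷ l) (NP.≤-refl ∷ h))) ∙
     LP.++-assoc Γ (R ∷ []) (Λ ++ S)
   old : (Γ ++ legs r 0 m l) ++ + (r + m) ∷ [] ≡ Γ ++ Λ ++ R ∷ S
   old = LP.++-assoc Γ (legs r 0 m l) _ ∙ cong (Γ ++_) (cong₂ (λ k x → legs r 0 k l ++ + x ∷ []) (sym a+w) (cong (λ z → r + z) (sym a+w) ∙ sym (NP.+-assoc r a w)) ∙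
     cong (_++ + (r + a + w) ∷ []) (legs-++ r 0 a w l) ∙ LP.++-assoc Λ (legs r a w l) _ ∙ cong (Λ ++_) (cong (_++ + (r + a + w) ∷ []) (legs-above r a w l h) ∙
       sym (iv-snoc (r + a) w) ∙ cong (λ k → R ∷ iv (+ k) w) (NP.+-comm (r + a) 1)))

 padL-applyUpTo : ∀ n M (g : ℕ → ℕ) → M ≤ n → (∀ j → M ≤ j → g j ≡ 0) → padL n (applyUpTo g M) ≡ applyUpTo g n
 padL-applyUpTo zero zero g _ _ = refl
 padL-applyUpTo (suc n) zero g _ h = cong₂ _∷_ (sym (h 0 z≤n)) (padL-applyUpTo n zero (g ∘ suc) z≤n (λ j _ → h (suc j) z≤n))
 padL-applyUpTo (suc n) (suc M) g (s≤s l) h = cong (g 0 ∷_) (padL-applyUpTo n M (g ∘ suc) l (λ j p → h (suc j) (s≤s p)))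

 ≤-max : ∀ l → All (_≤ foldr _⊔_ 0 l) l
 ≤-max [] = []
 ≤-max (a ∷ l) = NP.m≤m⊔n a _ ∷ All.map (λ h → NP.≤-trans h (NP.m≤n⊔m a _)) (≤-max l)

 max-≤ : ∀ {l n} → All (_≤ n) l → foldr _⊔_ 0 l ≤ n
 max-≤ [] = z≤n
 max-≤ (h ∷ hs) = NP.⊔-lub h (max-≤ hs)

 conjAt-pad : ∀ l k j → conjAt (l ++ replicate k 0) (suc j) ≡ conjAt l (suc j)
 conjAt-pad [] k j = conjAt-above (replicate k 0) j (AllP.replicate⁺ k z≤n)
 conjAt-pad (a ∷ l) k j with suc j N.≤? a
 ... | yes p = conjAt-cons-≤ a _ (suc j) p ∙ cong suc (conjAt-pad l k j) ∙ sym (conjAt-cons-≤ a l (suc j) p)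
 ... | no p = conjAt-cons-> a _ (suc j) (NP.≰⇒> p) ∙ conjAt-pad l k j ∙ sym (conjAt-cons-> a l (suc j) (NP.≰⇒> p))

 conjAt-antitone : ∀ l {i j} → i ≤ j → conjAt l j ≤ conjAt l i
 conjAt-antitone [] _ = z≤n
 conjAt-antitone (a ∷ l) {i} {j} h with j N.≤? a | i N.≤? a
 ... | yes p | yes q = subst (_≤ _) (sym (conjAt-cons-≤ a l j p)) (subst (suc (conjAt l j) ≤_) (sym (conjAt-cons-≤ a l i q)) (s≤s (conjAt-antitone l h)))
 ... | yes p | no q = ⊥-elim (q (NP.≤-trans h p))
 ... | no p | yes q = subst (_≤ _) (sym (conjAt-cons-> a l j (NP.≰⇒> p))) (subst (conjAt l j ≤_) (sym (conjAt-cons-≤ a l i q)) (NP.m≤n⇒m≤1+n (conjAt-antitone l h)))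
 ... | no p | no q = subst (_≤ _) (sym (conjAt-cons-> a l j (NP.≰⇒> p))) (subst (conjAt l j ≤_) (sym (conjAt-cons-> a l i (NP.≰⇒> q))) (conjAt-antitone l h))

 module ConjP {n d l} (p : Part n d l) where
   open PartP p
   columns : padL n (conj l) ≡ applyUpTo (λ j → conjAt l (suc j)) n
   columns = cong (padL n) (sym (LP.map-∘ (upTo M)) ∙ LP.map-upTo (λ j → conjAt l (suc j)) M) ∙
     padL-applyUpTo n M _ (max-≤ (AllP.++⁻ˡ l (subst (All (_≤ n)) (proj₂ padded) bounded))) (λ j M≤j → conjAt-above l j (All.map (λ h → NP.≤-trans h M≤j) (≤-max l)))
     where M = foldr _⊔_ 0 l
   conjAt-padL : ∀ j → conjAt (padL n l) (suc j) ≡ conjAt l (suc j)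
   conjAt-padL j = cong (λ m → conjAt m (suc j)) (proj₂ padded) ∙ conjAt-pad l (proj₁ padded) j
   legs-dn : legs n 0 n (padL n l) ≡ dn n (padL n (conj l))
   legs-dn = go 0 n n (NP.+-identityʳ n) ∙ cong (dn n) (sym columns)
     where
     go : ∀ k w N → n + k ≡ N → legs n k w (padL n l) ≡ dn N (applyUpTo (λ j → conjAt l (suc (k + j))) w)
     go k zero N e = refl
     go k (suc w) N e = cong₂ _∷_ (cong₂ (λ x y → + x Z.- + y) e (conjAt-padL k ∙ cong (λ m → conjAt l (suc m)) (sym (NP.+-identityʳ k))))
       (go (suc k) w (suc N) (NP.+-suc n k ∙ cong suc e) ∙ cong (dn (suc N)) (shifted k w))
       where
       shifted : ∀ k w → applyUpTo (λ j → conjAt l (suc (suc k + j))) w ≡ applyUpTo (λ j → conjAt l (suc (k + suc j))) w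
       shifted k w = sym (LP.map-upTo _ w) ∙ LP.map-cong (λ j → cong (λ m → conjAt l (suc m)) (sym (NP.+-suc k j))) (upTo w) ∙ LP.map-upTo _ w
   -- The classical complementarity of a partition and its conjugate in an n by n box: the numbers
   -- λᵢ + n - i and n - 1 + j - λ'ⱼ exhaust 0, ..., 2n - 1. The second family appears in `diagram`
   -- as the legs.
   full : up 0 (reverse (padL n l)) ++ dn n (padL n (conj l)) ↭ iv +0 (n + n)
   full = subst (λ k → up 0 (reverse (padL n l)) ++ dn n (padL n (conj l)) ↭ iv +0 (k + n)) (length-toList (pad n l))
     (subst (λ z → up 0 (reverse (padL n l)) ++ z ↭ iv +0 (length (padL n l) + n)) legs' (proj₁ (diagram n (padL n l) sorted bounded)))
     where legs' = cong (λ k → legs k 0 n (padL n l)) (length-toList (pad n l)) ∙ legs-dn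
   full-sign : sg (up 0 (reverse (padL n l)) ++ dn n (padL n (conj l))) ≡ negOnePow d
   full-sign = cong (λ z → sg (up 0 (reverse (padL n l)) ++ z)) (sym (cong (λ k → legs k 0 n (padL n l)) (length-toList (pad n l)) ∙ legs-dn)) ∙
     proj₂ (diagram n (padL n l) sorted bounded) ∙ cong negOnePow sum-pad
   conj-sorted : Sorted (padL n (conj l))
   conj-sorted = subst Sorted (sym columns) (AllPairsP.applyUpTo⁺₁ _ n (λ i<j _ → conjAt-antitone l (s≤s (NP.<⇒≤ i<j))))
   conj-bounded : All (_≤ n) (padL n (conj l))
   conj-bounded = subst (All (_≤ n)) (sym columns) (AllP.applyUpTo⁺₂ _ n (λ j → NP.≤-trans (LP.length-filter (suc j N.≤?_) l) len))
   -- Read off from `full` by taking sums: what the first half adds to 0, ..., 2n - 1 the second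
   -- half has to subtract.
   conj-sum : sum (padL n (conj l)) ≡ d
   conj-sum = ZP.+-injective (aux (Σℤ (iv +0 n)) (Σℤ (iv (+ n) n)) (+ d) (+ sum (padL n (conj l)))
     (sym (cong₂ Z._+_ (Σ-up 0 (reverse (padL n l)) ∙ cong₂ (λ k s → Σℤ (iv +0 k) Z.+ + s) (LP.length-reverse (padL n l) ∙ length-toList (pad n l)) (SumP.sum-↭ (PermP.↭-reverse (padL n l)) ∙ sum-pad))
         (Σ-dn n (padL n (conj l)) ∙ cong (λ k → Σℤ (iv (+ n) k) Z.- + sum (padL n (conj l))) (length-toList (pad n (conj l))))) ∙
       sym (Σℤ-++ (up 0 (reverse (padL n l))) _) ∙ Σℤ-↭ full ∙ cong Σℤ (iv-++ 0 n n) ∙ Σℤ-++ (iv +0 n) (iv (+ n) n)))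
     where aux : ∀ x y d s → (x Z.+ d) Z.+ (y Z.- s) ≡ x Z.+ y → s ≡ d
           aux x y d s e = ∙-cancelˡ (x Z.+ y Z.- s) s d (aux₁ x y s ∙ sym e ∙ aux₂ x y d s)
             where aux₁ = ring23
                   aux₂ = ring24

 statP : ℕ → List ℕ → ℕ
 statP n l = stat (padL n l)

 ++-cancelʳ-↭ : ∀ {A : Set} (zs : List A) {xs ys} → xs ++ zs ↭ ys ++ zs → xs ↭ ys
 ++-cancelʳ-↭ zs {xs} {ys} p = go zs (Perm.↭-trans (PermP.++-comm zs xs) (Perm.↭-trans p (PermP.++-comm ys zs)))
   where go : ∀ zs → zs ++ xs ↭ zs ++ ys → xs ↭ ys
         go [] p = p
         go (z ∷ zs) p = go zs (PermP.drop-∷ p)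

 beta : List ℕ → List ℕ
 beta [] = []
 beta (a ∷ l) = (length l + a) ∷ beta l

 up-beta : ∀ l → up 0 (reverse l) ≡ reverse (map +_ (beta l))
 up-beta [] = refl
 up-beta (a ∷ l) = cong (up 0) (LP.unfold-reverse a l) ∙ up-snoc 0 (reverse l) a ∙ cong₂ (λ x k → x ++ + (k + a) ∷ []) (up-beta l) (LP.length-reverse l) ∙
   sym (LP.unfold-reverse (+ (length l + a)) (map +_ (beta l)))

 beta-sorted : ∀ {l} → Sorted l → Sorted (beta l)
 beta-sorted [] = []
 beta-sorted {a ∷ l} (h ∷ s) = go l h ∷ beta-sorted s
   where go : ∀ m → All (_≤ a) m → All (_≤ length m + a) (beta m)
         go [] _ = []
         go (b ∷ m) (l ∷ h) = NP.≤-trans (NP.+-monoʳ-≤ (length m) l) (NP.n≤1+n _) ∷ All.map NP.m≤n⇒m≤1+n (go m h)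

 beta-injective : ∀ l m → length l ≡ length m → beta l ≡ beta m → l ≡ m
 beta-injective [] [] _ _ = refl
 beta-injective (a ∷ l) (b ∷ m) e e' with LP.∷-injective e'
 ... | x , y = cong₂ _∷_ (NP.+-cancelˡ-≡ (length l) a b (x ∙ cong (_+ b) (sym (NP.suc-injective e)))) (beta-injective l m (NP.suc-injective e) y)

 module Triangular {n d mu nu} (pm : Part n d mu) (pn : Part n d nu) where
   private
     module Pm = PartP pm
     module Pn = PartP pn
     module Cn = ConjP pn

   stat-total : ∀ b a → b ↭ padL n mu → a ↭ padL n (conj nu) → up 0 (reverse b) ++ dn n a ↭ iv +0 (n + n) → stat b + stat a ≡ statP n nu + stat (padL n (conj nu))
   stat-total b a pb pa p = ZP.+-injective (stat-sum n b a (PermP.↭-length pb ∙ length-toList (pad n mu)) (PermP.↭-length pa ∙ length-toList (pad n (conj nu))) (sb ∙ sym sa) p ∙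
     cong (λ z → + 2 Z.* ((+ n Z.+ + n Z.- + 1) Z.* + z)) (sa ∙ sym Cn.conj-sum) ∙
       sym (stat-sum n (padL n nu) (padL n (conj nu)) (length-toList (pad n nu)) (length-toList (pad n (conj nu))) (Pn.sum-pad ∙ sym Cn.conj-sum) Cn.full))
     where sb = SumP.sum-↭ pb ∙ Pm.sum-pad
           sa = SumP.sum-↭ pa ∙ Cn.conj-sum

   stat-≤ : ∀ {b m} → Sorted m → b ↭ m → stat b ≤ stat m
   stat-≤ s p = NP.+-mono-≤ (NP.*-monoʳ-≤ 2 (rearrange s p)) (NP.≤-reflexive (sq-↭ p))

   stat-≡ : ∀ {b m} → Sorted m → b ↭ m → stat b ≡ stat m → b ≡ m
   stat-≡ {b} {m} s p e = rearrange-≡ s p (NP.*-cancelˡ-≡ _ _ 2 (NP.+-cancelʳ-≡ (sq m) (2 * wN b) (2 * wN m) (cong (λ z → 2 * wN b + z) (sym (sq-↭ p)) ∙ e)))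

   -- Cancelling the second half against `full` leaves the beta-numbers of μ and ν as rearrangements
   -- of each other. Both are sorted, hence equal, and they determine the partitions.
   same : up 0 (reverse (padL n mu)) ++ dn n (padL n (conj nu)) ↭ iv +0 (n + n) → nu ≡ mu
   same p = pad-≡ pn pm (sym (beta-injective (padL n mu) (padL n nu) (length-toList (pad n mu) ∙ sym (length-toList (pad n nu))) (sorted-unique (beta-sorted Pm.sorted) (beta-sorted Pn.sorted)
     (P.subst₂ _↭_ (abs-+ (beta (padL n mu))) (abs-+ (beta (padL n nu))) (PermP.map⁺ Z.∣_∣
       (Perm.↭-trans (unreverse (padL n mu)) (Perm.↭-trans (++-cancelʳ-↭ (dn n (padL n (conj nu))) (Perm.↭-trans p (Perm.↭-sym Cn.full))) (Perm.↭-sym (unreverse (padL n nu))))))))))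
     where
     unreverse : ∀ l → map +_ (beta l) ↭ up 0 (reverse l)
     unreverse l = Perm.↭-trans (Perm.↭-sym (PermP.↭-reverse (map +_ (beta l)))) (Perm.↭-reflexive (sym (up-beta l)))
     abs-+ : ∀ l → map Z.∣_∣ (map +_ l) ≡ l
     abs-+ l = sym (LP.map-∘ l) ∙ LP.map-id l

   fills : ∀ {b a} → up 0 (reverse b) ++ dn n a ↭ iv +0 (n + n) → b ≡ padL n mu → a ≡ padL n (conj nu) → nu ≡ mu × b ≡ padL n mu × a ≡ padL n (conj nu)
   fills p refl refl = same p , refl , refl

   -- The sum stat b + stat a is the same for all fillings, in particular for the sorted ν and ν'.
   -- Sorting can only increase `stat`, so stat ν + stat ν' is at most stat μ + stat ν', and
   -- equality forces b and a to be sorted already.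
   triangular : ∀ b a → b ↭ padL n mu → a ↭ padL n (conj nu) → up 0 (reverse b) ++ dn n a ↭ iv +0 (n + n) →
     statP n nu < statP n mu ⊎ (nu ≡ mu × b ≡ padL n mu × a ≡ padL n (conj nu))
   triangular b a pb pa p = Sum.map₂ equal (NP.m≤n⇒m<n∨m≡n (NP.+-cancelʳ-≤ A (statP n nu) (statP n mu) (subst (_≤ statP n mu + A) total (NP.+-mono-≤ b≤ a≤))))
     where
     A = stat (padL n (conj nu))
     total : stat b + stat a ≡ statP n nu + A
     total = stat-total b a pb pa p
     b≤ : stat b ≤ statP n mu
     b≤ = stat-≤ Pm.sorted pb
     a≤ : stat a ≤ A
     a≤ = stat-≤ Cn.conj-sorted pa
     equal : statP n nu ≡ statP n mu → nu ≡ mu × b ≡ padL n mu × a ≡ padL n (conj nu)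
     equal e = fills p (stat-≡ Pm.sorted pb (proj₁ s)) (stat-≡ Cn.conj-sorted pa (proj₂ s))
       where s = +-≡-split {stat b} {stat a} {statP n mu} {A} b≤ a≤ (total ∙ cong (_+ A) e)

module Main (n : ℕ) where
 open Polynomials
 open RingIdentities
 open AntisymmetricFunctions
 open Partitions

 -- Exponents and variables
 im : IntegerMap (PR n)
 im = record { ι = cst ; ι-+ = cst-+ ; ι-* = cst-* ; ι-neg = cst-neg ; ι-0 = cst-0 ; ι-1 = ≋-refl }

 open RingTheory (PR n) im public

 infixr 1 _◦_
 _◦_ : ∀ {p r s : Poly n} → p ≈ r → r ≈ s → p ≈ s
 _◦_ = trans

 E : Set
 E = Exp n

 N : ℕ
 N = n N.+ n

 swapV : ∀ {A : Set} {m} → ℕ → Vec A m → Vec A m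
 swapV zero (a ∷ b ∷ v) = b ∷ a ∷ v
 swapV zero v = v
 swapV (suc k) [] = []
 swapV (suc k) (a ∷ v) = a ∷ swapV k v

 swapV-+ : ∀ {m} k (v w : Vec ℤ m) → swapV k (V.zipWith Z._+_ v w) ≡ V.zipWith Z._+_ (swapV k v) (swapV k w)
 swapV-+ zero [] [] = P.refl
 swapV-+ zero (a ∷ []) (b ∷ []) = P.refl
 swapV-+ zero (a ∷ b ∷ v) (c ∷ d ∷ w) = P.refl
 swapV-+ (suc k) [] [] = P.refl
 swapV-+ (suc k) (a ∷ v) (b ∷ w) = cong (a Z.+ b ∷_) (swapV-+ k v w)

 swapV-0 : ∀ m k → swapV k (V.replicate m +0) ≡ V.replicate m +0
 swapV-0 zero zero = P.refl
 swapV-0 (suc zero) zero = P.refl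
 swapV-0 (suc (suc m)) zero = P.refl
 swapV-0 zero (suc k) = P.refl
 swapV-0 (suc m) (suc k) = cong (+0 ∷_) (swapV-0 m k)

 swapV-invol : ∀ {A : Set} {m} k (v : Vec A m) → swapV k (swapV k v) ≡ v
 swapV-invol zero [] = P.refl
 swapV-invol zero (a ∷ []) = P.refl
 swapV-invol zero (a ∷ b ∷ v) = P.refl
 swapV-invol (suc k) [] = P.refl
 swapV-invol (suc k) (a ∷ v) = cong (a ∷_) (swapV-invol k v)

 swapV-braid : ∀ {m} k (v : Vec ℤ m) → suc (suc k) N.< m → swapV k (swapV (suc k) (swapV k v)) ≡ swapV (suc k) (swapV k (swapV (suc k) v))
 swapV-braid zero (a ∷ b ∷ c ∷ v) _ = P.refl
 swapV-braid (suc k) (a ∷ v) (s≤s l) = cong (a ∷_) (swapV-braid k v l)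
 swapV-braid zero (a ∷ b ∷ []) (s≤s (s≤s ()))
 swapV-braid zero (a ∷ []) (s≤s ())

 swapV-comm : ∀ {m} k j (v : Vec ℤ m) → suc k N.< j → swapV k (swapV j v) ≡ swapV j (swapV k v)
 swapV-comm zero (suc zero) v (s≤s ())
 swapV-comm zero (suc (suc j)) [] _ = P.refl
 swapV-comm zero (suc (suc j)) (a ∷ []) _ = P.refl
 swapV-comm zero (suc (suc j)) (a ∷ b ∷ v) _ = P.refl
 swapV-comm (suc k) (suc j) [] _ = P.refl
 swapV-comm (suc k) (suc j) (a ∷ v) (s≤s l) = cong (a ∷_) (swapV-comm k j v l)

 toList-swapV : ∀ {m} k (v : Vec ℤ m) → toList (swapV k v) ≡ swapL k (toList v)
 toList-swapV zero [] = P.refl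
 toList-swapV zero (a ∷ []) = P.refl
 toList-swapV zero (a ∷ b ∷ v) = P.refl
 toList-swapV (suc k) [] = P.refl
 toList-swapV (suc k) (a ∷ v) = cong (a ∷_) (toList-swapV k v)

 setV-swap : ∀ {m} k j (v : Vec ℤ m) b → j ≢ k → j ≢ suc k → swapV k (setV j b v) ≡ setV j b (swapV k v)
 setV-swap zero zero v b h _ = ⊥-elim (h P.refl)
 setV-swap zero (suc zero) v b _ h = ⊥-elim (h P.refl)
 setV-swap zero (suc (suc j)) [] b _ _ = P.refl
 setV-swap zero (suc (suc j)) (a ∷ []) b _ _ = P.refl
 setV-swap zero (suc (suc j)) (a ∷ c ∷ v) b _ _ = P.refl
 setV-swap (suc k) j [] b _ _ = P.refl
 setV-swap (suc k) zero (a ∷ v) b _ _ = P.refl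
 setV-swap (suc k) (suc j) (a ∷ v) b h h' = cong (a ∷_) (setV-swap k j v b (h ∘ cong suc) (h' ∘ cong suc))

 setV-swapped : ∀ m k b → suc k N.< m → swapV k (setV k b (V.replicate m +0)) ≡ setV (suc k) b (V.replicate m +0)
 setV-swapped (suc (suc m)) zero b _ = P.refl
 setV-swapped (suc m) (suc k) b (s≤s l) = cong (+0 ∷_) (setV-swapped m k b l)
 setV-swapped (suc zero) zero b (s≤s ())

 -- An additive map of exponents acts on polynomials as a ring homomorphism. Exchanges of variables
 -- and the substitutions xᵢ ↦ q xᵢ and xᵢ ↦ t xᵢ are all of this form.
 record Additive (φ : E → E) : Set where
   field
     φ-⊕ : ∀ e e' → φ (e ⊕ e') ≡ φ e ⊕ φ e'
     φ-0 : φ zeroExp ≡ zeroExp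

 module Hom {φ : E → E} (A : Additive φ) where
   open Additive A
   hom-+ : ∀ p r → mapE φ (p + r) ≈ mapE φ p + mapE φ r
   hom-+ p r .app f = lin-mapE φ f (p + r) ∙ lin-addP _ p r ∙
     P.sym (lin-addP f (mapE φ p) (mapE φ r) ∙ cong₂ Z._+_ (lin-mapE φ f p) (lin-mapE φ f r))
   hom-neg : ∀ p → mapE φ (- p) ≈ - mapE φ p
   hom-neg p .app f = lin-mapE φ f (- p) ∙ lin-oppP _ p ∙ P.sym (lin-oppP f (mapE φ p) ∙ (cong Z.-_ (lin-mapE φ f p)))
   hom-* : ∀ p r → mapE φ (p * r) ≈ mapE φ p * mapE φ r
   hom-* p r .app f = begin
     lin f (mapE φ (p * r)) ≡⟨ lin-mapE φ f (p * r) ⟩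
     lin (f ∘ φ) (p * r) ≡⟨ lin-mulP (f ∘ φ) p r ⟩
     lin (λ e → lin (λ e' → f (φ (e ⊕ e'))) r) p
       ≡⟨ lin-cong (λ e → lin-cong (λ e' → cong f (φ-⊕ e e')) r ∙ P.sym (lin-mapE φ (λ e' → f (φ e ⊕ e')) r)) p ⟩
     lin (λ e → lin (λ e' → f (φ e ⊕ e')) (mapE φ r)) p ≡⟨ P.sym (lin-mapE φ _ p) ⟩
     lin (λ e → lin (λ e' → f (e ⊕ e')) (mapE φ r)) (mapE φ p) ≡⟨ P.sym (lin-mulP f (mapE φ p) (mapE φ r)) ⟩
     lin f (mapE φ p * mapE φ r) ∎
     where open ≡-Reasoning
   hom-0 : mapE φ 0# ≈ 0#
   hom-0 .app f = lin-mapE φ f []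
   hom-1 : mapE φ 1# ≈ 1#
   hom-1 = reflexive (mapE-mono φ zeroExp (+ 1) ∙ cong (λ e → mono e (+ 1)) φ-0)
   hom-cong : ∀ {p r} → p ≈ r → mapE φ p ≈ mapE φ r
   hom-cong = mapE-cong φ
   hom-sub : ∀ p r → mapE φ (p - r) ≈ mapE φ p - mapE φ r
   hom-sub p r = hom-+ p (- r) ◦ +-congˡ (hom-neg r)
   hom-ΣL : {A : Set} (f : A → Poly n) (xs : List A) → mapE φ (ΣL xs f) ≈ ΣL xs (mapE φ ∘ f)
   hom-ΣL f [] = hom-0
   hom-ΣL f (x ∷ xs) = hom-+ (f x) _ ◦ +-congˡ (hom-ΣL f xs)
   hom-Π : {A : Set} (f : A → Poly n) (xs : List A) → mapE φ (Π (map f xs)) ≈ Π (map (mapE φ ∘ f) xs)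
   hom-Π f [] = hom-1
   hom-Π f (x ∷ xs) = hom-* (f x) (Π (map f xs)) ◦ *-congˡ (hom-Π f xs)
   hom-pairProd : {A : Set} (F : A → A → Poly n) (xs : List A) → mapE φ (pairProd F xs) ≈ pairProd (λ x y → mapE φ (F x y)) xs
   hom-pairProd F [] = hom-1
   hom-pairProd F (x ∷ xs) = hom-* (Π (map (F x) xs)) _ ◦ *-cong (hom-Π (F x) xs) (hom-pairProd F xs)

 mapE-∘ : ∀ (φ ψ : E → E) p → mapE φ (mapE ψ p) ≈ mapE (φ ∘ ψ) p
 mapE-∘ φ ψ p .app f = lin-mapE φ f (mapE ψ p) ∙ lin-mapE ψ _ p ∙ P.sym (lin-mapE (φ ∘ ψ) f p)

 mapE-≗ : ∀ {φ ψ : E → E} → (∀ e → φ e ≡ ψ e) → ∀ p → mapE φ p ≈ mapE ψ p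
 mapE-≗ {φ} {ψ} h p .app f = lin-mapE φ f p ∙ lin-cong (λ e → cong f (h e)) p ∙ P.sym (lin-mapE ψ f p)

 mapE-id : ∀ {φ : E → E} → (∀ e → φ e ≡ e) → ∀ p → mapE φ p ≈ p
 mapE-id {φ} h p .app f = lin-mapE φ f p ∙ lin-cong (λ e → cong f (h e)) p

 σ : ℕ → E → E
 σ k e = mkE (swapV (2 N.+ k) (vec e))

 σ-additive : ∀ k → Additive (σ k)
 σ-additive k = record { φ-⊕ = λ e e' → cong mkE (swapV-+ (2 N.+ k) (vec e) (vec e')) ; φ-0 = cong mkE (swapV-0 _ (2 N.+ k)) }

 σP : ℕ → Poly n → Poly n
 σP k = mapE (σ k)

 σP-invol : ∀ k p → σP k (σP k p) ≈ p
 σP-invol k p = mapE-∘ (σ k) (σ k) p ◦ mapE-id (λ e → cong mkE (swapV-invol (2 N.+ k) (vec e))) p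

 xE : ℕ → E
 xE k = setE (2 N.+ k) (+ 1) zeroExp

 -- From here on variables are counted from 0, so X k is the variable with index k + 1. Those with k
 -- < n form the alphabet x, those with n ≤ k < 2n the alphabet y.
 X : ℕ → Poly n
 X k = xP (suc k)

 σ-X-other : ∀ k j → j ≢ k → j ≢ suc k → σP k (X j) ≈ X j
 σ-X-other k j h h' = reflexive (mapE-mono (σ k) (xE j) (+ 1) ∙ cong (λ v → mono (mkE v) (+ 1)) (setV-swap (2 N.+ k) (2 N.+ j) (V.replicate (2 N.+ N) +0) (+ 1)
   (h ∘ NP.suc-injective ∘ NP.suc-injective) (h' ∘ NP.suc-injective ∘ NP.suc-injective) ∙ cong (setV (2 N.+ j) (+ 1)) (swapV-0 (2 N.+ N) (2 N.+ k))))

 σ-X : ∀ k → suc k N.< N → σP k (X k) ≈ X (suc k)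
 σ-X k l = reflexive (mapE-mono (σ k) (xE k) (+ 1) ∙ cong (λ v → mono (mkE v) (+ 1)) (setV-swapped (2 N.+ N) (2 N.+ k) (+ 1) (s≤s (s≤s l))))

 σ-X' : ∀ k → suc k N.< N → σP k (X (suc k)) ≈ X k
 σ-X' k l = mapE-cong (σ k) (sym (σ-X k l)) ◦ σP-invol k (X k)

 -- Gradings, leading forms and regular elements

 keep : (E → Bool) → Poly n → Poly n
 keep b = L.filterᵇ (b ∘ proj₁)

 lin-keep : ∀ b f p → lin f (keep b p) ≡ lin (λ e → if b e then f e else +0) p
 lin-keep b f [] = P.refl
 lin-keep b f ((e , c) ∷ p) with b e
 ... | true = +ˡ (c Z.* f e) (lin-keep b f p)
 ... | false = lin-keep b f p ∙ P.sym (cong (Z._+ lin (λ e → if b e then f e else +0) p) (ZP.*-zeroʳ c) ∙ ZP.+-identityˡ _)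

 keep-cong : ∀ b {p r} → p ≈ r → keep b p ≈ keep b r
 keep-cong b {p} {r} h .app f = lin-keep b f p ∙ app h _ ∙ P.sym (lin-keep b f r)

 lin-congAll : ∀ {ℓ} {Q : E × ℤ → Set ℓ} {f g : E → ℤ} {p} → All Q p → (∀ e c → Q (e , c) → f e ≡ g e) → lin f p ≡ lin g p
 lin-congAll [] h = P.refl
 lin-congAll {p = (e , c) ∷ p} (q ∷ qs) h = cong₂ Z._+_ (cong (c Z.*_) (h e c q)) (lin-congAll qs h)

 -- `Top g` bounds the degree of every listed term, even of terms that cancel. Under this bound
 -- `comp g p` is the leading form of p or zero, and by `comp-*` such forms multiply.
 module Grading (gr : E → ℤ) (gr-⊕ : ∀ e e' → gr (e ⊕ e') ≡ gr e Z.+ gr e') where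

   Top : ℤ → Poly n → Set
   Top g = All (λ t → gr (proj₁ t) Z.≤ g)

   at : ℤ → E → Bool
   at g e = ⌊ gr e Z.≟ g ⌋

   comp : ℤ → Poly n → Poly n
   comp g = keep (at g)

   opaque
     unfolding addP mapE

     top-+ : ∀ {g p r} → Top g p → Top g r → Top g (p + r)
     top-+ = AllP.++⁺

     top-neg : ∀ {g p} → Top g p → Top g (- p)
     top-neg [] = []
     top-neg (h ∷ t) = h ∷ top-neg t

     top-weaken : ∀ {g g' p} → g Z.≤ g' → Top g p → Top g' p
     top-weaken l = All.map (λ h → ZP.≤-trans h l)

     top-* : ∀ {g g' p r} → Top g p → Top g' r → Top (g Z.+ g') (p * r)
     top-* [] _ = []
     top-* {g} {g'} {(e , c) ∷ p} (h ∷ t) t' = AllP.++⁺ (row t') (top-* t t')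
       where
       row : ∀ {r} → Top g' r → Top (g Z.+ g') (map (λ { (e' , c') → (mkE (V.zipWith Z._+_ (vec e) (vec e')) , c Z.* c') }) r)
       row [] = []
       row {(e' , c') ∷ r} (h' ∷ t') = P.subst (Z._≤ g Z.+ g') (P.sym (gr-⊕ e e')) (ZP.+-mono-≤ h h') ∷ row t'

     top-mapE : ∀ {g p} φ → (∀ e → gr (φ e) ≡ gr e) → Top g p → Top g (mapE φ p)
     top-mapE φ h [] = []
     top-mapE {g} {(e , c) ∷ p} φ h (l ∷ t) = P.subst (Z._≤ g) (P.sym (h e)) l ∷ top-mapE φ h t

   comp-cong : ∀ g {p r} → p ≈ r → comp g p ≈ comp g r
   comp-cong g = keep-cong (at g)

   comp-+ : ∀ g p r → comp g (p + r) ≈ comp g p + comp g r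
   comp-+ g p r .app f = lin-keep (at g) f (p + r) ∙ lin-addP _ p r ∙ P.sym (lin-addP f (comp g p) (comp g r) ∙
     cong₂ Z._+_ (lin-keep (at g) f p) (lin-keep (at g) f r))

   comp-neg : ∀ g p → comp g (- p) ≈ - comp g p
   comp-neg g p .app f = lin-keep (at g) f (- p) ∙ lin-oppP _ p ∙ P.sym (lin-oppP f (comp g p) ∙ (cong Z.-_ (lin-keep (at g) f p)))

   comp-mapE : ∀ g φ → (∀ e → gr (φ e) ≡ gr e) → ∀ p → comp g (mapE φ p) ≈ mapE φ (comp g p)
   comp-mapE g φ h p .app f = lin-keep (at g) f (mapE φ p) ∙ lin-mapE φ _ p ∙
     lin-cong (λ e → cong (λ z → if ⌊ z Z.≟ g ⌋ then f (φ e) else +0) (h e)) p ∙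
       P.sym (lin-mapE φ f (comp g p) ∙ lin-keep (at g) _ p)

   comp-* : ∀ {g g' p r} → Top g p → Top g' r → comp (g Z.+ g') (p * r) ≈ comp g p * comp g' r
   comp-* {g} {g'} {p} {r} tp tr .app f = begin
     lin f (comp (g Z.+ g') (p * r)) ≡⟨ lin-keep (at (g Z.+ g')) f (p * r) ⟩
     lin (λ e → if at (g Z.+ g') e then f e else +0) (p * r) ≡⟨ lin-mulP _ p r ⟩
     lin (λ e → lin (λ e' → if at (g Z.+ g') (e ⊕ e') then f (e ⊕ e') else +0) r) p
       ≡⟨ lin-congAll tp (λ e _ h → lin-congAll tr (λ e' _ h' → both e e' h h') ∙ inner e) ⟩
     lin (λ e → if at g e then lin (λ e' → f (e ⊕ e')) (comp g' r) else +0) p ≡⟨ P.sym (lin-keep (at g) _ p) ⟩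
     lin (λ e → lin (λ e' → f (e ⊕ e')) (comp g' r)) (comp g p) ≡⟨ P.sym (lin-mulP f (comp g p) (comp g' r)) ⟩
     lin f (comp g p * comp g' r) ∎
     where
     open ≡-Reasoning
     both : ∀ e e' → gr e Z.≤ g → gr e' Z.≤ g' → (if at (g Z.+ g') (e ⊕ e') then f (e ⊕ e') else +0)
       ≡ (if at g e then (if at g' e' then f (e ⊕ e') else +0) else +0)
     both e e' l l' with gr e Z.≟ g | gr e' Z.≟ g' | gr (e ⊕ e') Z.≟ g Z.+ g'
     ... | yes a | yes b | yes _ = P.refl
     ... | yes a | yes b | no ne = ⊥-elim (ne (gr-⊕ e e' ∙ cong₂ Z._+_ a b))
     ... | yes a | no b | yes eq = ⊥-elim (ZP.<-irrefl (P.sym (gr-⊕ e e') ∙ eq) (ZP.+-mono-≤-< l (ZP.≤∧≢⇒< l' b)))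
     ... | no a | _ | yes eq = ⊥-elim (ZP.<-irrefl (P.sym (gr-⊕ e e') ∙ eq) (ZP.+-mono-<-≤ (ZP.≤∧≢⇒< l a) l'))
     ... | yes a | no b | no _ = P.refl
     ... | no a | _ | no _ = P.refl
     inner : ∀ e → lin (λ e' → if at g e then (if at g' e' then f (e ⊕ e') else +0) else +0) r ≡ (if at g e then lin (λ e' → f (e ⊕ e')) (comp g' r) else +0)
     inner e with at g e
     ... | true = P.sym (lin-keep (at g') _ r)
     ... | false = lin-0 r

   maxGrade : E × ℤ → Poly n → ℤ
   maxGrade t [] = gr (proj₁ t)
   maxGrade t (u ∷ p) = gr (proj₁ t) Z.⊔ maxGrade u p

   top-max : ∀ t p → Top (maxGrade t p) (t ∷ p)
   top-max t [] = ZP.≤-refl ∷ []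
   top-max t (u ∷ p) = ZP.i≤i⊔j (gr (proj₁ t)) (maxGrade u p) ∷ top-weaken (ZP.i≤j⊔i (gr (proj₁ t)) (maxGrade u p)) (top-max u p)

   below : ℤ → E → Bool
   below g e = if at g e then false else true

   below-length : ∀ g p → length (keep (below g) p) N.≤ length p
   below-length g p = LP.length-filter _ p

   below-shorter : ∀ t p → length (keep (below (maxGrade t p)) (t ∷ p)) N.< length (t ∷ p)
   below-shorter t p = go t p (maxGrade t p) (attained t p)
     where
     data Has (g : ℤ) : Poly n → Set where
       here : ∀ {u r} → gr (proj₁ u) ≡ g → Has g (u ∷ r)
       there : ∀ {u r} → Has g r → Has g (u ∷ r)
     attained : ∀ t p → Has (maxGrade t p) (t ∷ p)
     attained t [] = here P.refl
     attained t (u ∷ p) with ZP.≤-total (gr (proj₁ t)) (maxGrade u p)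
     ... | inj₁ l rewrite ZP.i≤j⇒i⊔j≡j l = there (attained u p)
     ... | inj₂ l rewrite ZP.i≥j⇒i⊔j≡i l = here P.refl
     go : ∀ t p g → Has g (t ∷ p) → length (keep (below g) (t ∷ p)) N.< length (t ∷ p)
     go t p g (here e) with gr (proj₁ t) Z.≟ g
     ... | yes _ = s≤s (below-length g p)
     ... | no ne = ⊥-elim (ne e)
     go t (u ∷ p) g (there h) with gr (proj₁ t) Z.≟ g
     ... | yes _ = s≤s (below-length g (u ∷ p))
     ... | no _ = s≤s (go u p g h)

   below-≈ : ∀ g p → comp g p ≈ 0# → p ≈ keep (below g) p
   below-≈ g p h .app f = (lin-cong split p ∙ lin-add _ _ p) ∙
     cong₂ Z._+_ (P.sym (lin-keep (at g) f p) ∙ app h f) (P.sym (lin-keep (below g) f p)) ∙ ZP.+-identityˡ _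
     where
     split : ∀ e → f e ≡ (if at g e then f e else +0) Z.+ (if below g e then f e else +0)
     split e with at g e
     ... | true = P.sym (ZP.+-identityʳ _)
     ... | false = P.sym (ZP.+-identityˡ _)

   -- It suffices that the top component of every p with Q vanishes. Deleting the terms of top
   -- degree then gives an equal polynomial with fewer listed terms, and Q passes to it because it
   -- respects equality.
   descend : (Q : Poly n → Set) → (∀ {p r} → p ≈ r → Q p → Q r) → (∀ p g → Top g p → Q p → comp g p ≈ 0#) → ∀ p → Q p → p ≈ 0#
   descend Q resp step p = go (length p) p NP.≤-refl
     where
     go : ∀ k p → length p N.≤ k → Q p → p ≈ 0#
     go k [] _ _ = refl
     go (suc k) (t ∷ p) l q = e ◦ go k (keep (below g) (t ∷ p)) (NP.≤-pred (NP.≤-trans (below-shorter t p) l)) (resp e q)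
       where g = maxGrade t p
             e = below-≈ g (t ∷ p) (step (t ∷ p) g (top-max t p) q)

   -- If s p = 0, the leading form of s times the top component of p is zero, so that component
   -- vanishes; `descend` does the rest.
   regular-top : ∀ g s → Top g s → Regular (comp g s) → Regular s
   regular-top g s ts rs = descend (λ p → s * p ≈ 0#) (λ e h → *-congˡ (sym e) ◦ h)
     (λ p g' tp h → rs _ (sym (comp-* ts tp) ◦ comp-cong (g Z.+ g') h))

 getV-+ : ∀ {m} j (v w : Vec ℤ m) → getV j (V.zipWith Z._+_ v w) ≡ getV j v Z.+ getV j w
 getV-+ zero [] [] = P.refl
 getV-+ (suc j) [] [] = P.refl
 getV-+ zero (a ∷ v) (b ∷ w) = P.refl
 getV-+ (suc j) (a ∷ v) (b ∷ w) = getV-+ j v w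

 getV-0 : ∀ m j → getV j (V.replicate m +0) ≡ +0
 getV-0 zero zero = P.refl
 getV-0 zero (suc j) = P.refl
 getV-0 (suc m) zero = P.refl
 getV-0 (suc m) (suc j) = getV-0 m j

 getV-set : ∀ {m} j b (v : Vec ℤ m) → j N.< m → getV j (setV j b v) ≡ b
 getV-set zero b (a ∷ v) _ = P.refl
 getV-set (suc j) b (a ∷ v) (s≤s l) = getV-set j b v l

 getV-set-other : ∀ {m} i j b (v : Vec ℤ m) → i ≢ j → getV i (setV j b v) ≡ getV i v
 getV-set-other zero zero b v h = ⊥-elim (h P.refl)
 getV-set-other i j b [] h = P.refl
 getV-set-other zero (suc j) b (a ∷ v) h = P.refl
 getV-set-other (suc i) zero b (a ∷ v) h = P.refl
 getV-set-other (suc i) (suc j) b (a ∷ v) h = getV-set-other i j b v (h ∘ cong suc)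

 getV-ext : ∀ {m} (v w : Vec ℤ m) → (∀ j → getV j v ≡ getV j w) → v ≡ w
 getV-ext [] [] h = P.refl
 getV-ext (a ∷ v) (b ∷ w) h = cong₂ _∷_ (h 0) (getV-ext v w (h ∘ suc))

 zip-inverse : ∀ {m} (v : Vec ℤ m) → V.zipWith Z._+_ (V.map Z.-_ v) v ≡ V.replicate m +0
 zip-inverse [] = P.refl
 zip-inverse (a ∷ v) = cong₂ _∷_ (ZP.+-inverseˡ a) (zip-inverse v)

 regular-mono : ∀ e → Regular (mono e (+ 1))
 regular-mono e = regular-unit {u = mono (mkE (V.map Z.-_ (vec e))) (+ 1)} (mono-* _ e (+ 1) (+ 1) ◦ reflexive (cong (λ v → mono (mkE v) (+ 1)) (zip-inverse (vec e))))

 module Coord (j : ℕ) = Grading (getE j) (λ e e' → getV-+ j (vec e) (vec e'))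

 -- In the j-th exponent the leading form is a single monomial, and monomials are invertible among
 -- Laurent polynomials.
 regular-binomial : ∀ j e e' → getE j e' Z.< getE j e → Regular (mono e (+ 1) - mono e' (+ 1))
 regular-binomial j e e' l = regular-top (getE j e) _ (top-+ (ZP.≤-refl ∷ []) (top-neg (ZP.<⇒≤ l ∷ [])))
   (regular-≈ (sym (comp-+ g (mono e (+ 1)) (- mono e' (+ 1)) ◦ +-cong here* (comp-neg g (mono e' (+ 1)) ◦ -‿cong gone ◦ -0#≈0#) ◦ +-identityʳ _)) (regular-mono e))
   where
   open Coord j
   g = getE j e
   here* : comp g (mono e (+ 1)) ≈ mono e (+ 1)
   here* with getE j e Z.≟ getE j e
   ... | no ne = ⊥-elim (ne P.refl)
   ... | yes _ = refl
   gone : comp g (mono e' (+ 1)) ≈ 0#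
   gone with getE j e' Z.≟ getE j e
   ... | no _ = refl
   ... | yes eq = ⊥-elim (ZP.<-irrefl eq l)

 regular-X : ∀ i j → i N.< N → i ≢ j → Regular (X i - X j)
 regular-X i j l ne = regular-binomial (2 N.+ i) (xE i) (xE j) (P.subst₂ Z._<_
   (P.sym (getV-set-other (2 N.+ i) (2 N.+ j) (+ 1) (V.replicate (2 N.+ N) +0) (ne ∘ NP.suc-injective ∘ NP.suc-injective) ∙ getV-0 (2 N.+ N) (2 N.+ i)))
   (P.sym (getV-set (2 N.+ i) (+ 1) (V.replicate (2 N.+ N) +0) (s≤s (s≤s l)))) (Z.+<+ (s≤s z≤n)))

 -- Divided differences
 open import Relation.Binary.Reasoning.Setoid setoid

 set2 : ∀ {m} → ℕ → ℤ → ℤ → Vec ℤ m → Vec ℤ m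
 set2 k a b v = setV k a (setV (suc k) b v)

 set2-get : ∀ {m} k (v : Vec ℤ m) → set2 k (getV k v) (getV (suc k) v) v ≡ v
 set2-get zero [] = P.refl
 set2-get zero (a ∷ []) = P.refl
 set2-get zero (a ∷ b ∷ v) = P.refl
 set2-get (suc k) [] = P.refl
 set2-get (suc k) (a ∷ v) = cong (a ∷_) (set2-get k v)

 set2-swap : ∀ {m} k (v : Vec ℤ m) → suc k N.< m → set2 k (getV (suc k) v) (getV k v) v ≡ swapV k v
 set2-swap zero (a ∷ b ∷ v) _ = P.refl
 set2-swap zero (a ∷ []) (s≤s ())
 set2-swap (suc k) (a ∷ v) (s≤s l) = cong (a ∷_) (set2-swap k v l)

 zip-0 : ∀ {m} (v : Vec ℤ m) → V.zipWith Z._+_ (V.replicate m +0) v ≡ v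
 zip-0 = VP.zipWith-identityˡ ZP.+-identityˡ

 set2-first : ∀ {m} k a b (v : Vec ℤ m) → suc k N.< m →
   V.zipWith Z._+_ (setV k (+ 1) (V.replicate m +0)) (set2 k a b v) ≡ set2 k (+ 1 Z.+ a) b v
 set2-first zero a b (c ∷ d ∷ v) _ = cong₂ (λ x w → + 1 Z.+ a ∷ x ∷ w) (ZP.+-identityˡ b) (zip-0 v)
 set2-first zero a b (c ∷ []) (s≤s ())
 set2-first (suc k) a b (c ∷ v) (s≤s l) = cong₂ _∷_ (ZP.+-identityˡ c) (set2-first k a b v l)

 set2-second : ∀ {m} k a b (v : Vec ℤ m) → suc k N.< m →
   V.zipWith Z._+_ (setV (suc k) (+ 1) (V.replicate m +0)) (set2 k a b v) ≡ set2 k a (+ 1 Z.+ b) v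
 set2-second zero a b (c ∷ d ∷ v) _ = cong₂ (λ x w → x ∷ + 1 Z.+ b ∷ w) (ZP.+-identityˡ a) (zip-0 v)
 set2-second zero a b (c ∷ []) (s≤s ())
 set2-second (suc k) a b (c ∷ v) (s≤s l) = cong₂ _∷_ (ZP.+-identityˡ c) (set2-second k a b v l)

 lin-sub : ∀ (f g : E → ℤ) p → lin (λ e → f e Z.- g e) p ≡ lin f p Z.- lin g p
 lin-sub f g p = lin-add f (λ e → Z.- g e) p ∙ +ˡ (lin f p) (lin-cong (λ e → P.sym (ZP.-1*i≡-i (g e))) p ∙
   lin-scale -1ℤ g p ∙ ZP.-1*i≡-i (lin g p))

 lin-mono1 : ∀ (f : E → ℤ) e → lin f (mono e (+ 1)) ≡ f e
 lin-mono1 f e = lin-mono f e (+ 1) ∙ ZP.*-identityˡ (f e)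

 lin-constant : ∀ (f : E → ℤ) (F : ℕ → E) c l → lin f (map (λ j → (F j , c)) l) ≡ c Z.* lin f (map (λ j → (F j , + 1)) l)
 lin-constant f F c [] = P.sym (ZP.*-zeroʳ c)
 lin-constant f F c (j ∷ l) = +ˡ (c Z.* f (F j)) (lin-constant f F c l) ∙ ring25 c (f (F j)) _

 telescope : ∀ (g : E → ℤ) (F : ℕ → E) (h : ℕ → ℤ) (s : ℕ → ℕ) m → (∀ j → g (F (s j)) ≡ h j Z.- h (suc j)) →
   lin g (map (λ j → (F j , + 1)) (applyUpTo s m)) ≡ h 0 Z.- h m
 telescope g F h s zero e = P.sym (ZP.+-inverseʳ (h 0))
 telescope g F h s (suc m) e = cong₂ Z._+_ (cong (+ 1 Z.*_) (e 0)) (telescope g F (h ∘ suc) (s ∘ suc) m (e ∘ suc)) ∙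
   ring26 (h 0) (h 1) (h (suc m))

 ddMono-scale : ∀ i f e c → lin f (ddMono i (e , c)) ≡ c Z.* lin f (ddMono {n} i (e , + 1))
 ddMono-scale i f e c with getE (suc i) e Z.- getE (suc (suc i)) e
 ... | + zero = P.sym (ZP.*-zeroʳ c)
 ... | + suc m = lin-constant f _ c (upTo (suc m))
 ... | -[1+ m ] = lin-constant f _ (Z.- c) (upTo (suc m)) ∙ ring27 c _ ∙
     cong (c Z.*_) (P.sym (lin-constant f _ -1ℤ (upTo (suc m))))

 opaque
   dd : ℕ → Poly n → Poly n
   dd k = ∂ (suc k)

   dd-def : ∀ k p → dd k p ≡ ∂ (suc k) p
   dd-def k p = P.refl

   lin-dd : ∀ k f p → lin f (dd k p) ≡ lin (λ e → lin f (ddMono (suc k) (e , + 1))) p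
   lin-dd k f [] = P.refl
   lin-dd k f ((e , c) ∷ p) = lin-++ f (ddMono (suc k) (e , c)) (∂ (suc k) p) ∙
     cong₂ Z._+_ (ddMono-scale (suc k) f e c) (lin-dd k f p)

 dd-cong : ∀ k {p r} → p ≈ r → dd k p ≈ dd k r
 dd-cong k {p} {r} h .app f = lin-dd k f p ∙ app h _ ∙ P.sym (lin-dd k f r)

 dd-0 : ∀ k {p} → p ≈ 0# → dd k p ≈ 0#
 dd-0 k h = dd-cong k h ◦ (λ-zero)
   where λ-zero : dd k 0# ≈ 0#
         λ-zero .app f = lin-dd k f 0#

 module _ (k : ℕ) (l : suc k N.< N) (f : E → ℤ) where
   private
     G : E → ℤ
     G e = f (xE k ⊕ e) Z.- f (xE (suc k) ⊕ e)
     l' : suc (suc (suc k)) N.< 2 N.+ N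
     l' = s≤s (s≤s l)

   -- G is f after multiplication by the difference of the two variables. On the monomials listed by
   -- `ddAux` it telescopes, and only e and its exchange remain.
   ddMono-spec : ∀ e → lin G (ddMono (suc k) (e , + 1)) ≡ f e Z.- f (σ k e)
   ddMono-spec e with getE (2 N.+ k) e Z.- getE (3 N.+ k) e in eq
   ... | + zero = P.sym (ZP.+-inverseʳ (f e)) ∙ cong (λ e' → f e Z.- f e') (cong mkE
         (P.sym (set2-get (2 N.+ k) (vec e)) ∙ cong₂ (λ a b → set2 (2 N.+ k) a b (vec e)) a≡b (P.sym a≡b) ∙ set2-swap (2 N.+ k) (vec e) l'))
     where a≡b = ZP.i-j≡0⇒i≡j (getE (2 N.+ k) e) (getE (3 N.+ k) e) eq
   ... | + suc m = telescope G _ h id (suc m) step ∙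
       cong₂ (λ x y → f x Z.- f y) (cong₂ F (aux₀ a) (ZP.+-identityʳ b) ∙ cong mkE (set2-get (2 N.+ k) (vec e)))
         (cong₂ F (cong (λ z → a Z.- z) (P.sym eq) ∙ aux₁ a b) (+ˡ b (P.sym eq) ∙ aux₂ a b) ∙ cong mkE (set2-swap (2 N.+ k) (vec e) l'))
     where
     a = getE (2 N.+ k) e
     b = getE (3 N.+ k) e
     F : ℤ → ℤ → E
     F a b = mkE (set2 (2 N.+ k) a b (vec e))
     h : ℕ → ℤ
     h j = f (F (a Z.- + j) (b Z.+ + j))
     aux₀ = ring28
     aux₁ = ring29
     aux₂ = ring30
     aux₃ = ring31
     aux₄ = ring32
     aux₅ = ring33
     step : ∀ j → G (F (a Z.- + 1 Z.- + j) (b Z.+ + j)) ≡ h j Z.- h (suc j)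
     step j = cong₂ (λ x y → f x Z.- f y)
       (cong mkE (set2-first (2 N.+ k) _ _ (vec e) l' ∙ cong (λ z → set2 (2 N.+ k) z (b Z.+ + j) (vec e)) (aux₃ a (+ j))))
       (cong mkE (set2-second (2 N.+ k) _ _ (vec e) l' ∙ cong₂ (λ y z → set2 (2 N.+ k) y z (vec e)) (aux₅ a (+ j)) (aux₄ b (+ j))))
   ... | -[1+ m ] = lin-constant G _ -1ℤ (upTo (suc m)) ∙ cong (Z.- + 1 Z.*_) (telescope G _ h id (suc m) step) ∙
       aux₆ (h 0) (h (suc m)) ∙ cong₂ (λ x y → f x Z.- f y)
         (cong₂ F (cong (λ z → b Z.+ z) (P.sym eq) ∙ aux₂ a b) (cong (λ z → a Z.- z) (P.sym eq) ∙ aux₁ a b) ∙ cong mkE (set2-get (2 N.+ k) (vec e)))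
         (cong₂ F (aux₀ b) (ZP.+-identityʳ a) ∙ cong mkE (set2-swap (2 N.+ k) (vec e) l'))
     where
     a = getE (2 N.+ k) e
     b = getE (3 N.+ k) e
     F : ℤ → ℤ → E
     F a b = mkE (set2 (2 N.+ k) a b (vec e))
     h : ℕ → ℤ
     h j = f (F (b Z.- + j) (a Z.+ + j))
     aux₀ = ring28
     aux₁ = ring29
     aux₂ = ring30
     aux₃ = ring31
     aux₄ = ring32
     aux₅ = ring33
     aux₆ = ring34
     step : ∀ j → G (F (b Z.- + 1 Z.- + j) (a Z.+ + j)) ≡ h j Z.- h (suc j)
     step j = cong₂ (λ x y → f x Z.- f y)
       (cong mkE (set2-first (2 N.+ k) _ _ (vec e) l' ∙ cong (λ z → set2 (2 N.+ k) z (a Z.+ + j) (vec e)) (aux₃ b (+ j))))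
       (cong mkE (set2-second (2 N.+ k) _ _ (vec e) l' ∙ cong₂ (λ y z → set2 (2 N.+ k) y z (vec e)) (aux₅ b (+ j)) (aux₄ a (+ j))))

   dd-lin-spec : ∀ p → lin f ((X k - X (suc k)) * dd k p) ≡ lin f (p - σP k p)
   dd-lin-spec p = lin-mulP f (X k - X (suc k)) (dd k p) ∙ lin-addP F (X k) (- X (suc k)) ∙
     cong₂ Z._+_ (lin-mono1 F (xE k)) (lin-oppP F (X (suc k)) ∙ (cong Z.-_ (lin-mono1 F (xE (suc k))))) ∙
     P.sym (lin-sub (λ e → f (xE k ⊕ e)) (λ e → f (xE (suc k) ⊕ e)) (dd k p)) ∙ lin-dd k G p ∙ lin-cong ddMono-spec p ∙
     lin-sub f (f ∘ σ k) p ∙ P.sym (lin-addP f p (- σP k p) ∙ +ˡ (lin f p) (lin-oppP f (σP k p) ∙ (cong Z.-_ (lin-mapE (σ k) f p))))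
     where F : E → ℤ
           F e = lin (λ e' → f (e ⊕ e')) (dd k p)

 u : ℕ → ℕ → Poly n
 u i j = X i - X j

 dd-spec : ∀ k → suc k N.< N → ∀ p → u k (suc k) * dd k p ≈ p - σP k p
 dd-spec k l p .app f = dd-lin-spec k l f p

 module σH k = Hom (σ-additive k)

 regular-u : ∀ k → suc k N.< N → Regular (u k (suc k))
 regular-u k l = regular-X k (suc k) (NP.<-trans (NP.n<1+n k) l) (NP.1+n≢n ∘ P.sym)

 σ-u : ∀ k → suc k N.< N → σP k (u k (suc k)) ≈ - u k (suc k)
 σ-u k l = σH.hom-sub k (X k) (X (suc k)) ◦ +-cong (σ-X k l) (-‿cong (σ-X' k l)) ◦
   solveR 2 (λ a b → a :- b := :- (b :- a)) refl (X (suc k)) (X k)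

 dd-symmetric : ∀ k → suc k N.< N → ∀ p → σP k (dd k p) ≈ dd k p
 dd-symmetric k l p = cancelR (regular-u k l) (begin
   U * σP k (dd k p) ≈⟨ solveR 2 (λ a b → a :* b := :- (:- a :* b)) refl U _ ⟩
   - (- U * σP k (dd k p)) ≈⟨ -‿cong (*-congʳ (sym (σ-u k l)) ◦ sym (σH.hom-* k U (dd k p))) ⟩
   - σP k (U * dd k p) ≈⟨ -‿cong (mapE-cong (σ k) (dd-spec k l p) ◦ σH.hom-sub k p (σP k p) ◦ +-congˡ (-‿cong (σP-invol k p))) ⟩
   - (σP k p - p) ≈⟨ solveR 2 (λ a b → :- (a :- b) := b :- a) refl (σP k p) p ⟩
   p - σP k p ≈⟨ sym (dd-spec k l p) ⟩
   U * dd k p ∎)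
   where U = u k (suc k)

 dd-of-symmetric : ∀ k → suc k N.< N → ∀ p → σP k p ≈ p → dd k p ≈ 0#
 dd-of-symmetric k l p h = regular-u k l _ (dd-spec k l p ◦ sub-zero (sym h))

 -- Everything symmetric in the two variables is thus in the image of `dd k`. Together with ∂_ω ∂ =
 -- 0 this makes ∂_ω vanish on it.
 dd-section : ∀ k → suc k N.< N → ∀ s → σP k s ≈ s → dd k (X k * s) ≈ s
 dd-section k l s h = cancelR (regular-u k l) (dd-spec k l (X k * s) ◦ +-congˡ (-‿cong (σH.hom-* k (X k) s ◦ *-cong (σ-X k l) h)) ◦
   solveR 3 (λ a b s → a :* s :- b :* s := (a :- b) :* s) refl (X k) (X (suc k)) s)

 dd-comm : ∀ k j → suc k N.< j → suc j N.< N → ∀ p → dd k (dd j p) ≈ dd j (dd k p)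
 dd-comm k j k<j j<N p = cancelR (regular-* (regular-u k k<N) (regular-u j j<N)) (begin
   (uk * uj) * dd k (dd j p) ≈⟨ solveR 3 (λ a b c → (a :* b) :* c := b :* (a :* c)) refl uk uj _ ⟩
   uj * (uk * dd k (dd j p)) ≈⟨ half k j k<N j<N fixj ⟩
   (p - σP j p) - (σP k p - σP k (σP j p)) ≈⟨ solveR 4 (λ a b c d → (a :- b) :- (c :- d) := (a :- c) :- (b :- d)) refl p (σP j p) (σP k p) _ ⟩
   (p - σP k p) - (σP j p - σP k (σP j p)) ≈⟨ +-congˡ (-‿cong (+-congˡ (-‿cong commute))) ⟩
   (p - σP k p) - (σP j p - σP j (σP k p)) ≈⟨ sym (half j k j<N k<N fixk) ⟩
   uk * (uj * dd j (dd k p)) ≈⟨ sym (*-assoc uk uj _) ⟩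
   (uk * uj) * dd j (dd k p) ∎)
   where
   k<N = NP.<-trans k<j (NP.<-trans (NP.n<1+n j) j<N)
   uk = u k (suc k)
   uj = u j (suc j)
   commute : σP k (σP j p) ≈ σP j (σP k p)
   commute = mapE-∘ (σ k) (σ j) p ◦ mapE-≗ (λ e → cong mkE (swapV-comm (2 N.+ k) (2 N.+ j) (vec e) (s≤s (s≤s k<j)))) p ◦ sym (mapE-∘ (σ j) (σ k) p)
   k≢ : ∀ {a b} → a N.< b → a ≢ b
   k≢ = NP.<⇒≢
   fixj : σP k uj ≈ uj
   fixj = σH.hom-sub k (X j) (X (suc j)) ◦ +-cong (σ-X-other k j (k≢ (NP.<-trans (NP.n<1+n k) k<j) ∘ P.sym) (k≢ k<j ∘ P.sym))
     (-‿cong (σ-X-other k (suc j) (k≢ (NP.<-trans (NP.n<1+n k) (NP.<-trans k<j (NP.n<1+n j))) ∘ P.sym) (k≢ (NP.<-trans k<j (NP.n<1+n j)) ∘ P.sym)))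
   fixk : σP j uk ≈ uk
   fixk = σH.hom-sub j (X k) (X (suc k)) ◦ +-cong (σ-X-other j k (k≢ (NP.<-trans (NP.n<1+n k) k<j)) (k≢ (NP.<-trans (NP.n<1+n k) (NP.<-trans k<j (NP.n<1+n j)))))
     (-‿cong (σ-X-other j (suc k) (k≢ k<j) (k≢ (NP.<-trans k<j (NP.n<1+n j)))))
   half : ∀ a b → suc a N.< N → suc b N.< N → σP a (u b (suc b)) ≈ u b (suc b) →
     u b (suc b) * (u a (suc a) * dd a (dd b p)) ≈ (p - σP b p) - (σP a p - σP a (σP b p))
   half a b la lb fix = begin
     ub * (u a (suc a) * dd a (dd b p)) ≈⟨ *-congˡ (dd-spec a la (dd b p)) ⟩
     ub * (dd b p - σP a (dd b p)) ≈⟨ solveR 3 (λ a b c → a :* (b :- c) := a :* b :- a :* c) refl ub _ _ ⟩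
     ub * dd b p - ub * σP a (dd b p) ≈⟨ +-cong (dd-spec b lb p) (-‿cong (*-congʳ (sym fix) ◦ sym (σH.hom-* a ub (dd b p)) ◦
        mapE-cong (σ a) (dd-spec b lb p) ◦ σH.hom-sub a p (σP b p))) ⟩
     (p - σP b p) - (σP a p - σP a (σP b p)) ∎
     where ub = u b (suc b)

 -- Multiplied by the three differences of the variables involved, ∂_a ∂_b ∂_a becomes the
 -- alternating sum over six permutations. The statement leaves open which of a and b is smaller,
 -- with uC for the difference of the outer two variables, so both sides of the braid relation are
 -- instances.
 braid-half : ∀ a b → suc a N.< N → suc b N.< N → ∀ uC → let uA = u a (suc a) ; uB = u b (suc b) in
   σP a uC ≈ uB → σP a uB ≈ uC → σP b uA ≈ uC → uC - uB ≈ uA → ∀ p →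
   uA * (uC * (uB * dd a (dd b (dd a p)))) ≈
     (((p - σP a p) - σP b p) + σP b (σP a p)) + (σP a (σP b p) - σP a (σP b (σP a p)))
 braid-half a b la lb uC h₁ h₂ h₃ h₄ p = begin
   uA * (uC * (uB * dd a q)) ≈⟨ solveR 4 (λ a b c d → a :* (b :* (c :* d)) := (b :* c) :* (a :* d)) refl uA uC uB _ ⟩
   (uC * uB) * (uA * dd a q) ≈⟨ *-congˡ (dd-spec a la q) ⟩
   (uC * uB) * (q - σP a q) ≈⟨ solveR 4 (λ c b q s → (c :* b) :* (q :- s) := c :* (b :* q) :- (b :* c) :* s) refl uC uB q _ ⟩
   uC * (uB * q) - (uB * uC) * σP a q ≈⟨ +-congˡ (-‿cong (*-congʳ (sym (σH.hom-* a uC uB ◦ *-cong h₁ h₂)) ◦ sym (σH.hom-* a (uC * uB) q) ◦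
       mapE-cong (σ a) (*-assoc uC uB q ◦ inner))) ⟩
   uC * (uB * q) - σP a (uC * r - (σP b p - σP b (σP a p))) ≈⟨ +-cong inner (-‿cong (σH.hom-sub a (uC * r) _ ◦ +-cong (σH.hom-* a uC r ◦ *-cong h₁ (dd-symmetric a la p))
       (-‿cong (σH.hom-sub a (σP b p) _)))) ⟩
   (uC * r - (σP b p - σP b (σP a p))) - (uB * r - (σP a (σP b p) - σP a (σP b (σP a p))))
     ≈⟨ solveR 7 (λ c b r x y z w → (c :* r :- (x :- y)) :- (b :* r :- (z :- w)) := ((c :- b) :* r :- x :+ y) :+ (z :- w)) refl uC uB r _ _ _ _ ⟩
   (((uC - uB) * r - σP b p) + σP b (σP a p)) + (σP a (σP b p) - σP a (σP b (σP a p)))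
     ≈⟨ +-congʳ (+-congʳ (+-congʳ (*-congʳ h₄ ◦ dd-spec a la p))) ⟩
   (((p - σP a p) - σP b p) + σP b (σP a p)) + (σP a (σP b p) - σP a (σP b (σP a p))) ∎
   where
   uA = u a (suc a)
   uB = u b (suc b)
   r = dd a p
   q = dd b r
   inner : uC * (uB * q) ≈ uC * r - (σP b p - σP b (σP a p))
   inner = begin
     uC * (uB * q) ≈⟨ *-congˡ (dd-spec b lb r) ⟩
     uC * (r - σP b r) ≈⟨ solveR 3 (λ a b c → a :* (b :- c) := a :* b :- a :* c) refl uC r _ ⟩
     uC * r - uC * σP b r ≈⟨ +-congˡ (-‿cong (*-congʳ (sym h₃) ◦ sym (σH.hom-* b uA r) ◦ mapE-cong (σ b) (dd-spec a la p) ◦ σH.hom-sub b p (σP a p))) ⟩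
     uC * r - (σP b p - σP b (σP a p)) ∎

 dd-braid : ∀ k → suc (suc k) N.< N → ∀ p → dd k (dd (suc k) (dd k p)) ≈ dd (suc k) (dd k (dd (suc k) p))
 dd-braid k l p = cancelR (regular-* (regular-u k l₀) (regular-* (regular-X k (2 N.+ k) (NP.<-trans (NP.n<1+n k) l₀) (NP.<⇒≢ (NP.m≤n⇒m≤1+n (NP.n<1+n k)))) (regular-u (suc k) l))) (begin
   (u01 * (u02 * u12)) * dd k (dd (suc k) (dd k p)) ≈⟨ solveR 4 (λ a b c d → (a :* (b :* c)) :* d := a :* (b :* (c :* d))) refl u01 u02 u12 _ ⟩
   u01 * (u02 * (u12 * dd k (dd (suc k) (dd k p)))) ≈⟨ braid-half k (suc k) l₀ l u02
       (sub k (σ-X k l₀) s2) (sub k (σ-X' k l₀) s2) (sub (suc k) s0 (σ-X (suc k) l)) (solveR 3 (λ a b c → (a :- c) :- (b :- c) := a :- b) refl (X k) (X (suc k)) (X (2 N.+ k))) p ⟩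
   (((p - σP k p) - σP (suc k) p) + σP (suc k) (σP k p)) + (σP k (σP (suc k) p) - σP k (σP (suc k) (σP k p)))
     ≈⟨ solveR 6 (λ a b c d e f → (((a :- b) :- c) :+ d) :+ (e :- f) := (((a :- c) :- b) :+ e) :+ (d :- f)) refl p _ _ _ _ _ ⟩
   (((p - σP (suc k) p) - σP k p) + σP k (σP (suc k) p)) + (σP (suc k) (σP k p) - σP k (σP (suc k) (σP k p)))
     ≈⟨ +-congˡ (+-congˡ (-‿cong braid)) ⟩
   (((p - σP (suc k) p) - σP k p) + σP k (σP (suc k) p)) + (σP (suc k) (σP k p) - σP (suc k) (σP k (σP (suc k) p)))
     ≈⟨ sym (braid-half (suc k) k l l₀ u02 (sub (suc k) s0 (σ-X' (suc k) l)) (sub (suc k) s0 (σ-X (suc k) l)) (sub k (σ-X' k l₀) s2)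
        (solveR 3 (λ a b c → (a :- c) :- (a :- b) := b :- c) refl (X k) (X (suc k)) (X (2 N.+ k))) p) ⟩
   u12 * (u02 * (u01 * dd (suc k) (dd k (dd (suc k) p)))) ≈⟨ solveR 4 (λ a b c d → c :* (b :* (a :* d)) := (a :* (b :* c)) :* d) refl u01 u02 u12 _ ⟩
   (u01 * (u02 * u12)) * dd (suc k) (dd k (dd (suc k) p)) ∎)
   where
   l₀ = NP.<-trans (NP.n<1+n (suc k)) l
   u01 = u k (suc k)
   u02 = u k (2 N.+ k)
   u12 = u (suc k) (2 N.+ k)
   s0 : σP (suc k) (X k) ≈ X k
   s0 = σ-X-other (suc k) k (NP.<⇒≢ (NP.n<1+n k)) (NP.<⇒≢ (NP.m≤n⇒m≤1+n (NP.n<1+n k)))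
   s2 : σP k (X (2 N.+ k)) ≈ X (2 N.+ k)
   s2 = σ-X-other k (2 N.+ k) (NP.<⇒≢ (NP.m≤n⇒m≤1+n (NP.n<1+n k)) ∘ P.sym) (NP.<⇒≢ (NP.n<1+n (suc k)) ∘ P.sym)
   sub : ∀ j {a b c d} → σP j a ≈ c → σP j b ≈ d → σP j (a - b) ≈ c - d
   sub j {a} {b} h h' = σH.hom-sub j a b ◦ +-cong h (-‿cong h')
   braid : σP k (σP (suc k) (σP k p)) ≈ σP (suc k) (σP k (σP (suc k) p))
   braid = mapE-cong (σ k) (mapE-∘ (σ (suc k)) (σ k) p) ◦ mapE-∘ (σ k) _ p ◦
     mapE-≗ (λ e → cong mkE (swapV-braid (2 N.+ k) (vec e) (s≤s (s≤s l)))) p ◦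
       sym (mapE-cong (σ (suc k)) (mapE-∘ (σ k) (σ (suc k)) p) ◦ mapE-∘ (σ (suc k)) _ p)

 -- chain k m = ∂ₖ₊₁ ∂ₖ₊₂ ⋯ ∂ₖ₊ₘ
 chain : ℕ → ℕ → Poly n → Poly n
 chain k zero f = f
 chain k (suc m) f = dd k (chain (suc k) m f)

 chain-cong : ∀ k m {p r} → p ≈ r → chain k m p ≈ chain k m r
 chain-cong k zero h = h
 chain-cong k (suc m) h = dd-cong k (chain-cong (suc k) m h)

 chain-0 : ∀ k m {p} → p ≈ 0# → chain k m p ≈ 0#
 chain-0 k zero h = h
 chain-0 k (suc m) h = dd-0 k (chain-0 (suc k) m h)

 chain-dd : ∀ k m i p → suc i N.< k → k N.+ m N.< N → chain k m (dd i p) ≈ dd i (chain k m p)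
 chain-dd k zero i p _ _ = refl
 chain-dd k (suc m) i p l l' = dd-cong k (chain-dd (suc k) m i p (NP.m≤n⇒m≤1+n l) l″) ◦
   sym (dd-comm i k l (NP.≤-trans (s≤s (s≤s (NP.m≤m+n k m))) l″) _)
   where l″ = P.subst (N._< N) (NP.+-suc k m) l'

 -- ∂_i commutes with the factors of index above i + 1, the braid relation turns ∂_i ∂_(i+1) ∂_i
 -- into ∂_(i+1) ∂_i ∂_(i+1), and the new factor ∂_(i+1) commutes with those of index below i.
 chain-push : ∀ k m i p → k N.≤ i → suc (suc i) N.≤ k N.+ m → k N.+ m N.< N → chain k m (dd i p) ≈ dd (suc i) (chain k m p)
 chain-push k zero i p a b c = ⊥-elim (NP.<-irrefl P.refl (NP.≤-trans (NP.m≤n⇒m≤1+n (s≤s a)) (P.subst (suc (suc i) N.≤_) (NP.+-identityʳ k) b)))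
 chain-push k (suc m) i p a b c with NP.m≤n⇒m<n∨m≡n a
 ... | inj₁ k<i = dd-cong k (chain-push (suc k) m i p k<i (P.subst (suc (suc i) N.≤_) (NP.+-suc k m) b) (P.subst (N._< N) (NP.+-suc k m) c)) ◦
     dd-comm k (suc i) (s≤s k<i) (NP.≤-<-trans b c) _
 chain-push k (suc zero) i p a b c | inj₂ P.refl = ⊥-elim (NP.<-irrefl P.refl (P.subst (suc (suc k) N.≤_) (NP.+-comm k 1) b))
 chain-push k (suc (suc m)) i p a b c | inj₂ P.refl = dd-cong k (dd-cong (suc k) (chain-dd (2 N.+ k) m k p NP.≤-refl c″)) ◦
     dd-braid k (NP.≤-<-trans (s≤s (s≤s (NP.m≤m+n k m))) c″) _
   where c″ : 2 N.+ k N.+ m N.< N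
         c″ = P.subst (N._< N) (NP.+-suc k (suc m) ∙ cong suc (NP.+-suc k m)) c

 chain-last : ∀ k m p → k N.+ suc m N.< N → chain k (suc m) (dd (k N.+ m) p) ≈ 0#
 chain-last k zero p l rewrite NP.+-identityʳ k = dd-of-symmetric k l' (dd k p) (dd-symmetric k l' p)
   where l' = P.subst (N._< N) (NP.+-comm k 1) l
 chain-last k (suc m) p l rewrite NP.+-suc k m = dd-0 k (chain-last (suc k) m p (P.subst (N._< N) (NP.+-suc k (suc m)) l))

 -- omega m = (∂ₘ ⋯ ∂_{N-1}) ⋯ (∂₁ ⋯ ∂_{N-1})
 omega : ℕ → Poly n → Poly n
 omega zero f = f
 omega (suc m) f = chain m (N N.∸ 1 N.∸ m) (omega m f)

 omega-cong : ∀ m {p r} → p ≈ r → omega m p ≈ omega m r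
 omega-cong zero h = h
 omega-cong (suc m) h = chain-cong m (N N.∸ 1 N.∸ m) (omega-cong m h)

 private
   width : ∀ m → m N.< N → m N.+ (N N.∸ 1 N.∸ m) ≡ N N.∸ 1
   width m l = NP.m+[n∸m]≡n (NP.≤-pred (P.subst (suc m N.≤_) (P.sym (suc-pred l)) l))
     where suc-pred : ∀ {a b} → a N.< b → suc (b N.∸ 1) ≡ b
           suc-pred (s≤s _) = P.refl
   bound : ∀ {m M} → m N.< M → M N.∸ 1 N.< M
   bound (s≤s _) = NP.n<1+n _

 omega-push : ∀ m i p → suc i N.+ m N.< N → omega m (dd i p) ≈ dd (i N.+ m) (omega m p)
 omega-push zero i p l = reflexive (cong (λ j → dd j p) (P.sym (NP.+-identityʳ i)))
 omega-push (suc m) i p l = chain-cong m (N N.∸ 1 N.∸ m) (omega-push m i p l₁) ◦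
   chain-push m _ (i N.+ m) _ (NP.m≤n+m m i) (P.subst (suc (suc (i N.+ m)) N.≤_) (P.sym w) (NP.≤-pred (NP.≤-trans l₂ (NP.≤-reflexive (P.sym (suc-pred l₁)))))) (P.subst (N._< N) (P.sym w) (bound l₁)) ◦
     reflexive (cong (λ j → dd j (chain m (N N.∸ 1 N.∸ m) (omega m p))) (P.sym (NP.+-suc i m)))
   where
   l₂ : suc (suc (suc (i N.+ m))) N.≤ N
   l₂ = P.subst (N._≤ N) (cong (suc ∘ suc) (NP.+-suc i m)) l
   l₁ : suc i N.+ m N.< N
   l₁ = NP.<⇒≤ l₂
   w = width m (NP.≤-<-trans (NP.m≤n+m m (suc i)) l₁)
   suc-pred : ∀ {a b} → a N.< b → suc (b N.∸ 1) ≡ b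
   suc-pred (s≤s _) = P.refl

 -- Each chain raises the index of ∂_i by one, until it equals that of the last factor of the next
 -- chain; there a divided difference is applied twice, which gives zero.
 omega-kill : ∀ m i p → suc i N.< N → m N.< N → N N.≤ suc i N.+ m → omega m (dd i p) ≈ 0#
 omega-kill zero i p l _ h = ⊥-elim (NP.<-irrefl P.refl (NP.≤-trans l (P.subst (N N.≤_) (NP.+-identityʳ (suc i)) h)))
 omega-kill (suc m) i p l m<N h with N N.≤? suc i N.+ m
 ... | yes h' = chain-0 m (N N.∸ 1 N.∸ m) (omega-kill m i p l (NP.<⇒≤ m<N) h')
 ... | no ¬h' = chain-cong m (N N.∸ 1 N.∸ m) (omega-push m i p (NP.≰⇒> ¬h')) ◦
     reflexive (cong₂ (λ w j → chain m w (dd j (omega m p))) wid (NP.+-comm i m)) ◦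
       chain-last m i (omega m p) (P.subst (N._< N) (NP.+-comm (suc i) m ∙ P.refl) (NP.≰⇒> ¬h'))
   where
   eq : N ≡ suc (suc i N.+ m)
   eq = NP.≤-antisym (P.subst (N N.≤_) (NP.+-suc (suc i) m) h) (NP.≰⇒> ¬h')
   wid : N N.∸ 1 N.∸ m ≡ suc i
   wid = cong (λ z → z N.∸ 1 N.∸ m) eq ∙ NP.m+n∸n≡m (suc i) m

 -- p plus its exchange is symmetric, hence an image under `dd k`, hence killed. This gives the
 -- antisymmetry of ∂_ω without its expansion over all permutations.
 omega-anti : ∀ k → suc k N.< N → ∀ p → omega (N N.∸ 1) (p + σP k p) ≈ 0#
 omega-anti k l p = omega-cong (N N.∸ 1) (sym (dd-section k l _ sym')) ◦
   omega-kill (N N.∸ 1) k _ l (bound l) (NP.≤-trans (NP.≤-reflexive (P.sym (suc-pred l))) (s≤s (NP.m≤n+m (N N.∸ 1) k)))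
   where
   suc-pred : ∀ {a b} → a N.< b → suc (b N.∸ 1) ≡ b
   suc-pred (s≤s _) = P.refl
   sym' : σP k (p + σP k p) ≈ p + σP k p
   sym' = σH.hom-+ k p (σP k p) ◦ +-congˡ (σP-invol k p) ◦ +-comm (σP k p) p

 -- The staircase functional
 mkX : ℤ → ℤ → Vec ℤ N → E
 mkX q t v = mkE (q ∷ t ∷ v)

 xs : E → Vec ℤ N
 xs e = V.tail (V.tail (vec e))

 exps : E → List ℤ
 exps e = toList (xs e)

 0V : ∀ {m} → Vec ℤ m
 0V = V.replicate _ +0

 qtE : E → E
 qtE e = mkX (getE 0 e) (getE 1 e) 0V

 mkX-η : ∀ e → mkX (getE 0 e) (getE 1 e) (xs e) ≡ e
 mkX-η (mkE (q ∷ t ∷ v)) = P.refl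

 vl : ∀ m → List ℤ → Vec ℤ m
 vl zero _ = []
 vl (suc m) [] = +0 ∷ vl m []
 vl (suc m) (a ∷ L) = a ∷ vl m L

 vl-toList : ∀ {m} (v : Vec ℤ m) → vl m (toList v) ≡ v
 vl-toList [] = P.refl
 vl-toList (a ∷ v) = cong (a ∷_) (vl-toList v)

 toList-vl : ∀ m L → length L ≡ m → toList (vl m L) ≡ L
 toList-vl zero [] _ = P.refl
 toList-vl (suc m) (a ∷ L) e = cong (a ∷_) (toList-vl m L (NP.suc-injective e))

 vl-replicate : ∀ m → vl m (replicate m +0) ≡ 0V
 vl-replicate zero = P.refl
 vl-replicate (suc m) = cong (+0 ∷_) (vl-replicate m)

 vl-unit : ∀ m p x s → V.zipWith Z._+_ (setV (length p) (+ 1) 0V) (vl m (p ++ x ∷ s)) ≡ vl m (p ++ (+ 1 Z.+ x) ∷ s)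
 vl-unit zero p x s = zeroV _ _
   where zeroV : ∀ (v w : Vec ℤ 0) → v ≡ w
         zeroV [] [] = P.refl
 vl-unit (suc m) [] x s = cong (+ 1 Z.+ x ∷_) (zip-0 (vl m s))
 vl-unit (suc m) (y ∷ p) x s = cong₂ _∷_ (ZP.+-identityˡ y) (vl-unit m p x s)

 vl-swap : ∀ m p y z s → suc (length p) N.< m → swapV (length p) (vl m (p ++ y ∷ z ∷ s)) ≡ vl m (p ++ z ∷ y ∷ s)
 vl-swap (suc (suc m)) [] y z s _ = P.refl
 vl-swap (suc zero) [] y z s (s≤s ())
 vl-swap (suc m) (x ∷ p) y z s (s≤s l) = cong (x ∷_) (vl-swap m p y z s l)

 lst : ℤ → ℤ → List ℤ → E
 lst q t L = mkX q t (vl N L)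

 mono-neg : ∀ (e : E) c → mono e (Z.- c) ≈ - mono e c
 mono-neg e c .app f = lin-mono f e (Z.- c) ∙ P.sym (ZP.neg-distribˡ-* c (f e)) ∙
   P.sym (lin-oppP f (mono e c) ∙ (cong Z.-_ (lin-mono f e c)))

 X-mono : ∀ k e c → X k * mono e c ≈ mono (xE k ⊕ e) c
 X-mono k e c = mono-* (xE k) e (+ 1) c ◦ reflexive (cong (mono _) (ZP.*-identityˡ c))

 dd-mono : ∀ q t p a s c → suc (length p) N.< N →
   dd (length p) (mono (lst q t (p ++ a ∷ (+ 1 Z.+ a) ∷ s)) c) ≈ mono (lst q t (p ++ a ∷ a ∷ s)) (Z.- c)
 dd-mono q t p a s c l = cancelR (regular-u (length p) l) (begin
   u k (suc k) * dd k (mono e c) ≈⟨ dd-spec k l (mono e c) ⟩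
   mono e c - σP k (mono e c) ≈⟨ +-congˡ (-‿cong (reflexive (mapE-mono (σ k) e c ∙ cong (λ v → mono (mkX q t v) c) (vl-swap N p _ _ s l)))) ⟩
   mono e c - mono (lst q t (p ++ (+ 1 Z.+ a) ∷ a ∷ s)) c ≈⟨ +-cong (reflexive (cong (λ e → mono e c) (P.sym second))) (-‿cong (reflexive (cong (λ e → mono e c) (P.sym first)))) ⟩
   mono (xE (suc k) ⊕ e') c - mono (xE k ⊕ e') c ≈⟨ sym (+-cong (X-mono (suc k) e' c) (-‿cong (X-mono k e' c))) ⟩
   X (suc k) * mono e' c - X k * mono e' c ≈⟨ solveR 3 (λ a b m → b :* m :- a :* m := (a :- b) :* (:- m)) refl (X k) (X (suc k)) _ ⟩
   u k (suc k) * - mono e' c ≈⟨ *-congˡ (sym (mono-neg e' c)) ⟩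
   u k (suc k) * mono e' (Z.- c) ∎)
   where
   k = length p
   e = lst q t (p ++ a ∷ (+ 1 Z.+ a) ∷ s)
   e' = lst q t (p ++ a ∷ a ∷ s)
   unit : ∀ p x s → xE (length p) ⊕ lst q t (p ++ x ∷ s) ≡ lst q t (p ++ (+ 1 Z.+ x) ∷ s)
   unit p x s = cong mkE (cong₂ _∷_ (ZP.+-identityˡ q) (cong₂ _∷_ (ZP.+-identityˡ t) (vl-unit N p x s)))
   first : xE k ⊕ e' ≡ lst q t (p ++ (+ 1 Z.+ a) ∷ a ∷ s)
   first = unit p a (a ∷ s)
   second : xE (suc k) ⊕ e' ≡ e
   second = cong₂ (λ j L → xE j ⊕ lst q t L) (P.sym (LP.length-++ p ∙ NP.+-comm k 1)) (P.sym (LP.++-assoc p (a ∷ []) (a ∷ s))) ∙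
     unit (p ++ a ∷ []) a s ∙ cong (lst q t) (LP.++-assoc p (a ∷ []) _)

 negOnePow-sq : ∀ a → negOnePow a Z.* negOnePow a ≡ + 1
 negOnePow-sq zero = P.refl
 negOnePow-sq (suc a) = ring35 (negOnePow a) ∙ negOnePow-sq a

 -- From the right, each ∂ meets exponents a, a + 1 in neighbouring variables and returns a, a with
 -- a minus sign, so all entries of the interval but the first drop by one.
 chain-mono : ∀ q t p a w c → length p N.+ suc w ≡ N →
   chain (length p) w (mono (lst q t (p ++ iv a (suc w))) c) ≈ mono (lst q t (p ++ a ∷ iv a w)) (negOnePow w Z.* c)
 chain-mono q t p a zero c _ = reflexive (cong (mono _) (P.sym (ZP.*-identityˡ c)))
 chain-mono q t p a (suc w) c l = dd-cong k (reflexive (cong₂ (λ j L → chain j w (mono (lst q t L) c)) k' (P.sym (LP.++-assoc p (a ∷ []) _))) ◦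
     chain-mono q t (p ++ a ∷ []) (a Z.+ + 1) w c (cong (N._+ suc w) (P.sym k') ∙ P.sym (NP.+-suc k (suc w)) ∙ l) ◦
      reflexive (cong (λ L → mono (lst q t L) (negOnePow w Z.* c)) (LP.++-assoc p (a ∷ []) _ ∙ cong (λ z → p ++ a ∷ z ∷ iv (a Z.+ + 1) w) (ZP.+-comm a (+ 1))))) ◦
   dd-mono q t p a _ _ (P.subst (suc k N.<_) l (P.subst (suc k N.<_) (P.sym (NP.+-suc k (suc w) ∙ cong suc (NP.+-suc k w))) (s≤s (s≤s (NP.m≤m+n k w))))) ◦
     reflexive (cong (mono _) (ZP.neg-distribˡ-* (negOnePow w) c))
   where k = length p
         k' : suc k ≡ length (p ++ a ∷ [])
         k' = P.sym (LP.length-++ p ∙ NP.+-comm k 1)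

 drops : ℕ → ℕ
 drops zero = 0
 drops (suc m) = (N N.∸ 1 N.∸ m) N.+ drops m

 replicate-snoc : ∀ m (s : List ℤ) → replicate m +0 ++ +0 ∷ s ≡ replicate (suc m) +0 ++ s
 replicate-snoc zero s = P.refl
 replicate-snoc (suc m) s = cong (+0 ∷_) (replicate-snoc m s)

 omega-mono : ∀ q t m → m N.≤ N N.∸ 1 → omega m (mono (lst q t (iv +0 N)) (+ 1)) ≈ mono (lst q t (replicate m +0 ++ iv +0 (N N.∸ m))) (negOnePow (drops m))
 omega-mono q t zero _ = refl
 omega-mono q t (suc m) l = chain-cong m w (omega-mono q t m (NP.<⇒≤ l) ◦ reflexive (cong (λ j → mono (lst q t (replicate m +0 ++ iv +0 j)) (negOnePow (drops m))) eq)) ◦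
   reflexive (cong (λ j → chain j w (mono (lst q t (replicate m +0 ++ iv +0 (suc w))) (negOnePow (drops m)))) (P.sym (LP.length-replicate m))) ◦
   chain-mono q t (replicate m +0) +0 w _ (cong (N._+ suc w) (LP.length-replicate m) ∙ cong (m N.+_) (P.sym eq) ∙ NP.m+[n∸m]≡n (NP.≤-trans (NP.<⇒≤ l) (NP.m∸n≤m N 1))) ◦
     reflexive (cong₂ (λ L c → mono (lst q t L) c) (replicate-snoc m (iv +0 w) ∙ cong (λ j → replicate (suc m) +0 ++ iv +0 j) (NP.∸-+-assoc N 1 m))
       (P.sym (negOnePow-+ w (drops m))))
   where
   w = N N.∸ 1 N.∸ m
   eq : N N.∸ m ≡ suc w
   eq = go N l
     where go : ∀ M → suc m N.≤ M N.∸ 1 → M N.∸ m ≡ suc (M N.∸ 1 N.∸ m)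
           go (suc M) h = NP.+-∸-assoc 1 (NP.<⇒≤ h)

 Σℤ-iv-suc : ∀ a w → Σℤ (iv a (suc w)) ≡ Σℤ (iv a w) Z.+ (a Z.+ + w)
 Σℤ-iv-suc a zero = P.sym (ZP.+-identityˡ (a Z.+ +0))
 Σℤ-iv-suc a (suc w) = +ˡ a (Σℤ-iv-suc (a Z.+ + 1) w) ∙ ring36 a (Σℤ (iv (a Z.+ + 1) w)) (+ w)

 -- Each divided difference lowers the degree by one and contributes one sign, so the number of
 -- signs is the degree lost. In the end ∂_ω has the sign (-1)^|ρ| on x^ρ.
 Σℤ-drops : ∀ m → m N.≤ N N.∸ 1 → Σℤ (iv +0 (N N.∸ m)) Z.+ + drops m ≡ Σℤ (iv +0 N)
 Σℤ-drops zero _ = ZP.+-identityʳ _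
 Σℤ-drops (suc m) l = cong (λ j → Σℤ (iv +0 j) Z.+ + (w N.+ drops m)) (P.sym (NP.∸-+-assoc N 1 m)) ∙
   aux (Σℤ (iv +0 w)) (+ w) (+ drops m) ∙ cong (Z._+ + drops m) (P.sym (Σℤ-iv-suc +0 w) ∙ cong (Σℤ ∘ iv +0) (P.sym eq)) ∙ Σℤ-drops m (NP.<⇒≤ l)
   where
   w = N N.∸ 1 N.∸ m
   eq : N N.∸ m ≡ suc w
   eq = go N l
     where go : ∀ M → suc m N.≤ M N.∸ 1 → M N.∸ m ≡ suc (M N.∸ 1 N.∸ m)
           go (suc M) h = NP.+-∸-assoc 1 (NP.<⇒≤ h)
   aux = ring37

 staircaseSign : ℤ
 staircaseSign = negOnePow (drops (N N.∸ 1))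

 Σℤ-iv-N : Σℤ (iv +0 N) ≡ + drops (N N.∸ 1)
 Σℤ-iv-N = P.sym (Σℤ-drops (N N.∸ 1) NP.≤-refl) ∙ cong (Z._+ + drops (N N.∸ 1)) (go N) ∙ ZP.+-identityˡ _
   where go : ∀ M → Σℤ (iv +0 (M N.∸ (M N.∸ 1))) ≡ +0
         go zero = P.refl
         go (suc M) rewrite NP.+-∸-assoc 1 (NP.≤-refl {M}) | NP.n∸n≡0 M = P.refl

 omega-ρ : ∀ q t → omega (N N.∸ 1) (mono (lst q t (iv +0 N)) (+ 1)) ≈ mono (mkX q t 0V) staircaseSign
 omega-ρ q t = omega-mono q t (N N.∸ 1) NP.≤-refl ◦ reflexive (cong (λ v → mono (mkX q t v) staircaseSign) (cong (vl N) (go N) ∙ vl-replicate N))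
   where go : ∀ M → replicate (M N.∸ 1) +0 ++ iv +0 (M N.∸ (M N.∸ 1)) ≡ replicate M +0
         go zero = P.refl
         go (suc M) rewrite NP.+-∸-assoc 1 (NP.≤-refl {M}) | NP.n∸n≡0 M = replicate-snoc M [] ∙ LP.++-identityʳ _

 Linear : (Poly n → Poly n) → Set
 Linear T = ∀ f p → lin f (T p) ≡ lin (λ e → lin f (T (mono e (+ 1)))) p

 linear-∘ : ∀ {S T} → Linear S → Linear T → Linear (S ∘ T)
 linear-∘ {S} {T} hS hT f p = hS f (T p) ∙ hT _ p ∙ lin-cong (λ e → P.sym (hS f (T (mono e (+ 1))))) p

 linear-id : Linear id
 linear-id f p = lin-cong (λ e → P.sym (lin-mono1 f e)) p

 linear-dd : ∀ k → Linear (dd k)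
 linear-dd k f p = lin-dd k f p ∙ lin-cong (λ e → P.sym (lin-dd k f (mono e (+ 1)) ∙ lin-mono1 (λ e → lin f (ddMono (suc k) (e , + 1))) e)) p

 linear-chain : ∀ k m → Linear (chain k m)
 linear-chain k zero = linear-id
 linear-chain k (suc m) = linear-∘ {dd k} (linear-dd k) (linear-chain (suc k) m)

 linear-omega : ∀ m → Linear (omega m)
 linear-omega zero = linear-id
 linear-omega (suc m) = linear-∘ {chain m (N N.∸ 1 N.∸ m)} (linear-chain m (N N.∸ 1 N.∸ m)) (linear-omega m)

 -- Both sides are antisymmetric in L, the left one by `omega-anti`, so `anti-unique` reduces the
 -- claim to L = 0, ..., N - 1.
 omega-sign : ∀ q t L → Staircase N L → omega (N N.∸ 1) (mono (lst q t L) (+ 1)) ≈ mono (mkX q t 0V) (staircaseSign Z.* sg L)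
 omega-sign q t L st .app f = anti-unique {a = a} {b} antia antib st (app (omega-ρ q t) f ∙
     cong (λ c → lin f (mono (mkX q t 0V) c)) (P.sym (ZP.*-identityʳ staircaseSign) ∙ cong (staircaseSign Z.*_) (P.sym (sg-iv +0 N))))
   where
   a b : List ℤ → ℤ
   a L = lin f (omega (N N.∸ 1) (mono (lst q t L) (+ 1)))
   b L = lin f (mono (mkX q t 0V) (staircaseSign Z.* sg L))
   antib : Anti N b
   antib ys y z zs l = cong (λ s → lin f (mono (mkX q t 0V) (staircaseSign Z.* s))) (sg-swap ys y z zs) ∙
     lin-mono f _ (staircaseSign Z.* Z.- sg (ys ++ z ∷ y ∷ zs)) ∙
       ring38 staircaseSign (sg (ys ++ z ∷ y ∷ zs)) (f (mkX q t 0V)) ∙ (cong Z.-_ (P.sym (lin-mono f (mkX q t 0V) (staircaseSign Z.* sg (ys ++ z ∷ y ∷ zs)))))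
   antia : Anti N a
   antia ys y z zs l = ZP.i-j≡0⇒i≡j _ _ (+ˡ (a Lyz) (ZP.neg-involutive (a Lzy)) ∙
     cong (λ v → a Lyz Z.+ lin f (omega (N N.∸ 1) (mono (mkX q t v) (+ 1)))) (P.sym (vl-swap N ys y z zs l')) ∙
     cong (λ p → a Lyz Z.+ lin f (omega (N N.∸ 1) p)) (P.sym (mapE-mono (σ k) (lst q t Lyz) (+ 1))) ∙
     cong₂ Z._+_ (linear-omega (N N.∸ 1) f p) (linear-omega (N N.∸ 1) f (σP k p)) ∙ P.sym (lin-addP (λ e → lin f (omega (N N.∸ 1) (mono e (+ 1)))) p (σP k p)) ∙
     P.sym (linear-omega (N N.∸ 1) f (p + σP k p)) ∙ app (omega-anti k l' p) f)
     where
     k = length ys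
     Lyz = ys ++ y ∷ z ∷ zs
     Lzy = ys ++ z ∷ y ∷ zs
     p = mono (lst q t Lyz) (+ 1)
     l' : suc k N.< N
     l' = P.subst (suc k N.<_) (P.sym (LP.length-++ ys) ∙ l) (P.subst (suc k N.<_) (P.sym (NP.+-suc k _ ∙ cong suc (NP.+-suc k _))) (s≤s (s≤s (NP.m≤m+n k (length zs)))))

 -- sg restricted to lists of the total degree of the staircase
 sgS : List ℤ → ℤ
 sgS L with Σℤ L Z.≟ Σℤ (iv +0 N)
 ... | yes _ = sg L
 ... | no _ = +0

 sgS-staircase : ∀ {L} → Σℤ L ≡ Σℤ (iv +0 N) → sgS L ≡ sg L
 sgS-staircase {L} h with Σℤ L Z.≟ Σℤ (iv +0 N)
 ... | yes _ = P.refl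
 ... | no ne = ⊥-elim (ne h)

 sgS-Σ : ∀ {L} → sgS L ≢ +0 → Σℤ L ≡ Σℤ (iv +0 N)
 sgS-Σ {L} h with Σℤ L Z.≟ Σℤ (iv +0 N)
 ... | yes e = e
 ... | no _ = ⊥-elim (h P.refl)

 sgS-swap : ∀ ys y z zs → sgS (ys ++ y ∷ z ∷ zs) ≡ Z.- sgS (ys ++ z ∷ y ∷ zs)
 sgS-swap ys y z zs with Σℤ (ys ++ y ∷ z ∷ zs) Z.≟ Σℤ (iv +0 N) | Σℤ (ys ++ z ∷ y ∷ zs) Z.≟ Σℤ (iv +0 N)
 ... | yes _ | yes _ = sg-swap ys y z zs
 ... | no _ | no _ = P.refl
 ... | yes a | no b = ⊥-elim (b (Σℤ-↭ (PermP.++⁺ˡ ys (Perm.swap z y Perm.refl)) ∙ a))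
 ... | no a | yes b = ⊥-elim (a (Σℤ-↭ (PermP.++⁺ˡ ys (Perm.swap y z Perm.refl)) ∙ b))

 -- The value of ∂_ω, up to an overall sign, on monomials of the degree of the staircase.
 ψ : Poly n → Poly n
 ψ = bind (λ e → mono (qtE e) (sgS (exps e)))

 lin-ψ : ∀ f p → lin f (ψ p) ≡ lin (λ e → sgS (exps e) Z.* f (qtE e)) p
 lin-ψ f p = lin-bind _ f p ∙ lin-cong (λ e → lin-mono f (qtE e) (sgS (exps e))) p

 ∂-chain : ∀ s k m f → (∀ j → s j ≡ suc k N.+ j) → foldr ∂ f (applyUpTo s m) ≡ chain k m f
 ∂-chain s k zero f h = P.refl
 ∂-chain s k (suc m) f h = cong₂ ∂ (h 0 ∙ NP.+-identityʳ (suc k)) (∂-chain (s ∘ suc) (suc k) m f (λ j → h (suc j) ∙ cong suc (NP.+-suc k j))) ∙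
   P.sym (dd-def k _)

 chainA-chain : ∀ k f → chainA n (suc k) f ≡ chain k (N N.∸ 1 N.∸ k) f
 chainA-chain k f = cong (foldr ∂ f) (LP.map-upTo (suc k N.+_) (N N.∸ suc k)) ∙
   ∂-chain (suc k N.+_) k (N N.∸ suc k) f (λ _ → P.refl) ∙ cong (λ m → chain k m f) (P.sym (NP.∸-+-assoc N 1 k))

 ∂ω-omega : ∀ f → ∂ω n f ≡ omega (N N.∸ 1) f
 ∂ω-omega f = go (N N.∸ 1)
   where
   go : ∀ M → foldr (chainA n) f (map (λ j → M N.∸ j) (upTo M)) ≡ omega M f
   go zero = P.refl
   go (suc M) = chainA-chain M _ ∙ cong (chain M (N N.∸ 1 N.∸ M)) (cong (foldr (chainA n) f)
     (LP.map-applyUpTo suc (λ j → suc M N.∸ j) M ∙ P.sym (LP.map-upTo (λ j → M N.∸ j) M)) ∙ go M)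

 -- On staircase exponents the two differ only by a sign. Elsewhere they need not agree: ψ does not
 -- look at the signs of exponents, which keeps it a plain formula on monomials.
 ∂ω-ψ : ∀ {p} → All (λ t → Staircase N (exps (proj₁ t))) p → ∂ω n p ≈ cst staircaseSign * ψ p
 ∂ω-ψ {p} st .app f = cong (lin f) (∂ω-omega p) ∙ linear-omega (N N.∸ 1) f p ∙
   lin-congAll st value ∙ lin-scale staircaseSign _ p ∙ cong (staircaseSign Z.*_) (P.sym (lin-ψ f p)) ∙ P.sym cst-lin
   where
   value : ∀ e c → Staircase N (exps e) → lin f (omega (N N.∸ 1) (mono e (+ 1))) ≡ staircaseSign Z.* (sgS (exps e) Z.* f (qtE e))
   value e@(mkE (q ∷ t ∷ v)) _ h = cong (λ v → lin f (omega (N N.∸ 1) (mono (mkX q t v) (+ 1)))) (P.sym (vl-toList v)) ∙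
     app (omega-sign q t (exps e) h) f ∙ lin-mono f (qtE e) (staircaseSign Z.* sg (exps e)) ∙ ZP.*-assoc staircaseSign (sg (exps e)) (f (qtE e)) ∙ cong (λ z → staircaseSign Z.* (z Z.* f (qtE e))) (P.sym (sgS-staircase {exps e} (proj₂ (proj₂ h))))
   cst-lin : lin f (cst staircaseSign * ψ p) ≡ staircaseSign Z.* lin f (ψ p)
   cst-lin = lin-mulP f (cst staircaseSign) (ψ p) ∙ lin-mono (λ e → lin (λ e' → f (e ⊕ e')) (ψ p)) zeroExp staircaseSign ∙
     cong (staircaseSign Z.*_) (lin-cong (λ e → cong f (⊕-identityˡ e)) (ψ p))

 -- Scalings of the variables
 qtm : ℤ → ℤ → Poly n
 qtm a b = mono (mkX a b 0V) (+ 1)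

 qtm-* : ∀ a b c d → qtm a b * qtm c d ≈ qtm (a Z.+ c) (b Z.+ d)
 qtm-* a b c d = mono-* _ _ (+ 1) (+ 1) ◦ reflexive (cong (λ v → mono (mkX (a Z.+ c) (b Z.+ d) v) (+ 1)) (zip-0 0V))

 regular-qtm : ∀ a b → Regular (qtm a b)
 regular-qtm a b = regular-mono (mkX a b 0V)

 qScale tScale : ℤ → ℕ → E → E
 qScale s i e = mkX (getE 0 e Z.+ s Z.* getV i (xs e)) (getE 1 e) (xs e)
 tScale s i e = mkX (getE 0 e) (getE 1 e Z.+ s Z.* getV i (xs e)) (xs e)

 private
   scale-+ = ring39

 qScale-additive : ∀ s i → Additive (qScale s i)
 qScale-additive s i = record { φ-⊕ = add ; φ-0 = cong (λ z → mkX z +0 0V) (ZP.+-identityˡ _ ∙ cong (s Z.*_) (getV-0 N i) ∙ ZP.*-zeroʳ s) }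
   where
   add : ∀ e e' → qScale s i (e ⊕ e') ≡ qScale s i e ⊕ qScale s i e'
   add (mkE (q ∷ t ∷ v)) (mkE (r ∷ u ∷ w)) = cong (λ z → mkX z (t Z.+ u) (V.zipWith Z._+_ v w))
     (cong (λ y → q Z.+ r Z.+ s Z.* y) (getV-+ i v w) ∙ scale-+ q s (getV i v) r (getV i w))

 tScale-additive : ∀ s i → Additive (tScale s i)
 tScale-additive s i = record { φ-⊕ = add ; φ-0 = cong (λ z → mkX +0 z 0V) (ZP.+-identityˡ _ ∙ cong (s Z.*_) (getV-0 N i) ∙ ZP.*-zeroʳ s) }
   where
   add : ∀ e e' → tScale s i (e ⊕ e') ≡ tScale s i e ⊕ tScale s i e'
   add (mkE (q ∷ t ∷ v)) (mkE (r ∷ u ∷ w)) = cong (λ z → mkX (q Z.+ r) z (V.zipWith Z._+_ v w))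
     (cong (λ y → t Z.+ u Z.+ s Z.* y) (getV-+ i v w) ∙ scale-+ t s (getV i v) u (getV i w))

 -- T s i substitutes q^s xᵢ for xᵢ, and S s i substitutes t^s xᵢ; the operators below use s = 1 and
 -- s = -1.
 T S : ℤ → ℕ → Poly n → Poly n
 T s i = mapE (qScale s i)
 S s i = mapE (tScale s i)

 module TH s i = Hom (qScale-additive s i)
 module SH s i = Hom (tScale-additive s i)

 T-mono : ∀ s i e c → T s i (mono e c) ≈ qtm (s Z.* getV i (xs e)) +0 * mono e c
 T-mono s i e@(mkE (q ∷ t ∷ v)) c = reflexive (mapE-mono (qScale s i) e c) ◦ sym (mono-* _ e (+ 1) c ◦
   reflexive (cong₂ mono (cong mkE (cong₂ _∷_ (ZP.+-comm _ q) (cong₂ _∷_ (ZP.+-identityˡ t) (zip-0 v)))) (ZP.*-identityˡ c)))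

 S-mono : ∀ s i e c → S s i (mono e c) ≈ qtm +0 (s Z.* getV i (xs e)) * mono e c
 S-mono s i e@(mkE (q ∷ t ∷ v)) c = reflexive (mapE-mono (tScale s i) e c) ◦ sym (mono-* _ e (+ 1) c ◦
   reflexive (cong₂ mono (cong mkE (cong₂ _∷_ (ZP.+-identityˡ q) (cong₂ _∷_ (ZP.+-comm _ t) (zip-0 v)))) (ZP.*-identityˡ c)))

 qtm-0 : ∀ {p} → qtm +0 +0 * p ≈ p
 qtm-0 {p} = *-identityˡ p

 getX-self : ∀ i → i N.< N → getV i (xs (xE i)) ≡ + 1
 getX-self i l = getV-set i (+ 1) 0V l

 getX-other : ∀ i j → i ≢ j → getV i (xs (xE j)) ≡ +0
 getX-other i j ne = getV-set-other i j (+ 1) (0V {N}) ne ∙ getV-0 N i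

 T-X : ∀ s i → i N.< N → T s i (X i) ≈ qtm s +0 * X i
 T-X s i l = T-mono s i (xE i) (+ 1) ◦ *-congʳ (reflexive (cong (λ a → qtm a +0) (cong (s Z.*_) (getX-self i l) ∙ ZP.*-identityʳ s)))

 S-X : ∀ s i → i N.< N → S s i (X i) ≈ qtm +0 s * X i
 S-X s i l = S-mono s i (xE i) (+ 1) ◦ *-congʳ (reflexive (cong (λ a → qtm +0 a) (cong (s Z.*_) (getX-self i l) ∙ ZP.*-identityʳ s)))

 T-X-other : ∀ s i j → i ≢ j → T s i (X j) ≈ X j
 T-X-other s i j ne = T-mono s i (xE j) (+ 1) ◦ *-congʳ (reflexive (cong (λ a → qtm a +0) (cong (s Z.*_) (getX-other i j ne) ∙ ZP.*-zeroʳ s))) ◦ qtm-0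

 S-X-other : ∀ s i j → i ≢ j → S s i (X j) ≈ X j
 S-X-other s i j ne = S-mono s i (xE j) (+ 1) ◦ *-congʳ (reflexive (cong (λ a → qtm +0 a) (cong (s Z.*_) (getX-other i j ne) ∙ ZP.*-zeroʳ s))) ◦ qtm-0

 T-inverse : ∀ s i p → T (Z.- s) i (T s i p) ≈ p
 T-inverse s i p = mapE-∘ _ _ p ◦ mapE-id inv p
   where
   aux = ring40
   inv : ∀ e → qScale (Z.- s) i (qScale s i e) ≡ e
   inv (mkE (q ∷ t ∷ v)) = cong (λ z → mkX z t v) (aux q s (getV i v))

 TT-comm : ∀ s i r j p → T s i (T r j p) ≈ T r j (T s i p)
 TT-comm s i r j p = mapE-∘ _ _ p ◦ mapE-≗ com p ◦ sym (mapE-∘ _ _ p)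
   where
   aux = ring41
   com : ∀ e → qScale s i (qScale r j e) ≡ qScale r j (qScale s i e)
   com (mkE (q ∷ t ∷ v)) = cong (λ z → mkX z t v) (aux q (r Z.* getV j v) (s Z.* getV i v))

 regular-T : ∀ s i p → Regular p → Regular (T s i p)
 regular-T s i p h r e = sym (reflexive (cong (λ z → T z i (T (Z.- s) i r)) (P.sym (ZP.neg-involutive s))) ◦ T-inverse (Z.- s) i r) ◦
   TH.hom-cong s i (h _ (*-congʳ (sym (T-inverse s i p)) ◦ sym (TH.hom-* (Z.- s) i (T s i p) r) ◦ TH.hom-cong (Z.- s) i e ◦ TH.hom-0 (Z.- s) i)) ◦ TH.hom-0 s i


 V : List ℕ → Poly n
 V = pairProd (λ a b → X a - X b)

 Π-congAll : {A : Set} {f g : A → Poly n} {l : List A} → All (λ x → f x ≈ g x) l → Π (map f l) ≈ Π (map g l)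
 Π-congAll [] = refl
 Π-congAll (h ∷ hs) = *-cong h (Π-congAll hs)

 pairProd-congAll : {F G : ℕ → ℕ → Poly n} {l : List ℕ} → AllPairs (λ a b → F a b ≈ G a b) l → pairProd F l ≈ pairProd G l
 pairProd-congAll [] = refl
 pairProd-congAll (h ∷ hs) = *-cong (Π-congAll h) (pairProd-congAll hs)

 pairProd-* : (F G : ℕ → ℕ → Poly n) (l : List ℕ) → pairProd (λ a b → F a b * G a b) l ≈ pairProd F l * pairProd G l
 pairProd-* F G [] = sym (*-identityˡ 1#)
 pairProd-* F G (x ∷ l) = *-cong (Π-* (F x) (G x) l) (pairProd-* F G l) ◦
   solveR 4 (λ a b c d → (a :* b) :* (c :* d) := (a :* c) :* (b :* d)) refl _ _ _ _

 V-insert : (G : ℕ → Poly n) (p : List ℕ) (i : ℕ) (s : List ℕ) →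
   pairProd (λ a b → G a - G b) (p ++ i ∷ s) ≈ sgn p * (Π (map (λ m → G i - G m) (p ++ s)) * pairProd (λ a b → G a - G b) (p ++ s))
 V-insert G [] i s = sym (*-identityˡ _)
 V-insert G (x ∷ p) i s = *-cong (Π-split (λ m → G x - G m) p i s) (V-insert G p i s) ◦
     solveR 6 (λ x w px sp pw v → ((x :- w) :* px) :* (sp :* (pw :* v)) := (:- sp) :* (((w :- x) :* pw) :* (px :* v))) refl
       (G x) (G i) (Π (map (λ m → G x - G m) (p ++ s))) (sgn p) (Π (map (λ m → G i - G m) (p ++ s))) (pairProd (λ a b → G a - G b) (p ++ s))

 allPairs-of : {Q : ℕ → Set} {R : ℕ → ℕ → Set} {l : List ℕ} → All Q l → (∀ a b → Q a → Q b → R a b) → AllPairs R l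
 allPairs-of [] h = []
 allPairs-of (q ∷ qs) h = All.map (h _ _ q) qs ∷ allPairs-of qs h

 unique-split : ∀ p (i : ℕ) s → Unique (p ++ i ∷ s) → All (i ≢_) (p ++ s)
 unique-split [] i s (h ∷ _) = h
 unique-split (x ∷ p) i s (h ∷ hs) = (All.lookup h (mem p) ∘ P.sym) ∷ unique-split p i s hs
   where
   open import Data.List.Membership.Propositional using (_∈_)
   open import Data.List.Relation.Unary.Any using (here; there)
   mem : ∀ p → i ∈ p ++ i ∷ s
   mem [] = here P.refl
   mem (y ∷ p) = there (mem p)

 -- The Vandermonde product with the variable xᵢ multiplied by w.
 V-scaled : {φ : E → E} (A : Additive φ) (w : Poly n) (p : List ℕ) (i : ℕ) (s : List ℕ) →
   mapE φ (X i) ≈ w * X i → All (λ m → mapE φ (X m) ≈ X m) (p ++ s) →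
   mapE φ (V (p ++ i ∷ s)) ≈ sgn p * (Π (map (λ m → w * X i - X m) (p ++ s)) * V (p ++ s))
 V-scaled {φ} A w p i s hi hm = hom-pairProd (λ a b → X a - X b) (p ++ i ∷ s) ◦
   pairProd-congAll (allPairs-of (All.universal (λ _ → P.refl) (p ++ i ∷ s)) (λ a b (_ : a ≡ a) (_ : b ≡ b) → hom-sub (X a) (X b))) ◦
   V-insert (mapE φ ∘ X) p i s ◦ *-congˡ (*-cong
     (Π-congAll (All.map (λ h → +-cong hi (-‿cong h)) hm))
     (pairProd-congAll (allPairs-of hm (λ a b h h' → +-cong h (-‿cong h')))))
   where open Hom A

 S-V : ∀ r p i s → Unique (p ++ i ∷ s) → i N.< N →
   S r i (V (p ++ i ∷ s)) ≈ sgn p * (Π (map (λ m → qtm +0 r * X i - X m) (p ++ s)) * V (p ++ s))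
 S-V r p i s u l = V-scaled (tScale-additive r i) (qtm +0 r) p i s (S-X r i l) (All.map (S-X-other r i _) (unique-split p i s u))

 regular-1-qtm : ∀ a b → (a ≢ +0) ⊎ (b ≢ +0) → Regular (qtm a b - 1#)
 regular-1-qtm a b (inj₁ ne) with ZP.<-cmp a +0
 ... | tri< l _ _ = regular-≈ (solveR 2 (λ x y → :- (y :- x) := x :- y) refl (qtm a b) 1#) (regular-neg (regular-binomial 0 zeroExp (mkX a b 0V) l))
 ... | tri≈ _ e _ = ⊥-elim (ne e)
 ... | tri> _ _ l = regular-binomial 0 (mkX a b 0V) zeroExp l
 regular-1-qtm a b (inj₂ ne) with ZP.<-cmp b +0
 ... | tri< l _ _ = regular-≈ (solveR 2 (λ x y → :- (y :- x) := x :- y) refl (qtm a b) 1#) (regular-neg (regular-binomial 1 zeroExp (mkX a b 0V) l))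
 ... | tri≈ _ e _ = ⊥-elim (ne e)
 ... | tri> _ _ l = regular-binomial 1 (mkX a b 0V) zeroExp l

 nodes-regular : ∀ (l : List ℕ) → Regular (Πdiff 0# (map X l))
 nodes-regular [] = regular-1
 nodes-regular (i ∷ l) = regular-* (regular-≈ (sym (+-identityˡ _)) (regular-neg (regular-mono (xE i)))) (nodes-regular l)

 -- Divided by V l this says that the Aᵢ, with w = t^r for t and m variables, have the sum (w^m -
 -- 1)/(w - 1). It is `lagrange` with all aₘ equal to w, and it makes 1 an eigenvector.
 Σ-S-V : ∀ r l → Unique l → All (N._< N) l → (qtm +0 r - 1#) * ΣL l (λ i → S r i (V l)) ≈ (Π (map (λ _ → qtm +0 r) l) - 1#) * V l
 Σ-S-V r l u b = begin
   (w - 1#) * ΣL l (λ i → S r i (V l)) ≈⟨ sym (ΣL-*ˡ (w - 1#) _ l) ⟩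
   ΣL l (λ i → (w - 1#) * S r i (V l)) ≈⟨ sym (Σs-mid _ l) ⟩
   Σs (λ _ i _ → (w - 1#) * S r i (V l)) l ≈⟨ Σs-cong l term ⟩
   Σs (λ p i s → (w - 1#) * (sgn (map wX p) * (linProd (map wX p ++ map wX s) (X i) * vdm (map proj₂ (map wX p ++ map wX s))))) l
     ≈⟨ sym (Σs-map wX _ l) ⟩
   _ ≈⟨ lagrange (map wX l) (regular-≈ (reflexive (cong (Πdiff 0#) (LP.map-∘ l))) (nodes-regular l)) ⟩
   (Π (map proj₁ (map wX l)) - 1#) * vdm (map proj₂ (map wX l)) ≈⟨ *-cong (+-congʳ (reflexive (cong Π (P.sym (LP.map-∘ l))))) (vdm-V l) ⟩
   (Π (map (λ _ → w) l) - 1#) * V l ∎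
   where
   w = qtm +0 r
   wX : ℕ → Poly n × Poly n
   wX i = w , X i
   vdm-V : ∀ l → vdm (map proj₂ (map wX l)) ≈ V l
   vdm-V [] = refl
   vdm-V (i ∷ l) = *-cong (reflexive (cong Π (P.sym (LP.map-∘ (map wX l)) ∙ P.sym (LP.map-∘ l)))) (vdm-V l)
   sgn-map : ∀ p → sgn (map wX p) ≈ sgn p
   sgn-map [] = refl
   sgn-map (x ∷ p) = -‿cong (sgn-map p)
   term : ∀ p i s → p ++ i ∷ s ≡ l → (w - 1#) * S r i (V l) ≈ (w - 1#) * (sgn (map wX p) * (linProd (map wX p ++ map wX s) (X i) * vdm (map proj₂ (map wX p ++ map wX s))))
   term p i s P.refl = *-congˡ (S-V r p i s u (All.lookup b (mem p)) ◦ sym (*-cong (sgn-map p) (*-cong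
       (reflexive (cong (λ m → linProd m (X i)) (P.sym (LP.map-++ wX p s)) ∙ cong Π (P.sym (LP.map-∘ (p ++ s)))))
       (reflexive (cong (vdm ∘ map proj₂) (P.sym (LP.map-++ wX p s))) ◦ vdm-V (p ++ s)))))
     where
     open import Data.List.Membership.Propositional using (_∈_)
     open import Data.List.Relation.Unary.Any using (here; there)
     mem : ∀ p → i ∈ p ++ i ∷ s
     mem [] = here P.refl
     mem (y ∷ p) = there (mem p)

 -- Commutation with the dual operator
 ΣL-cong' : {A : Set} {f g : A → Poly n} (l : List A) → (∀ x → x ∈ l → f x ≈ g x) → ΣL l f ≈ ΣL l g
 ΣL-cong' [] h = refl
 ΣL-cong' (x ∷ l) h = +-cong (h x (here P.refl)) (ΣL-cong' l (λ y m → h y (there m)))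

 xVars : List ℕ
 xVars = upTo n

 xVars-unique : Unique xVars
 xVars-unique = UniqueP.upTo⁺ n

 xVars-increasing : AllPairs N._<_ xVars
 xVars-increasing = AllPairsP.applyUpTo⁺₁ id n (λ i<j _ → i<j)

 xVars-< : All (N._< n) xVars
 xVars-< = AllP.all-upTo n

 n≤N : n N.≤ N
 n≤N = NP.m≤m+n n n

 xVars-<N : All (N._< N) xVars
 xVars-<N = All.map (λ l → NP.<-≤-trans l n≤N) xVars-<

 Δ : Poly n
 Δ = V xVars

 -- Pairwise comparison of SᵢΔ·TᵢSⱼ⁻Δ·Tⱼ⁻Δ and Sⱼ⁻Δ·Tⱼ⁻SᵢΔ·TᵢΔ.
 data Kind : Set where
   isI isJ other : Kind

 kind : ℕ → ℕ → ℕ → Kind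
 kind i j a with a N.≟ i | a N.≟ j
 ... | yes _ | _ = isI
 ... | no _ | yes _ = isJ
 ... | no _ | no _ = other

 tᵘ t⁻ qᵘ q⁻ : Poly n
 tᵘ = qtm +0 (+ 1)
 t⁻ = qtm +0 -1ℤ
 qᵘ = qtm (+ 1) +0
 q⁻ = qtm -1ℤ +0

 wt : Poly n → Poly n → Kind → Poly n
 wt u v isI = u
 wt u v isJ = v
 wt u v other = 1#

 triple : (s p r : Kind → Poly n) → Kind → Kind → Poly n → Poly n → Poly n
 triple s p r κ κ' x y = (s κ * x - s κ' * y) * ((p κ * x - p κ' * y) * (r κ * x - r κ' * y))

 -- The contribution of one pair of variables. In most cases the three factors are only permuted;
 -- for xᵢ against xⱼ they change by t, q t⁻¹ and q⁻¹, whose product is 1.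
 triple-shift : ∀ κ κ' x y → ¬ (κ ≡ isI × κ' ≡ isI) → ¬ (κ ≡ isJ × κ' ≡ isJ) →
   triple (wt tᵘ 1#) (wt qᵘ t⁻) (wt 1# q⁻) κ κ' x y ≈ triple (wt 1# t⁻) (wt tᵘ q⁻) (wt qᵘ 1#) κ κ' x y
 triple-shift isI isI x y h _ = ⊥-elim (h (P.refl , P.refl))
 triple-shift isJ isJ x y _ h = ⊥-elim (h (P.refl , P.refl))
 triple-shift isI other x y _ _ = solveR 5 (λ t q u x y → (t :* x :- u :* y) :* ((q :* x :- u :* y) :* (u :* x :- u :* y))
   := (u :* x :- u :* y) :* ((t :* x :- u :* y) :* (q :* x :- u :* y))) refl tᵘ qᵘ 1# x y
 triple-shift other isI x y _ _ = solveR 5 (λ t q u x y → (u :* x :- t :* y) :* ((u :* x :- q :* y) :* (u :* x :- u :* y))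
   := (u :* x :- u :* y) :* ((u :* x :- t :* y) :* (u :* x :- q :* y))) refl tᵘ qᵘ 1# x y
 triple-shift isJ other x y _ _ = solveR 5 (λ t q u x y → (u :* x :- u :* y) :* ((t :* x :- u :* y) :* (q :* x :- u :* y))
   := (t :* x :- u :* y) :* ((q :* x :- u :* y) :* (u :* x :- u :* y))) refl t⁻ q⁻ 1# x y
 triple-shift other isJ x y _ _ = solveR 5 (λ t q u x y → (u :* x :- u :* y) :* ((u :* x :- t :* y) :* (u :* x :- q :* y))
   := (u :* x :- t :* y) :* ((u :* x :- q :* y) :* (u :* x :- u :* y))) refl t⁻ q⁻ 1# x y
 triple-shift other other x y _ _ = refl
 triple-shift isI isJ x y _ _ = begin
   (tᵘ * x - 1# * y) * ((qᵘ * x - t⁻ * y) * (1# * x - q⁻ * y))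
     ≈⟨ *-cong (+-congˡ (-‿cong (*-congʳ (sym t-inv)))) (*-cong (+-cong (*-congʳ (sym (*-identityˡ qᵘ) ◦ *-congʳ (sym t-inv))) (-‿cong (*-congʳ (sym (*-identityˡ t⁻) ◦ *-congʳ (sym q-inv)))))
         (+-congʳ (*-congʳ (sym q-inv)))) ⟩
   (tᵘ * x - (tᵘ * t⁻) * y) * ((((tᵘ * t⁻) * qᵘ) * x - ((qᵘ * q⁻) * t⁻) * y) * ((qᵘ * q⁻) * x - q⁻ * y))
     ≈⟨ solveR 6 (λ t s q r x y → (t :* x :- (t :* s) :* y) :* ((((t :* s) :* q) :* x :- ((q :* r) :* s) :* y) :* ((q :* r) :* x :- r :* y))
        := (t :* s) :* ((q :* r) :* ((x :- s :* y) :* ((t :* x :- r :* y) :* (q :* x :- y))))) refl tᵘ t⁻ qᵘ q⁻ x y ⟩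
   (tᵘ * t⁻) * ((qᵘ * q⁻) * ((x - t⁻ * y) * ((tᵘ * x - q⁻ * y) * (qᵘ * x - y))))
     ≈⟨ *-cong t-inv (*-congʳ q-inv ◦ *-identityˡ _) ◦ *-identityˡ _ ⟩
   (x - t⁻ * y) * ((tᵘ * x - q⁻ * y) * (qᵘ * x - y))
     ≈⟨ *-cong (+-congʳ (sym (*-identityˡ x))) (*-congˡ (+-congˡ (-‿cong (sym (*-identityˡ y))))) ⟩
   (1# * x - t⁻ * y) * ((tᵘ * x - q⁻ * y) * (qᵘ * x - 1# * y)) ∎
   where
   t-inv : tᵘ * t⁻ ≈ 1#
   t-inv = qtm-* +0 (+ 1) +0 -1ℤ
   q-inv : qᵘ * q⁻ ≈ 1#
   q-inv = qtm-* (+ 1) +0 -1ℤ +0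
 triple-shift isJ isI x y _ _ = flip (1# * x) (tᵘ * y) (t⁻ * x) (qᵘ * y) (q⁻ * x) (1# * y) ◦
   -‿cong (triple-shift isI isJ y x (λ { (_ , ()) }) (λ { (() , _) })) ◦ sym (flip (t⁻ * x) (1# * y) (q⁻ * x) (tᵘ * y) (1# * x) (qᵘ * y))
   where
   flip : ∀ a b c d e f → (a - b) * ((c - d) * (e - f)) ≈ - ((b - a) * ((d - c) * (f - e)))
   flip = solveR 6 (λ a b c d e f → (a :- b) :* ((c :- d) :* (e :- f)) := :- ((b :- a) :* ((d :- c) :* (f :- e)))) refl

 module _ (i j : ℕ) (i≢j : i ≢ j) (i<N : i N.< N) (j<N : j N.< N) where
   private
     K : ℕ → Kind
     K = kind i j

     T-qtm : ∀ s k a b → T s k (qtm a b) ≈ qtm a b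
     T-qtm s k a b = T-mono s k (mkX a b 0V) (+ 1) ◦ *-congʳ (reflexive (cong (λ z → qtm z +0) (cong (s Z.*_) (getV-0 N k) ∙ ZP.*-zeroʳ s))) ◦ qtm-0

     SX : ∀ a → S (+ 1) i (X a) ≈ wt tᵘ 1# (K a) * X a
     SX a with a N.≟ i | a N.≟ j
     ... | yes P.refl | _ = S-X (+ 1) i i<N
     ... | no ne | yes _ = S-X-other (+ 1) i a (ne ∘ P.sym) ◦ sym (*-identityˡ _)
     ... | no ne | no _ = S-X-other (+ 1) i a (ne ∘ P.sym) ◦ sym (*-identityˡ _)

     S⁻X : ∀ a → S -1ℤ j (X a) ≈ wt 1# t⁻ (K a) * X a
     S⁻X a with a N.≟ i | a N.≟ j
     ... | yes P.refl | _ = S-X-other -1ℤ j i (i≢j ∘ P.sym) ◦ sym (*-identityˡ _)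
     ... | no _ | yes P.refl = S-X -1ℤ j j<N
     ... | no _ | no ne = S-X-other -1ℤ j a (ne ∘ P.sym) ◦ sym (*-identityˡ _)

     TX : ∀ a → T (+ 1) i (X a) ≈ wt qᵘ 1# (K a) * X a
     TX a with a N.≟ i | a N.≟ j
     ... | yes P.refl | _ = T-X (+ 1) i i<N
     ... | no ne | yes _ = T-X-other (+ 1) i a (ne ∘ P.sym) ◦ sym (*-identityˡ _)
     ... | no ne | no _ = T-X-other (+ 1) i a (ne ∘ P.sym) ◦ sym (*-identityˡ _)

     T⁻X : ∀ a → T -1ℤ j (X a) ≈ wt 1# q⁻ (K a) * X a
     T⁻X a with a N.≟ i | a N.≟ j
     ... | yes P.refl | _ = T-X-other -1ℤ j i (i≢j ∘ P.sym) ◦ sym (*-identityˡ _)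
     ... | no _ | yes P.refl = T-X -1ℤ j j<N
     ... | no _ | no ne = T-X-other -1ℤ j a (ne ∘ P.sym) ◦ sym (*-identityˡ _)

     TS⁻X : ∀ a → T (+ 1) i (S -1ℤ j (X a)) ≈ wt qᵘ t⁻ (K a) * X a
     TS⁻X a with a N.≟ i | a N.≟ j
     ... | yes P.refl | _ = TH.hom-cong (+ 1) i (S-X-other -1ℤ j i (i≢j ∘ P.sym)) ◦ T-X (+ 1) i i<N
     ... | no ne | yes P.refl = TH.hom-cong (+ 1) i (S-X -1ℤ j j<N) ◦ TH.hom-* (+ 1) i t⁻ (X j) ◦ *-cong (T-qtm (+ 1) i _ _) (T-X-other (+ 1) i j i≢j)
     ... | no ne | no ne' = TH.hom-cong (+ 1) i (S-X-other -1ℤ j a (ne' ∘ P.sym)) ◦ T-X-other (+ 1) i a (ne ∘ P.sym) ◦ sym (*-identityˡ _)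

     T⁻SX : ∀ a → T -1ℤ j (S (+ 1) i (X a)) ≈ wt tᵘ q⁻ (K a) * X a
     T⁻SX a with a N.≟ i | a N.≟ j
     ... | yes P.refl | _ = TH.hom-cong -1ℤ j (S-X (+ 1) i i<N) ◦ TH.hom-* -1ℤ j tᵘ (X i) ◦ *-cong (T-qtm -1ℤ j _ _) (T-X-other -1ℤ j i (i≢j ∘ P.sym))
     ... | no ne | yes P.refl = TH.hom-cong -1ℤ j (S-X-other (+ 1) i j i≢j) ◦ T-X -1ℤ j j<N
     ... | no ne | no ne' = TH.hom-cong -1ℤ j (S-X-other (+ 1) i a (ne ∘ P.sym)) ◦ T-X-other -1ℤ j a (ne' ∘ P.sym) ◦ sym (*-identityˡ _)

     scaled : (Kind → Poly n) → ℕ → ℕ → Poly n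
     scaled w a b = w (K a) * X a - w (K b) * X b

     pairs : ∀ {F G : ℕ → ℕ → Poly n} l → (∀ a b → F a b ≈ G a b) → pairProd F l ≈ pairProd G l
     pairs l h = pairProd-congAll (allPairs-of (All.universal (λ _ → tt) l) (λ a b _ _ → h a b))

     one-hom : ∀ {φ} (A : Additive φ) w → (∀ a → mapE φ (X a) ≈ w (K a) * X a) → ∀ l → mapE φ (V l) ≈ pairProd (scaled w) l
     one-hom A w h l = Hom.hom-pairProd A (λ a b → X a - X b) l ◦
       pairs l (λ a b → Hom.hom-sub A (X a) (X b) ◦ +-cong (h a) (-‿cong (h b)))

     two-hom : ∀ {φ χ} (A : Additive φ) (B : Additive χ) w → (∀ a → mapE φ (mapE χ (X a)) ≈ w (K a) * X a) → ∀ l → mapE φ (mapE χ (V l)) ≈ pairProd (scaled w) l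
     two-hom {φ} A B w h l = Hom.hom-cong A (Hom.hom-pairProd B (λ a b → X a - X b) l) ◦ Hom.hom-pairProd A _ l ◦
       pairs l (λ a b → Hom.hom-cong A (Hom.hom-sub B (X a) (X b)) ◦ Hom.hom-sub A _ _ ◦ +-cong (h a) (-‿cong (h b)))

     kinds-differ : ∀ a b → a ≢ b → ∀ x y → triple (wt tᵘ 1#) (wt qᵘ t⁻) (wt 1# q⁻) (K a) (K b) x y ≈ triple (wt 1# t⁻) (wt tᵘ q⁻) (wt qᵘ 1#) (K a) (K b) x y
     kinds-differ a b ne x y = triple-shift (K a) (K b) x y (λ { (p , r) → ne (kI a p ∙ P.sym (kI b r)) }) (λ { (p , r) → ne (kJ a p ∙ P.sym (kJ b r)) })
       where
       kI : ∀ a → K a ≡ isI → a ≡ i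
       kI a e with a N.≟ i | a N.≟ j
       ... | yes h | _ = h
       kI a () | no _ | yes _
       kI a () | no _ | no _
       kJ : ∀ a → K a ≡ isJ → a ≡ j
       kJ a e with a N.≟ i | a N.≟ j
       kJ a () | yes _ | _
       ... | no _ | yes h = h
       kJ a () | no _ | no _

     triple-prod : ∀ s p r l → pairProd (scaled s) l * (pairProd (scaled p) l * pairProd (scaled r) l) ≈ pairProd (λ a b → triple s p r (K a) (K b) (X a) (X b)) l
     triple-prod s p r l = sym (pairProd-* (scaled s) (λ a b → scaled p a b * scaled r a b) l ◦ *-congˡ (pairProd-* (scaled p) (scaled r) l))

   -- This is the equality of Aᵢ Tᵢ Aⱼ⁻ Tⱼ⁻ and Aⱼ⁻ Tⱼ⁻ Aᵢ Tᵢ for i ≠ j, cleared of denominators.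
   -- Both sides are products over pairs of variables, which `triple-shift` compares one by one.
   V-exchange : ∀ l → Unique l →
     S (+ 1) i (V l) * (T (+ 1) i (S -1ℤ j (V l)) * T -1ℤ j (V l)) ≈ S -1ℤ j (V l) * (T -1ℤ j (S (+ 1) i (V l)) * T (+ 1) i (V l))
   V-exchange l u = begin
     _ ≈⟨ *-cong (one-hom (tScale-additive (+ 1) i) (wt tᵘ 1#) SX l) (*-cong (two-hom (qScale-additive (+ 1) i) (tScale-additive -1ℤ j) (wt qᵘ t⁻) TS⁻X l) (one-hom (qScale-additive -1ℤ j) (wt 1# q⁻) T⁻X l)) ⟩
     _ ≈⟨ triple-prod (wt tᵘ 1#) (wt qᵘ t⁻) (wt 1# q⁻) l ⟩
     _ ≈⟨ pairProd-congAll (AllPairs.map (λ {a} {b} ne → kinds-differ a b ne (X a) (X b)) u) ⟩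
     _ ≈⟨ sym (triple-prod (wt 1# t⁻) (wt tᵘ q⁻) (wt qᵘ 1#) l) ⟩
     _ ≈⟨ sym (*-cong (one-hom (tScale-additive -1ℤ j) (wt 1# t⁻) S⁻X l) (*-cong (two-hom (qScale-additive -1ℤ j) (tScale-additive (+ 1) i) (wt tᵘ q⁻) T⁻SX l) (one-hom (qScale-additive (+ 1) i) (wt qᵘ 1#) TX l))) ⟩
     _ ∎

 -- The factor at i is replaced by 1 instead of being removed, so that the product ranges over the
 -- same list for every i.
 omit : (ℕ → Poly n) → ℕ → List ℕ → Poly n
 omit f i l = Π (map (λ k → if ⌊ k N.≟ i ⌋ then 1# else f k) l)

 omit-absent : ∀ f i l → All (i ≢_) l → omit f i l ≈ Π (map f l)
 omit-absent f i [] _ = refl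
 omit-absent f i (k ∷ l) (ne ∷ h) with k N.≟ i
 ... | yes e = ⊥-elim (ne (P.sym e))
 ... | no _ = *-congˡ (omit-absent f i l h)

 omit-* : ∀ f i l → i ∈ l → Unique l → omit f i l * f i ≈ Π (map f l)
 omit-* f i (k ∷ l) (here P.refl) (h ∷ u) with i N.≟ i
 ... | yes _ = *-comm _ _ ◦ *-congˡ (*-identityˡ _ ◦ omit-absent f i l h)
 ... | no ne = ⊥-elim (ne P.refl)
 omit-* f i (k ∷ l) (there m) (h ∷ u) with k N.≟ i
 ... | yes P.refl = ⊥-elim (All.lookup h m P.refl)
 ... | no _ = *-assoc _ _ _ ◦ *-congˡ (omit-* f i l m u)

 Δq Δq⁻ : ℕ → Poly n
 Δq k = T (+ 1) k Δ
 Δq⁻ k = T -1ℤ k Δ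

 -- Divided by Δ these are Macdonald's Aᵢ and its analogue with t inverted.
 Δt Δt⁻ : ℕ → Poly n
 Δt k = S (+ 1) k Δ
 Δt⁻ k = S -1ℤ k Δ

 regular-V : ∀ l → All (N._< N) l → Unique l → Regular (V l)
 regular-V [] _ _ = regular-1
 regular-V (a ∷ l) (a<N ∷ b) (h ∷ u) = regular-* (row l h) (regular-V l b u)
   where
   row : ∀ l → All (a ≢_) l → Regular (Π (map (λ b → X a - X b) l))
   row [] _ = regular-1
   row (b ∷ l) (ne ∷ h) = regular-* (regular-X a b a<N ne) (row l h)

 regular-Δ : Regular Δ
 regular-Δ = regular-V xVars xVars-<N xVars-unique

 -- A common multiple of the denominators TᵢΔ and Tⱼ⁻Δ that appear when one operator acts on the
 -- coefficients of the other; `Q` and `Q⁻` are the cofactors.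
 PΔ : Poly n
 PΔ = Π (map Δq xVars) * Π (map Δq⁻ xVars)

 Q Q⁻ : ℕ → Poly n
 Q i = omit Δq i xVars * Π (map Δq⁻ xVars)
 Q⁻ j = Π (map Δq xVars) * omit Δq⁻ j xVars

 Q-* : ∀ i → i ∈ xVars → Q i * Δq i ≈ PΔ
 Q-* i m = solveR 3 (λ a b c → (a :* b) :* c := (a :* c) :* b) refl _ _ (Δq i) ◦ *-congʳ (omit-* Δq i xVars m xVars-unique)

 Q⁻-* : ∀ j → j ∈ xVars → Q⁻ j * Δq⁻ j ≈ PΔ
 Q⁻-* j m = *-assoc _ _ _ ◦ *-congˡ (omit-* Δq⁻ j xVars m xVars-unique)

 private
   Am Bm : ℕ → ℕ → Poly n
   Am i j = (Δt i * Q i) * T (+ 1) i (Δt⁻ j)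
   Bm i j = (Δt⁻ j * Q⁻ j) * T -1ℤ j (Δt i)

   lt : ∀ {i} → i ∈ xVars → i N.< N
   lt m = All.lookup xVars-<N m

   off-diagonal : ∀ i j → i ∈ xVars → j ∈ xVars → i ≢ j → Am i j ≈ Bm i j
   off-diagonal i j mi mj ne = cancelR (regular-* (regular-T (+ 1) i Δ regular-Δ) (regular-T -1ℤ j Δ regular-Δ)) (begin
     (Δq i * Δq⁻ j) * ((Δt i * Q i) * T (+ 1) i (Δt⁻ j))
       ≈⟨ solveR 5 (λ a b c d e → (a :* b) :* ((c :* d) :* e) := (d :* a) :* (c :* (e :* b))) refl (Δq i) (Δq⁻ j) (Δt i) (Q i) _ ⟩
     (Q i * Δq i) * (Δt i * (T (+ 1) i (Δt⁻ j) * Δq⁻ j))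
       ≈⟨ *-cong (Q-* i mi ◦ sym (Q⁻-* j mj)) (V-exchange i j ne (lt mi) (lt mj) xVars xVars-unique) ⟩
     (Q⁻ j * Δq⁻ j) * (Δt⁻ j * (T -1ℤ j (Δt i) * Δq i))
       ≈⟨ solveR 5 (λ a b c d e → (d :* b) :* (c :* (e :* a)) := (a :* b) :* ((c :* d) :* e)) refl (Δq i) (Δq⁻ j) (Δt⁻ j) (Q⁻ j) _ ⟩
     (Δq i * Δq⁻ j) * ((Δt⁻ j * Q⁻ j) * T -1ℤ j (Δt i)) ∎)

   left right : Poly n → Poly n
   left J = ΣL xVars (λ i → (Δt i * Q i) * T (+ 1) i (ΣL xVars (λ j → Δt⁻ j * T -1ℤ j J)))
   right J = ΣL xVars (λ j → (Δt⁻ j * Q⁻ j) * T -1ℤ j (ΣL xVars (λ i → Δt i * T (+ 1) i J)))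

   defect : Poly n
   defect = ΣL xVars (λ i → ΣL xVars (λ j → Am i j - Bm i j))

   ΣL-neg : ∀ {A : Set} (f : A → Poly n) l → ΣL l (λ x → - f x) ≈ - ΣL l f
   ΣL-neg f [] = sym -0#≈0#
   ΣL-neg f (x ∷ l) = +-congˡ (ΣL-neg f l) ◦ solveR 2 (λ a b → :- a :+ :- b := :- (a :+ b)) refl (f x) _

   -- For i ≠ j the coefficients of Tᵢ Tⱼ⁻ agree in both orders, and for i = j the two shifts cancel
   -- each other. So the commutator multiplies by a polynomial that does not depend on J.
   left-right : ∀ J → left J - right J ≈ defect * J
   left-right J = begin
     left J - right J ≈⟨ +-cong expandL (-‿cong expandR) ⟩
     ΣL xVars (λ i → ΣL xVars (λ j → Am i j * TT i j)) - ΣL xVars (λ i → ΣL xVars (λ j → Bm i j * TT i j))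
       ≈⟨ +-congˡ (sym (ΣL-neg _ xVars)) ◦ sym (ΣL-+ _ _ xVars) ⟩
     ΣL xVars (λ i → ΣL xVars (λ j → Am i j * TT i j) - ΣL xVars (λ j → Bm i j * TT i j))
       ≈⟨ ΣL-cong' xVars (λ i mi → (+-congˡ (sym (ΣL-neg _ xVars)) ◦ sym (ΣL-+ _ _ xVars)) ◦ ΣL-cong' xVars (λ j mj → term i j mi mj) ◦ ΣL-*ʳ J _ xVars) ⟩
     ΣL xVars (λ i → ΣL xVars (λ j → Am i j - Bm i j) * J) ≈⟨ ΣL-*ʳ J _ xVars ⟩
     defect * J ∎
     where
     TT : ℕ → ℕ → Poly n
     TT i j = T (+ 1) i (T -1ℤ j J)
     expandL : left J ≈ ΣL xVars (λ i → ΣL xVars (λ j → Am i j * TT i j))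
     expandL = ΣL-cong xVars (λ i → *-congˡ (TH.hom-ΣL (+ 1) i _ xVars ◦ ΣL-cong xVars (λ j → TH.hom-* (+ 1) i (Δt⁻ j) _)) ◦
       sym (ΣL-*ˡ _ _ xVars) ◦ ΣL-cong xVars (λ j → sym (*-assoc _ _ _)))
     expandR : right J ≈ ΣL xVars (λ i → ΣL xVars (λ j → Bm i j * TT i j))
     expandR = ΣL-cong xVars (λ j → *-congˡ (TH.hom-ΣL -1ℤ j _ xVars ◦ ΣL-cong xVars (λ i → TH.hom-* -1ℤ j (Δt i) _ ◦ *-congˡ (TT-comm -1ℤ j (+ 1) i J))) ◦
       sym (ΣL-*ˡ _ _ xVars) ◦ ΣL-cong xVars (λ i → sym (*-assoc _ _ _))) ◦ ΣL-swap (λ j i → Bm i j * TT i j) xVars xVars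
     term : ∀ i j → i ∈ xVars → j ∈ xVars → Am i j * TT i j - Bm i j * TT i j ≈ (Am i j - Bm i j) * J
     term i j mi mj with i N.≟ j
     ... | yes P.refl = solveR 3 (λ a b c → a :* c :- b :* c := (a :- b) :* c) refl _ _ _ ◦ *-congˡ (T-inverse -1ℤ i J)
     ... | no ne = sub-zero (*-congʳ (off-diagonal i j mi mj ne)) ◦ sym (*-congʳ (sub-zero (off-diagonal i j mi mj ne)) ◦ zeroˡ J)

 Invariant : Poly n → Set
 Invariant p = ∀ s i → T s i p ≈ p

 private
   -- The factor k serves the eigenvector 1, whose eigenvalue (t^n - 1)/(t - 1) is available only
   -- with its denominator on the other side; for J it is 1.
   right-eigen : ∀ J k e → Invariant e → Invariant k → k * ΣL xVars (λ i → Δt i * T (+ 1) i J) ≈ e * (Δ * J) →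
     k * right J ≈ e * (PΔ * ΣL xVars (λ j → Δt⁻ j * T -1ℤ j J))
   right-eigen J k e ie ik h = begin
     k * right J ≈⟨ sym (ΣL-*ˡ k _ xVars) ⟩
     ΣL xVars (λ j → k * ((Δt⁻ j * Q⁻ j) * T -1ℤ j Y)) ≈⟨ ΣL-cong' xVars (λ j m → begin
         k * ((Δt⁻ j * Q⁻ j) * T -1ℤ j Y) ≈⟨ x∙yz≈y∙xz k _ _ ⟩
         (Δt⁻ j * Q⁻ j) * (k * T -1ℤ j Y) ≈⟨ *-congˡ (*-congʳ (sym (ik -1ℤ j)) ◦ sym (TH.hom-* -1ℤ j k Y) ◦ TH.hom-cong -1ℤ j h ◦
              TH.hom-* -1ℤ j e (Δ * J) ◦ *-cong (ie -1ℤ j) (TH.hom-* -1ℤ j Δ J)) ⟩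
         (Δt⁻ j * Q⁻ j) * (e * (Δq⁻ j * T -1ℤ j J)) ≈⟨ solveR 5 (λ a b c d f → (a :* b) :* (c :* (d :* f)) := c :* ((b :* d) :* (a :* f))) refl (Δt⁻ j) (Q⁻ j) e (Δq⁻ j) _ ⟩
         e * ((Q⁻ j * Δq⁻ j) * (Δt⁻ j * T -1ℤ j J)) ≈⟨ *-congˡ (*-congʳ (Q⁻-* j m)) ⟩
         e * (PΔ * (Δt⁻ j * T -1ℤ j J)) ∎) ⟩
     ΣL xVars (λ j → e * (PΔ * (Δt⁻ j * T -1ℤ j J))) ≈⟨ ΣL-*ˡ e _ xVars ◦ *-congˡ (ΣL-*ˡ PΔ _ xVars) ⟩
     e * (PΔ * ΣL xVars (λ j → Δt⁻ j * T -1ℤ j J)) ∎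
     where Y = ΣL xVars (λ i → Δt i * T (+ 1) i J)

   left-eigen : ∀ J k e → Invariant e → Invariant k → k * ΣL xVars (λ j → Δt⁻ j * T -1ℤ j J) ≈ e * (Δ * J) →
     k * left J ≈ e * (PΔ * ΣL xVars (λ i → Δt i * T (+ 1) i J))
   left-eigen J k e ie ik h = begin
     k * left J ≈⟨ sym (ΣL-*ˡ k _ xVars) ⟩
     ΣL xVars (λ j → k * ((Δt j * Q j) * T (+ 1) j Y)) ≈⟨ ΣL-cong' xVars (λ j m → begin
         k * ((Δt j * Q j) * T (+ 1) j Y) ≈⟨ x∙yz≈y∙xz k _ _ ⟩
         (Δt j * Q j) * (k * T (+ 1) j Y) ≈⟨ *-congˡ (*-congʳ (sym (ik (+ 1) j)) ◦ sym (TH.hom-* (+ 1) j k Y) ◦ TH.hom-cong (+ 1) j h ◦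
              TH.hom-* (+ 1) j e (Δ * J) ◦ *-cong (ie (+ 1) j) (TH.hom-* (+ 1) j Δ J)) ⟩
         (Δt j * Q j) * (e * (Δq j * T (+ 1) j J)) ≈⟨ solveR 5 (λ a b c d f → (a :* b) :* (c :* (d :* f)) := c :* ((b :* d) :* (a :* f))) refl (Δt j) (Q j) e (Δq j) _ ⟩
         e * ((Q j * Δq j) * (Δt j * T (+ 1) j J)) ≈⟨ *-congˡ (*-congʳ (Q-* j m)) ⟩
         e * (PΔ * (Δt j * T (+ 1) j J)) ∎) ⟩
     ΣL xVars (λ j → e * (PΔ * (Δt j * T (+ 1) j J))) ≈⟨ ΣL-*ˡ e _ xVars ◦ *-congˡ (ΣL-*ˡ PΔ _ xVars) ⟩
     e * (PΔ * ΣL xVars (λ j → Δt j * T (+ 1) j J)) ∎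
     where Y = ΣL xVars (λ i → Δt⁻ i * T -1ℤ i J)

   invariant-qtm : ∀ a b → Invariant (qtm a b)
   invariant-qtm a b s k = T-mono s k (mkX a b 0V) (+ 1) ◦ *-congʳ (reflexive (cong (λ z → qtm z +0) (cong (s Z.*_) (getV-0 N k) ∙ ZP.*-zeroʳ s))) ◦ qtm-0

   invariant-sub1 : ∀ {p} → Invariant p → Invariant (p - 1#)
   invariant-sub1 {p} h s i = TH.hom-sub s i p 1# ◦ +-cong (h s i) (-‿cong (TH.hom-1 s i))

   invariant-power : ∀ {p} → Invariant p → (l : List ℕ) → Invariant (Π (map (λ _ → p) l))
   invariant-power h [] s i = TH.hom-1 s i
   invariant-power {p} h (_ ∷ l) s i = TH.hom-* s i p _ ◦ *-cong (h s i) (invariant-power h l s i)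

   -- A multiplication operator is known from its value on 1, and 1 is an eigenvector of both
   -- operators by `Σ-S-V`, so there the two orders agree.
   defect-zero : defect ≈ 0#
   defect-zero = regular-* reg reg⁻ defect (begin
     (k * k⁻) * defect ≈⟨ *-congˡ (sym (left-right 1# ◦ *-identityʳ defect)) ⟩
     (k * k⁻) * (left 1# - right 1#) ≈⟨ solveR 4 (λ a b x y → (a :* b) :* (x :- y) := a :* (b :* x) :- b :* (a :* y)) refl k k⁻ _ _ ⟩
     k * (k⁻ * left 1#) - k⁻ * (k * right 1#) ≈⟨ +-cong (*-congˡ (left-eigen 1# k⁻ e⁻ (invariant-sub1 (invariant-power (invariant-qtm _ _) xVars)) (invariant-sub1 (invariant-qtm _ _)) base⁻))
         (-‿cong (*-congˡ (right-eigen 1# k e (invariant-sub1 (invariant-power (invariant-qtm _ _) xVars)) (invariant-sub1 (invariant-qtm _ _)) base))) ⟩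
     k * (e⁻ * (PΔ * Y)) - k⁻ * (e * (PΔ * Y⁻)) ≈⟨ solveR 7 (λ a b c d p x y → a :* (c :* (p :* x)) :- b :* (d :* (p :* y)) := p :* (c :* (a :* x) :- d :* (b :* y))) refl k k⁻ e⁻ e PΔ Y Y⁻ ⟩
     PΔ * (e⁻ * (k * Y) - e * (k⁻ * Y⁻)) ≈⟨ *-congˡ (+-cong (*-congˡ base) (-‿cong (*-congˡ base⁻))) ⟩
     PΔ * (e⁻ * (e * (Δ * 1#)) - e * (e⁻ * (Δ * 1#))) ≈⟨ *-congˡ (sub-zero (x∙yz≈y∙xz e⁻ e _)) ⟩
     PΔ * 0# ≈⟨ zeroʳ PΔ ⟩
     0# ∎)
     where
     k = tᵘ - 1#
     k⁻ = t⁻ - 1#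
     e = Π (map (λ _ → tᵘ) xVars) - 1#
     e⁻ = Π (map (λ _ → t⁻) xVars) - 1#
     Y = ΣL xVars (λ i → Δt i * T (+ 1) i 1#)
     Y⁻ = ΣL xVars (λ j → Δt⁻ j * T -1ℤ j 1#)
     reg : Regular k
     reg = regular-1-qtm +0 (+ 1) (inj₂ (λ ()))
     reg⁻ : Regular k⁻
     reg⁻ = regular-1-qtm +0 -1ℤ (inj₂ (λ ()))
     base : k * Y ≈ e * (Δ * 1#)
     base = *-congˡ (ΣL-cong xVars (λ i → *-congˡ (TH.hom-1 (+ 1) i) ◦ *-identityʳ _)) ◦ Σ-S-V (+ 1) xVars xVars-unique xVars-<N ◦ *-congˡ (sym (*-identityʳ Δ))
     base⁻ : k⁻ * Y⁻ ≈ e⁻ * (Δ * 1#)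
     base⁻ = *-congˡ (ΣL-cong xVars (λ i → *-congˡ (TH.hom-1 -1ℤ i) ◦ *-identityʳ _)) ◦ Σ-S-V -1ℤ xVars xVars-unique xVars-<N ◦ *-congˡ (sym (*-identityʳ Δ))

 -- If D J = e J then D⁻J is again an eigenfunction of D, up to the common denominator.
 commute-eigen : ∀ J e → Invariant e → ΣL xVars (λ i → Δt i * T (+ 1) i J) ≈ e * (Δ * J) →
   let Y = ΣL xVars (λ j → Δt⁻ j * T -1ℤ j J) in
   ΣL xVars (λ i → (Δt i * Q i) * T (+ 1) i Y) ≈ e * (PΔ * Y)
 commute-eigen J e ie h = zero-sub (left-right J ◦ *-congʳ defect-zero ◦ zeroˡ J) ◦
   sym (*-identityˡ _) ◦ right-eigen J 1# e ie (λ s i → TH.hom-1 s i) (*-identityˡ _ ◦ h)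

 -- The dual eigenvalue equation
 sumW : ℕ → (ℕ → ℤ) → ℤ
 sumW zero f = +0
 sumW (suc m) f = + m Z.* f 0 Z.+ sumW m (f ∘ suc)

 sumW-+ : ∀ m f g → sumW m (λ k → f k Z.+ g k) ≡ sumW m f Z.+ sumW m g
 sumW-+ zero f g = P.refl
 sumW-+ (suc m) f g = +ˡ (+ m Z.* (f 0 Z.+ g 0)) (sumW-+ m (f ∘ suc) (g ∘ suc)) ∙ ring2 (+ m) (f 0) (g 0) _ _

 sumW-cong : ∀ m {f g} → (∀ k → k N.< m → f k ≡ g k) → sumW m f ≡ sumW m g
 sumW-cong zero h = P.refl
 sumW-cong (suc m) h = cong₂ (λ a b → + m Z.* a Z.+ b) (h 0 (s≤s z≤n)) (sumW-cong m (λ k l → h (suc k) (s≤s l)))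

 sumW-0 : ∀ m → sumW m (λ _ → +0) ≡ +0
 sumW-0 zero = P.refl
 sumW-0 (suc m) = cong₂ Z._+_ (ZP.*-zeroʳ (+ m)) (sumW-0 m)

 sumW-unit : ∀ m a f → a N.< m → f a ≡ + 1 → (∀ k → k ≢ a → f k ≡ +0) → sumW m f ≡ + (m N.∸ suc a)
 sumW-unit (suc m) zero f _ h0 h = cong₂ (λ x y → + m Z.* x Z.+ y) h0 (sumW-cong m (λ k _ → h (suc k) (λ ())) ∙ sumW-0 m) ∙
   ZP.+-identityʳ _ ∙ ZP.*-identityʳ (+ m)
 sumW-unit (suc m) (suc a) f (s≤s l) h0 h = cong₂ (λ x y → + m Z.* x Z.+ y) (h 0 (λ ())) (sumW-unit m a (f ∘ suc) l h0 (λ k ne → h (suc k) (ne ∘ NP.suc-injective))) ∙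
   cong (Z._+ + (m N.∸ suc a)) (ZP.*-zeroʳ (+ m)) ∙ ZP.+-identityˡ _

 -- the grading in which xₖ₊₁ has degree n - 1 - k
 gr : E → ℤ
 gr e = sumW n (λ k → getV k (xs e))

 gr-⊕ : ∀ e e' → gr (e ⊕ e') ≡ gr e Z.+ gr e'
 gr-⊕ (mkE (_ ∷ _ ∷ v)) (mkE (_ ∷ _ ∷ w)) = sumW-cong n (λ k _ → getV-+ k v w) ∙ sumW-+ n (λ k → getV k v) (λ k → getV k w)

 open Grading gr gr-⊕ public

 gr-0V : ∀ e → xs e ≡ 0V → gr e ≡ +0
 gr-0V e h = sumW-cong n (λ k _ → cong (getV k) h ∙ getV-0 N k) ∙ sumW-0 n

 XF : Poly n → Set
 XF = All (λ t → xs (proj₁ t) ≡ 0V)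

 top-XF : ∀ {p} → XF p → Top +0 p
 top-XF = All.map (λ {t} h → ZP.≤-reflexive (gr-0V (proj₁ t) h))

 comp-XF : ∀ {p} → XF p → comp +0 p ≈ p
 comp-XF {p} xf .app f = lin-keep (at +0) f p ∙ lin-congAll xf (λ e _ h → yes-at e (gr-0V e h))
   where yes-at : ∀ e → gr e ≡ +0 → (if at +0 e then f e else +0) ≡ f e
         yes-at e h with gr e Z.≟ +0
         ... | yes _ = P.refl
         ... | no ne = ⊥-elim (ne h)

 T-XF : ∀ {p} → XF p → Invariant p
 T-XF {p} xf s i .app f = lin-mapE (qScale s i) f p ∙ lin-congAll xf (λ e _ h → cong f (fix e h))
   where fix : ∀ e → xs e ≡ 0V → qScale s i e ≡ e
         fix (mkE (q ∷ t ∷ v)) h = cong (λ z → mkX z t v) (cong (λ z → q Z.+ s Z.* z) (cong (getV i) h ∙ getV-0 N i) ∙ cong (λ z → q Z.+ z) (ZP.*-zeroʳ s) ∙ ZP.+-identityʳ q)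

 comp-mono : ∀ e c → comp (gr e) (mono e c) ≈ mono e c
 comp-mono e c with gr e Z.≟ gr e
 ... | yes _ = refl
 ... | no ne = ⊥-elim (ne P.refl)

 comp-mono-other : ∀ g e c → gr e ≢ g → comp g (mono e c) ≈ 0#
 comp-mono-other g e c ne with gr e Z.≟ g
 ... | yes eq = ⊥-elim (ne eq)
 ... | no _ = refl

 -- The leading form is a single monomial with coefficient 1. Such leading terms multiply by adding
 -- exponents, which makes those of the large products of shifted Vandermonde products accessible.
 record Lead (p : Poly n) (e : E) : Set where
   constructor lead
   field
     top : Top (gr e) p
     leading : comp (gr e) p ≈ mono e (+ 1)
 open Lead

 lead-mono : ∀ e → Lead (mono e (+ 1)) e
 lead-mono e = lead (ZP.≤-refl ∷ []) (comp-mono e (+ 1))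

 lead-* : ∀ {p r e e'} → Lead p e → Lead r e' → Lead (p * r) (e ⊕ e')
 lead-* {p} {r} {e} {e'} (lead t l) (lead t' l') = lead (P.subst (λ g → Top g (p * r)) (P.sym (gr-⊕ e e')) (top-* t t'))
   (reflexive (cong (λ g → comp g (p * r)) (gr-⊕ e e')) ◦ comp-* t t' ◦ *-cong l l' ◦ mono-* e e' (+ 1) (+ 1))

 lead-sub : ∀ e e' → gr e' Z.< gr e → Lead (mono e (+ 1) - mono e' (+ 1)) e
 lead-sub e e' l = lead (top-+ (ZP.≤-refl ∷ []) (top-neg (ZP.<⇒≤ l ∷ [])))
   (comp-+ (gr e) _ _ ◦ +-cong (comp-mono e (+ 1)) (comp-neg (gr e) _ ◦ -‿cong (comp-mono-other (gr e) e' (+ 1) (λ h → ZP.<-irrefl h l)) ◦ -0#≈0#) ◦ +-identityʳ _)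

 lead-T : ∀ {p e} s i → Lead p e → Lead (T s i p) (qScale s i e)
 lead-T {p} {e} s i (lead t l) = lead (top-mapE (qScale s i) (λ _ → P.refl) t)
   (comp-mapE (gr e) (qScale s i) (λ _ → P.refl) p ◦ mapE-cong _ l ◦ reflexive (mapE-mono (qScale s i) e (+ 1)))

 lead-S : ∀ {p e} s i → Lead p e → Lead (S s i p) (tScale s i e)
 lead-S {p} {e} s i (lead t l) = lead (top-mapE (tScale s i) (λ _ → P.refl) t)
   (comp-mapE (gr e) (tScale s i) (λ _ → P.refl) p ◦ mapE-cong _ l ◦ reflexive (mapE-mono (tScale s i) e (+ 1)))

 sumE : List E → E
 sumE = foldr _⊕_ zeroExp

 lead-Π : {A : Set} {f : A → Poly n} {h : A → E} (l : List A) → All (λ a → Lead (f a) (h a)) l → Lead (Π (map f l)) (sumE (map h l))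
 lead-Π [] [] = lead-mono zeroExp
 lead-Π (a ∷ l) (x ∷ xs) = lead-* x (lead-Π l xs)

 pairE : List ℕ → E
 pairE [] = zeroExp
 pairE (a ∷ l) = sumE (map (λ _ → xE a) l) ⊕ pairE l

 gr-xE : ∀ a → a N.< n → gr (xE a) ≡ + (n N.∸ suc a)
 gr-xE a l = sumW-unit n a _ l (getX-self a (NP.<-≤-trans l n≤N)) (λ k ne → getX-other k a ne)

 lead-V : ∀ l → All (N._< n) l → AllPairs N._<_ l → Lead (V l) (pairE l)
 lead-V [] _ _ = lead-mono zeroExp
 lead-V (a ∷ l) (a<n ∷ b) (h ∷ inc) = lead-* (lead-Π l (All.zipWith (λ { {b} (b<n , a<b) → lead-sub (xE a) (xE b)
     (P.subst₂ Z._<_ (P.sym (gr-xE b b<n)) (P.sym (gr-xE a a<n)) (Z.+<+ (NP.∸-monoʳ-< (s≤s a<b) b<n))) }) (b , h))) (lead-V l b inc)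

 upFrom : ℕ → ℕ → List ℕ
 upFrom k zero = []
 upFrom k (suc m) = k ∷ upFrom (suc k) m

 upFrom-applyUpTo : ∀ k m → applyUpTo (k N.+_) m ≡ upFrom k m
 upFrom-applyUpTo k zero = P.refl
 upFrom-applyUpTo k (suc m) = cong₂ _∷_ (NP.+-identityʳ k) (applyUpTo-cong m (λ j → NP.+-suc k j) ∙ upFrom-applyUpTo (suc k) m)
   where
   applyUpTo-cong : ∀ m {f g : ℕ → ℕ} → (∀ j → f j ≡ g j) → applyUpTo f m ≡ applyUpTo g m
   applyUpTo-cong zero h = P.refl
   applyUpTo-cong (suc m) h = cong₂ _∷_ (h 0) (applyUpTo-cong m (h ∘ suc))

 getX-⊕ : ∀ i e e' → getV i (xs (e ⊕ e')) ≡ getV i (xs e) Z.+ getV i (xs e')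
 getX-⊕ i (mkE (_ ∷ _ ∷ v)) (mkE (_ ∷ _ ∷ w)) = getV-+ i v w

 row-other : ∀ i a (l : List ℕ) → i ≢ a → getV i (xs (sumE (map (λ _ → xE a) l))) ≡ +0
 row-other i a [] ne = getV-0 N i
 row-other i a (_ ∷ l) ne = getX-⊕ i (xE a) (sumE (map (λ _ → xE a) l)) ∙ cong₂ Z._+_ (getX-other i a ne) (row-other i a l ne)

 row-self : ∀ a (l : List ℕ) → a N.< N → getV a (xs (sumE (map (λ _ → xE a) l))) ≡ + length l
 row-self a [] b = getV-0 N a
 row-self a (_ ∷ l) b = getX-⊕ a (xE a) (sumE (map (λ _ → xE a) l)) ∙ cong₂ Z._+_ (getX-self a b) (row-self a l b)

 length-upFrom : ∀ k m → length (upFrom k m) ≡ m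
 length-upFrom k zero = P.refl
 length-upFrom k (suc m) = cong suc (length-upFrom (suc k) m)

 pairE-before : ∀ i k m → i N.< k → getV i (xs (pairE (upFrom k m))) ≡ +0
 pairE-before i k zero l = getV-0 N i
 pairE-before i k (suc m) l = getX-⊕ i (sumE (map (λ _ → xE k) (upFrom (suc k) m))) _ ∙
   cong₂ Z._+_ (row-other i k (upFrom (suc k) m) (NP.<⇒≢ l)) (pairE-before i (suc k) m (NP.m≤n⇒m≤1+n l))

 pairE-value : ∀ k m j → j N.< m → k N.+ m N.≤ N → getV (k N.+ j) (xs (pairE (upFrom k m))) ≡ + (m N.∸ suc j)
 pairE-value k (suc m) zero _ b rewrite NP.+-identityʳ k = getX-⊕ k (sumE (map (λ _ → xE k) (upFrom (suc k) m))) _ ∙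
   cong₂ Z._+_ (row-self k (upFrom (suc k) m) (NP.≤-trans (s≤s (NP.m≤m+n k m)) (P.subst (N._≤ N) (NP.+-suc k m) b)) ∙ (cong +_ (length-upFrom (suc k) m)))
      (pairE-before k (suc k) m (NP.n<1+n k)) ∙ ZP.+-identityʳ (+ m)
 pairE-value k (suc m) (suc j) (s≤s l) b rewrite NP.+-suc k j = getX-⊕ (suc k N.+ j) (sumE (map (λ _ → xE k) (upFrom (suc k) m))) _ ∙
   cong₂ Z._+_ (row-other (suc k N.+ j) k (upFrom (suc k) m) (NP.<⇒≢ (s≤s (NP.m≤m+n k j)) ∘ P.sym))
       (pairE-value (suc k) m j l (P.subst (N._≤ N) (NP.+-suc k m) b)) ∙ ZP.+-identityˡ _

 -- The exponent of X i in the leading monomial x^δ of Δ, and at the same time the power of t next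
 -- to the i-th power of q in the eigenvalue of D.
 δ : ℕ → ℤ
 δ i = + (n N.∸ suc i)

 ΔE : E
 ΔE = pairE xVars

 lead-Δ : Lead Δ ΔE
 lead-Δ = lead-V xVars xVars-< xVars-increasing

 ΔE-δ : ∀ i → i N.< n → getV i (xs ΔE) ≡ δ i
 ΔE-δ i l = cong (λ l → getV i (xs (pairE l))) (upFrom-applyUpTo 0 n) ∙ pairE-value 0 n i l n≤N

 omitE : (ℕ → E) → ℕ → List ℕ → E
 omitE f i l = sumE (map (λ k → if ⌊ k N.≟ i ⌋ then zeroExp else f k) l)

 omitE-absent : ∀ f i l → All (i ≢_) l → omitE f i l ≡ sumE (map f l)
 omitE-absent f i [] _ = P.refl
 omitE-absent f i (k ∷ l) (ne ∷ h) with k N.≟ i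
 ... | yes e = ⊥-elim (ne (P.sym e))
 ... | no _ = cong (f k ⊕_) (omitE-absent f i l h)

 omitE-⊕ : ∀ f i l → i ∈ l → Unique l → omitE f i l ⊕ f i ≡ sumE (map f l)
 omitE-⊕ f i (k ∷ l) (here P.refl) (h ∷ u) with i N.≟ i
 ... | yes _ = ⊕-comm (zeroExp ⊕ omitE f i l) (f i) ∙ cong (f i ⊕_) (⊕-identityˡ _ ∙ omitE-absent f i l h)
 ... | no ne = ⊥-elim (ne P.refl)
 omitE-⊕ f i (k ∷ l) (there m) (h ∷ u) with k N.≟ i
 ... | yes P.refl = ⊥-elim (All.lookup h m P.refl)
 ... | no _ = ⊕-assoc (f k) (omitE f i l) (f i) ∙ cong (f k ⊕_) (omitE-⊕ f i l m u)

 lead-omit : ∀ {f h} i l → (∀ k → Lead (f k) (h k)) → Lead (omit f i l) (omitE h i l)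
 lead-omit {f} {h} i l le = lead-Π l (All.universal each l)
   where each : ∀ k → Lead (if ⌊ k N.≟ i ⌋ then 1# else f k) (if ⌊ k N.≟ i ⌋ then zeroExp else h k)
         each k with k N.≟ i
         ... | yes _ = lead-mono zeroExp
         ... | no _ = le k

 qΔ qΔ⁻ : ℕ → E
 qΔ k = qScale (+ 1) k ΔE
 qΔ⁻ k = qScale -1ℤ k ΔE

 πE : E
 πE = sumE (map qΔ xVars) ⊕ sumE (map qΔ⁻ xVars)

 QE : ℕ → E
 QE i = omitE qΔ i xVars ⊕ sumE (map qΔ⁻ xVars)

 lead-P : Lead PΔ πE
 lead-P = lead-* (lead-Π xVars (All.universal (λ k → lead-T (+ 1) k lead-Δ) xVars)) (lead-Π xVars (All.universal (λ k → lead-T -1ℤ k lead-Δ) xVars))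

 lead-Q : ∀ i → Lead (Q i) (QE i)
 lead-Q i = lead-* (lead-omit i xVars (λ k → lead-T (+ 1) k lead-Δ)) (lead-Π xVars (All.universal (λ k → lead-T -1ℤ k lead-Δ) xVars))

 QE-⊕ : ∀ i → i ∈ xVars → QE i ⊕ qΔ i ≡ πE
 QE-⊕ i m = ⊕-assoc (omitE qΔ i xVars) r (qΔ i) ∙ cong (omitE qΔ i xVars ⊕_) (⊕-comm r (qΔ i)) ∙
   P.sym (⊕-assoc (omitE qΔ i xVars) (qΔ i) r) ∙ cong (_⊕ r) (omitE-⊕ qΔ i xVars m xVars-unique)
   where r = sumE (map qΔ⁻ xVars)

 comp-ΣL : {A : Set} (g : ℤ) (f : A → Poly n) (l : List A) → comp g (ΣL l f) ≈ ΣL l (comp g ∘ f)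
 comp-ΣL g f [] = refl
 comp-ΣL g f (a ∷ l) = comp-+ g (f a) _ ◦ +-congˡ (comp-ΣL g f l)

 -- On the terms with fixed exponents γ each Tᵢ is multiplication by a power of q, so an operator
 -- identity becomes a scalar one.
 slice : Vec ℤ N → Poly n → Poly n
 slice γ = keep (λ e → ⌊ VP.≡-dec Z._≟_ (xs e) γ ⌋)

 slices-zero : ∀ p → (∀ γ → slice γ p ≈ 0#) → p ≈ 0#
 slices-zero p h = coeffs⇒≋ (λ e → (lin-cong (λ e' → only e e') p ∙ P.sym (lin-keep _ (δE e) p)) ∙ app (h (xs e)) (δE e))
   where only : ∀ e e' → δE e e' ≡ (if ⌊ VP.≡-dec Z._≟_ (xs e') (xs e) ⌋ then δE e e' else +0)
         only e e' with VP.≡-dec Z._≟_ (xs e') (xs e)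
         ... | yes _ = P.refl
         ... | no ne = δE-≢ (λ eq → ne (cong xs (P.sym eq)))

 slice-cong : ∀ γ {p r} → p ≈ r → slice γ p ≈ slice γ r
 slice-cong γ = keep-cong _

 slice-+ : ∀ γ p r → slice γ (p + r) ≈ slice γ p + slice γ r
 slice-+ γ p r .app f = lin-keep _ f (p + r) ∙ lin-addP _ p r ∙ P.sym (lin-addP f (slice γ p) (slice γ r) ∙ cong₂ Z._+_ (lin-keep _ f p) (lin-keep _ f r))

 slice-ΣL : {A : Set} (γ : Vec ℤ N) (f : A → Poly n) (l : List A) → slice γ (ΣL l f) ≈ ΣL l (slice γ ∘ f)
 slice-ΣL γ f [] = refl
 slice-ΣL γ f (a ∷ l) = slice-+ γ (f a) _ ◦ +-congˡ (slice-ΣL γ f l)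

 lin-qtm-* : ∀ f a b p → lin f (qtm a b * p) ≡ lin (λ e → f (mkX a b 0V ⊕ e)) p
 lin-qtm-* f a b p = lin-mulP f (qtm a b) p ∙ lin-mono1 (λ e → lin (λ e' → f (e ⊕ e')) p) (mkX a b 0V)

 xs-qt : ∀ a b e → xs (mkX a b 0V ⊕ e) ≡ xs e
 xs-qt a b (mkE (_ ∷ _ ∷ v)) = zip-0 v

 slice-qtm : ∀ γ a b p → slice γ (qtm a b * p) ≈ qtm a b * slice γ p
 slice-qtm γ a b p .app f = lin-keep _ f (qtm a b * p) ∙ lin-qtm-* _ a b p ∙ lin-cong (λ e → cong (λ v → if ⌊ VP.≡-dec Z._≟_ v γ ⌋ then f (mkX a b 0V ⊕ e) else +0) (xs-qt a b e)) p ∙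
   P.sym (lin-qtm-* f a b (slice γ p) ∙ lin-keep _ _ p)

 slice-T : ∀ γ s i p → slice γ (T s i p) ≈ qtm (s Z.* getV i γ) +0 * slice γ p
 slice-T γ s i p .app f = lin-keep _ f (T s i p) ∙ lin-mapE (qScale s i) _ p ∙ lin-cong same p ∙
   P.sym (lin-qtm-* f (s Z.* getV i γ) +0 (slice γ p) ∙ lin-keep _ _ p)
   where
   same : ∀ e → (if ⌊ VP.≡-dec Z._≟_ (xs e) γ ⌋ then f (qScale s i e) else +0) ≡ (if ⌊ VP.≡-dec Z._≟_ (xs e) γ ⌋ then f (mkX (s Z.* getV i γ) +0 0V ⊕ e) else +0)
   same e with VP.≡-dec Z._≟_ (xs e) γ
   ... | no _ = P.refl
   same (mkE (q ∷ t ∷ v)) | yes P.refl = cong f (cong mkE (cong₂ _∷_ (ZP.+-comm q _) (cong₂ _∷_ (P.sym (ZP.+-identityˡ t)) (P.sym (zip-0 v)))))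

 -- Σ_{i<m} q^{α i} t^{m-1-i} determines α.
 tSum : ℕ → (ℕ → ℤ) → Poly n
 tSum m α = ΣL (upTo m) (λ i → qtm (α i) (+ (m N.∸ suc i)))

 tSum-suc : ∀ m α → tSum (suc m) α ≡ qtm (α 0) (+ m) + tSum m (α ∘ suc)
 tSum-suc m α = cong (λ z → qtm (α 0) (+ m) + z) (cong (foldr _+_ 0#) (LP.map-applyUpTo suc (λ i → qtm (α i) (+ (suc m N.∸ suc i))) m ∙
   P.sym (LP.map-upTo (λ i → qtm (α (suc i)) (+ (m N.∸ suc i))) m)))

 private module T₁ = Coord 1

 tSum-low : ∀ m M α → m N.≤ M → T₁.Top (+ M) (tSum m α) × T₁.comp (+ M) (tSum m α) ≈ 0#
 tSum-low zero M α l = [] , refl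
 tSum-low (suc m) M α l rewrite tSum-suc m α with tSum-low m M (α ∘ suc) (NP.<⇒≤ l)
 ... | t , c = T₁.top-+ (Z.+≤+ (NP.<⇒≤ l) ∷ []) t , (T₁.comp-+ (+ M) (qtm (α 0) (+ m)) _ ◦ +-cong none c ◦ +-identityˡ 0#)
   where none : T₁.comp (+ M) (qtm (α 0) (+ m)) ≈ 0#
         none with + m Z.≟ + M
         ... | yes e = ⊥-elim (NP.<⇒≢ l (ZP.+-injective e))
         ... | no _ = refl

 regular-qq : ∀ a b m → a ≢ b → Regular (qtm a m - qtm b m)
 regular-qq a b m ne with ZP.<-cmp a b
 ... | tri< l _ _ = regular-≈ (solveR 2 (λ x y → :- (y :- x) := x :- y) refl (qtm a m) (qtm b m)) (regular-neg (regular-binomial 0 (mkX b m 0V) (mkX a m 0V) l))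
 ... | tri≈ _ e _ = ⊥-elim (ne e)
 ... | tri> _ _ l = regular-binomial 0 (mkX a m 0V) (mkX b m 0V) l

 -- The highest power of t at which the sums differ has the coefficient q^a - q^b with a ≠ b. This
 -- is the leading form in t of the difference, and it is regular.
 regular-tSum : ∀ m α β i → i N.< m → α i ≢ β i → Regular (tSum m α - tSum m β)
 regular-tSum (suc m) α β i l ne with α 0 Z.≟ β 0
 regular-tSum (suc m) α β zero l ne | yes e = ⊥-elim (ne e)
 regular-tSum (suc m) α β (suc i) (s≤s l) ne | yes e = regular-≈ (begin
     tSum m (α ∘ suc) - tSum m (β ∘ suc) ≈⟨ solveR 3 (λ q a b → a :- b := (q :+ a) :- (q :+ b)) refl (qtm (α 0) (+ m)) _ _ ⟩
     (qtm (α 0) (+ m) + tSum m (α ∘ suc)) - (qtm (α 0) (+ m) + tSum m (β ∘ suc)) ≈⟨ +-congˡ (-‿cong (+-congʳ (reflexive (cong (λ a → qtm a (+ m)) e)))) ⟩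
     (qtm (α 0) (+ m) + tSum m (α ∘ suc)) - (qtm (β 0) (+ m) + tSum m (β ∘ suc)) ≈⟨ reflexive (cong₂ _-_ (P.sym (tSum-suc m α)) (P.sym (tSum-suc m β))) ⟩
     tSum (suc m) α - tSum (suc m) β ∎)
   (regular-tSum m (α ∘ suc) (β ∘ suc) i l ne)
 ... | no ne' = T₁.regular-top (+ m) _ (T₁.top-+ (tp α) (T₁.top-neg (tp β)))
     (regular-≈ (sym (T₁.comp-+ (+ m) _ _ ◦ +-cong (cp α) (T₁.comp-neg (+ m) _ ◦ -‿cong (cp β)))) (regular-qq (α 0) (β 0) (+ m) ne'))
   where
   tp : ∀ α → T₁.Top (+ m) (tSum (suc m) α)
   tp α rewrite tSum-suc m α = T₁.top-+ (ZP.≤-refl ∷ []) (proj₁ (tSum-low m m (α ∘ suc) NP.≤-refl))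
   cp : ∀ α → T₁.comp (+ m) (tSum (suc m) α) ≈ qtm (α 0) (+ m)
   cp α rewrite tSum-suc m α = T₁.comp-+ (+ m) (qtm (α 0) (+ m)) _ ◦ +-cong self (proj₂ (tSum-low m m (α ∘ suc) NP.≤-refl)) ◦ +-identityʳ _
     where self : T₁.comp (+ m) (qtm (α 0) (+ m)) ≈ qtm (α 0) (+ m)
           self with + m Z.≟ + m
           ... | yes _ = refl
           ... | no h = ⊥-elim (h P.refl)

 search : ∀ m (α β : ℕ → ℤ) → (∃ λ i → i N.< m × α i ≢ β i) ⊎ (∀ i → i N.< m → α i ≡ β i)
 search zero α β = inj₂ (λ _ ())
 search (suc m) α β with α 0 Z.≟ β 0 | search m (α ∘ suc) (β ∘ suc)
 ... | no ne | _ = inj₁ (0 , s≤s z≤n , ne)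
 ... | yes e | inj₁ (i , l , ne) = inj₁ (suc i , s≤s l , ne)
 ... | yes e | inj₂ h = inj₂ (λ { zero _ → e ; (suc i) (s≤s l) → h i l })

 ∈xVars⇒< : ∀ {i} → i ∈ xVars → i N.< n
 ∈xVars⇒< m = All.lookup xVars-< m

 xf-qtm : ∀ a b → XF (qtm a b)
 xf-qtm a b = P.refl ∷ []

 opaque
   unfolding addP
   xf-+ : ∀ {p r} → XF p → XF r → XF (p + r)
   xf-+ = AllP.++⁺

 xf-ΣL : {A : Set} {f : A → Poly n} (l : List A) → (∀ a → XF (f a)) → XF (ΣL l f)
 xf-ΣL [] h = []
 xf-ΣL (a ∷ l) h = xf-+ (h a) (xf-ΣL l h)

 -- Z measures the failure of the dual equation. It satisfies the equation of D for the eigenvalue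
 -- of J, and its component in the degree of x^(δ+λ) cancels; other exponents have other
 -- eigenvalues, which rules out any leading form.
 module DualEigen (lam : ℕ → ℤ) (lamE : E) (lamE-x : ∀ i → i N.< n → getV i (xs lamE) ≡ lam i)
   (J c : Poly n) (c-xf : XF c) (topJ : Top (gr lamE) J) (compJ : comp (gr lamE) J ≈ c * mono lamE (+ 1))
   (eigenJ : ΣL xVars (λ i → Δt i * T (+ 1) i J) ≈ tSum n lam * (Δ * J)) where

   eig⁻ : Poly n
   eig⁻ = ΣL xVars (λ i → qtm (Z.- lam i) (Z.- δ i))

   Y Z : Poly n
   Y = ΣL xVars (λ j → Δt⁻ j * T -1ℤ j J)
   Z = Y - eig⁻ * (Δ * J)

   private
     eig = tSum n lam

     eig-xf : XF eig
     eig-xf = xf-ΣL xVars (λ i → xf-qtm _ _)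

     eig⁻-xf : XF eig⁻
     eig⁻-xf = xf-ΣL xVars (λ i → xf-qtm _ _)

     g* : ℤ
     g* = gr ΔE Z.+ gr lamE

     DQ : Poly n → Poly n
     DQ p = ΣL xVars (λ i → (Δt i * Q i) * T (+ 1) i p)

     DQ-Z : DQ Z ≈ eig * (PΔ * Z)
     DQ-Z = begin
       DQ Z ≈⟨ ΣL-cong xVars (λ i → *-congˡ (TH.hom-sub (+ 1) i Y _ ◦ +-congˡ (-‿cong (TH.hom-* (+ 1) i eig⁻ (Δ * J) ◦ *-cong (T-XF eig⁻-xf (+ 1) i) (TH.hom-* (+ 1) i Δ J)))) ◦
           solveR 6 (λ a b y e d j → (a :* b) :* (y :- e :* (d :* j)) := (a :* b) :* y :+ (:- e) :* ((b :* d) :* (a :* j))) refl (Δt i) (Q i) _ eig⁻ (Δq i) _) ⟩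
       ΣL xVars (λ i → (Δt i * Q i) * T (+ 1) i Y + - eig⁻ * ((Q i * Δq i) * (Δt i * T (+ 1) i J)))
         ≈⟨ ΣL-+ _ _ xVars ◦ +-cong (commute-eigen J eig (T-XF eig-xf) eigenJ)
              (ΣL-*ˡ (- eig⁻) _ xVars ◦ *-congˡ (ΣL-cong' xVars (λ i m → *-congʳ (Q-* i m)) ◦ ΣL-*ˡ PΔ _ xVars ◦ *-congˡ eigenJ)) ⟩
       eig * (PΔ * Y) + - eig⁻ * (PΔ * (eig * (Δ * J)))
         ≈⟨ solveR 5 (λ e p y f d → e :* (p :* y) :+ (:- f) :* (p :* (e :* d)) := e :* (p :* (y :- f :* d))) refl eig PΔ Y eig⁻ _ ⟩
       eig * (PΔ * Z) ∎

     -- The leading term of Δt⁻ j is t^(-δ j) x^δ, and that of Tⱼ⁻ J is c q^(-λ j) x^λ; the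
     -- coefficients, summed over j, are the definition of `eig⁻`.
     comp-Z : comp g* Z ≈ 0#
     comp-Z = comp-+ g* Y _ ◦ +-cong compY (comp-neg g* _ ◦ -‿cong compE) ◦ -‿inverseʳ _
       where
       M = mono ΔE (+ 1) * (c * mono lamE (+ 1))
       compE : comp g* (eig⁻ * (Δ * J)) ≈ eig⁻ * M
       compE = reflexive (cong (λ g → comp g (eig⁻ * (Δ * J))) (P.sym (ZP.+-identityˡ g*))) ◦ comp-* (top-XF eig⁻-xf) (top-* (top lead-Δ) topJ) ◦
         *-cong (comp-XF eig⁻-xf) (comp-* (top lead-Δ) topJ ◦ *-cong (leading lead-Δ) compJ)
       compY : comp g* Y ≈ eig⁻ * M
       compY = comp-ΣL g* _ xVars ◦ ΣL-cong' xVars term ◦ ΣL-*ʳ M _ xVars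
         where
         term : ∀ j → j ∈ xVars → comp g* (Δt⁻ j * T -1ℤ j J) ≈ qtm (Z.- lam j) (Z.- δ j) * M
         term j m = begin
           comp g* (Δt⁻ j * T -1ℤ j J) ≈⟨ comp-* (top (lead-S -1ℤ j lead-Δ)) (top-mapE _ (λ _ → P.refl) topJ) ⟩
           comp (gr ΔE) (Δt⁻ j) * comp (gr lamE) (T -1ℤ j J)
             ≈⟨ *-cong (leading (lead-S -1ℤ j lead-Δ) ◦ reflexive (P.sym (mapE-mono (tScale -1ℤ j) ΔE (+ 1))) ◦ S-mono -1ℤ j ΔE (+ 1))
                 (comp-mapE (gr lamE) _ (λ _ → P.refl) J ◦ mapE-cong _ compJ ◦ TH.hom-* -1ℤ j c _ ◦ *-cong (T-XF c-xf -1ℤ j) (T-mono -1ℤ j lamE (+ 1))) ⟩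
           (qtm +0 (Z.- + 1 Z.* getV j (xs ΔE)) * mono ΔE (+ 1)) * (c * (qtm (Z.- + 1 Z.* getV j (xs lamE)) +0 * mono lamE (+ 1)))
             ≈⟨ *-cong (*-congʳ (reflexive (cong (qtm +0) (ZP.-1*i≡-i _ ∙ (cong Z.-_ (ΔE-δ j (∈xVars⇒< m)))))))
                 (*-congˡ (*-congʳ (reflexive (cong (λ z → qtm z +0) (ZP.-1*i≡-i _ ∙ (cong Z.-_ (lamE-x j (∈xVars⇒< m)))))))) ⟩
           (qtm +0 (Z.- δ j) * mono ΔE (+ 1)) * (c * (qtm (Z.- lam j) +0 * mono lamE (+ 1)))
             ≈⟨ solveR 5 (λ a d c b l → (a :* d) :* (c :* (b :* l)) := (b :* a) :* (d :* (c :* l))) refl _ _ c _ _ ⟩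
           (qtm (Z.- lam j) +0 * qtm +0 (Z.- δ j)) * M ≈⟨ *-congʳ (qtm-* _ _ _ _ ◦ reflexive (cong₂ qtm (ZP.+-identityʳ _) (ZP.+-identityˡ _))) ⟩
           qtm (Z.- lam j) (Z.- δ j) * M ∎

     -- On x^γ the leading part of the operator is the scalar `tSum` of the numbers γᵢ - δᵢ. By
     -- `regular-tSum` a slice survives only for γ = δ + λ, which has degree g*, and p has no
     -- component in that degree.
     step : ∀ p g → Top g p → (DQ p ≈ eig * (PΔ * p)) × (comp g* p ≈ 0#) → comp g p ≈ 0#
     step p g tp (h , h*) = slices-zero pg slice-zero
       where
       pg = comp g p
       -- t^(δ i) is the leading coefficient of Δt i, and q^(-δ i) makes up for the factor Δq i by
       -- which Q i falls short of PΔ.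
       w : ℕ → Poly n
       w i = qtm (Z.- δ i) (δ i)
       G = gr πE Z.+ g
       grade : ∀ i → i ∈ xVars → gr (tScale (+ 1) i ΔE ⊕ QE i) ≡ gr πE
       grade i m = gr-⊕ (tScale (+ 1) i ΔE) (QE i) ∙ ZP.+-comm (gr ΔE) (gr (QE i)) ∙ P.sym (gr-⊕ (QE i) (qΔ i)) ∙ cong gr (QE-⊕ i m)
       lhs : comp G (DQ p) ≈ mono πE (+ 1) * ΣL xVars (λ i → w i * T (+ 1) i pg)
       lhs = comp-ΣL G _ xVars ◦ ΣL-cong' xVars term ◦ ΣL-*ˡ _ _ xVars
         where
         term : ∀ i → i ∈ xVars → comp G ((Δt i * Q i) * T (+ 1) i p) ≈ mono πE (+ 1) * (w i * T (+ 1) i pg)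
         term i m = begin
           comp G ((Δt i * Q i) * T (+ 1) i p) ≈⟨ reflexive (cong (λ z → comp (z Z.+ g) ((Δt i * Q i) * T (+ 1) i p)) (P.sym (grade i m))) ⟩
           comp (gr (tScale (+ 1) i ΔE ⊕ QE i) Z.+ g) ((Δt i * Q i) * T (+ 1) i p) ≈⟨ comp-* (top le) (top-mapE _ (λ _ → P.refl) tp) ⟩
           comp (gr (tScale (+ 1) i ΔE ⊕ QE i)) (Δt i * Q i) * comp g (T (+ 1) i p) ≈⟨ *-cong (leading le) (comp-mapE g _ (λ _ → P.refl) p) ⟩
           mono (tScale (+ 1) i ΔE ⊕ QE i) (+ 1) * T (+ 1) i pg
             ≈⟨ *-congʳ (reflexive (cong (λ e → mono e (+ 1)) (cong (_⊕ QE i) (shift i (∈xVars⇒< m)) ∙ ⊕-assoc _ (qΔ i) (QE i) ∙ cong (mkX (Z.- δ i) (δ i) 0V ⊕_) (⊕-comm (qΔ i) (QE i) ∙ QE-⊕ i m)))) ⟩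
           mono (mkX (Z.- δ i) (δ i) 0V ⊕ πE) (+ 1) * T (+ 1) i pg ≈⟨ *-congʳ (sym (mono-* _ πE (+ 1) (+ 1))) ⟩
           (w i * mono πE (+ 1)) * T (+ 1) i pg ≈⟨ solveR 3 (λ a b c → (a :* b) :* c := b :* (a :* c)) refl (w i) _ _ ⟩
           mono πE (+ 1) * (w i * T (+ 1) i pg) ∎
           where
           le = lead-* (lead-S (+ 1) i lead-Δ) (lead-Q i)
           shift : ∀ i → i N.< n → tScale (+ 1) i ΔE ≡ mkX (Z.- δ i) (δ i) 0V ⊕ qΔ i
           shift i l = go ΔE (ΔE-δ i l)
             where
             go : ∀ e → getV i (xs e) ≡ δ i → tScale (+ 1) i e ≡ mkX (Z.- δ i) (δ i) 0V ⊕ qScale (+ 1) i e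
             go (mkE (q ∷ t ∷ v)) eq = cong mkE (cong₂ _∷_ (aux q (δ i) ∙ cong (λ z → Z.- δ i Z.+ (q Z.+ + 1 Z.* z)) (P.sym eq))
               (cong₂ _∷_ (cong (λ z → t Z.+ + 1 Z.* z) eq ∙ aux' t (δ i)) (P.sym (zip-0 v))))
               where
               aux = ring42
               aux' = ring43
       rhs : comp G (eig * (PΔ * p)) ≈ mono πE (+ 1) * (eig * pg)
       rhs = reflexive (cong (λ z → comp z (eig * (PΔ * p))) (P.sym (ZP.+-identityˡ G))) ◦ comp-* (top-XF eig-xf) (top-* (top lead-P) tp) ◦
         *-cong (comp-XF eig-xf) (comp-* (top lead-P) tp ◦ *-congʳ (leading lead-P)) ◦ x∙yz≈y∙xz eig _ pg
       main : ΣL xVars (λ i → w i * T (+ 1) i pg) ≈ eig * pg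
       main = cancelR (regular-mono πE) (sym lhs ◦ comp-cong G h ◦ rhs)
       slice-main : ∀ γ → tSum n (λ i → Z.- δ i Z.+ getV i γ) * slice γ pg ≈ eig * slice γ pg
       slice-main γ = sym (slice-ΣL γ _ xVars ◦ ΣL-cong xVars (λ i → slice-qtm γ _ _ _ ◦ *-congˡ (slice-T γ (+ 1) i pg) ◦
             sym (*-assoc _ _ _) ◦ *-congʳ (qtm-* _ _ _ _ ◦ reflexive (cong₂ qtm (+ˡ (Z.- δ i) (ZP.*-identityˡ _)) (ZP.+-identityʳ _)))) ◦
           ΣL-*ʳ (slice γ pg) _ xVars) ◦
         slice-cong γ main ◦ slice-cong γ (sym (ΣL-*ʳ pg _ xVars)) ◦ slice-ΣL γ _ xVars ◦ ΣL-cong xVars (λ i → slice-qtm γ _ _ pg) ◦ ΣL-*ʳ (slice γ pg) _ xVars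
       slice-zero : ∀ γ → slice γ pg ≈ 0#
       slice-zero γ with search n (λ i → Z.- δ i Z.+ getV i γ) lam
       ... | inj₁ (i , l , ne) = regular-tSum n _ lam i l ne _ (solveR 3 (λ a b s → (a :- b) :* s := a :* s :- b :* s) refl _ eig _ ◦ sub-zero (slice-main γ))
       ... | inj₂ eq with g Z.≟ g*
       ...   | yes P.refl = slice-cong γ h* ◦ refl
       ...   | no ne = slice-comp
         where
         γ-grade : ∀ e → xs e ≡ γ → gr e ≡ g*
         γ-grade e P.refl = sumW-cong n (λ k l → aux (δ k) (getV k (xs e)) ∙ cong₂ Z._+_ (P.sym (ΔE-δ k l)) (eq k l ∙ P.sym (lamE-x k l))) ∙
            sumW-+ n _ _
           where aux = ring44
         slice-comp : slice γ pg ≈ 0#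
         slice-comp .app f = lin-keep _ f pg ∙ lin-keep (at g) _ p ∙ lin-cong none p ∙ lin-0 p
           where
           none : ∀ e → (if at g e then (if ⌊ VP.≡-dec Z._≟_ (xs e) γ ⌋ then f e else +0) else +0) ≡ +0
           none e with gr e Z.≟ g | VP.≡-dec Z._≟_ (xs e) γ
           ... | yes a | yes b = ⊥-elim (ne (P.sym a ∙ γ-grade e b))
           ... | yes a | no _ = P.refl
           ... | no _ | _ = P.refl

   -- J is an eigenfunction of the operator with q and t inverted as well.
   dual-eigen : Y ≈ eig⁻ * (Δ * J)
   dual-eigen = zero-sub (descend (λ p → (DQ p ≈ eig * (PΔ * p)) × (comp g* p ≈ 0#))
     (λ e (h , h*) → (ΣL-cong xVars (λ i → *-congˡ (TH.hom-cong (+ 1) i (sym e))) ◦ h ◦ *-congˡ (*-congˡ e)) , (comp-cong g* (sym e) ◦ h*))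
     step Z (DQ-Z , comp-Z))

 -- The Cauchy kernel
 yVars : List ℕ
 yVars = map (n N.+_) (upTo n)

 allVars : List ℕ
 allVars = xVars ++ yVars

 yVars-≥ : All (n N.≤_) yVars
 yVars-≥ = AllP.map⁺ (All.universal (λ k → NP.m≤m+n n k) (upTo n))

 yVars-<N : All (N._< N) yVars
 yVars-<N = AllP.map⁺ (All.map (λ l → NP.+-monoʳ-< n l) (AllP.all-upTo n))

 yVars-unique : Unique yVars
 yVars-unique = UniqueP.map⁺ (NP.+-cancelˡ-≡ n _ _) (UniqueP.upTo⁺ n)

 disjoint : ∀ {i j} → i ∈ xVars → j ∈ yVars → i ≢ j
 disjoint mi mj = NP.<⇒≢ (NP.<-≤-trans (All.lookup xVars-< mi) (All.lookup yVars-≥ mj))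

 allVars-unique : Unique allVars
 allVars-unique = AllPairsP.++⁺ xVars-unique yVars-unique (All.tabulate (λ mi → All.tabulate (λ mj → disjoint mi mj)))

 allVars-<N : All (N._< N) allVars
 allVars-<N = AllP.++⁺ xVars-<N yVars-<N

 Cr : List ℕ → List ℕ → Poly n
 Cr l m = Π (map (λ a → Π (map (λ b → X a - X b) m)) l)

 V-++ : ∀ l m → V (l ++ m) ≈ (V l * V m) * Cr l m
 V-++ [] m = sym (*-identityʳ _ ◦ *-identityˡ _)
 V-++ (a ∷ l) m = *-cong (reflexive (cong Π (LP.map-++ (λ b → X a - X b) l m)) ◦ Π-++ (map (λ b → X a - X b) l) _) (V-++ l m) ◦
   solveR 5 (λ a b c d e → (a :* b) :* ((c :* d) :* e) := ((a :* c) :* d) :* (b :* e)) refl _ _ _ _ _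

 Δy Ψ W : Poly n
 Δy = V yVars
 Ψ = Cr xVars yVars
 W = V allVars

 Π-++map : (f : ℕ → Poly n) (l m : List ℕ) → Π (map f (l ++ m)) ≈ Π (map f l) * Π (map f m)
 Π-++map f l m = reflexive (cong Π (LP.map-++ f l m)) ◦ Π-++ (map f l) (map f m)

 Σs-++ : (F : List ℕ → ℕ → List ℕ → Poly n) (l m : List ℕ) →
   Σs F (l ++ m) ≈ Σs (λ p z s → F p z (s ++ m)) l + Σs (λ p → F (l ++ p)) m
 Σs-++ F [] m = sym (+-identityˡ _)
 Σs-++ F (a ∷ l) m = +-congˡ (Σs-++ (λ p → F (a ∷ p)) l m) ◦ sym (+-assoc _ _ _)

 T-V : ∀ r p i s → Unique (p ++ i ∷ s) → i N.< N →
   T r i (V (p ++ i ∷ s)) ≈ sgn p * (Π (map (λ m → qtm r +0 * X i - X m) (p ++ s)) * V (p ++ s))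
 T-V r p i s u l = V-scaled (qScale-additive r i) (qtm r +0) p i s (T-X r i l) (All.map (T-X-other r i _) (unique-split p i s u))

 -- With t⁻¹ at the nodes x and q⁻¹ at the nodes y, the interpolation term at xᵢ is the t-shift of Δ
 -- times the q-shift of Ψ, and at a node y it is the q-shift of Δy times the t-shift of Ψ. This is
 -- where q and t change roles.
 weight : ℕ → Poly n
 weight i with i N.<? n
 ... | yes _ = t⁻
 ... | no _ = q⁻

 weight-x : ∀ {i} → i N.< n → weight i ≡ t⁻
 weight-x {i} l with i N.<? n
 ... | yes _ = P.refl
 ... | no h = ⊥-elim (h l)

 weight-y : ∀ {i} → n N.≤ i → weight i ≡ q⁻
 weight-y {i} l with i N.<? n
 ... | yes h = ⊥-elim (NP.<⇒≱ h l)
 ... | no _ = P.refl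

 mid∈ : ∀ (p : List ℕ) {i s} → i ∈ p ++ i ∷ s
 mid∈ [] = here P.refl
 mid∈ (_ ∷ p) = there (mid∈ p)

 remove-mid : ∀ {Q : ℕ → Set} p {i s} → All Q (p ++ i ∷ s) → All Q (p ++ s)
 remove-mid [] (_ ∷ h) = h
 remove-mid (_ ∷ p) (q ∷ h) = q ∷ remove-mid p h

 Cr-scaled-x : ∀ p i s → All (N._< n) (p ++ i ∷ s) → Unique (p ++ i ∷ s) →
   T -1ℤ i (Cr (p ++ i ∷ s) yVars) ≈ Π (map (λ m → q⁻ * X i - X m) yVars) * Cr (p ++ s) yVars
 Cr-scaled-x p i s b u = TH.hom-Π -1ℤ i _ (p ++ i ∷ s) ◦ Π-split _ p i s ◦ *-cong
     (TH.hom-Π -1ℤ i _ yVars ◦ Π-congAll (All.tabulate (λ {m} mm → TH.hom-sub -1ℤ i (X i) (X m) ◦ +-cong (T-X -1ℤ i (NP.<-≤-trans i<n n≤N)) (-‿cong (T-X-other -1ℤ i m (ne mm))))))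
     (Π-congAll (All.map (λ {a} i≢a → TH.hom-Π -1ℤ i _ yVars ◦ Π-congAll (All.tabulate (λ {m} mm →
         TH.hom-sub -1ℤ i (X a) (X m) ◦ +-cong (T-X-other -1ℤ i a i≢a) (-‿cong (T-X-other -1ℤ i m (ne mm)))))) (unique-split p i s u)))
   where
   i<n = All.lookup b (mid∈ p)
   ne : ∀ {m} → m ∈ yVars → i ≢ m
   ne mm = NP.<⇒≢ (NP.<-≤-trans i<n (All.lookup yVars-≥ mm))

 Cr-split : ∀ l p i s → Cr l (p ++ i ∷ s) ≈ Π (map (λ a → X a - X i) l) * Cr l (p ++ s)
 Cr-split l p i s = Π-cong l (λ a → Π-split (λ b → X a - X b) p i s) ◦ Π-* _ _ l

 Π-flip : ∀ (w : Poly n) l → Π (map (λ m → X m - w) l) ≈ sgn l * Π (map (λ m → w - X m) l)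
 Π-flip w [] = sym (*-identityˡ _)
 Π-flip w (a ∷ l) = *-congˡ (Π-flip w l) ◦ solveR 4 (λ x w s r → (x :- w) :* (s :* r) := :- s :* ((w :- x) :* r)) refl (X a) w _ _

 Cr-scaled-y : ∀ p i s → All (N._< N) (p ++ i ∷ s) → All (n N.≤_) (p ++ i ∷ s) → Unique (p ++ i ∷ s) →
   S -1ℤ i (Cr xVars (p ++ i ∷ s)) ≈ (sgn xVars * Π (map (λ m → t⁻ * X i - X m) xVars)) * Cr xVars (p ++ s)
 Cr-scaled-y p i s b b' u = SH.hom-cong -1ℤ i (Cr-split xVars p i s) ◦ SH.hom-* -1ℤ i _ _ ◦ *-cong
     (SH.hom-Π -1ℤ i _ xVars ◦ Π-congAll (All.tabulate (λ {a} ma → SH.hom-sub -1ℤ i (X a) (X i) ◦ +-cong (S-X-other -1ℤ i a (ne ma)) (-‿cong (S-X -1ℤ i (All.lookup b (mid∈ p)))))) ◦ Π-flip (t⁻ * X i) xVars)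
     (SH.hom-Π -1ℤ i _ xVars ◦ Π-congAll (All.tabulate (λ {a} ma → SH.hom-Π -1ℤ i _ (p ++ s) ◦ Π-congAll (All.map (λ {m} i≢m →
         SH.hom-sub -1ℤ i (X a) (X m) ◦ +-cong (S-X-other -1ℤ i a (ne ma)) (-‿cong (S-X-other -1ℤ i m i≢m))) (unique-split p i s u)))))
   where
   ne : ∀ {a} → a ∈ xVars → i ≢ a
   ne ma = NP.<⇒≢ (NP.<-≤-trans (All.lookup xVars-< ma) (All.lookup b' (mid∈ p))) ∘ P.sym

 sgn-++ : {A : Set} (p q : List A) → sgn (p ++ q) ≈ sgn p * sgn q
 sgn-++ [] q = sym (*-identityˡ _)
 sgn-++ (x ∷ p) q = -‿cong (sgn-++ p q) ◦ solveR 2 (λ a b → :- (a :* b) := :- a :* b) refl (sgn p) (sgn q)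

 total : Poly n
 total = Π (map (λ _ → t⁻) xVars) * Π (map (λ _ → q⁻) yVars)

 -- The operators D(q⁻¹,t⁻¹) in x and D(t⁻¹,q⁻¹) in y act on Ψ = ∏(xᵢ - yⱼ) in the same way, up to scalars.
 kernel : (t⁻ - 1#) * ΣL xVars (λ i → Δt⁻ i * (Δy * T -1ℤ i Ψ)) + (q⁻ - 1#) * ΣL yVars (λ i → Δ * (T -1ℤ i Δy * S -1ℤ i Ψ))
   ≈ (total - 1#) * W
 kernel = begin
   _ ≈⟨ sym (+-cong (Σs-cong xVars x-term ◦ Σs-*ˡ (t⁻ - 1#) _ xVars ◦ *-congˡ (Σs-mid _ xVars))
         (Σs-cong yVars y-term ◦ Σs-*ˡ (q⁻ - 1#) _ yVars ◦ *-congˡ (Σs-mid _ yVars))) ⟩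
   Σs (λ p i s → F p i (s ++ yVars)) xVars + Σs (λ p → F (xVars ++ p)) yVars ≈⟨ sym (Σs-++ F xVars yVars) ⟩
   Σs F allVars ≈⟨ Σs-cong allVars (λ p i s e → *-congˡ (sym (*-cong (sgn-map p) (*-cong
       (reflexive (cong (λ m → linProd m (X i)) (P.sym (LP.map-++ wX p s)) ∙ cong Π (P.sym (LP.map-∘ (p ++ s)))))
       (reflexive (cong (vdm ∘ map proj₂) (P.sym (LP.map-++ wX p s))) ◦ vdm-V (p ++ s)))))) ⟩
   Σs (λ p i s → (weight i - 1#) * (sgn (map wX p) * (linProd (map wX p ++ map wX s) (X i) * vdm (map proj₂ (map wX p ++ map wX s))))) allVars
     ≈⟨ sym (Σs-map wX _ allVars) ⟩
   _ ≈⟨ lagrange (map wX allVars) (regular-≈ (reflexive (cong (Πdiff 0#) (LP.map-∘ allVars))) (nodes-regular allVars)) ⟩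
   (Π (map proj₁ (map wX allVars)) - 1#) * vdm (map proj₂ (map wX allVars))
     ≈⟨ *-cong (+-congʳ (reflexive (cong Π (P.sym (LP.map-∘ allVars))) ◦ Π-++map weight xVars yVars ◦ *-cong
          (Π-congAll (All.map (λ l → reflexive (weight-x l)) xVars-<)) (Π-congAll (All.map (λ l → reflexive (weight-y l)) yVars-≥)))) (vdm-V allVars) ⟩
   (total - 1#) * W ∎
   where
   wX : ℕ → Poly n × Poly n
   wX i = weight i , X i
   vdm-V : ∀ l → vdm (map proj₂ (map wX l)) ≈ V l
   vdm-V [] = refl
   vdm-V (i ∷ l) = *-cong (reflexive (cong Π (P.sym (LP.map-∘ (map wX l)) ∙ P.sym (LP.map-∘ l)))) (vdm-V l)
   sgn-map : ∀ p → sgn (map wX p) ≈ sgn p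
   sgn-map [] = refl
   sgn-map (x ∷ p) = -‿cong (sgn-map p)
   L : ℕ → List ℕ → Poly n
   L i l = Π (map (λ m → weight m * X i - X m) l)
   F : List ℕ → ℕ → List ℕ → Poly n
   F p i s = (weight i - 1#) * (sgn p * (L i (p ++ s) * V (p ++ s)))
   x-term : ∀ p i s → p ++ i ∷ s ≡ xVars → F p i (s ++ yVars) ≈ (t⁻ - 1#) * (Δt⁻ i * (Δy * T -1ℤ i Ψ))
   x-term p i s e = *-cong (+-congʳ (reflexive (weight-x (All.lookup b (mid∈ p))))) (begin
     sgn p * (L i (p ++ s ++ yVars) * V (p ++ s ++ yVars)) ≈⟨ reflexive (cong (λ l → sgn p * (L i l * V l)) (P.sym (LP.++-assoc p s yVars))) ⟩
     sgn p * (L i ((p ++ s) ++ yVars) * V ((p ++ s) ++ yVars)) ≈⟨ *-congˡ (*-cong (Π-++map _ (p ++ s) yVars ◦ *-cong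
         (Π-congAll (All.map (λ l → +-congʳ (*-congʳ (reflexive (weight-x l)))) (remove-mid p b)))
         (Π-congAll (All.map (λ l → +-congʳ (*-congʳ (reflexive (weight-y l)))) yVars-≥))) (V-++ (p ++ s) yVars)) ⟩
     sgn p * ((A₁ * A₂) * ((V (p ++ s) * Δy) * Cr (p ++ s) yVars)) ≈⟨ solveR 6 (λ s a b v d c → s :* ((a :* b) :* ((v :* d) :* c)) := (s :* (a :* v)) :* (d :* (b :* c))) refl _ _ _ _ _ _ ⟩
     (sgn p * (A₁ * V (p ++ s))) * (Δy * (A₂ * Cr (p ++ s) yVars)) ≈⟨ sym (*-cong (S-V -1ℤ p i s uq (NP.<-≤-trans (All.lookup b (mid∈ p)) n≤N)) (*-congˡ (Cr-scaled-x p i s b uq))) ⟩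
     S -1ℤ i (V (p ++ i ∷ s)) * (Δy * T -1ℤ i (Cr (p ++ i ∷ s) yVars)) ≈⟨ reflexive (cong (λ l → S -1ℤ i (V l) * (Δy * T -1ℤ i (Cr l yVars))) e) ⟩
     Δt⁻ i * (Δy * T -1ℤ i Ψ) ∎)
     where
     b = P.subst (All (N._< n)) (P.sym e) xVars-<
     uq = P.subst Unique (P.sym e) xVars-unique
     A₁ = Π (map (λ m → t⁻ * X i - X m) (p ++ s))
     A₂ = Π (map (λ m → q⁻ * X i - X m) yVars)
   -- Moving the node past the n variables x costs `sgn xVars`, the same sign that turns the factors
   -- of Ψ with y in second place into factors with y in front.
   y-term : ∀ p i s → p ++ i ∷ s ≡ yVars → F (xVars ++ p) i s ≈ (q⁻ - 1#) * (Δ * (T -1ℤ i Δy * S -1ℤ i Ψ))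
   y-term p i s e = *-cong (+-congʳ (reflexive (weight-y (All.lookup b (mid∈ p))))) (begin
     sgn (xVars ++ p) * (L i ((xVars ++ p) ++ s) * V ((xVars ++ p) ++ s)) ≈⟨ *-cong (sgn-++ xVars p) (reflexive (cong (λ l → L i l * V l) (LP.++-assoc xVars p s))) ⟩
     (sgn xVars * sgn p) * (L i (xVars ++ p ++ s) * V (xVars ++ p ++ s)) ≈⟨ *-congˡ (*-cong (Π-++map _ xVars (p ++ s) ◦ *-cong
         (Π-congAll (All.map (λ l → +-congʳ (*-congʳ (reflexive (weight-x l)))) xVars-<))
         (Π-congAll (All.map (λ l → +-congʳ (*-congʳ (reflexive (weight-y l)))) (remove-mid p b)))) (V-++ xVars (p ++ s))) ⟩
     (sgn xVars * sgn p) * ((A₁ * A₂) * ((Δ * V (p ++ s)) * Cr xVars (p ++ s))) ≈⟨ solveR 7 (λ x s a b d v c → (x :* s) :* ((a :* b) :* ((d :* v) :* c)) := d :* ((s :* (b :* v)) :* ((x :* a) :* c))) refl _ _ _ _ _ _ _ ⟩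
     Δ * ((sgn p * (A₂ * V (p ++ s))) * ((sgn xVars * A₁) * Cr xVars (p ++ s))) ≈⟨ sym (*-congˡ (*-cong (T-V -1ℤ p i s uq (All.lookup b' (mid∈ p))) (Cr-scaled-y p i s b' b uq))) ⟩
     Δ * (T -1ℤ i (V (p ++ i ∷ s)) * S -1ℤ i (Cr xVars (p ++ i ∷ s))) ≈⟨ reflexive (cong (λ l → Δ * (T -1ℤ i (V l) * S -1ℤ i (Cr xVars l))) e) ⟩
     Δ * (T -1ℤ i Δy * S -1ℤ i Ψ) ∎)
     where
     b = P.subst (All (n N.≤_)) (P.sym e) yVars-≥
     b' = P.subst (All (N._< N)) (P.sym e) yVars-<N
     uq = P.subst Unique (P.sym e) yVars-unique
     A₁ = Π (map (λ m → t⁻ * X i - X m) xVars)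
     A₂ = Π (map (λ m → q⁻ * X i - X m) (p ++ s))

 -- Blocks of variables
 unique-↭ : ∀ {xs ys : List ℤ} → xs ↭ ys → Unique xs → Unique ys
 unique-↭ Perm.refl u = u
 unique-↭ (Perm.prep x p) (h ∷ u) = PermP.All-resp-↭ p h ∷ unique-↭ p u
 unique-↭ (Perm.swap x y p) ((ne ∷ h) ∷ h' ∷ u) = (ne ∘ P.sym ∷ PermP.All-resp-↭ p h') ∷ PermP.All-resp-↭ p h ∷ unique-↭ p u
 unique-↭ (Perm.trans p q) u = unique-↭ q (unique-↭ p u)

 distinct-cases : ∀ L → Repeats L ⊎ Unique L
 distinct-cases L with sorted-cases (sort-↗ L)
 ... | inj₁ (ys , y , zs , e) = inj₁ (ys , y , zs , Perm.↭-trans (Perm.↭-sym (sort-↭ L)) (Perm.↭-reflexive e))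
 ... | inj₂ l = inj₂ (unique-↭ (sort-↭ L) (AllPairs.map ZP.<⇒≢ (LinkedP.Linked⇒AllPairs ZP.<-trans l)))

 take-++ : ∀ {A : Set} {s} (p q : List A) → length p ≡ s → L.take s (p ++ q) ≡ p
 take-++ [] q P.refl = P.refl
 take-++ (x ∷ p) q P.refl = cong (x ∷_) (take-++ p q P.refl)

 drop-++ : ∀ {A : Set} {s} (p q : List A) → length p ≡ s → L.drop s (p ++ q) ≡ q
 drop-++ [] q P.refl = P.refl
 drop-++ (x ∷ p) q P.refl = drop-++ p q P.refl

 swapL-skip : ∀ s k p q → length p ≡ s → swapL (s N.+ k) (p ++ q) ≡ p ++ swapL k q
 swapL-skip zero k [] q _ = P.refl
 swapL-skip (suc s) k (x ∷ p) q e = cong (x ∷_) (swapL-skip s k p q (NP.suc-injective e))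

 swapL-within : ∀ k p q → suc k N.< length p → swapL k (p ++ q) ≡ swapL k p ++ q
 swapL-within zero (x ∷ y ∷ p) q _ = P.refl
 swapL-within zero (x ∷ []) q (s≤s ())
 swapL-within (suc k) (x ∷ p) q (s≤s l) = cong (x ∷_) (swapL-within k p q l)

 swapL-mid : ∀ ys y z zs → swapL (length ys) (ys ++ y ∷ z ∷ zs) ≡ ys ++ z ∷ y ∷ zs
 swapL-mid [] y z zs = P.refl
 swapL-mid (x ∷ ys) y z zs = cong (x ∷_) (swapL-mid ys y z zs)

 length-swapL : ∀ k L → length (swapL k L) ≡ length L
 length-swapL zero [] = P.refl
 length-swapL zero (x ∷ []) = P.refl
 length-swapL zero (x ∷ y ∷ L) = P.refl
 length-swapL (suc k) [] = P.refl
 length-swapL (suc k) (x ∷ L) = cong suc (length-swapL k L)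

 swapL-split : ∀ k (L : List ℤ) → suc k N.< length L → ∃ λ ys → ∃ λ (y : ℤ) → ∃ λ z → ∃ λ zs → L ≡ ys ++ y ∷ z ∷ zs × length ys ≡ k
 swapL-split zero (y ∷ z ∷ L) _ = [] , y , z , L , P.refl , P.refl
 swapL-split zero (x ∷ []) (s≤s ())
 swapL-split (suc k) (x ∷ L) (s≤s l) with swapL-split k L l
 ... | ys , y , z , zs , e , e' = x ∷ ys , y , z , zs , cong (x ∷_) e , cong suc e'

 anti-swapL : ∀ {a : List ℤ → ℤ} → (∀ ys y z zs → a (ys ++ y ∷ z ∷ zs) ≡ Z.- a (ys ++ z ∷ y ∷ zs)) → ∀ k (L : List ℤ) → suc k N.< length L → a (swapL k L) ≡ Z.- a L
 anti-swapL {a} h k L l with swapL-split k L l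
 ... | ys , y , z , zs , P.refl , P.refl = cong a (swapL-mid ys y z zs) ∙ h ys z y zs

 swapL-anti : ∀ {m} {a : List ℤ → ℤ} → (∀ k L → length L ≡ m → suc k N.< m → a (swapL k L) ≡ Z.- a L) → Anti m a
 swapL-anti {a = a} h ys y z zs l = cong a (P.sym (swapL-mid ys z y zs)) ∙ h (length ys) (ys ++ z ∷ y ∷ zs) len
   (P.subst (suc (length ys) N.<_) (P.sym (LP.length-++ ys) ∙ len) (P.subst (suc (length ys) N.<_) (P.sym (NP.+-suc (length ys) _ ∙ cong suc (NP.+-suc (length ys) (length zs)))) (s≤s (s≤s (NP.m≤m+n (length ys) (length zs))))))
   where len = LP.length-++ ys ∙ P.sym (LP.length-++ ys) ∙ l

 length-exps : ∀ e → length (exps e) ≡ N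
 length-exps e = VP.length-toList (xs e)

 swapV-vl : ∀ j Ls → length Ls ≡ N → swapV j (vl N Ls) ≡ vl N (swapL j Ls)
 swapV-vl j Ls l = P.sym (vl-toList _) ∙ cong (vl N) (toList-swapV j (vl N Ls) ∙ cong (swapL j) (toList-vl N Ls l))

 eqL-self : ∀ γ → eqL γ γ ≡ + 1
 eqL-self [] = P.refl
 eqL-self (g ∷ γ) = hd-self g (eqL γ) γ ∙ eqL-self γ

 eqL-≢ : ∀ γ L → length γ ≡ length L → γ ≢ L → eqL γ L ≡ +0
 eqL-≢ [] [] _ ne = ⊥-elim (ne P.refl)
 eqL-≢ (g ∷ γ) (h ∷ L) l ne with h Z.≟ g
 ... | yes P.refl = eqL-≢ γ L (NP.suc-injective l) (ne ∘ cong (h ∷_))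
 ... | no _ = P.refl

 -- The m variables after the first s ones.
 module Block (s m : ℕ) (s+m≤N : s N.+ m N.≤ N) where

   bl : E → List ℤ
   bl e = L.take m (L.drop s (exps e))

   put : E → List ℤ → E
   put e L = lst (getE 0 e) (getE 1 e) (L.take s (exps e) ++ L ++ L.drop (s N.+ m) (exps e))

   private
     len-pre : ∀ e → length (L.take s (exps e)) ≡ s
     len-pre e = LP.length-take s (exps e) ∙ NP.m≤n⇒m⊓n≡m (P.subst (s N.≤_) (P.sym (length-exps e)) (NP.≤-trans (NP.m≤m+n s m) s+m≤N))

     len-put : ∀ e L → length L ≡ m → length (L.take s (exps e) ++ L ++ L.drop (s N.+ m) (exps e)) ≡ N
     len-put e L l = LP.length-++ (L.take s (exps e)) ∙ cong₂ N._+_ (len-pre e) (LP.length-++ L ∙ cong₂ N._+_ l (LP.length-drop (s N.+ m) (exps e) ∙ cong (N._∸ (s N.+ m)) (length-exps e))) ∙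
       P.sym (NP.+-assoc s m _) ∙ NP.m+[n∸m]≡n s+m≤N

   length-bl : ∀ e → length (bl e) ≡ m
   length-bl e = LP.length-take m _ ∙ NP.m≤n⇒m⊓n≡m (P.subst (m N.≤_) (P.sym (LP.length-drop s (exps e) ∙ cong (N._∸ s) (length-exps e))) (P.subst (N._≤ N N.∸ s) (NP.m+n∸m≡n s m) (NP.∸-monoˡ-≤ s s+m≤N)))

   exps-put : ∀ e L → length L ≡ m → exps (put e L) ≡ L.take s (exps e) ++ L ++ L.drop (s N.+ m) (exps e)
   exps-put e L l = toList-vl N _ (len-put e L l)

   bl-put : ∀ e L → length L ≡ m → bl (put e L) ≡ L
   bl-put e L l = cong (L.take m ∘ L.drop s) (exps-put e L l) ∙ cong (L.take m) (drop-++ (L.take s (exps e)) _ (len-pre e)) ∙ take-++ L _ l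

   put-bl : ∀ e → put e (bl e) ≡ e
   put-bl e = cong (lst (getE 0 e) (getE 1 e)) whole ∙ cong (mkX (getE 0 e) (getE 1 e)) (vl-toList (xs e)) ∙ mkX-η e
     where whole : L.take s (exps e) ++ L.take m (L.drop s (exps e)) ++ L.drop (s N.+ m) (exps e) ≡ exps e
           whole = cong (λ r → L.take s (exps e) ++ L.take m (L.drop s (exps e)) ++ r) (P.sym (LP.drop-drop s m (exps e))) ∙
             cong (L.take s (exps e) ++_) (LP.take++drop≡id m (L.drop s (exps e))) ∙ LP.take++drop≡id s (exps e)

   put-σ : ∀ e L k → length L ≡ m → suc k N.< m → σ (s N.+ k) (put e L) ≡ put e (swapL k L)
   put-σ e L k l k<m = cong (mkX (getE 0 e) (getE 1 e)) (swapV-vl (s N.+ k) _ (len-put e L l) ∙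
     cong (vl N) (swapL-skip s k (L.take s (exps e)) _ (len-pre e) ∙ cong (L.take s (exps e) ++_) (swapL-within k L _ (P.subst (suc k N.<_) (P.sym l) k<m))))

   bl-σ : ∀ e k → suc k N.< m → bl (σ (s N.+ k) e) ≡ swapL k (bl e)
   bl-σ e k l = cong (λ z → bl (σ (s N.+ k) z)) (P.sym (put-bl e)) ∙ cong bl (put-σ e (bl e) k (length-bl e) l) ∙
     bl-put e _ (length-swapL k (bl e) ∙ length-bl e)

   index-< : ∀ {k} → suc k N.< m → suc (s N.+ k) N.< N
   index-< {k} l = NP.≤-trans (P.subst (N._≤ s N.+ m) (NP.+-suc s (suc k) ∙ cong suc (NP.+-suc s k)) (NP.+-monoʳ-≤ s l)) s+m≤N

   Antisym : Poly n → Set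
   Antisym p = ∀ k → suc k N.< m → σP (s N.+ k) p ≈ - p

   antisym-lin : ∀ {p} → Antisym p → ∀ f k → suc k N.< m → lin (f ∘ σ (s N.+ k)) p ≡ Z.- lin f p
   antisym-lin {p} h f k l = P.sym (lin-mapE (σ (s N.+ k)) f p) ∙ app (h k l) f ∙ lin-oppP f p

   σ-σ : ∀ k e → σ k (σ k e) ≡ e
   σ-σ k e = cong (mkE {n}) (swapV-invol (2 N.+ k) (vec e))

   coefficient : Poly n → E → List ℤ → ℤ
   coefficient p e L = lin (δE (put e L)) p

   δE-σ : ∀ k e e' → δE (σ k e) e' ≡ δE e (σ k e')
   δE-σ k e e' with e ≟E σ k e'
   ... | yes P.refl = cong (λ z → δE z e') (σ-σ k e') ∙ δE-refl e' ∙ P.sym (δE-refl (σ k e'))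
   ... | no ne = δE-≢ {e = σ k e} {e'} (λ h → ne (P.sym (σ-σ k e) ∙ cong (σ k) h)) ∙ P.sym (δE-≢ ne)

   coefficient-anti : ∀ {p} → Antisym p → ∀ e → Anti m (coefficient p e)
   coefficient-anti {p} h e = swapL-anti (λ k L l k<m → cong (λ z → lin (δE z) p) (P.sym (put-σ e L k l k<m)) ∙
     lin-cong (δE-σ (s N.+ k) (put e L)) p ∙ antisym-lin h (δE (put e L)) k k<m)

   distinct? : E → Bool
   distinct? e with distinct-cases (bl e)
   ... | inj₁ _ = false
   ... | inj₂ _ = true

   antisym-distinct : ∀ {p} → Antisym p → p ≈ keep distinct? p
   antisym-distinct {p} h = coeffs⇒≋ (λ e → go e ∙ P.sym (lin-keep distinct? (δE e) p))
     where
     go : ∀ e → lin (δE e) p ≡ lin (λ e' → if distinct? e' then δE e e' else +0) p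
     go e with distinct-cases (bl e) in eq
     ... | inj₁ r = (cong (λ z → lin (δE z) p) (P.sym (put-bl e)) ∙ anti-repeats {a = coefficient p e} (coefficient-anti h e) (length-bl e) r) ∙
         P.sym (lin-cong zero-here p ∙ lin-0 p)
       where zero-here : ∀ e' → (if distinct? e' then δE e e' else +0) ≡ +0
             zero-here e' with e ≟E e'
             ... | no ne with distinct? e'
             ...   | true = δE-≢ ne
             ...   | false = P.refl
             zero-here e' | yes P.refl rewrite eq = P.refl
     ... | inj₂ u = lin-cong same p
       where same : ∀ e' → δE e e' ≡ (if distinct? e' then δE e e' else +0)
             same e' with e ≟E e'
             ... | no ne with distinct? e'
             ...   | true = P.refl
             ...   | false = δE-≢ ne
             same e' | yes P.refl rewrite eq = P.refl

   -- Against an antisymmetric weight, an antisymmetric polynomial is a multiple of one of its coefficients.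
   orbit-lin : ∀ {p} → Antisym p → (h : E → ℤ) → (∀ k e → suc k N.< m → h (σ (s N.+ k) e) ≡ Z.- h e) →
     ∀ γ → Unique γ → length γ ≡ m → All (λ t → h (proj₁ t) ≡ +0 ⊎ bl (proj₁ t) ↭ γ) p →
     lin h p ≡ + (m !) Z.* lin (λ e → eqL γ (bl e) Z.* h e) p
   orbit-lin {p} ap h hσ γ u l q = lin-cong (λ e → P.sym (ZP.*-identityˡ (h e))) p ∙
       orbit-sum γ {μ} u sym-μ ∙ cong (λ k → + (k !) Z.* μ (eqL γ)) l
     where
     -- The functional for `orbit-sum`: a function of the block exponents is weighted by h and
     -- paired with p. Under an exchange p and h both change sign, so the functional is invariant.
     μ : (List ℤ → ℤ) → ℤ
     μ B = lin (λ e → B (bl e) Z.* h e) p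
     sym-μ : Symmetric (length γ) γ μ
     sym-μ = record
       { add = λ B B' → lin-cong (λ e → ZP.*-distribʳ-+ (h e) (B (bl e)) (B' (bl e))) p ∙ lin-add _ _ p
       ; swap = λ B k l' → let k<m = P.subst (suc k N.<_) l l' in
           (P.sym (ZP.neg-involutive (μ B)) ∙ (cong Z.-_ (P.sym (antisym-lin ap (λ e → B (bl e) Z.* h e) k k<m))) ∙
             (cong Z.-_ (lin-cong (λ e → cong₂ Z._*_ (cong B (bl-σ e k k<m)) (hσ k e k<m) ∙ P.sym (ZP.neg-distribʳ-* (B (swapL k (bl e))) (h e)) ∙ P.sym (ZP.-1*i≡-i _)) p)) ∙
               (cong Z.-_ (lin-scale -1ℤ (λ e → B (swapL k (bl e)) Z.* h e) p ∙ ZP.-1*i≡-i _)) ∙ ZP.neg-involutive _)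
       ; on = λ B B' eq → lin-congAll q (λ { e _ (inj₁ z) → cong (B (bl e) Z.*_) z ∙ ZP.*-zeroʳ (B (bl e)) ∙ P.sym (cong (B' (bl e) Z.*_) z ∙ ZP.*-zeroʳ (B' (bl e)))
                                             ; e _ (inj₂ p) → cong (Z._* h e) (eq (bl e) p) }) }

   -- The shape of the terms of a Vandermonde product in the block: q, t and the other variables are
   -- absent, and the exponents in the block form a staircase list.
   InBlock : E → Set
   InBlock e = e ≡ put zeroExp (bl e) × Staircase m (bl e)

   ρ-coefficient : Poly n → ℤ
   ρ-coefficient p = coefficient p zeroExp (iv +0 m)

   staircase-coefficient : ∀ {p} → Antisym p → All (InBlock ∘ proj₁) p → ∀ e → InBlock e → lin (δE e) p ≡ ρ-coefficient p Z.* sg (bl e)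
   staircase-coefficient {p} ap q e (e≡ , st) = cong (λ z → lin (δE z) p) e≡ ∙
     anti-unique {a = coefficient p zeroExp} {b = λ L → ρ-coefficient p Z.* sg L} (coefficient-anti ap zeroExp)
       (λ ys y z zs _ → cong (ρ-coefficient p Z.*_) (sg-swap ys y z zs) ∙ P.sym (ZP.neg-distribʳ-* (ρ-coefficient p) (sg (ys ++ z ∷ y ∷ zs))))
       st (P.sym (ZP.*-identityʳ (ρ-coefficient p)) ∙ cong (ρ-coefficient p Z.*_) (P.sym (sg-iv +0 m)))

   inBlock? : ∀ e {p} → All (InBlock ∘ proj₁) p → lin (δE e) p ≡ +0 ⊎ InBlock e
   inBlock? e [] = inj₁ P.refl
   inBlock? e {(e' , c) ∷ p} (h ∷ q) with e ≟E e' | inBlock? e q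
   ... | yes P.refl | _ = inj₂ h
   ... | no ne | inj₂ ib = inj₂ ib
   ... | no ne | inj₁ z = inj₁ (cong₂ Z._+_ (cong (c Z.*_) (δE-≢ ne) ∙ ZP.*-zeroʳ c) z)

   -- The coefficient is never computed. Were it zero, antisymmetry would make all coefficients
   -- vanish, and zero is not regular.
   ρ-coefficient-≢0 : ∀ {p} → Antisym p → All (InBlock ∘ proj₁) p → Regular p → ρ-coefficient p ≢ +0
   ρ-coefficient-≢0 {p} ap q reg z = one≢0 (app (reg 1# (*-identityʳ p ◦ coeffs⇒≋ all-zero)) (λ _ → + 1))
     where
     one≢0 : + 1 ≡ +0 → ⊥
     one≢0 ()
     all-zero : ∀ e → lin (δE e) p ≡ +0
     all-zero e with inBlock? e q
     ... | inj₁ h = h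
     ... | inj₂ ib = staircase-coefficient ap q e ib ∙ cong (Z._* sg (bl e)) z

   ρ-unique : Unique (iv +0 m)
   ρ-unique = AllPairs.map ZP.<⇒≢ (iv-increasing +0 m)

   -- An antisymmetric functional does not distinguish the Vandermonde product from a multiple of x^ρ.
   blockFactor : Poly n → ℤ
   blockFactor p = lin (sg ∘ bl) p

   blockFactor-value : ∀ {p} → Antisym p → All (InBlock ∘ proj₁) p → blockFactor p ≡ + (m !) Z.* ρ-coefficient p
   blockFactor-value {p} ap q = orbit-lin ap (sg ∘ bl)
       (λ k e l → cong sg (bl-σ e k l) ∙ anti-swapL {sg} sg-swap k (bl e) (P.subst (suc k N.<_) (P.sym (length-bl e)) l))
       (iv +0 m) ρ-unique (length-iv +0 m) (All.map (λ {t} h → perm (proj₁ t) h) q) ∙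
     cong (+ (m !) Z.*_) (lin-congAll q indicator)
     where
     perm : ∀ e → InBlock e → sg (bl e) ≡ +0 ⊎ bl e ↭ iv +0 m
     perm e (_ , st) with sg (bl e) Z.≟ +0
     ... | yes z = inj₁ z
     ... | no ne = inj₂ (sg-↭ st ne)
     indicator : ∀ e c → InBlock e → eqL (iv +0 m) (bl e) Z.* sg (bl e) ≡ δE (put zeroExp (iv +0 m)) e
     indicator e _ (e≡ , _) with put zeroExp (iv +0 m) ≟E e
     ... | yes P.refl = cong (λ L → eqL (iv +0 m) L Z.* sg L) (bl-put zeroExp (iv +0 m) (length-iv +0 m)) ∙
         cong₂ Z._*_ (eqL-self (iv +0 m)) (sg-iv +0 m) ∙ P.sym (δE-refl (put zeroExp (iv +0 m)))
     ... | no ne = cong (Z._* sg (bl e)) (eqL-≢ (iv +0 m) (bl e) (length-iv +0 m ∙ P.sym (length-bl e)) (λ h → ne (cong (put zeroExp) h ∙ P.sym e≡))) ∙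
         P.sym (δE-≢ ne)

   blockFactor-≢0 : ∀ {p} → Antisym p → All (InBlock ∘ proj₁) p → Regular p → blockFactor p ≢ +0
   blockFactor-≢0 {p} ap q reg z with ZP.i*j≡0⇒i≡0∨j≡0 (+ (m !)) {ρ-coefficient p} (P.sym (blockFactor-value ap q) ∙ z)
   ... | inj₁ e = N.≢-nonZero⁻¹ (m !) {{m NP.!≢0}} (ZP.+-injective e)
   ... | inj₂ e = ρ-coefficient-≢0 ap q reg e

   antisym-functional : ∀ {p} → All (InBlock ∘ proj₁) p → {Φ : Poly n → Poly n} → Linear Φ →
     (∀ k e → suc k N.< m → Φ (mono (σ (s N.+ k) e) (+ 1)) ≈ - Φ (mono e (+ 1))) →
     Φ p ≈ cst (blockFactor p) * Φ (mono (put zeroExp (iv +0 m)) (+ 1))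
   antisym-functional {p} q {Φ} linΦ anti .app f = linΦ f p ∙ lin-congAll q value ∙
     (lin-cong (λ e → ZP.*-comm (sg (bl e)) (a ρ)) p ∙ lin-scale (a ρ) (sg ∘ bl) p ∙ ZP.*-comm (a ρ) (blockFactor p)) ∙
       P.sym (lin-mulP f (cst (blockFactor p)) _ ∙ lin-mono (λ e → lin (λ e' → f (e ⊕ e')) (Φ (mono (put zeroExp ρ) (+ 1)))) zeroExp (blockFactor p) ∙
         cong (blockFactor p Z.*_) (lin-cong (λ e → cong f (⊕-identityˡ e)) (Φ (mono (put zeroExp ρ) (+ 1)))))
     where
     ρ = iv +0 m
     a : List ℤ → ℤ
     a L = lin f (Φ (mono (put zeroExp L) (+ 1)))
     value : ∀ e c → InBlock e → lin f (Φ (mono e (+ 1))) ≡ sg (bl e) Z.* a ρ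
     value e _ (e≡ , st) = cong (λ z → lin f (Φ (mono z (+ 1)))) e≡ ∙ anti-unique {a = a} {b = λ L → sg L Z.* a ρ}
       (swapL-anti (λ k L l k<m → cong (λ z → lin f (Φ (mono z (+ 1)))) (P.sym (put-σ zeroExp L k l k<m)) ∙ app (anti k (put zeroExp L) k<m) f ∙ lin-oppP f _))
       (λ ys y z zs _ → cong (Z._* a ρ) (sg-swap ys y z zs) ∙ P.sym (ZP.neg-distribˡ-* (sg (ys ++ z ∷ y ∷ zs)) (a ρ)))
       st (P.sym (cong (Z._* a ρ) (sg-iv +0 m) ∙ ZP.*-identityˡ (a ρ)))

 -- Contraction against antisymmetric polynomials
 cancelˡ-↭ : ∀ (zs : List ℤ) {xs ys} → zs ++ xs ↭ zs ++ ys → xs ↭ ys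
 cancelˡ-↭ [] p = p
 cancelˡ-↭ (z ∷ zs) p = cancelˡ-↭ zs (PermP.drop-∷ p)

 cancelʳ-↭ : ∀ (zs : List ℤ) {xs ys} → xs ++ zs ↭ ys ++ zs → xs ↭ ys
 cancelʳ-↭ zs {xs} {ys} p = cancelˡ-↭ zs (Perm.↭-trans (PermP.++-comm zs xs) (Perm.↭-trans p (PermP.++-comm ys zs)))

 ∈-iv : ∀ a m x → a Z.≤ x → x Z.< a Z.+ + m → x ∈ iv a m
 ∈-iv a zero x l u = ⊥-elim (ZP.<-irrefl P.refl (ZP.≤-<-trans l (P.subst (x Z.<_) (ZP.+-identityʳ a) u)))
 ∈-iv a (suc m) x l u with x Z.≟ a
 ... | yes e = here e
 ... | no ne = there (∈-iv (a Z.+ + 1) m x (<⇒+1≤ (ZP.≤∧≢⇒< l (ne ∘ P.sym))) (P.subst (x Z.<_) (P.sym (ZP.+-assoc a (+ 1) (+ m))) u))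

 -- Supplies the exponents left for the second block when those of the first are given.
 complement : ∀ (L R : List ℤ) → Unique L → All (_∈ R) L → ∃ λ M → L ++ M ↭ R
 complement [] R _ _ = R , Perm.refl
 complement (x ∷ L) R (ne ∷ u) (x∈ ∷ h) with MemP.∈-∃++ x∈
 ... | as , bs , P.refl with complement L (as ++ bs) u (All.zipWith (λ { (x≢y , y∈) → elsewhere as x≢y y∈ }) (ne , h))
   where
   elsewhere : ∀ as {y} → x ≢ y → y ∈ as ++ x ∷ bs → y ∈ as ++ bs
   elsewhere [] x≢y (here P.refl) = ⊥-elim (x≢y P.refl)
   elsewhere [] x≢y (there m) = m
   elsewhere (a ∷ as) x≢y (here e) = here e
   elsewhere (a ∷ as) x≢y (there m) = there (elsewhere as x≢y m)
 ...   | M , p = M , Perm.↭-trans (Perm.prep x p) (Perm.↭-sym (PermP.shift x as bs))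

 all-keep : ∀ {ℓ} {Q : E × ℤ → Set ℓ} b {p} → All Q p → All (λ t → Q t × b (proj₁ t) ≡ true) (keep b p)
 all-keep b [] = []
 all-keep b {(e , c) ∷ p} (q ∷ qs) with b e in eq
 ... | true = (q , eq) ∷ all-keep b qs
 ... | false = all-keep b qs

 sg-square-↭ : ∀ {L} → L ↭ iv +0 N → sg L Z.* sg L ≡ + 1
 sg-square-↭ p = symmetric-↭ (λ ys y z zs → cong₂ Z._*_ (sg-swap ys y z zs) (sg-swap ys y z zs) ∙ aux (sg (ys ++ z ∷ y ∷ zs)))
     (Perm.↭-sym p) (cong₂ Z._*_ (sg-iv +0 N) (sg-iv +0 N))
   where
   aux = ring35
   symmetric-↭ : ∀ {a : List ℤ → ℤ} {c xs ys} → (∀ us y z zs → a (us ++ y ∷ z ∷ zs) ≡ a (us ++ z ∷ y ∷ zs)) → xs ↭ ys → a xs ≡ c → a ys ≡ c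
   symmetric-↭ h Perm.refl e = e
   symmetric-↭ {a} h (Perm.prep x p) e = symmetric-↭ {λ L → a (x ∷ L)} (λ us → h (x ∷ us)) p e
   symmetric-↭ {a} h (Perm.swap {xs} x y p) e = symmetric-↭ {λ L → a (y ∷ x ∷ L)} (λ us → h (y ∷ x ∷ us)) p (h [] y x xs ∙ e)
   symmetric-↭ h (Perm.trans p q) e = symmetric-↭ h q (symmetric-↭ h p e)

 module BX = Block 0 n n≤N
 module BY = Block n n NP.≤-refl
 module BA = Block 0 N NP.≤-refl

 exps-all : ∀ e → BA.bl e ≡ exps e
 exps-all e = LP.take-all N (exps e) (NP.≤-reflexive (length-exps e))

 inBlock-all : ∀ e → qtE e ≡ zeroExp → Staircase N (exps e) → BA.InBlock e
 inBlock-all e z st = ((P.sym (BA.put-bl e) ∙ cong₂ (λ q t → lst q t (BA.bl e ++ L.drop N (exps e))) (cong (getE 0) z) (cong (getE 1) z)) ∙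
     cong (λ r → lst +0 +0 (BA.bl e ++ r)) drop-all) , P.subst (Staircase N) (P.sym (exps-all e)) st
   where
   drop-all : L.drop N (exps e) ≡ L.drop N (exps zeroExp)
   drop-all = LP.drop-all N (exps e) (NP.≤-reflexive (length-exps e)) ∙ P.sym (LP.drop-all N (exps zeroExp) (NP.≤-reflexive (length-exps zeroExp)))

 allW : All (BA.InBlock ∘ proj₁) W → All (λ t → qtE (proj₁ t) ≡ zeroExp × Staircase N (exps (proj₁ t))) W
 allW = All.map (λ { {e , _} (e≡ , st) → cong qtE e≡ , P.subst (Staircase N) (exps-all e) st })

 -- One block contracted against an antisymmetric polynomial p in the other one.
 record SideData : Set where
   field
     sF sS : ℕ
     hF : sF N.+ n N.≤ N
     hS : sS N.+ n N.≤ N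
   fs : E → List ℤ
   fs = Block.bl sF n hF
   ss : E → List ℤ
   ss = Block.bl sS n hS
   field
     mF mS : E → E
     κ : List ℤ → List ℤ → ℤ
     mF-⊕ : ∀ a e → mF (a ⊕ e) ≡ mF a ⊕ mF e
     ss-⊕ : ∀ a e → mF a ≡ a → ss (a ⊕ e) ≡ ss e
     fs-⊕ : ∀ a e → mS a ≡ a → fs (a ⊕ e) ≡ fs e
     mF-mS : ∀ e → mS e ≡ e → mF e ≡ qtE e
     κ-exps : ∀ e → κ (fs e) (ss e) ≡ sgS (exps e)
     κ-antiF : ∀ k L M → length L ≡ n → suc k N.< n → κ (swapL k L) M ≡ Z.- κ L M
     κ-antiS : ∀ k L M → length L ≡ n → length M ≡ n → suc k N.< n → κ L (swapL k M) ≡ Z.- κ L M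
     κ-perm : ∀ L M → length L ≡ n → length M ≡ n → All (+0 Z.≤_) L → All (+0 Z.≤_) M → κ L M ≢ +0 → L ++ M ↭ iv +0 N
     fs-σS : ∀ k e → suc k N.< n → fs (σ (sS N.+ k) e) ≡ fs e
     fs-put : ∀ e M → length M ≡ n → fs (Block.put sS n hS e M) ≡ fs e
     exps-parts : ∀ e → exps e ↭ fs e ++ ss e
     recon : ∀ e e' → qtE e ≡ zeroExp → qtE e' ≡ zeroExp → fs e ≡ fs e' → ss e ≡ ss e' → e ≡ e'
     mF-build : ∀ e e' → qtE e ≡ zeroExp → fs e ≡ fs e' → mF e' ≡ e' → qtE e' ⊕ mF e ≡ e'

 qtE-σ : ∀ k e → qtE (σ k e) ≡ qtE e
 qtE-σ k (mkE (q ∷ t ∷ v)) = P.refl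

 qtE-⊕ : ∀ a e → qtE (a ⊕ e) ≡ qtE a ⊕ qtE e
 qtE-⊕ (mkE (q ∷ t ∷ v)) (mkE (q' ∷ t' ∷ v')) = cong (mkX (q Z.+ q') (t Z.+ t')) (P.sym (zip-0 0V))

 module Side (D : SideData) where
   open SideData D
   module BF = Block sF n hF
   module BS = Block sS n hS

   -- The sign of ψ is taken of the first block of p together with the second block of G, while the
   -- first block of G is carried along as a spectator. Hence the contraction is linear over
   -- polynomials in the first block, as `contract-*` states.
   contract : Poly n → Poly n → Poly n
   contract p = bind (λ e → bind (λ e' → mono (qtE e' ⊕ mF e) (κ (fs e') (ss e))) p)

   lin-contract : ∀ f p G → lin f (contract p G) ≡ lin (λ e → lin (λ e' → κ (fs e') (ss e) Z.* f (qtE e' ⊕ mF e)) p) G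
   lin-contract f p G = lin-bind _ f G ∙ lin-cong (λ e → lin-bind _ f p ∙ lin-cong (λ e' → lin-mono f _ (κ (fs e') (ss e))) p) G

   contract-cong : ∀ p {G H} → G ≈ H → contract p G ≈ contract p H
   contract-cong p = bind-cong (λ _ → refl)

   contract-+ : ∀ p G H → contract p (G + H) ≈ contract p G + contract p H
   contract-+ p G H .app f = lin-contract f p (G + H) ∙ lin-addP _ G H ∙ P.sym (lin-addP f (contract p G) (contract p H) ∙ cong₂ Z._+_ (lin-contract f p G) (lin-contract f p H))

   contract-ΣL : ∀ {A : Set} p (g : A → Poly n) l → contract p (ΣL l g) ≈ ΣL l (contract p ∘ g)
   contract-ΣL p g [] .app f = lin-contract f p []
   contract-ΣL p g (x ∷ l) = contract-+ p (g x) _ ◦ +-congˡ (contract-ΣL p g l)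

   contract-* : ∀ p {s} G → All (λ t → mF (proj₁ t) ≡ proj₁ t) s → contract p (s * G) ≈ s * contract p G
   contract-* p {s} G hs .app f = lin-contract f p (s * G) ∙ lin-mulP _ s G ∙ lin-congAll hs (λ a _ h → lin-cong (λ e → lin-cong (λ e' → step a e e' h) p) G ∙ P.sym (lin-contract (λ e → f (a ⊕ e)) p G)) ∙
       P.sym (lin-mulP f s (contract p G))
     where
     step : ∀ a e e' → mF a ≡ a → κ (fs e') (ss (a ⊕ e)) Z.* f (qtE e' ⊕ mF (a ⊕ e)) ≡ κ (fs e') (ss e) Z.* f (a ⊕ (qtE e' ⊕ mF e))
     step a e e' h = cong₂ (λ M z → κ (fs e') M Z.* f z) (ss-⊕ a e h) (cong (qtE e' ⊕_) (mF-⊕ a e ∙ cong (_⊕ mF e) h) ∙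
       P.sym (⊕-assoc (qtE e') a (mF e)) ∙ cong (_⊕ mF e) (⊕-comm (qtE e') a) ∙ ⊕-assoc a (qtE e') (mF e))

   contract-hom : ∀ p {φ} → Additive φ → (∀ e → ss (φ e) ≡ ss e) → (∀ e → mF (φ e) ≡ φ (mF e)) → (∀ e → φ (qtE e) ≡ qtE e) → ∀ G → contract p (mapE φ G) ≈ mapE φ (contract p G)
   contract-hom p {φ} ad h₁ h₂ h₃ G .app f = lin-contract f p (mapE φ G) ∙ lin-mapE φ _ G ∙ lin-cong (λ e → lin-cong (λ e' →
       cong₂ (λ M z → κ (fs e') M Z.* f z) (h₁ e) (cong₂ _⊕_ (P.sym (h₃ e')) (h₂ e) ∙ P.sym (Additive.φ-⊕ ad (qtE e') (mF e)))) p) G ∙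
       P.sym (lin-mapE φ f (contract p G) ∙ lin-contract (f ∘ φ) p G)

   -- Here s has no first block to carry along, so only the sign remains and the contraction is ψ of
   -- a product.
   contract-second : ∀ {p s} → All (λ t → mF (proj₁ t) ≡ proj₁ t) p → All (λ t → mS (proj₁ t) ≡ proj₁ t) s → contract p s ≈ ψ (p * s)
   contract-second {p} {s} hp hs .app f = lin-contract f p s ∙ lin-congAll hs (λ e _ h → lin-congAll hp (λ e' _ h' → step e e' h h')) ∙
       lin-swap (λ e e' → sgS (exps (e' ⊕ e)) Z.* f (qtE (e' ⊕ e))) s p ∙ P.sym (lin-ψ f (p * s) ∙ lin-mulP _ p s)
     where
     step : ∀ e e' → mS e ≡ e → mF e' ≡ e' → κ (fs e') (ss e) Z.* f (qtE e' ⊕ mF e) ≡ sgS (exps (e' ⊕ e)) Z.* f (qtE (e' ⊕ e))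
     step e e' h h' = cong₂ (λ z y → z Z.* f y) (cong₂ κ (P.sym (cong fs (⊕-comm e' e) ∙ fs-⊕ e e' h)) (P.sym (ss-⊕ e' e h')) ∙ κ-exps (e' ⊕ e))
       (cong (qtE e' ⊕_) (mF-mS e h) ∙ P.sym (qtE-⊕ e' e))

   Representable : Poly n → Set
   Representable p = BF.Antisym p × All (λ t → mF (proj₁ t) ≡ proj₁ t × All (+0 Z.≤_) (fs (proj₁ t)) × All (Z._< + N) (fs (proj₁ t))) p

   module Reproduce (antiW : BA.Antisym W) (inW : All (BA.InBlock ∘ proj₁) W) where

     c₀ : ℤ
     c₀ = BA.ρ-coefficient W

     -- One n! counts the rearrangements of the exponents of p, the other those of the second block
     -- of W, and c₀ is the coefficient of W at ρ.
     factor : ℤ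
     factor = + (n !) Z.* (+ (n !) Z.* c₀)

     private
       W' : Poly n
       W' = keep BA.distinct? W

       W-facts : All (λ t → qtE (proj₁ t) ≡ zeroExp × Staircase N (exps (proj₁ t))) W
       W-facts = allW inW

       W'-facts : All (λ t → qtE (proj₁ t) ≡ zeroExp × exps (proj₁ t) ↭ iv +0 N) W'
       W'-facts = All.map (λ { {e , _} ((z , st) , d) → z , perm e st d }) (all-keep BA.distinct? W-facts)
         where
         perm : ∀ e → Staircase N (exps e) → BA.distinct? e ≡ true → exps e ↭ iv +0 N
         perm e st d with distinct-cases (BA.bl e)
         perm e st () | inj₁ _
         ... | inj₂ un with staircase-cases st
         ...   | inj₁ p = p
         ...   | inj₂ (ys , y , zs , p) = ⊥-elim (no-repeat ys (unique-↭ p (P.subst Unique (exps-all e) un)))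
           where no-repeat : ∀ ys → ¬ Unique (ys ++ y ∷ y ∷ zs)
                 no-repeat [] ((ne ∷ _) ∷ _) = ne P.refl
                 no-repeat (_ ∷ ys) (_ ∷ un) = no-repeat ys un

       split : ∀ e → exps e ↭ iv +0 N → fs e ++ ss e ↭ iv +0 N
       split e p = Perm.↭-trans (Perm.↭-sym (exps-parts e)) p

       unique-left : ∀ L {M : List ℤ} → Unique (L ++ M) → Unique L
       unique-left [] _ = []
       unique-left (x ∷ L) (h ∷ un) = AllP.++⁻ˡ L h ∷ unique-left L un

       nonneg-iv : ∀ {L} → L ↭ iv +0 N → All (+0 Z.≤_) L
       nonneg-iv p = PermP.All-resp-↭ (Perm.↭-sym p) (iv-lower +0 +0 N ZP.≤-refl)

       nonneg-exps : ∀ e → All (+0 Z.≤_) (exps e) → All (+0 Z.≤_) (fs e) × All (+0 Z.≤_) (ss e)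
       nonneg-exps e h = AllP.++⁻ˡ (fs e) h' , AllP.++⁻ʳ (fs e) h'
         where h' = PermP.All-resp-↭ (exps-parts e) h

       ν : E → ℤ
       ν e' = lin (λ e → eqL (fs e) (fs e') Z.* κ (fs e) (ss e)) W

       -- A given first block leaves one set M of exponents for the second. Antisymmetry of W in
       -- that block reduces the sum to n! times the term with M in order; its coefficient is c₀
       -- times a sign, and κ supplies the same sign again.
       ν-value : ∀ e' → All (+0 Z.≤_) (fs e') → All (Z._< + N) (fs e') → Unique (fs e') → ν e' ≡ + (n !) Z.* c₀
       ν-value e' nn lt un with complement (fs e') (iv +0 N) un (All.zipWith (λ { {x} (a , b) → ∈-iv +0 N x a (P.subst (x Z.<_) (P.sym (ZP.+-identityˡ (+ N))) b) }) (nn , lt))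
       ... | M , perm = BS.orbit-lin antiS h hσ M unique-M len-M cases ∙ cong (+ (n !) Z.*_) (lin-congAll W-facts point ∙
             lin-scale κ₀ (δE e₀) W ∙ cong (κ₀ Z.*_) (BA.staircase-coefficient antiW inW e₀ in₀) ∙ sq*)
         where
         len-M : length M ≡ n
         len-M = NP.+-cancelˡ-≡ n _ _ (cong (N._+ length M) (P.sym (BF.length-bl e')) ∙ P.sym (LP.length-++ (fs e')) ∙ PermP.↭-length perm ∙ length-iv +0 N)
         nn-M : All (+0 Z.≤_) M
         nn-M = AllP.++⁻ʳ (fs e') (nonneg-iv perm)
         unique-M : Unique M
         unique-M = unique-left M (unique-↭ (Perm.↭-trans (Perm.↭-sym perm) (PermP.++-comm (fs e') M)) BA.ρ-unique)
         κ₀ = κ (fs e') M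
         e₁ e₀ : E
         e₁ = BF.put zeroExp (fs e')
         e₀ = BS.put e₁ M
         fs₀ : fs e₀ ≡ fs e'
         fs₀ = fs-put e₁ M len-M ∙ BF.bl-put zeroExp (fs e') (BF.length-bl e')
         ss₀ : ss e₀ ≡ M
         ss₀ = BS.bl-put e₁ M len-M
         perm₀ : exps e₀ ↭ iv +0 N
         perm₀ = Perm.↭-trans (exps-parts e₀) (Perm.↭-trans (Perm.↭-reflexive (cong₂ _++_ fs₀ ss₀)) perm)
         st₀ : Staircase N (exps e₀)
         st₀ = length-exps e₀ , nonneg-iv perm₀ , Σℤ-↭ perm₀
         in₀ : BA.InBlock e₀
         in₀ = inBlock-all e₀ P.refl st₀
         κ₀-sg : κ₀ ≡ sg (exps e₀)
         κ₀-sg = P.sym (cong₂ κ fs₀ ss₀) ∙ κ-exps e₀ ∙ sgS-staircase {exps e₀} (proj₂ (proj₂ st₀))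
         sg-square : sg (exps e₀) Z.* sg (exps e₀) ≡ + 1
         sg-square = sg-square-↭ perm₀
         sq* : κ₀ Z.* (c₀ Z.* sg (BA.bl e₀)) ≡ c₀
         sq* = cong₂ (λ a L → a Z.* (c₀ Z.* sg L)) κ₀-sg (exps-all e₀) ∙ aux (sg (exps e₀)) c₀ ∙ cong (c₀ Z.*_) sg-square ∙ ZP.*-identityʳ c₀
           where aux = ring45
         h : E → ℤ
         h e = eqL (fs e) (fs e') Z.* κ (fs e) (ss e)
         antiS : BS.Antisym W
         antiS k l = antiW (sS N.+ k) (BS.index-< l)
         hσ : ∀ k e → suc k N.< n → h (σ (sS N.+ k) e) ≡ Z.- h e
         hσ k e l = cong₂ (λ L M → eqL L (fs e') Z.* κ L M) (fs-σS k e l) (BS.bl-σ e k l) ∙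
           cong (eqL (fs e) (fs e') Z.*_) (κ-antiS k (fs e) (ss e) (BF.length-bl e) (BS.length-bl e) l) ∙ P.sym (ZP.neg-distribʳ-* (eqL (fs e) (fs e')) (κ (fs e) (ss e)))
         cases : All (λ t → h (proj₁ t) ≡ +0 ⊎ ss (proj₁ t) ↭ M) W
         cases = All.map (λ { {e , _} (_ , st) → one e st }) W-facts
           where
           one : ∀ e → Staircase N (exps e) → h e ≡ +0 ⊎ ss e ↭ M
           one e (_ , nn' , _) with LP.≡-dec Z._≟_ (fs e) (fs e')
           ... | no ne = inj₁ (cong (Z._* κ (fs e) (ss e)) (eqL-≢ (fs e) (fs e') (BF.length-bl e ∙ P.sym (BF.length-bl e')) ne))
           ... | yes eq with κ (fs e) (ss e) Z.≟ +0
           ...   | yes z = inj₁ (cong (eqL (fs e) (fs e') Z.*_) z ∙ ZP.*-zeroʳ (eqL (fs e) (fs e')))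
           ...   | no nz = inj₂ (cancelˡ-↭ (fs e) (Perm.↭-trans (κ-perm (fs e) (ss e) (BF.length-bl e) (BS.length-bl e) (proj₁ (nonneg-exps e nn')) (proj₂ (nonneg-exps e nn')) nz)
                     (Perm.↭-trans (Perm.↭-sym perm) (Perm.↭-reflexive (cong (_++ M) (P.sym eq))))))
         point : ∀ e c → qtE e ≡ zeroExp × Staircase N (exps e) → eqL M (ss e) Z.* h e ≡ κ₀ Z.* δE e₀ e
         point e _ (z , _) with e₀ ≟E e
         ... | yes P.refl = cong₂ (λ L I → eqL M I Z.* (eqL L (fs e') Z.* κ L I)) fs₀ ss₀ ∙ cong₂ (λ x y → x Z.* (y Z.* κ₀)) (eqL-self M) (eqL-self (fs e')) ∙
             aux κ₀ ∙ cong (κ₀ Z.*_) (P.sym (δE-refl e₀))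
           where aux = ring46
         ... | no ne with LP.≡-dec Z._≟_ M (ss e) | LP.≡-dec Z._≟_ (fs e) (fs e')
         ...   | no h₁ | _ = cong (Z._* h e) (eqL-≢ M (ss e) (len-M ∙ P.sym (BS.length-bl e)) h₁) ∙ P.sym (cong (κ₀ Z.*_) (δE-≢ ne) ∙ ZP.*-zeroʳ κ₀)
         ...   | yes _ | no h₂ = cong (λ x → eqL M (ss e) Z.* (x Z.* κ (fs e) (ss e))) (eqL-≢ (fs e) (fs e') (BF.length-bl e ∙ P.sym (BF.length-bl e')) h₂) ∙
                   ZP.*-zeroʳ (eqL M (ss e)) ∙ P.sym (cong (κ₀ Z.*_) (δE-≢ ne) ∙ ZP.*-zeroʳ κ₀)
         ...   | yes h₁ | yes h₂ = ⊥-elim (ne (recon e₀ e P.refl z (fs₀ ∙ P.sym h₂) (ss₀ ∙ h₁)))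

     -- For a fixed term of W, κ sees only terms of p whose first block rearranges that of W, and
     -- `orbit-lin` keeps those with equal exponents. The spectator then rebuilds the term of p, and
     -- collecting by terms of p leaves the weight ν.
     reproduce : ∀ {p} → Representable p → contract p W ≈ cst factor * p
     reproduce {p} (antiF , hp) .app f = lin-contract f p W ∙ app (BA.antisym-distinct antiW) inner ∙ lin-congAll W'-facts inner-value ∙
         lin-scale (+ (n !)) _ W' ∙ cong (+ (n !) Z.*_) (lin-swap (λ e e' → eqL (fs e) (fs e') Z.* (κ (fs e) (ss e) Z.* f e')) W' p ∙ lin-cong collect p ∙ app (BF.antisym-distinct antiF) _ ∙
           lin-congAll p'-facts (λ { e' _ (nn , lt , un) → cong (f e' Z.*_) (ν-value e' nn lt un) }) ∙ P.sym (app (BF.antisym-distinct antiF) _) ∙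
             lin-cong (λ e' → ZP.*-comm (f e') (+ (n !) Z.* c₀)) p ∙ lin-scale (+ (n !) Z.* c₀) f p) ∙ P.sym (ZP.*-assoc (+ (n !)) (+ (n !) Z.* c₀) (lin f p)) ∙ P.sym cst-lin
       where
       inner : E → ℤ
       inner e = lin (λ e' → κ (fs e') (ss e) Z.* f (qtE e' ⊕ mF e)) p
       inner-value : ∀ e c → qtE e ≡ zeroExp × exps e ↭ iv +0 N → inner e ≡ + (n !) Z.* lin (λ e' → eqL (fs e) (fs e') Z.* (κ (fs e) (ss e) Z.* f e')) p
       inner-value e _ (z , perm) = BF.orbit-lin antiF (λ e' → κ (fs e') (ss e) Z.* f (qtE e' ⊕ mF e))
           (λ k e' l → cong₂ (λ L q → κ L (ss e) Z.* f (q ⊕ mF e)) (BF.bl-σ e' k l) (qtE-σ (sF N.+ k) e') ∙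
              cong (Z._* f (qtE e' ⊕ mF e)) (κ-antiF k (fs e') (ss e) (BF.length-bl e') l) ∙ P.sym (ZP.neg-distribˡ-* (κ (fs e') (ss e)) _))
           (fs e) (unique-left (fs e) (unique-↭ (Perm.↭-sym (split e perm)) BA.ρ-unique)) (BF.length-bl e) (All.map (λ { {e' , _} (_ , nn , _) → one e' nn }) hp) ∙
         cong (+ (n !) Z.*_) (lin-congAll hp (λ { e' _ (me , _) → point e' me }))
         where
         one : ∀ e' → All (+0 Z.≤_) (fs e') → κ (fs e') (ss e) Z.* f (qtE e' ⊕ mF e) ≡ +0 ⊎ fs e' ↭ fs e
         one e' nn with κ (fs e') (ss e) Z.≟ +0
         ... | yes z = inj₁ (cong (Z._* f (qtE e' ⊕ mF e)) z)
         ... | no nz = inj₂ (cancelʳ-↭ (ss e) (Perm.↭-trans (κ-perm (fs e') (ss e) (BF.length-bl e') (BS.length-bl e) nn (proj₂ (nonneg-exps e (nonneg-iv perm))) nz) (Perm.↭-sym (split e perm))))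
         point : ∀ e' → mF e' ≡ e' → eqL (fs e) (fs e') Z.* (κ (fs e') (ss e) Z.* f (qtE e' ⊕ mF e)) ≡ eqL (fs e) (fs e') Z.* (κ (fs e) (ss e) Z.* f e')
         point e' me with LP.≡-dec Z._≟_ (fs e) (fs e')
         ... | yes eq = cong₂ (λ L y → eqL (fs e) (fs e') Z.* (κ L (ss e) Z.* f y)) (P.sym eq) (mF-build e e' z eq me)
         ... | no ne rewrite eqL-≢ (fs e) (fs e') (BF.length-bl e ∙ P.sym (BF.length-bl e')) ne = P.refl
       collect : ∀ e' → lin (λ e → eqL (fs e) (fs e') Z.* (κ (fs e) (ss e) Z.* f e')) W' ≡ f e' Z.* ν e'
       collect e' = lin-cong (λ e → ring47 (eqL (fs e) (fs e')) (κ (fs e) (ss e)) (f e')) W' ∙ lin-scale (f e') _ W' ∙ cong (f e' Z.*_) (P.sym (app (BA.antisym-distinct antiW) _))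
       p'-facts : All (λ t → All (+0 Z.≤_) (fs (proj₁ t)) × All (Z._< + N) (fs (proj₁ t)) × Unique (fs (proj₁ t))) (keep BF.distinct? p)
       p'-facts = All.map (λ { {e , _} ((_ , nn , lt) , d) → nn , lt , un e d }) (all-keep BF.distinct? hp)
         where
         un : ∀ e → BF.distinct? e ≡ true → Unique (fs e)
         un e d with distinct-cases (BF.bl e)
         un e () | inj₁ _
         ... | inj₂ v = v
       cst-lin : lin f (cst factor * p) ≡ factor Z.* lin f p
       cst-lin = lin-mulP f (cst factor) p ∙ lin-mono (λ e → lin (λ e' → f (e ⊕ e')) p) zeroExp factor ∙ cong (factor Z.*_) (lin-cong (λ e → cong f (⊕-identityˡ e)) p)

 -- The two alphabets
 maskX maskY : ∀ {k} → ℕ → Vec ℤ k → Vec ℤ k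
 maskX m [] = []
 maskX zero v@(_ ∷ _) = 0V
 maskX (suc m) (a ∷ v) = a ∷ maskX m v
 maskY m [] = []
 maskY zero v@(_ ∷ _) = v
 maskY (suc m) (a ∷ v) = +0 ∷ maskY m v

 infixl 6 _⊞_
 _⊞_ : ∀ {k} → Vec ℤ k → Vec ℤ k → Vec ℤ k
 _⊞_ = V.zipWith Z._+_

 maskX-⊞ : ∀ {k} m (v w : Vec ℤ k) → maskX m (v ⊞ w) ≡ maskX m v ⊞ maskX m w
 maskX-⊞ m [] [] = P.refl
 maskX-⊞ zero (a ∷ v) (b ∷ w) = P.sym (zip-0 0V)
 maskX-⊞ (suc m) (a ∷ v) (b ∷ w) = cong (a Z.+ b ∷_) (maskX-⊞ m v w)

 maskY-⊞ : ∀ {k} m (v w : Vec ℤ k) → maskY m (v ⊞ w) ≡ maskY m v ⊞ maskY m w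
 maskY-⊞ m [] [] = P.refl
 maskY-⊞ zero (a ∷ v) (b ∷ w) = P.refl
 maskY-⊞ (suc m) (a ∷ v) (b ∷ w) = cong (+0 ∷_) (maskY-⊞ m v w)

 maskX-0 : ∀ {k} m → maskX m (0V {k}) ≡ 0V
 maskX-0 {zero} m = P.refl
 maskX-0 {suc k} zero = P.refl
 maskX-0 {suc k} (suc m) = cong (+0 ∷_) (maskX-0 m)

 maskY-0 : ∀ {k} m → maskY m (0V {k}) ≡ 0V
 maskY-0 {zero} m = P.refl
 maskY-0 {suc k} zero = P.refl
 maskY-0 {suc k} (suc m) = cong (+0 ∷_) (maskY-0 m)

 maskX-maskY : ∀ {k} m (v : Vec ℤ k) → maskX m (maskY m v) ≡ 0V
 maskX-maskY m [] = P.refl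
 maskX-maskY zero (a ∷ v) = P.refl
 maskX-maskY (suc m) (a ∷ v) = cong (+0 ∷_) (maskX-maskY m v)

 maskY-maskX : ∀ {k} m (v : Vec ℤ k) → maskY m (maskX m v) ≡ 0V
 maskY-maskX m [] = P.refl
 maskY-maskX zero (a ∷ v) = P.refl
 maskY-maskX (suc m) (a ∷ v) = cong (+0 ∷_) (maskY-maskX m v)

 toList-0⊞ : ∀ {k} (v : Vec ℤ k) → toList (0V ⊞ v) ≡ toList v
 toList-0⊞ v = cong toList (zip-0 v)

 drop-maskX : ∀ {k} m (v w : Vec ℤ k) → L.drop m (toList (maskX m v ⊞ w)) ≡ L.drop m (toList w)
 drop-maskX zero [] [] = P.refl
 drop-maskX (suc m) [] [] = P.refl
 drop-maskX zero (a ∷ v) (b ∷ w) = toList-0⊞ (b ∷ w)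
 drop-maskX (suc m) (a ∷ v) (b ∷ w) = drop-maskX m v w

 take-maskY : ∀ {k} m (v w : Vec ℤ k) → L.take m (toList (maskY m v ⊞ w)) ≡ L.take m (toList w)
 take-maskY zero v w = P.refl
 take-maskY (suc m) [] [] = P.refl
 take-maskY (suc m) (a ∷ v) (b ∷ w) = cong₂ _∷_ (ZP.+-identityˡ b) (take-maskY m v w)

 vl-[] : ∀ k → vl k [] ≡ 0V
 vl-[] zero = P.refl
 vl-[] (suc k) = cong (+0 ∷_) (vl-[] k)

 maskX-vl : ∀ {k} m (v : Vec ℤ k) → maskX m v ≡ vl k (L.take m (toList v))
 maskX-vl m [] = P.refl
 maskX-vl {suc k} zero (a ∷ v) = P.sym (vl-[] (suc k))
 maskX-vl (suc m) (a ∷ v) = cong (a ∷_) (maskX-vl m v)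

 maskY-vl : ∀ {k} m (v : Vec ℤ k) → maskY m v ≡ vl k (replicate m +0 ++ L.drop m (toList v))
 maskY-vl m [] = P.refl
 maskY-vl zero (a ∷ v) = P.sym (vl-toList (a ∷ v))
 maskY-vl (suc m) (a ∷ v) = cong (+0 ∷_) (maskY-vl m v)

 getV-maskX : ∀ {k} m i (v : Vec ℤ k) → i N.< m → getV i (maskX m v) ≡ getV i v
 getV-maskX m i [] l = P.refl
 getV-maskX (suc m) zero (a ∷ v) l = P.refl
 getV-maskX (suc m) (suc i) (a ∷ v) (s≤s l) = getV-maskX m i v l

 getV-maskY : ∀ {k} m i (v : Vec ℤ k) → m N.≤ i → getV i (maskY m v) ≡ getV i v
 getV-maskY m i [] l = P.refl
 getV-maskY zero i (a ∷ v) l = P.refl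
 getV-maskY (suc m) (suc i) (a ∷ v) (s≤s l) = getV-maskY m i v l

 qtx qty : E → E
 qtx e = mkX (getE 0 e) (getE 1 e) (maskX n (xs e))
 qty e = mkX (getE 0 e) (getE 1 e) (maskY n (xs e))

 xl yl : E → List ℤ
 xl = BX.bl
 yl = BY.bl

 yl-drop : ∀ e → yl e ≡ L.drop n (exps e)
 yl-drop e = LP.take-all n _ (NP.≤-reflexive (LP.length-drop n (exps e) ∙ cong (N._∸ n) (length-exps e) ∙ NP.m+n∸n≡m n n))

 parts : ∀ e → exps e ≡ xl e ++ yl e
 parts e = P.sym (cong (xl e ++_) (yl-drop e) ∙ LP.take++drop≡id n (exps e))

 exps-⊕ : ∀ a e → exps (a ⊕ e) ≡ toList (xs a ⊞ xs e)
 exps-⊕ (mkE (_ ∷ _ ∷ v)) (mkE (_ ∷ _ ∷ w)) = P.refl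

 xs-⊕ : ∀ a e → xs (a ⊕ e) ≡ xs a ⊞ xs e
 xs-⊕ (mkE (_ ∷ _ ∷ v)) (mkE (_ ∷ _ ∷ w)) = P.refl

 qtx-⊕ : ∀ a e → qtx (a ⊕ e) ≡ qtx a ⊕ qtx e
 qtx-⊕ (mkE (q ∷ t ∷ v)) (mkE (q' ∷ t' ∷ w)) = cong (mkX (q Z.+ q') (t Z.+ t')) (maskX-⊞ n v w)

 qty-⊕ : ∀ a e → qty (a ⊕ e) ≡ qty a ⊕ qty e
 qty-⊕ (mkE (q ∷ t ∷ v)) (mkE (q' ∷ t' ∷ w)) = cong (mkX (q Z.+ q') (t Z.+ t')) (maskY-⊞ n v w)

 yl-⊕ : ∀ a e → qtx a ≡ a → yl (a ⊕ e) ≡ yl e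
 yl-⊕ a e h = cong (L.take n) (cong (L.drop n) (exps-⊕ a e) ∙ cong (λ v → L.drop n (toList (v ⊞ xs e))) (P.sym (cong xs h)) ∙ drop-maskX n (xs a) (xs e))

 xl-⊕ : ∀ a e → qty a ≡ a → xl (a ⊕ e) ≡ xl e
 xl-⊕ a e h = cong (L.take n) (exps-⊕ a e) ∙ cong (λ v → L.take n (toList (v ⊞ xs e))) (P.sym (cong xs h)) ∙ take-maskY n (xs a) (xs e)

 exps-σ : ∀ k e → exps (σ k e) ≡ swapL k (exps e)
 exps-σ k (mkE (q ∷ t ∷ v)) = toList-swapV k v

 xl-σ : ∀ k e → suc k N.< n → xl (σ (n N.+ k) e) ≡ xl e
 xl-σ k e l = cong (L.take n) (exps-σ (n N.+ k) e ∙ cong (swapL (n N.+ k)) (parts e) ∙ swapL-skip n k (xl e) (yl e) (BX.length-bl e)) ∙ take-++ (xl e) _ (BX.length-bl e)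

 yl-σ : ∀ k e → suc k N.< n → yl (σ k e) ≡ yl e
 yl-σ k e l = yl-drop (σ k e) ∙ cong (L.drop n) (exps-σ k e ∙ cong (swapL k) (parts e) ∙ swapL-within k (xl e) (yl e) (P.subst (suc k N.<_) (P.sym (BX.length-bl e)) l)) ∙
   drop-++ (swapL k (xl e)) (yl e) (length-swapL k (xl e) ∙ BX.length-bl e)

 whole : ∀ e → e ≡ lst (getE 0 e) (getE 1 e) (xl e ++ yl e)
 whole e = P.sym (mkX-η e) ∙ cong (mkX (getE 0 e) (getE 1 e)) (P.sym (vl-toList (xs e)) ∙ cong (vl N) (parts e))

 qt-0 : ∀ e → qtE e ≡ zeroExp → getE 0 e ≡ +0 × getE 1 e ≡ +0
 qt-0 e h = cong (getE 0) h , cong (getE 1) h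

 recon-xy : ∀ e e' → qtE e ≡ zeroExp → qtE e' ≡ zeroExp → xl e ≡ xl e' → yl e ≡ yl e' → e ≡ e'
 recon-xy e e' z z' hx hy = whole e ∙ cong₂ (λ a L → mkX (proj₁ a) (proj₂ a) (vl N L)) (cong₂ _,_ (proj₁ (qt-0 e z) ∙ P.sym (proj₁ (qt-0 e' z'))) (proj₂ (qt-0 e z) ∙ P.sym (proj₂ (qt-0 e' z')))) (cong₂ _++_ hx hy) ∙ P.sym (whole e')

 add-qt : ∀ e e' {v} → qtE e ≡ zeroExp → v ≡ xs e' → qtE e' ⊕ mkX (getE 0 e) (getE 1 e) v ≡ e'
 add-qt e (mkE (q ∷ t ∷ w)) z P.refl = cong₂ (λ a b → mkX a b (0V ⊞ w)) (+ˡ q (proj₁ (qt-0 e z)) ∙ ZP.+-identityʳ q) (+ˡ t (proj₂ (qt-0 e z)) ∙ ZP.+-identityʳ t) ∙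
   cong (mkX q t) (zip-0 w)

 sgS-perm : ∀ L → length L ≡ N → All (+0 Z.≤_) L → sgS L ≢ +0 → L ↭ iv +0 N
 sgS-perm L l nn ne = sg-↭ (l , nn , sgS-Σ {L} ne) (λ z → ne (sgS-staircase {L} (sgS-Σ {L} ne) ∙ z))

 sgS-swap-left : ∀ k L M → length L ≡ n → suc k N.< n → sgS (swapL k L ++ M) ≡ Z.- sgS (L ++ M)
 sgS-swap-left k L M l k<n = cong sgS (P.sym (swapL-within k L M (P.subst (suc k N.<_) (P.sym l) k<n))) ∙
   anti-swapL {sgS} sgS-swap k (L ++ M) (P.subst (suc k N.<_) (P.sym (LP.length-++ L)) (NP.<-≤-trans (P.subst (suc k N.<_) (P.sym l) k<n) (NP.m≤m+n (length L) (length M))))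

 sgS-swap-right : ∀ k L M → length L ≡ n → length M ≡ n → suc k N.< n → sgS (L ++ swapL k M) ≡ Z.- sgS (L ++ M)
 sgS-swap-right k L M l m k<n = cong sgS (P.sym (swapL-skip n k L M l)) ∙ anti-swapL {sgS} sgS-swap (n N.+ k) (L ++ M)
   (P.subst₂ N._<_ (NP.+-suc n k) (P.sym (LP.length-++ L ∙ cong₂ N._+_ l m)) (NP.+-monoʳ-< n k<n))

 sideX sideY : SideData
 sideX = record
   { sF = 0 ; sS = n ; hF = n≤N ; hS = NP.≤-refl ; mF = qtx ; mS = qty ; κ = λ L M → sgS (L ++ M)
   ; mF-⊕ = qtx-⊕ ; ss-⊕ = yl-⊕ ; fs-⊕ = xl-⊕
   ; mF-mS = λ e h → cong (mkX (getE 0 e) (getE 1 e)) (cong (maskX n) (P.sym (cong xs h)) ∙ maskX-maskY n (xs e))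
   ; κ-exps = λ e → cong sgS (P.sym (parts e))
   ; κ-antiF = sgS-swap-left
   ; κ-antiS = sgS-swap-right
   ; κ-perm = λ L M l m a b → sgS-perm (L ++ M) (LP.length-++ L ∙ cong₂ N._+_ l m) (AllP.++⁺ a b)
   ; fs-σS = xl-σ
   ; fs-put = λ e M m → cong (L.take n) (BY.exps-put e M m) ∙ take-++ (L.take n (exps e)) _ (BX.length-bl e)
   ; exps-parts = λ e → Perm.↭-reflexive (parts e)
   ; recon = recon-xy
   ; mF-build = λ e e' z h me → add-qt e e' z (maskX-vl n (xs e) ∙ cong (vl N) h ∙ P.sym (maskX-vl n (xs e')) ∙ cong xs me) }
 sideY = record
   -- Although y is now the first block, κ lists the exponents of x before those of y, so both sides
   -- use the same sign.
   { sF = n ; sS = 0 ; hF = NP.≤-refl ; hS = n≤N ; mF = qty ; mS = qtx ; κ = λ L M → sgS (M ++ L)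
   ; mF-⊕ = qty-⊕ ; ss-⊕ = xl-⊕ ; fs-⊕ = yl-⊕
   ; mF-mS = λ e h → cong (mkX (getE 0 e) (getE 1 e)) (cong (maskY n) (P.sym (cong xs h)) ∙ maskY-maskX n (xs e))
   ; κ-exps = λ e → cong sgS (P.sym (parts e))
   ; κ-antiF = λ k L M l k<n → swap-second k L M l k<n
   ; κ-antiS = λ k L M l m k<n → sgS-swap-left k M L m k<n
   ; κ-perm = λ L M l m a b ne → Perm.↭-trans (PermP.++-comm L M) (sgS-perm (M ++ L) (LP.length-++ M ∙ cong₂ N._+_ m l) (AllP.++⁺ b a) ne)
   ; fs-σS = yl-σ
   ; fs-put = λ e M m → cong (L.take n) (cong (L.drop n) (BX.exps-put e M m) ∙ drop-++ M _ m)
   ; exps-parts = λ e → Perm.↭-trans (Perm.↭-reflexive (parts e)) (PermP.++-comm (xl e) (yl e))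
   ; recon = λ e e' z z' hy hx → recon-xy e e' z z' hx hy
   ; mF-build = λ e e' z h me → add-qt e e' z (maskY-vl n (xs e) ∙ cong (λ L → vl N (replicate n +0 ++ L)) (P.sym (yl-drop e) ∙ h ∙ yl-drop e') ∙ P.sym (maskY-vl n (xs e')) ∙ cong xs me) }
   where
   swap-second : ∀ k L M → length L ≡ n → suc k N.< n → sgS (M ++ swapL k L) ≡ Z.- sgS (M ++ L)
   swap-second k L M l k<n with swapL-split k L (P.subst (suc k N.<_) (P.sym l) k<n)
   ... | ys , y , z , zs , P.refl , P.refl = cong (λ r → sgS (M ++ r)) (swapL-mid ys y z zs) ∙
         cong sgS (P.sym (LP.++-assoc M ys (z ∷ y ∷ zs))) ∙ sgS-swap (M ++ ys) z y zs ∙ cong (Z.-_ ∘ sgS) (LP.++-assoc M ys (y ∷ z ∷ zs))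

 upFrom-split : ∀ s k m → upFrom s (k N.+ suc (suc m)) ≡ upFrom s k ++ (s N.+ k) ∷ suc (s N.+ k) ∷ upFrom (2 N.+ s N.+ k) m
 upFrom-split s zero m rewrite NP.+-identityʳ s = P.refl
 upFrom-split s (suc k) m rewrite NP.+-suc s k = cong (s ∷_) (upFrom-split (suc s) k m)

 upFrom-bounds : ∀ s m → All (λ i → s N.≤ i × i N.< s N.+ m) (upFrom s m)
 upFrom-bounds s zero = []
 upFrom-bounds s (suc m) = (NP.≤-refl , NP.m<m+n s (s≤s z≤n)) ∷ All.map (λ { {i} (a , b) → NP.<⇒≤ a , P.subst (i N.<_) (P.sym (NP.+-suc s m)) b }) (upFrom-bounds (suc s) m)

 V-σ : ∀ k p s → suc k N.< N → All (λ i → i ≢ k × i ≢ suc k) (p ++ s) → σP k (V (p ++ k ∷ suc k ∷ s)) ≈ - V (p ++ k ∷ suc k ∷ s)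
 V-σ k p s l h = σH.hom-pairProd k (λ a b → X a - X b) (p ++ k ∷ suc k ∷ s) ◦
     pairProd-congAll (allPairs-of (All.universal (λ _ → P.refl) (p ++ k ∷ suc k ∷ s)) (λ a b (_ : a ≡ a) (_ : b ≡ b) → σH.hom-sub k (X a) (X b))) ◦ go p h
   where
   G = σP k ∘ X
   row : ∀ {f g : ℕ → Poly n} p → All (λ i → f i ≈ g i) (p ++ s) → f k ≈ g (suc k) → f (suc k) ≈ g k → Π (map f (p ++ k ∷ suc k ∷ s)) ≈ Π (map g (p ++ k ∷ suc k ∷ s))
   row [] h a b = *-cong a (*-cong b (Π-congAll h)) ◦ x∙yz≈y∙xz _ _ _
   row (i ∷ p) (h ∷ hs) a b = *-cong h (row p hs a b)
   fixed : ∀ {i} → i ≢ k × i ≢ suc k → G i ≈ X i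
   fixed (a , b) = σ-X-other k _ a b
   go : ∀ p → All (λ i → i ≢ k × i ≢ suc k) (p ++ s) → pairProd (λ a b → G a - G b) (p ++ k ∷ suc k ∷ s) ≈ - V (p ++ k ∷ suc k ∷ s)
   go [] h = *-cong (*-cong (+-cong (σ-X k l) (-‿cong (σ-X' k l))) (Π-congAll (All.map (λ f → +-cong (σ-X k l) (-‿cong (fixed f))) h)))
       (*-cong (Π-congAll (All.map (λ f → +-cong (σ-X' k l) (-‿cong (fixed f))) h)) (pairProd-congAll (allPairs-of h (λ a b f g → +-cong (fixed f) (-‿cong (fixed g)))))) ◦
     solveR 5 (λ a b pa pb v → ((b :- a) :* pb) :* (pa :* v) := :- (((a :- b) :* pa) :* (pb :* v))) refl (X k) (X (suc k)) _ _ _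
   go (i ∷ p) (f ∷ h) = *-cong (row {λ j → G i - G j} {λ j → X i - X j} p (All.map (λ g → +-cong (fixed f) (-‿cong (fixed g))) h)
         (+-cong (fixed f) (-‿cong (σ-X k l))) (+-cong (fixed f) (-‿cong (σ-X' k l)))) (go p h) ◦
     solveR 2 (λ a b → a :* :- b := :- (a :* b)) refl _ _

 V-antisym : ∀ s m (h : s N.+ m N.≤ N) → Block.Antisym s m h (V (upFrom s m))
 V-antisym s m h k l = P.subst (λ L → σP (s N.+ k) (V L) ≈ - V L) (P.sym eq) (V-σ (s N.+ k) (upFrom s k) (upFrom (2 N.+ s N.+ k) m') (Block.index-< s m h l)
     (AllP.++⁺ (All.map (λ { (_ , b) → NP.<⇒≢ b , NP.<⇒≢ (NP.m≤n⇒m≤1+n b) }) (upFrom-bounds s k))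
       (All.map (λ { (a , _) → NP.<⇒≢ (NP.<-trans (NP.n<1+n _) a) ∘ P.sym , NP.<⇒≢ a ∘ P.sym }) (upFrom-bounds (2 N.+ s N.+ k) m'))))
   where
   m' = m N.∸ (2 N.+ k)
   eq : upFrom s m ≡ upFrom s k ++ (s N.+ k) ∷ suc (s N.+ k) ∷ upFrom (2 N.+ s N.+ k) m'
   eq = cong (upFrom s) (P.sym ((NP.+-suc k (suc m') ∙ cong suc (NP.+-suc k m')) ∙ NP.m+[n∸m]≡n l)) ∙ upFrom-split s k m'

 xVars-upFrom : xVars ≡ upFrom 0 n
 xVars-upFrom = upFrom-applyUpTo 0 n

 yVars-upFrom : yVars ≡ upFrom n n
 yVars-upFrom = LP.map-upTo (n N.+_) n ∙ upFrom-applyUpTo n n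

 upFrom-++ : ∀ s a b → upFrom s a ++ upFrom (s N.+ a) b ≡ upFrom s (a N.+ b)
 upFrom-++ s zero b rewrite NP.+-identityʳ s = P.refl
 upFrom-++ s (suc a) b rewrite NP.+-suc s a = cong (s ∷_) (upFrom-++ (suc s) a b)

 allVars-upFrom : allVars ≡ upFrom 0 N
 allVars-upFrom = cong₂ _++_ xVars-upFrom yVars-upFrom ∙ upFrom-++ 0 n n

 Δ-antisym : BX.Antisym Δ
 Δ-antisym = P.subst (λ l → BX.Antisym (V l)) (P.sym xVars-upFrom) (V-antisym 0 n n≤N)

 Δy-antisym : BY.Antisym Δy
 Δy-antisym = P.subst (λ l → BY.Antisym (V l)) (P.sym yVars-upFrom) (V-antisym n n NP.≤-refl)

 W-antisym : BA.Antisym W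
 W-antisym = P.subst (λ l → BA.Antisym (V l)) (P.sym allVars-upFrom) (V-antisym 0 N NP.≤-refl)

 -- Supports of Vandermonde products
 opaque
   unfolding addP mapE

   all-* : {P Q R : E → Set} → (∀ {e e'} → P e → Q e' → R (e ⊕ e')) → ∀ {p r} → All (P ∘ proj₁) p → All (Q ∘ proj₁) r → All (R ∘ proj₁) (p * r)
   all-* h [] _ = []
   all-* {P} {Q} {R} h {(e , c) ∷ p} (x ∷ xs) ys = AllP.++⁺ (row ys) (all-* {P} {Q} {R} h xs ys)
     where
     row : ∀ {r} → All (Q ∘ proj₁) r → All (R ∘ proj₁) (map (λ { (e' , c') → (mkE (V.zipWith Z._+_ (vec e) (vec e')) , c Z.* c') }) r)
     row [] = []
     row (y ∷ ys) = h x y ∷ row ys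

   all-+ : {P : E × ℤ → Set} → ∀ {p r} → All P p → All P r → All P (p + r)
   all-+ = AllP.++⁺

   all-neg : {P : E → Set} → ∀ {p} → All (P ∘ proj₁) p → All (P ∘ proj₁) (- p)
   all-neg [] = []
   all-neg (x ∷ xs) = x ∷ all-neg xs

   all-mapE : {P Q : E → Set} {φ : E → E} → (∀ {e} → P e → Q (φ e)) → ∀ {p} → All (P ∘ proj₁) p → All (Q ∘ proj₁) (mapE φ p)
   all-mapE h [] = []
   all-mapE h (x ∷ xs) = h x ∷ all-mapE h xs

 all-ΣL : {A : Set} {P : E × ℤ → Set} {f : A → Poly n} (l : List A) → (∀ a → a ∈ l → All P (f a)) → All P (ΣL l f)
 all-ΣL [] h = []
 all-ΣL (a ∷ l) h = all-+ (h a (here P.refl)) (all-ΣL l (λ b m → h b (there m)))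

 -- Predicates on exponents that are preserved by products, graded by the total degree.
 record GradedPred : Set₁ where
   field
     R : ℤ → E → Set
     R-⊕ : ∀ {d d' e e'} → R d e → R d' e' → R (d Z.+ d') (e ⊕ e')
     R-0 : R +0 zeroExp

   all-V : ∀ l → All (λ a → R (+ 1) (xE a)) l → All (R (Σℤ (iv +0 (length l))) ∘ proj₁) (V l)
   all-V [] _ = R-0 ∷ []
   all-V (a ∷ l) (ha ∷ hl) = P.subst (λ d → All (R d ∘ proj₁) (V (a ∷ l))) (ZP.+-comm (+ length l) (Σℤ (iv +0 (length l))) ∙ P.sym (Σℤ-iv-suc +0 (length l) ∙ +ˡ (Σℤ (iv +0 (length l))) (ZP.+-identityˡ (+ length l))))
       (all-* {R (+ length l)} {R _} {R _} R-⊕ (row l hl) (all-V l hl))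
     where
     row : ∀ l → All (λ a → R (+ 1) (xE a)) l → All (R (+ length l) ∘ proj₁) (Π (map (λ b → X a - X b) l))
     row [] _ = R-0 ∷ []
     row (b ∷ l) (hb ∷ h) = all-* {R (+ 1)} {R (+ length l)} {R _} R-⊕ (all-+ (ha ∷ []) (all-neg {R (+ 1)} (hb ∷ []))) (row l h)

 NonNeg : E → Set
 NonNeg e = All (+0 Z.≤_) (exps e)

 nonneg-⊞ : ∀ {k} (v w : Vec ℤ k) → All (+0 Z.≤_) (toList v) → All (+0 Z.≤_) (toList w) → All (+0 Z.≤_) (toList (v ⊞ w))
 nonneg-⊞ [] [] _ _ = []
 nonneg-⊞ (a ∷ v) (b ∷ w) (x ∷ xs) (y ∷ ys) = ZP.+-mono-≤ x y ∷ nonneg-⊞ v w xs ys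

 nonneg-⊕ : ∀ e e' → NonNeg e → NonNeg e' → NonNeg (e ⊕ e')
 nonneg-⊕ e e' a b = P.subst (All (+0 Z.≤_)) (P.sym (exps-⊕ e e')) (nonneg-⊞ (xs e) (xs e') a b)

 Σ-⊞ : ∀ {k} (v w : Vec ℤ k) → Σℤ (toList (v ⊞ w)) ≡ Σℤ (toList v) Z.+ Σℤ (toList w)
 Σ-⊞ [] [] = P.refl
 Σ-⊞ (a ∷ v) (b ∷ w) = +ˡ (a Z.+ b) (Σ-⊞ v w) ∙ ring48 a b _ _

 Σ-⊕ : ∀ e e' → Σℤ (exps (e ⊕ e')) ≡ Σℤ (exps e) Z.+ Σℤ (exps e')
 Σ-⊕ e e' = cong Σℤ (exps-⊕ e e') ∙ Σ-⊞ (xs e) (xs e')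

 zeros : ∀ k → All (_≡ +0) (toList (0V {k}))
 zeros zero = []
 zeros (suc k) = P.refl ∷ zeros k

 Σ-zeros : ∀ {L} → All (_≡ +0) L → Σℤ L ≡ +0
 Σ-zeros [] = P.refl
 Σ-zeros (P.refl ∷ h) = ZP.+-identityˡ _ ∙ Σ-zeros h

 unit-nonneg : ∀ {k} i → All (+0 Z.≤_) (toList (setV i (+ 1) (0V {k})))
 unit-nonneg {zero} i = []
 unit-nonneg {suc k} zero = Z.+≤+ z≤n ∷ All.map (λ { P.refl → ZP.≤-refl }) (zeros k)
 unit-nonneg {suc k} (suc i) = ZP.≤-refl ∷ unit-nonneg {k} i

 unit-Σ : ∀ {k} i → i N.< k → Σℤ (toList (setV i (+ 1) (0V {k}))) ≡ + 1
 unit-Σ {suc k} zero _ = +ˡ (+ 1) (Σ-zeros (zeros k))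
 unit-Σ {suc k} (suc i) (s≤s l) = ZP.+-identityˡ _ ∙ unit-Σ i l

 graded : (M : E → Set) → (∀ {e e'} → M e → M e' → M (e ⊕ e')) → M zeroExp → GradedPred
 graded M M-⊕ M-0 = record
   { R = λ d e → qtE e ≡ zeroExp × M e × NonNeg e × Σℤ (exps e) ≡ d
   ; R-⊕ = λ { {d} {d'} {e} {e'} (z , m , nn , s) (z' , m' , nn' , s') → (qtE-⊕ e e' ∙ cong₂ _⊕_ z z' ∙ ⊕-identityˡ zeroExp) , M-⊕ m m' , nonneg-⊕ e e' nn nn' , (Σ-⊕ e e' ∙ cong₂ Z._+_ s s') }
   ; R-0 = P.refl , M-0 , All.map (λ { P.refl → ZP.≤-refl }) (zeros N) , Σ-zeros (zeros N) }

 XOnly YOnly : E → Set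
 XOnly e = maskX n (xs e) ≡ xs e
 YOnly e = maskY n (xs e) ≡ xs e

 xOnly-⊕ : ∀ {e e'} → XOnly e → XOnly e' → XOnly (e ⊕ e')
 xOnly-⊕ {e} {e'} h h' = cong (maskX n) (xs-⊕ e e') ∙ maskX-⊞ n (xs e) (xs e') ∙ cong₂ _⊞_ h h' ∙ P.sym (xs-⊕ e e')

 yOnly-⊕ : ∀ {e e'} → YOnly e → YOnly e' → YOnly (e ⊕ e')
 yOnly-⊕ {e} {e'} h h' = cong (maskY n) (xs-⊕ e e') ∙ maskY-⊞ n (xs e) (xs e') ∙ cong₂ _⊞_ h h' ∙ P.sym (xs-⊕ e e')

 maskX-unit : ∀ {k} m i → i N.< m → maskX m (setV i (+ 1) (0V {k})) ≡ setV i (+ 1) 0V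
 maskX-unit {zero} m i _ = P.refl
 maskX-unit {suc k} (suc m) zero _ = cong (+ 1 ∷_) (maskX-0 m)
 maskX-unit {suc k} (suc m) (suc i) (s≤s l) = cong (+0 ∷_) (maskX-unit {k} m i l)

 maskY-unit : ∀ {k} m i → m N.≤ i → maskY m (setV i (+ 1) (0V {k})) ≡ setV i (+ 1) 0V
 maskY-unit {zero} m i _ = P.refl
 maskY-unit {suc k} zero zero _ = P.refl
 maskY-unit {suc k} zero (suc i) _ = P.refl
 maskY-unit {suc k} (suc m) (suc i) (s≤s l) = cong (+0 ∷_) (maskY-unit {k} m i l)

 inX : ∀ e → XOnly e → yl e ≡ L.drop n (exps zeroExp)
 inX e h = yl-drop e ∙ cong (L.drop n ∘ toList) (P.sym h ∙ P.sym (zip-0 (maskX n (xs e))) ∙ VP.zipWith-comm ZP.+-comm 0V (maskX n (xs e))) ∙ drop-maskX n (xs e) 0V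

 inY : ∀ e → YOnly e → xl e ≡ L.take n (exps zeroExp)
 inY e h = cong (L.take n ∘ toList) (P.sym h ∙ P.sym (zip-0 (maskY n (xs e))) ∙ VP.zipWith-comm ZP.+-comm 0V (maskY n (xs e))) ∙ take-maskY n (xs e) 0V

 whole-0 : ∀ e → qtE e ≡ zeroExp → e ≡ lst +0 +0 (xl e ++ yl e)
 whole-0 e z = whole e ∙ cong₂ (λ a b → lst a b (xl e ++ yl e)) (proj₁ (qt-0 e z)) (proj₂ (qt-0 e z))

 Σ-parts : ∀ e → Σℤ (exps e) ≡ Σℤ (xl e) Z.+ Σℤ (yl e)
 Σ-parts e = cong Σℤ (parts e) ∙ go (xl e)
   where go : ∀ L → Σℤ (L ++ yl e) ≡ Σℤ L Z.+ Σℤ (yl e)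
         go [] = P.sym (ZP.+-identityˡ _)
         go (x ∷ L) = +ˡ x (go L) ∙ P.sym (ZP.+-assoc x (Σℤ L) _)

 nonneg-xl : ∀ e → NonNeg e → All (+0 Z.≤_) (xl e)
 nonneg-xl e = AllP.take⁺ n

 nonneg-yl : ∀ e → NonNeg e → All (+0 Z.≤_) (yl e)
 nonneg-yl e h = P.subst (All (+0 Z.≤_)) (P.sym (yl-drop e)) (AllP.drop⁺ n h)

 module GX = GradedPred (graded XOnly (λ {e} {e'} → xOnly-⊕ {e} {e'}) (maskX-0 n))
 module GY = GradedPred (graded YOnly (λ {e} {e'} → yOnly-⊕ {e} {e'}) (maskY-0 n))
 module GA = GradedPred (graded (λ _ → ⊤) (λ _ _ → tt) tt)

 Δ-graded : All (GX.R (Σℤ (iv +0 n)) ∘ proj₁) Δ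
 Δ-graded = P.subst (λ m → All (GX.R (Σℤ (iv +0 m)) ∘ proj₁) Δ) (LP.length-upTo n)
   (GX.all-V xVars (All.map (λ {a} l → P.refl , maskX-unit n a l , unit-nonneg a , unit-Σ a (NP.<-≤-trans l n≤N)) xVars-<))

 Δy-graded : All (GY.R (Σℤ (iv +0 n)) ∘ proj₁) Δy
 Δy-graded = P.subst (λ m → All (GY.R (Σℤ (iv +0 m)) ∘ proj₁) Δy) (LP.length-map (n N.+_) (upTo n) ∙ LP.length-upTo n)
   (GY.all-V yVars (All.zipWith (λ { {a} (l , b) → P.refl , maskY-unit n a l , unit-nonneg a , unit-Σ a b }) (yVars-≥ , yVars-<N)))

 Δ-inBlock : All (BX.InBlock ∘ proj₁) Δ
 Δ-inBlock = All.map (λ { {e , _} h → go e h }) Δ-graded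
   where
   go : ∀ e → GX.R (Σℤ (iv +0 n)) e → BX.InBlock e
   go e (z , m , nn , s) = (whole-0 e z ∙ cong (λ r → lst +0 +0 (xl e ++ r)) (inX e m)) ,
     BX.length-bl e , nonneg-xl e nn , (P.sym (Σ-parts e ∙ +ˡ (Σℤ (xl e)) (cong Σℤ (inX e m) ∙ Σ-zeros (AllP.drop⁺ n (zeros N))) ∙ ZP.+-identityʳ _) ∙ s)

 Δy-inBlock : All (BY.InBlock ∘ proj₁) Δy
 Δy-inBlock = All.map (λ { {e , _} h → go e h }) Δy-graded
   where
   go : ∀ e → GY.R (Σℤ (iv +0 n)) e → BY.InBlock e
   go e (z , m , nn , s) = (whole-0 e z ∙ cong (lst +0 +0) (cong₂ _++_ (inY e m) (P.sym (LP.++-identityʳ (yl e)) ∙ cong (yl e ++_) (P.sym (LP.drop-all N (exps zeroExp) (NP.≤-reflexive (length-exps zeroExp))))))) ,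
     BY.length-bl e , nonneg-yl e nn , (P.sym (Σ-parts e ∙ cong (Z._+ Σℤ (yl e)) (cong Σℤ (inY e m) ∙ Σ-zeros (AllP.take⁺ n (zeros N))) ∙ ZP.+-identityˡ _) ∙ s)

 W-inBlock : All (BA.InBlock ∘ proj₁) W
 W-inBlock = All.map (λ { {e , _} (z , _ , nn , s) → inBlock-all e z (length-exps e , nn , s) })
   (P.subst (λ m → All (GA.R (Σℤ (iv +0 m)) ∘ proj₁) W) (cong length allVars-upFrom ∙ length-upFrom 0 N)
     (GA.all-V allVars (All.map (λ {a} l → P.refl , tt , unit-nonneg a , unit-Σ a l) allVars-<N)))

 -- Degrees in a single variable

 module _ (i : ℕ) where
   private module Cᵢ = Coord (2 N.+ i)

   top-X : ∀ a → Cᵢ.Top (+ 1) (X a)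
   top-X a with i N.≟ a
   ... | no ne = ZP.≤-trans (ZP.≤-reflexive (getX-other i a ne)) (Z.+≤+ z≤n) ∷ []
   ... | yes P.refl with i N.<? N
   ...   | yes l = ZP.≤-reflexive (getX-self i l) ∷ []
   ...   | no ge = ZP.≤-trans (ZP.≤-reflexive (beyond (V.replicate N +0) (NP.≮⇒≥ ge))) (Z.+≤+ z≤n) ∷ []
     where beyond : ∀ {m i} (v : Vec ℤ m) → m N.≤ i → getV i (setV i (+ 1) v) ≡ +0
           beyond {zero} {zero} [] _ = P.refl
           beyond {zero} {suc i} [] _ = P.refl
           beyond {suc m} {suc i} (x ∷ v) (s≤s l) = beyond v l

   top-X-other : ∀ {a} → i ≢ a → Cᵢ.Top +0 (X a)
   top-X-other {a} ne = ZP.≤-reflexive (getX-other i a ne) ∷ []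

   row : ℕ → List ℕ → Poly n
   row a l = Π (map (λ b → X a - X b) l)

   top-1 : Cᵢ.Top +0 1#
   top-1 = ZP.≤-reflexive (getV-0 N i) ∷ []

   row-absent : ∀ a l → i ≢ a → All (i ≢_) l → Cᵢ.Top +0 (row a l)
   row-absent a [] _ _ = top-1
   row-absent a (b ∷ l) ne (ne' ∷ h) = Cᵢ.top-* (Cᵢ.top-+ (top-X-other ne) (Cᵢ.top-neg (top-X-other ne'))) (row-absent a l ne h)

   row-one : ∀ a l → i ≢ a → Unique l → Cᵢ.Top (+ 1) (row a l)
   row-one a [] _ _ = Cᵢ.top-weaken (Z.+≤+ z≤n) top-1
   row-one a (b ∷ l) ne (h ∷ un) with i N.≟ b
   ... | yes P.refl = Cᵢ.top-* (Cᵢ.top-+ (Cᵢ.top-weaken (Z.+≤+ z≤n) (top-X-other ne)) (Cᵢ.top-neg (top-X b))) (row-absent a l ne h)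
   ... | no ne' = Cᵢ.top-* (Cᵢ.top-+ (top-X-other ne) (Cᵢ.top-neg (top-X-other ne'))) (row-one a l ne un)

   row-any : ∀ a l → Cᵢ.Top (+ length l) (row a l)
   row-any a [] = top-1
   row-any a (b ∷ l) = Cᵢ.top-* (Cᵢ.top-+ (top-X a) (Cᵢ.top-neg (top-X b))) (row-any a l)

   V-absent : ∀ l → All (i ≢_) l → Cᵢ.Top +0 (V l)
   V-absent [] _ = top-1
   V-absent (a ∷ l) (ne ∷ h) = Cᵢ.top-* (row-absent a l ne h) (V-absent l h)

   -- A variable meets each other one in a single factor. The resulting bound keeps the exponents of
   -- Δ J below 2n, as reproduction by W requires.
   V-top : ∀ l → Unique l → Cᵢ.Top (+ (length l N.∸ 1)) (V l)
   V-top [] _ = top-1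
   V-top (a ∷ []) _ = Cᵢ.top-* {+0} {+0} top-1 top-1
   V-top (a ∷ l@(b ∷ l')) (h ∷ un) with i N.≟ a
   ... | yes P.refl = P.subst (λ g → Cᵢ.Top g (V (i ∷ l))) (ZP.+-identityʳ _) (Cᵢ.top-* (row-any i l) (V-absent l h))
   ... | no ne = Cᵢ.top-* (row-one a l ne un) (V-top l un)

 all-toList : ∀ {Q : ℤ → Set} {k} (v : Vec ℤ k) → (∀ i → i N.< k → Q (getV i v)) → All Q (toList v)
 all-toList [] h = []
 all-toList (a ∷ v) h = h 0 (s≤s z≤n) ∷ all-toList v (λ i l → h (suc i) (s≤s l))

 all-bounded : ∀ {p} (g : ℤ) → g Z.< + N → (∀ i → Coord.Top (2 N.+ i) g p) → All (λ t → All (Z._< + N) (exps (proj₁ t))) p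
 all-bounded {p} g g<N h = All.tabulate (λ {t} m → all-toList (xs (proj₁ t)) (λ i _ → ZP.≤-<-trans (P.subst (Z._≤ g) (getE-xs i (proj₁ t)) (All.lookup (h i) m)) g<N))
   where getE-xs : ∀ i e → getE (2 N.+ i) e ≡ getV i (xs e)
         getE-xs i (mkE (_ ∷ _ ∷ v)) = P.refl

 regular-cst : ∀ k → k ≢ +0 → Regular (cst k)
 regular-cst k ne r h .app f with ZP.i*j≡0⇒i≡0∨j≡0 k {lin f r} (P.sym (lin-mulP f (cst k) r ∙ lin-mono (λ e → lin (λ e' → f (e ⊕ e')) r) zeroExp k ∙ cong (k Z.*_) (lin-cong (λ e → cong f (⊕-identityˡ e)) r)) ∙ app h f)
 ... | inj₁ z = ⊥-elim (ne z)
 ... | inj₂ z = z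

 module SX = Side sideX
 module SY = Side sideY
 module RX = SX.Reproduce W-antisym W-inBlock
 module RY = SY.Reproduce W-antisym W-inBlock

 regular-factor : Regular (cst RX.factor)
 regular-factor = regular-cst _ λ z → case ZP.i*j≡0⇒i≡0∨j≡0 (+ (n !)) {+ (n !) Z.* RX.c₀} z of λ
   { (inj₁ e) → fact e
   ; (inj₂ z') → case ZP.i*j≡0⇒i≡0∨j≡0 (+ (n !)) {RX.c₀} z' of λ
       { (inj₁ e) → fact e
       ; (inj₂ e) → BA.ρ-coefficient-≢0 W-antisym W-inBlock (regular-V allVars allVars-<N allVars-unique) e } }
   where fact : + (n !) ≢ +0
         fact e = N.≢-nonZero⁻¹ (n !) {{n NP.!≢0}} (ZP.+-injective e)

 -- One contraction uses up the y of G and carries its x along, the other does the opposite; in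
 -- either order both alphabets are used up once, by the same double sum.
 contract-exchange : ∀ p r G → SX.contract p (SY.contract r G) ≈ SY.contract r (SX.contract p G)
 contract-exchange p r G .app f = SX.lin-contract f p (SY.contract r G) ∙ SY.lin-contract _ r G ∙
   lin-cong (λ e → lin-cong (λ e″ → P.sym (lin-scale (sgS (xl e ++ yl e″)) _ p)) r ∙ lin-swap (λ e″ e' → sgS (xl e ++ yl e″) Z.* (sgS (xl e' ++ yl (qtE e″ ⊕ qty e)) Z.* f (qtE e' ⊕ qtx (qtE e″ ⊕ qty e)))) r p ∙
      lin-cong (λ e' → lin-cong (λ e″ → point e e' e″) r ∙ lin-scale (sgS (xl e' ++ yl e)) _ r) p) G ∙
   P.sym (SY.lin-contract f r (SX.contract p G) ∙ SX.lin-contract _ p G)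
   where
   yl-qty : ∀ e e″ → yl (qtE e″ ⊕ qty e) ≡ yl e
   yl-qty e e″ = yl-⊕ (qtE e″) (qty e) (cong (mkX (getE 0 e″) (getE 1 e″)) (maskX-0 n)) ∙ yl-drop (qty e) ∙ cong (L.drop n) (cong toList (maskY-vl n (xs e)) ∙ toList-vl N _ (LP.length-++ (replicate n +0) ∙ cong₂ N._+_ (LP.length-replicate n) (cong length (P.sym (yl-drop e)) ∙ BY.length-bl e))) ∙
     drop-++ (replicate n +0) _ (LP.length-replicate n) ∙ P.sym (yl-drop e)
   xl-qtx : ∀ e e' → xl (qtE e' ⊕ qtx e) ≡ xl e
   xl-qtx e e' = xl-⊕ (qtE e') (qtx e) (cong (mkX (getE 0 e') (getE 1 e')) (maskY-0 n)) ∙ cong (λ v → L.take n (toList v)) (P.sym (zip-0 (maskX n (xs e)))) ∙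
     cong (λ v → L.take n (toList v)) (zip-0 (maskX n (xs e)) ∙ P.refl) ∙ take-mask n (xs e)
     where
     take-mask : ∀ {k} m (v : Vec ℤ k) → L.take m (toList (maskX m v)) ≡ L.take m (toList v)
     take-mask zero v = P.refl
     take-mask (suc m) [] = P.refl
     take-mask (suc m) (a ∷ v) = cong (a ∷_) (take-mask m v)
   qtx-qty : ∀ e e″ → qtx (qtE e″ ⊕ qty e) ≡ qtE e″ ⊕ qtE e
   qtx-qty e e″ = qtx-⊕ (qtE e″) (qty e) ∙ cong₂ (λ v w → mkX (getE 0 e″) (getE 1 e″) v ⊕ mkX (getE 0 e) (getE 1 e) w) (maskX-0 n) (maskX-maskY n (xs e))
   qty-qtx : ∀ e e' → qty (qtE e' ⊕ qtx e) ≡ qtE e' ⊕ qtE e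
   qty-qtx e e' = qty-⊕ (qtE e') (qtx e) ∙ cong₂ (λ v w → mkX (getE 0 e') (getE 1 e') v ⊕ mkX (getE 0 e) (getE 1 e) w) (maskY-0 n) (maskY-maskX n (xs e))
   point : ∀ e e' e″ → sgS (xl e ++ yl e″) Z.* (sgS (xl e' ++ yl (qtE e″ ⊕ qty e)) Z.* f (qtE e' ⊕ qtx (qtE e″ ⊕ qty e)))
     ≡ sgS (xl e' ++ yl e) Z.* (sgS (xl (qtE e' ⊕ qtx e) ++ yl e″) Z.* f (qtE e″ ⊕ qty (qtE e' ⊕ qtx e)))
   point e e' e″ = cong₂ (λ M z → sgS (xl e ++ yl e″) Z.* (sgS (xl e' ++ M) Z.* f z)) (yl-qty e e″) exps-eq ∙
     aux (sgS (xl e ++ yl e″)) (sgS (xl e' ++ yl e)) _ ∙ cong (λ M → sgS (xl e' ++ yl e) Z.* (sgS (M ++ yl e″) Z.* f (qtE e″ ⊕ qty (qtE e' ⊕ qtx e)))) (P.sym (xl-qtx e e'))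
     where
     aux = ring9
     exps-eq : qtE e' ⊕ qtx (qtE e″ ⊕ qty e) ≡ qtE e″ ⊕ qty (qtE e' ⊕ qtx e)
     exps-eq = cong (qtE e' ⊕_) (qtx-qty e e″) ∙ P.sym (⊕-assoc (qtE e') (qtE e″) (qtE e)) ∙ cong (_⊕ qtE e) (⊕-comm (qtE e') (qtE e″)) ∙
       ⊕-assoc (qtE e″) (qtE e') (qtE e) ∙ cong (qtE e″ ⊕_) (P.sym (qty-qtx e e'))

 -- Adjointness of the two operators
 qtx-of : ∀ {e} → XOnly e → qtx e ≡ e
 qtx-of {e} h = cong (mkX (getE 0 e) (getE 1 e)) h ∙ mkX-η e

 qty-of : ∀ {e} → YOnly e → qty e ≡ e
 qty-of {e} h = cong (mkX (getE 0 e) (getE 1 e)) h ∙ mkX-η e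

 AllX AllY : Poly n → Set
 AllX = All (λ t → XOnly (proj₁ t))
 AllY = All (λ t → YOnly (proj₁ t))

 allX-* : ∀ {p r} → AllX p → AllX r → AllX (p * r)
 allX-* = all-* {XOnly} {XOnly} {XOnly} (λ {e} {e'} → xOnly-⊕ {e} {e'})

 allY-* : ∀ {p r} → AllY p → AllY r → AllY (p * r)
 allY-* = all-* {YOnly} {YOnly} {YOnly} (λ {e} {e'} → yOnly-⊕ {e} {e'})

 allX-XF : ∀ {p} → XF p → AllX p
 allX-XF = All.map (λ {t} h → cong (maskX n) h ∙ maskX-0 n ∙ P.sym h)

 allY-XF : ∀ {p} → XF p → AllY p
 allY-XF = All.map (λ {t} h → cong (maskY n) h ∙ maskY-0 n ∙ P.sym h)

 xf-* : ∀ {p r} → XF p → XF r → XF (p * r)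
 xf-* = all-* {λ e → xs e ≡ 0V} {λ e → xs e ≡ 0V} {λ e → xs e ≡ 0V} (λ {e} {e'} h h' → xs-⊕ e e' ∙ cong₂ _⊞_ h h' ∙ zip-0 0V)

 xf-neg : ∀ {p} → XF p → XF (- p)
 xf-neg = all-neg {λ e → xs e ≡ 0V}

 xf-Π : ∀ {p} → XF p → (l : List ℕ) → XF (Π (map (λ _ → p) l))
 xf-Π h [] = P.refl ∷ []
 xf-Π h (_ ∷ l) = xf-* h (xf-Π h l)

 V-T-fixed : ∀ s i l → All (i ≢_) l → T s i (V l) ≈ V l
 V-T-fixed s i l h = TH.hom-pairProd s i (λ a b → X a - X b) l ◦ pairProd-congAll (allPairs-of h (λ a b ha hb → TH.hom-sub s i (X a) (X b) ◦ +-cong (T-X-other s i a ha) (-‿cong (T-X-other s i b hb))))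

 V-S-fixed : ∀ s i l → All (i ≢_) l → S s i (V l) ≈ V l
 V-S-fixed s i l h = SH.hom-pairProd s i (λ a b → X a - X b) l ◦ pairProd-congAll (allPairs-of h (λ a b ha hb → SH.hom-sub s i (X a) (X b) ◦ +-cong (S-X-other s i a ha) (-‿cong (S-X-other s i b hb))))

 allX-Δ : AllX Δ
 allX-Δ = All.map (λ { (_ , m , _) → m }) Δ-graded

 allY-Δy : AllY Δy
 allY-Δy = All.map (λ { (_ , m , _) → m }) Δy-graded

 σP-AllY : ∀ {p} k → suc k N.< n → AllY p → σP k p ≈ p
 σP-AllY {p} k l h .app f = lin-mapE (σ k) f p ∙ lin-congAll h (λ e _ ye → cong f (fix e ye))
   where
   swap-mask : ∀ {m} n k (v : Vec ℤ m) → suc k N.< n → swapV k (maskY n v) ≡ maskY n v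
   swap-mask (suc (suc n)) zero [] _ = P.refl
   swap-mask (suc (suc n)) zero (a ∷ []) _ = P.refl
   swap-mask (suc (suc n)) zero (a ∷ b ∷ v) _ = P.refl
   swap-mask (suc zero) zero _ (s≤s ())
   swap-mask (suc n) (suc k) [] _ = P.refl
   swap-mask (suc n) (suc k) (a ∷ v) (s≤s l) = cong (+0 ∷_) (swap-mask n k v l)
   fix : ∀ e → YOnly e → σ k e ≡ e
   fix (mkE (q ∷ t ∷ v)) ye = cong (mkX q t) (cong (swapV k) (P.sym ye) ∙ swap-mask n k v l ∙ ye)

 σP-AllX : ∀ {p} k → AllX p → σP (n N.+ k) p ≈ p
 σP-AllX {p} k h .app f = lin-mapE (σ (n N.+ k)) f p ∙ lin-congAll h (λ e _ xe → cong f (fix e xe))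
   where
   swap-0 : ∀ m k → swapV k (0V {m}) ≡ 0V
   swap-0 m k = swapV-0 m k
   swap-mask : ∀ {m} n k (v : Vec ℤ m) → swapV (n N.+ k) (maskX n v) ≡ maskX n v
   swap-mask zero k [] = swap-0 0 k
   swap-mask zero k v@(_ ∷ _) = swap-0 _ k
   swap-mask (suc n) k [] = P.refl
   swap-mask (suc n) k (a ∷ v) = cong (a ∷_) (swap-mask n k v)
   fix : ∀ e → XOnly e → σ (n N.+ k) e ≡ e
   fix (mkE (q ∷ t ∷ v)) xe = cong (mkX q t) (cong (swapV (n N.+ k)) (P.sym xe) ∙ swap-mask n k v ∙ xe)

 ψ-cong : ∀ {p r} → p ≈ r → ψ p ≈ ψ r
 ψ-cong = bind-cong (λ _ → refl)

 linear-ψ : Linear ψ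
 linear-ψ f p = lin-ψ f p ∙ lin-cong (λ e → P.sym (lin-ψ f (mono e (+ 1)) ∙ lin-mono1 (λ e → sgS (exps e) Z.* f (qtE e)) e)) p

 ψ-+ : ∀ p r → ψ (p + r) ≈ ψ p + ψ r
 ψ-+ p r .app f = lin-ψ f (p + r) ∙ lin-addP _ p r ∙ P.sym (lin-addP f (ψ p) (ψ r) ∙ cong₂ Z._+_ (lin-ψ f p) (lin-ψ f r))

 ψ-ΣL : ∀ {A : Set} (g : A → Poly n) l → ψ (ΣL l g) ≈ ΣL l (ψ ∘ g)
 ψ-ΣL g [] .app f = lin-ψ f []
 ψ-ΣL g (a ∷ l) = ψ-+ (g a) _ ◦ +-congˡ (ψ-ΣL g l)

 ψ-XF : ∀ {c} → XF c → ∀ p → ψ (c * p) ≈ c * ψ p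
 ψ-XF {c} xf p .app f = lin-ψ f (c * p) ∙ lin-mulP _ c p ∙ lin-congAll xf (λ a _ h → lin-cong (λ e → step a e h) p ∙ P.sym (lin-ψ (λ e → f (a ⊕ e)) p)) ∙
     P.sym (lin-mulP f c (ψ p))
   where
   qtE-self : ∀ a → xs a ≡ 0V → qtE a ≡ a
   qtE-self a h = cong (mkX (getE 0 a) (getE 1 a)) (P.sym h) ∙ mkX-η a
   step : ∀ a e → xs a ≡ 0V → sgS (exps (a ⊕ e)) Z.* f (qtE (a ⊕ e)) ≡ sgS (exps e) Z.* f (a ⊕ qtE e)
   step a e h = cong₂ (λ L y → sgS L Z.* f y) (cong toList (xs-⊕ a e ∙ cong (_⊞ xs e) h ∙ zip-0 (xs e))) (qtE-⊕ a e ∙ cong (_⊕ qtE e) (qtE-self a h))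

 ψ-σ : ∀ k → suc k N.< N → ∀ p → ψ (σP k p) ≈ - ψ p
 ψ-σ k l p .app f = lin-ψ f (σP k p) ∙ lin-mapE (σ k) _ p ∙ lin-cong (λ e → cong₂ (λ s y → s Z.* f y) (cong sgS (exps-σ k e) ∙ anti-swapL {sgS} sgS-swap k (exps e) (P.subst (suc k N.<_) (P.sym (length-exps e)) l)) (qtE-σ k e)) p ∙
   lin-cong (λ e → P.sym (ZP.neg-distribˡ-* (sgS (exps e)) (f (qtE e))) ∙ P.sym (ZP.-1*i≡-i _)) p ∙ lin-scale -1ℤ _ p ∙ ZP.-1*i≡-i _ ∙ P.sym (lin-oppP f (ψ p) ∙ (cong Z.-_ (lin-ψ f p)))

 linear-*ʳ : ∀ s → Linear (_* s)
 linear-*ʳ s f p = lin-mulP f p s ∙ lin-cong (λ e → P.sym (lin-mulP f (mono e (+ 1)) s ∙ lin-mono1 (λ a → lin (λ e → f (a ⊕ e)) s) e)) p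

 linear-*ˡ : ∀ s → Linear (s *_)
 linear-*ˡ s f p = app (*-comm s p) f ∙ linear-*ʳ s f p ∙ lin-cong (λ e → app (*-comm (mono e (+ 1)) s) f) p

 linear-mapE : ∀ φ → Linear (mapE φ)
 linear-mapE φ f p = lin-mapE φ f p ∙ lin-cong (λ e → P.sym (lin-mapE φ f (mono e (+ 1)) ∙ lin-mono1 (λ a → f (φ a)) e)) p

 linear-ΣL : ∀ {A : Set} (l : List A) {B : A → Poly n → Poly n} → (∀ a → Linear (B a)) → Linear (λ p → ΣL l (λ a → B a p))
 linear-ΣL [] h f p = P.sym (lin-0 p)
 linear-ΣL (a ∷ l) {B} h f p = lin-addP f (B a p) _ ∙ cong₂ Z._+_ (h a f p) (linear-ΣL l {B} h f p) ∙ P.sym (lin-add (λ e → lin f (B a (mono e (+ 1)))) (λ e → lin f (ΣL l (λ a → B a (mono e (+ 1))))) p) ∙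
   lin-cong (λ e → P.sym (lin-addP f (B a (mono e (+ 1))) _)) p

 swN : ℕ → ℕ → ℕ
 swN zero zero = 1
 swN zero (suc zero) = 0
 swN zero (suc (suc j)) = suc (suc j)
 swN (suc k) zero = 0
 swN (suc k) (suc j) = suc (swN k j)

 getV-swap : ∀ {m} k j (v : Vec ℤ m) → suc k N.< m → getV j (swapV k v) ≡ getV (swN k j) v
 getV-swap zero zero (a ∷ b ∷ v) _ = P.refl
 getV-swap zero (suc zero) (a ∷ b ∷ v) _ = P.refl
 getV-swap zero (suc (suc j)) (a ∷ b ∷ v) _ = P.refl
 getV-swap zero j (a ∷ []) (s≤s ())
 getV-swap (suc k) zero (a ∷ v) _ = P.refl
 getV-swap (suc k) (suc j) (a ∷ v) (s≤s l) = getV-swap k j v l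

 swN-first : ∀ k → swN k k ≡ suc k
 swN-first zero = P.refl
 swN-first (suc k) = cong suc (swN-first k)

 swN-second : ∀ k → swN k (suc k) ≡ k
 swN-second zero = P.refl
 swN-second (suc k) = cong suc (swN-second k)

 swN-fixed : ∀ k j → j ≢ k → j ≢ suc k → swN k j ≡ j
 swN-fixed zero zero h _ = ⊥-elim (h P.refl)
 swN-fixed zero (suc zero) _ h = ⊥-elim (h P.refl)
 swN-fixed zero (suc (suc j)) _ _ = P.refl
 swN-fixed (suc k) zero _ _ = P.refl
 swN-fixed (suc k) (suc j) h h' = cong suc (swN-fixed k j (h ∘ cong suc) (h' ∘ cong suc))

 T-σ : ∀ s j k → suc k N.< N → ∀ p → T s j (σP k p) ≈ σP k (T s (swN k j) p)
 T-σ s j k l p = mapE-∘ _ _ p ◦ mapE-≗ go p ◦ sym (mapE-∘ _ _ p)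
   where go : ∀ e → qScale s j (σ k e) ≡ σ k (qScale s (swN k j) e)
         go (mkE (q ∷ t ∷ v)) = cong (λ z → mkX (q Z.+ s Z.* z) t (swapV k v)) (getV-swap k j v l)

 S-σ : ∀ s j k → suc k N.< N → ∀ p → S s j (σP k p) ≈ σP k (S s (swN k j) p)
 S-σ s j k l p = mapE-∘ _ _ p ◦ mapE-≗ go p ◦ sym (mapE-∘ _ _ p)
   where go : ∀ e → tScale s j (σ k e) ≡ σ k (tScale s (swN k j) e)
         go (mkE (q ∷ t ∷ v)) = cong (λ z → mkX q (t Z.+ s Z.* z) (swapV k v)) (getV-swap k j v l)

 ΣL-swN : ∀ k → suc k N.< n → (g : ℕ → Poly n) → ΣL yVars (λ j → g (swN (n N.+ k) j)) ≈ ΣL yVars g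
 ΣL-swN k l g = P.subst (λ L → ΣL L (λ j → g (swN (n N.+ k) j)) ≈ ΣL L g) (P.sym eq) (go (upFrom n k)
     (AllP.++⁺ (All.map (λ { (_ , b) → NP.<⇒≢ b , NP.<⇒≢ (NP.m≤n⇒m≤1+n b) }) (upFrom-bounds n k))
       (All.map (λ { (a , _) → NP.<⇒≢ (NP.<-trans (NP.n<1+n _) a) ∘ P.sym , NP.<⇒≢ a ∘ P.sym }) (upFrom-bounds (2 N.+ n N.+ k) m'))))
   where
   m' = n N.∸ (2 N.+ k)
   K = n N.+ k
   eq : yVars ≡ upFrom n k ++ K ∷ suc K ∷ upFrom (2 N.+ n N.+ k) m'
   eq = yVars-upFrom ∙ cong (upFrom n) (P.sym ((NP.+-suc k (suc m') ∙ cong suc (NP.+-suc k m')) ∙ NP.m+[n∸m]≡n l)) ∙ upFrom-split n k m'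
   rest : ∀ L → All (λ i → i ≢ K × i ≢ suc K) L → ΣL L (λ j → g (swN K j)) ≈ ΣL L g
   rest [] _ = refl
   rest (i ∷ L) ((a , b) ∷ h) = +-cong (reflexive (cong g (swN-fixed K i a b))) (rest L h)
   go : ∀ p {s} → All (λ i → i ≢ K × i ≢ suc K) (p ++ s) → ΣL (p ++ K ∷ suc K ∷ s) (λ j → g (swN K j)) ≈ ΣL (p ++ K ∷ suc K ∷ s) g
   go [] {s} h = +-cong (reflexive (cong g (swN-first K))) (+-cong (reflexive (cong g (swN-second K))) (rest s h)) ◦
     solveR 3 (λ a b c → b :+ (a :+ c) := a :+ (b :+ c)) refl (g K) (g (suc K)) _
   go (i ∷ p) ((a , b) ∷ h) = +-cong (reflexive (cong g (swN-fixed K i a b))) (go p h)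

 -- The bounds place the exponents of the product with a Vandermonde product between 0 and 2n - 1,
 -- the range that W covers.
 record Symmetrical (s : ℕ) (J : Poly n) : Set where
   field
     symmetric : ∀ k → suc k N.< n → σP (s N.+ k) J ≈ J
     nonneg : All (λ t → NonNeg (proj₁ t)) J
     bounded : ∀ i → Coord.Top (2 N.+ i) (+ n) J

 -- J is a polynomial in x, and h tests it in y. The kernel identity is contracted with Δ J in one
 -- alphabet and with Δy h in the other.
 module Adjoint (J h : Poly n) (symJ : Symmetrical 0 J) (J-x : AllX J) (symh : Symmetrical n h) (h-y : AllY h)
   (e⁻ : Poly n) (e⁻-xf : XF e⁻) (dual : ΣL xVars (λ j → Δt⁻ j * T -1ℤ j J) ≈ e⁻ * (Δ * J)) where

   private
     module SJ = Symmetrical symJ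
     module Sh = Symmetrical symh
     p r : Poly n
     p = Δ * J
     r = Δy * h
     κ : Poly n
     κ = cst RX.factor
     k₁ k₂ : Poly n
     k₁ = t⁻ - 1#
     k₂ = q⁻ - 1#

     n∸1+n<N : ∀ {k} → k N.< N → (n N.∸ 1) N.+ n N.< N
     n∸1+n<N {k} l = go n l
       where go : ∀ m → k N.< m N.+ m → (m N.∸ 1) N.+ m N.< m N.+ m
             go (suc m) _ = NP.n<1+n _

     bounded : ∀ {D G} → (∀ i → Coord.Top (2 N.+ i) (+ (n N.∸ 1)) D) → (∀ i → Coord.Top (2 N.+ i) (+ n) G) → All (λ t → All (Z._< + N) (exps (proj₁ t))) (D * G)
     bounded {D} {G} hD hG = go N P.refl
       where
       empty : ∀ (L : List ℤ) → length L ≡ 0 → [] ≡ L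
       empty [] _ = P.refl
       go : ∀ b → N ≡ b → All (λ t → All (Z._< + N) (exps (proj₁ t))) (D * G)
       -- For n = 0 the truncated difference n - 1 spoils the degree bound, but then there are no
       -- exponents to bound.
       go zero eqN = All.universal (λ { (e , _) → P.subst (All (Z._< + N)) (empty (exps e) (length-exps e ∙ eqN)) [] }) (D * G)
       go (suc m) eqN = all-bounded _ (Z.+<+ (n∸1+n<N {m} (P.subst (m N.<_) (P.sym eqN) (NP.n<1+n m)))) (λ i → Coord.top-* (2 N.+ i) (hD i) (hG i))

     nonneg-* : ∀ {D G} → All (λ t → NonNeg (proj₁ t)) D → All (λ t → NonNeg (proj₁ t)) G → All (λ t → NonNeg (proj₁ t)) (D * G)
     nonneg-* = all-* {NonNeg} {NonNeg} {NonNeg} (λ {e} {e'} → nonneg-⊕ e e')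

     p-x : AllX p
     p-x = allX-* allX-Δ J-x
     r-y : AllY r
     r-y = allY-* allY-Δy h-y

     rep-p : SX.Representable p
     rep-p = (λ k l → σH.hom-* k Δ J ◦ *-cong (Δ-antisym k l) (SJ.symmetric k l) ◦ solveR 2 (λ a b → :- a :* b := :- (a :* b)) refl Δ J) ,
       All.zipWith (λ { {e , _} (x , nn , lt) → qtx-of {e} x , nonneg-xl e nn , AllP.take⁺ n lt })
         (p-x , All.zip (nonneg-* (All.map (λ { (_ , _ , nn , _) → nn }) Δ-graded) SJ.nonneg , bounded (λ i → P.subst (λ m → Coord.Top (2 N.+ i) (+ (m N.∸ 1)) Δ) (LP.length-upTo n) (V-top i xVars xVars-unique)) SJ.bounded))

     rep-r : SY.Representable r
     rep-r = (λ k l → σH.hom-* (n N.+ k) Δy h ◦ *-cong (Δy-antisym k l) (Sh.symmetric k l) ◦ solveR 2 (λ a b → :- a :* b := :- (a :* b)) refl Δy h) ,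
       All.zipWith (λ { {e , _} (y , nn , lt) → qty-of {e} y , nonneg-yl e nn , P.subst (All (Z._< + N)) (P.sym (yl-drop e)) (AllP.drop⁺ n lt) })
         (r-y , All.zip (nonneg-* (All.map (λ { (_ , _ , nn , _) → nn }) Δy-graded) Sh.nonneg , bounded (λ i → P.subst (λ m → Coord.Top (2 N.+ i) (+ (m N.∸ 1)) Δy) (LP.length-map (n N.+_) (upTo n) ∙ LP.length-upTo n) (V-top i yVars yVars-unique)) Sh.bounded))

     CX-* : ∀ {s} G → AllX s → SX.contract p (s * G) ≈ s * SX.contract p G
     CX-* G h = SX.contract-* p G (All.map (λ {t} x → qtx-of {proj₁ t} x) h)

     CY-* : ∀ {s} G → AllY s → SY.contract r (s * G) ≈ s * SY.contract r G
     CY-* G h = SY.contract-* r G (All.map (λ {t} y → qty-of {proj₁ t} y) h)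

     W-split : W ≈ (Δ * Δy) * Ψ
     W-split = V-++ xVars yVars

     -- W is Δ Δy Ψ, and Δ passes through the contraction, so it can be cancelled from the
     -- reproduction of Δ J.
     CXΨ : SX.contract p (Δy * Ψ) ≈ κ * J
     CXΨ = cancelR regular-Δ (begin
       Δ * SX.contract p (Δy * Ψ) ≈⟨ sym (CX-* (Δy * Ψ) allX-Δ) ⟩
       SX.contract p (Δ * (Δy * Ψ)) ≈⟨ SX.contract-cong p (sym (*-assoc Δ Δy Ψ) ◦ sym W-split) ⟩
       SX.contract p W ≈⟨ RX.reproduce rep-p ⟩
       κ * (Δ * J) ≈⟨ x∙yz≈y∙xz κ Δ J ⟩
       Δ * (κ * J) ∎)

     regular-Δy : Regular Δy
     regular-Δy = regular-V yVars yVars-<N yVars-unique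

     CYΨ : SY.contract r (Δ * Ψ) ≈ κ * h
     CYΨ = cancelR regular-Δy (begin
       Δy * SY.contract r (Δ * Ψ) ≈⟨ sym (CY-* (Δ * Ψ) allY-Δy) ⟩
       SY.contract r (Δy * (Δ * Ψ)) ≈⟨ SY.contract-cong r (solveR 3 (λ a b c → a :* (b :* c) := (b :* a) :* c) refl Δy Δ Ψ ◦ sym W-split) ⟩
       SY.contract r W ≈⟨ RY.reproduce rep-r ⟩
       κ * (Δy * h) ≈⟨ x∙yz≈y∙xz κ Δy h ⟩
       Δy * (κ * h) ∎)

     CX-T : ∀ i → i ∈ xVars → ∀ G → SX.contract p (T -1ℤ i G) ≈ T -1ℤ i (SX.contract p G)
     CX-T i m = SX.contract-hom p (qScale-additive -1ℤ i) (λ e → P.refl)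
       (λ e → cong (λ z → mkX (getE 0 e Z.+ Z.- + 1 Z.* z) (getE 1 e) (maskX n (xs e))) (P.sym (getV-maskX n i (xs e) (∈xVars⇒< m))))
       (λ e → cong (λ z → mkX z (getE 1 e) 0V) (cong (λ z → getE 0 e Z.+ Z.- + 1 Z.* z) (getV-0 N i) ∙ ZP.+-identityʳ (getE 0 e)))

     CY-S : ∀ i → i ∈ yVars → ∀ G → SY.contract r (S -1ℤ i G) ≈ S -1ℤ i (SY.contract r G)
     CY-S i m = SY.contract-hom r (tScale-additive -1ℤ i) (λ e → P.refl)
       (λ e → cong (λ z → mkX (getE 0 e) (getE 1 e Z.+ Z.- + 1 Z.* z) (maskY n (xs e))) (P.sym (getV-maskY n i (xs e) (All.lookup yVars-≥ m))))
       (λ e → cong (λ z → mkX (getE 0 e) z 0V) (cong (λ z → getE 1 e Z.+ Z.- + 1 Z.* z) (getV-0 N i) ∙ ZP.+-identityʳ (getE 1 e)))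

     one-xf : XF 1#
     one-xf = P.refl ∷ []

     k₁-xf : XF k₁
     k₁-xf = xf-+ (xf-qtm _ _) (xf-neg one-xf)
     k₂-xf : XF k₂
     k₂-xf = xf-+ (xf-qtm _ _) (xf-neg one-xf)
     total-xf : XF (total - 1#)
     total-xf = xf-+ (xf-* (xf-Π (xf-qtm _ _) xVars) (xf-Π (xf-qtm _ _) yVars)) (xf-neg one-xf)
     κ-xf : XF κ
     κ-xf = P.refl ∷ []

     T-cst : ∀ i → T -1ℤ i κ ≈ κ
     T-cst i = T-XF κ-xf -1ℤ i

     G₁ G₂ : Poly n
     G₁ = ΣL yVars (λ j → T -1ℤ j Δy * S -1ℤ j Ψ)
     G₂ = ΣL yVars (λ j → T -1ℤ j Δy * S -1ℤ j h)

     allY-TΔy : ∀ j → AllY (T -1ℤ j Δy)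
     allY-TΔy j = all-mapE {YOnly} {YOnly} {qScale -1ℤ j} id allY-Δy

     allY-G₂ : AllY G₂
     allY-G₂ = all-ΣL yVars (λ j _ → allY-* (allY-TΔy j) (all-mapE {YOnly} {YOnly} {tScale -1ℤ j} id h-y))

     first : SX.contract p (ΣL xVars (λ i → Δt⁻ i * (Δy * T -1ℤ i Ψ))) ≈ κ * (e⁻ * (Δ * J))
     first = SX.contract-ΣL p _ xVars ◦ ΣL-cong' xVars (λ i m → begin
         SX.contract p (Δt⁻ i * (Δy * T -1ℤ i Ψ)) ≈⟨ CX-* _ (all-mapE {XOnly} {XOnly} {tScale -1ℤ i} id allX-Δ) ⟩
         Δt⁻ i * SX.contract p (Δy * T -1ℤ i Ψ) ≈⟨ *-congˡ (SX.contract-cong p (*-congʳ (sym (V-T-fixed -1ℤ i yVars (All.tabulate (λ mj → disjoint m mj)))) ◦ sym (TH.hom-* -1ℤ i Δy Ψ)) ◦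
            CX-T i m (Δy * Ψ) ◦ TH.hom-cong -1ℤ i CXΨ ◦ TH.hom-* -1ℤ i κ J ◦ *-congʳ (T-cst i)) ⟩
         Δt⁻ i * (κ * T -1ℤ i J) ≈⟨ x∙yz≈y∙xz (Δt⁻ i) κ _ ⟩
         κ * (Δt⁻ i * T -1ℤ i J) ∎) ◦ ΣL-*ˡ κ _ xVars ◦ *-congˡ dual

     E″ : Poly n
     E″ = (total - 1#) - k₁ * e⁻

     E″-xf : XF E″
     E″-xf = xf-+ total-xf (xf-neg (xf-* k₁-xf e⁻-xf))

     -- The identity `kernel` contracted with Δ J. On the x side the dual equation replaces the
     -- operator by a scalar, and what remains expresses the y side through J.
     stage₁ : k₂ * SX.contract p G₁ ≈ E″ * (κ * J)
     stage₁ = cancelR regular-Δ (begin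
       Δ * (k₂ * SX.contract p G₁) ≈⟨ solveR 4 (λ d k c a → d :* (k :* c) := (a :+ k :* (d :* c)) :- a) refl Δ k₂ _ (k₁ * SX.contract p A₁) ⟩
       (k₁ * SX.contract p A₁ + k₂ * (Δ * SX.contract p G₁)) - k₁ * SX.contract p A₁
         ≈⟨ +-cong (sym (SX.contract-+ p _ _ ◦ +-cong (CX-* _ (allX-XF k₁-xf)) (CX-* _ (allX-XF k₂-xf) ◦ *-congˡ (SX.contract-cong p (ΣL-*ˡ Δ _ yVars) ◦ CX-* G₁ allX-Δ)))) (-‿cong (*-congˡ first)) ⟩
       SX.contract p (k₁ * A₁ + k₂ * ΣL yVars (λ i → Δ * (T -1ℤ i Δy * S -1ℤ i Ψ))) - k₁ * (κ * (e⁻ * (Δ * J)))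
         ≈⟨ +-congʳ (SX.contract-cong p kernel ◦ CX-* W (allX-XF total-xf) ◦ *-congˡ (RX.reproduce rep-p)) ⟩
       (total - 1#) * (κ * (Δ * J)) - k₁ * (κ * (e⁻ * (Δ * J))) ≈⟨ solveR 6 (λ t c d j k e → t :* (c :* (d :* j)) :- k :* (c :* (e :* (d :* j))) := d :* ((t :- k :* e) :* (c :* j))) refl (total - 1#) κ Δ J k₁ e⁻ ⟩
       Δ * (E″ * (κ * J)) ∎)
       where A₁ = ΣL xVars (λ i → Δt⁻ i * (Δy * T -1ℤ i Ψ))

     -- This contraction carries the y along, so the shifts in y pass through it and act on the
     -- reproduced h.
     CYG : SY.contract r (Δ * G₁) ≈ κ * G₂
     CYG = SY.contract-cong r (sym (ΣL-*ˡ Δ _ yVars) ◦ ΣL-cong' yVars (λ j m → x∙yz≈y∙xz Δ _ _ ◦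
           *-congˡ (*-congʳ (sym (V-S-fixed -1ℤ j xVars (All.tabulate (λ mi → disjoint mi m ∘ P.sym)))) ◦ sym (SH.hom-* -1ℤ j Δ Ψ)))) ◦
       SY.contract-ΣL r _ yVars ◦ ΣL-cong' yVars (λ j m → CY-* _ (allY-TΔy j) ◦ *-congˡ (CY-S j m (Δ * Ψ) ◦ SH.hom-cong -1ℤ j CYΨ ◦ SH.hom-* -1ℤ j κ h ◦ *-congʳ (S-cst j)) ◦
           x∙yz≈y∙xz _ κ _) ◦ ΣL-*ˡ κ _ yVars
       where
       S-cst : ∀ j → S -1ℤ j κ ≈ κ
       S-cst j = S-mono -1ℤ j zeroExp RX.factor ◦ *-congʳ (reflexive (cong (λ z → qtm +0 (Z.- + 1 Z.* z)) (getV-0 N j))) ◦ qtm-0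

   eigenWeight : Poly n
   eigenWeight = (total - 1#) - (t⁻ - 1#) * e⁻

   -- G₂, the y operator applied to h, is itself a contraction of the kernel by `CYG`. Exchanging
   -- the two contractions makes `stage₁` applicable, and the contraction that remains is ψ of p
   -- times r.
   adjoint : (q⁻ - 1#) * ψ (p * G₂) ≈ eigenWeight * ψ (p * r)
   adjoint = cancelR regular-factor (begin
     κ * (k₂ * ψ (p * G₂)) ≈⟨ x∙yz≈y∙xz κ k₂ _ ⟩
     k₂ * (κ * ψ (p * G₂)) ≈⟨ *-congˡ (*-congˡ (sym (SX.contract-second (All.map (λ {t} x → qtx-of {proj₁ t} x) p-x) (All.map (λ {t} y → qty-of {proj₁ t} y) allY-G₂))) ◦ sym (CX-* G₂ (allX-XF κ-xf))) ⟩
     k₂ * SX.contract p (κ * G₂) ≈⟨ *-congˡ (SX.contract-cong p (sym CYG) ◦ contract-exchange p r (Δ * G₁)) ⟩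
     k₂ * SY.contract r (SX.contract p (Δ * G₁)) ≈⟨ *-congˡ (SY.contract-cong r (CX-* G₁ allX-Δ)) ⟩
     k₂ * SY.contract r (Δ * SX.contract p G₁) ≈⟨ sym (CY-* _ (allY-XF k₂-xf)) ⟩
     SY.contract r (k₂ * (Δ * SX.contract p G₁)) ≈⟨ SY.contract-cong r (x∙yz≈y∙xz k₂ Δ _ ◦ *-congˡ stage₁ ◦
         solveR 4 (λ d e c j → d :* (e :* (c :* j)) := e :* (c :* (d :* j))) refl Δ E″ κ J) ⟩
     SY.contract r (E″ * (κ * p)) ≈⟨ CY-* _ (allY-XF E″-xf) ◦ *-congˡ (CY-* p (allY-XF κ-xf)) ⟩
     E″ * (κ * SY.contract r p) ≈⟨ *-congˡ (*-congˡ (SY.contract-second (All.map (λ {t} y → qty-of {proj₁ t} y) r-y) (All.map (λ {t} x → qtx-of {proj₁ t} x) p-x) ◦ ψ-cong (*-comm r p))) ⟩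
     E″ * (κ * ψ (p * r)) ≈⟨ x∙yz≈y∙xz E″ κ _ ⟩
     κ * (E″ * ψ (p * r)) ∎)

   ρx ρy : E
   ρx = BX.put zeroExp (iv +0 n)
   ρy = BY.put zeroExp (iv +0 n)

   private
     σ-h : ∀ k → suc k N.< n → σP (n N.+ k) h ≈ h
     σ-h = Sh.symmetric

     index : ∀ {k} → suc k N.< n → suc k N.< N
     index l = NP.<-≤-trans l n≤N

     kx ky : Poly n
     kx = cst (BX.blockFactor Δ)
     ky = cst (BY.blockFactor Δy)

     -- ψ changes sign under exchanges of the x while J and s do not. As a function of the factor Δ
     -- the left side is therefore an antisymmetric functional, and x^ρ can take the place of Δ.
     undo-x : ∀ s → AllY s → ψ (p * s) ≈ kx * ψ (mono ρx (+ 1) * (J * s))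
     undo-x s ys = ψ-cong (*-assoc Δ J s) ◦ BX.antisym-functional Δ-inBlock {λ m → ψ (m * (J * s))} (linear-∘ {ψ} {_* (J * s)} linear-ψ (linear-*ʳ (J * s)))
       (λ k e l → ψ-cong (*-cong (reflexive (P.sym (mapE-mono (σ k) e (+ 1)))) (*-cong (sym (SJ.symmetric k l)) (sym (σP-AllY k l ys))) ◦
            *-congˡ (sym (σH.hom-* k J s)) ◦ sym (σH.hom-* k (mono e (+ 1)) (J * s))) ◦ ψ-σ k (index l) _)

     -- B is what is done to the factor Δy, with h kept fixed. The argument of `undo-x` applies as
     -- soon as B commutes with the exchanges of the y.
     undo-y : ∀ (B : Poly n → Poly n) → Linear B → (∀ k e → suc k N.< n → B (mono (σ (n N.+ k) e) (+ 1)) ≈ σP (n N.+ k) (B (mono e (+ 1)))) →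
       ψ (mono ρx (+ 1) * (J * B Δy)) ≈ ky * ψ (mono ρx (+ 1) * (J * B (mono ρy (+ 1))))
     undo-y B linB σB = BY.antisym-functional Δy-inBlock {λ m → ψ (mono ρx (+ 1) * (J * B m))}
       (linear-∘ {ψ} linear-ψ (linear-∘ {mono ρx (+ 1) *_} (linear-*ˡ _) (linear-∘ {J *_} (linear-*ˡ J) linB)))
       (λ k e l → ψ-cong (*-cong (sym (σP-AllX k (ρx-only ∷ []))) (*-cong (sym (σP-AllX k J-x)) (σB k e l)) ◦
           *-congˡ (sym (σH.hom-* (n N.+ k) J _)) ◦ sym (σH.hom-* (n N.+ k) (mono ρx (+ 1)) _)) ◦ ψ-σ (n N.+ k) (BY.index-< l) _)
       where
       ρx-only : XOnly ρx
       ρx-only = maskX-vl n (xs ρx) ∙ cong (vl N) (BX.bl-put zeroExp (iv +0 n) (length-iv +0 n) ∙ P.refl) `thenX` P.sym (cong xs (whole-ρ))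
         where
         whole-ρ : ρx ≡ lst +0 +0 (iv +0 n ++ L.drop n (exps zeroExp))
         whole-ρ = P.refl
         _`thenX`_ : vl N (BX.bl ρx) ≡ vl N (iv +0 n) → vl N (iv +0 n ++ L.drop n (exps zeroExp)) ≡ xs ρx → vl N (BX.bl ρx) ≡ xs ρx
         a `thenX` b = a ∙ pad-zeros* N (iv +0 n) (AllP.drop⁺ n (zeros N)) ∙ b
           where
           pad-zeros* : ∀ m L {Z} → All (_≡ +0) Z → vl m L ≡ vl m (L ++ Z)
           pad-zeros* zero L _ = P.refl
           pad-zeros* (suc m) [] [] = P.refl
           pad-zeros* (suc m) [] (P.refl ∷ h) = cong (+0 ∷_) (pad-zeros* m [] h)
           pad-zeros* (suc m) (a ∷ L) h = cong (a ∷_) (pad-zeros* m L h)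

     B₁ B₂ : Poly n → Poly n
     B₁ m = ΣL yVars (λ j → T -1ℤ j m * S -1ℤ j h)
     B₂ m = m * h

     lin-B₁ : Linear B₁
     lin-B₁ = linear-ΣL yVars {λ j m → T -1ℤ j m * S -1ℤ j h} (λ j → linear-∘ {_* S -1ℤ j h} (linear-*ʳ _) (linear-mapE _))

     σ-B₁ : ∀ k e → suc k N.< n → B₁ (mono (σ (n N.+ k) e) (+ 1)) ≈ σP (n N.+ k) (B₁ (mono e (+ 1)))
     σ-B₁ k e l = begin
       B₁ (mono (σ K e) (+ 1)) ≈⟨ ΣL-cong yVars (λ j → *-cong (TH.hom-cong -1ℤ j (reflexive (P.sym (mapE-mono (σ K) e (+ 1)))) ◦ T-σ -1ℤ j K (BY.index-< l) _)
            (SH.hom-cong -1ℤ j (sym (σ-h k l)) ◦ S-σ -1ℤ j K (BY.index-< l) h)) ⟩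
       ΣL yVars (λ j → σP K (T -1ℤ (swN K j) (mono e (+ 1))) * σP K (S -1ℤ (swN K j) h)) ≈⟨ ΣL-cong yVars (λ j → sym (σH.hom-* K _ _)) ⟩
       ΣL yVars (λ j → σP K (T -1ℤ (swN K j) (mono e (+ 1)) * S -1ℤ (swN K j) h)) ≈⟨ ΣL-swN k l (λ j → σP K (T -1ℤ j (mono e (+ 1)) * S -1ℤ j h)) ⟩
       ΣL yVars (λ j → σP K (T -1ℤ j (mono e (+ 1)) * S -1ℤ j h)) ≈⟨ sym (σH.hom-ΣL K _ yVars) ⟩
       σP K (B₁ (mono e (+ 1))) ∎
       where K = n N.+ k

     σ-B₂ : ∀ k e → suc k N.< n → B₂ (mono (σ (n N.+ k) e) (+ 1)) ≈ σP (n N.+ k) (B₂ (mono e (+ 1)))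
     σ-B₂ k e l = *-cong (reflexive (P.sym (mapE-mono (σ (n N.+ k)) e (+ 1)))) (sym (σ-h k l)) ◦ sym (σH.hom-* (n N.+ k) _ h)

   -- The eigenvalue relation against a single staircase monomial in each block.
   adjoint-ρ : (q⁻ - 1#) * ψ (mono ρx (+ 1) * (J * ΣL yVars (λ j → T -1ℤ j (mono ρy (+ 1)) * S -1ℤ j h))) ≈ eigenWeight * ψ (mono ρx (+ 1) * (J * (mono ρy (+ 1) * h)))
   adjoint-ρ = cancelR (regular-* (regular-cst _ (BX.blockFactor-≢0 Δ-antisym Δ-inBlock regular-Δ)) (regular-cst _ (BY.blockFactor-≢0 Δy-antisym Δy-inBlock regular-Δy))) (begin
     (kx * ky) * (k₂ * Ψ₁) ≈⟨ solveR 4 (λ a b c d → (a :* b) :* (c :* d) := c :* (a :* (b :* d))) refl kx ky k₂ Ψ₁ ⟩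
     k₂ * (kx * (ky * Ψ₁)) ≈⟨ *-congˡ (*-congˡ (sym (undo-y B₁ lin-B₁ σ-B₁)) ◦ sym (undo-x G₂ allY-G₂)) ⟩
     k₂ * ψ (p * G₂) ≈⟨ adjoint ⟩
     eigenWeight * ψ (p * r) ≈⟨ *-congˡ (undo-x r r-y ◦ *-congˡ (undo-y B₂ (linear-*ʳ h) σ-B₂)) ⟩
     eigenWeight * (kx * (ky * Ψ₂)) ≈⟨ solveR 4 (λ a b c d → c :* (a :* (b :* d)) := (a :* b) :* (c :* d)) refl kx ky eigenWeight Ψ₂ ⟩
     (kx * ky) * (eigenWeight * Ψ₂) ∎)
     where
     Ψ₁ = ψ (mono ρx (+ 1) * (J * B₁ (mono ρy (+ 1))))
     Ψ₂ = ψ (mono ρx (+ 1) * (J * B₂ (mono ρy (+ 1))))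

 -- Annihilation
 nth : ℕ → List ℕ → ℕ
 nth _ [] = 0
 nth zero (a ∷ l) = a
 nth (suc i) (a ∷ l) = nth i l

 getL : ℕ → List ℤ → ℤ
 getL _ [] = +0
 getL zero (a ∷ l) = a
 getL (suc i) (a ∷ l) = getL i l

 getV-toList : ∀ {k} i (v : Vec ℤ k) → getV i v ≡ getL i (toList v)
 getV-toList i [] = P.refl
 getV-toList zero (a ∷ v) = P.refl
 getV-toList (suc i) (a ∷ v) = getV-toList i v

 getL-skip : ∀ i (p s : List ℤ) → getL (length p N.+ i) (p ++ s) ≡ getL i s
 getL-skip i [] s = P.refl
 getL-skip i (_ ∷ p) s = getL-skip i p s

 getL-iv : ∀ k i m → i N.< m → getL i (iv (+ k) m) ≡ + (k N.+ i)
 getL-iv k zero (suc m) _ = cong +_ (P.sym (NP.+-identityʳ k))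
 getL-iv k (suc i) (suc m) (s≤s l) = cong (λ x → getL i (iv (+ x) m)) (NP.+-comm k 1) ∙ getL-iv (suc k) i m l ∙ (cong +_ (P.sym (NP.+-suc k i)))

 getL-map : ∀ (f : ℕ → ℤ) i l → i N.< length l → getL i (map f l) ≡ f (nth i l)
 getL-map f zero (a ∷ l) _ = P.refl
 getL-map f (suc i) (a ∷ l) (s≤s h) = getL-map f i l h

 zipL : List ℤ → List ℤ → List ℤ
 zipL = L.zipWith Z._+_

 zipL-++ : ∀ a b c d → length a ≡ length c → zipL (a ++ b) (c ++ d) ≡ zipL a c ++ zipL b d
 zipL-++ [] b [] d _ = P.refl
 zipL-++ (x ∷ a) b (y ∷ c) d e = cong (x Z.+ y ∷_) (zipL-++ a b c d (NP.suc-injective e))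

 toList-⊞ : ∀ {k} (v w : Vec ℤ k) → toList (v ⊞ w) ≡ zipL (toList v) (toList w)
 toList-⊞ [] [] = P.refl
 toList-⊞ (a ∷ v) (b ∷ w) = cong (a Z.+ b ∷_) (toList-⊞ v w)

 exps-zip : ∀ a e → exps (a ⊕ e) ≡ zipL (exps a) (exps e)
 exps-zip a e = exps-⊕ a e ∙ toList-⊞ (xs a) (xs e)

 oL : List ℤ
 oL = replicate n +0

 length-oL : length oL ≡ n
 length-oL = LP.length-replicate n

 toList-0V : ∀ k → toList (0V {k}) ≡ replicate k +0
 toList-0V zero = P.refl
 toList-0V (suc k) = cong (+0 ∷_) (toList-0V k)

 exps-0 : exps zeroExp ≡ oL ++ oL
 exps-0 = toList-0V N ∙ go n
   where go : ∀ k → replicate (k N.+ n) +0 ≡ replicate k +0 ++ oL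
         go zero = P.refl
         go (suc k) = cong (+0 ∷_) (go k)

 zipL-0ˡ : ∀ l → zipL (replicate (length l) +0) l ≡ l
 zipL-0ˡ [] = P.refl
 zipL-0ˡ (a ∷ l) = cong₂ _∷_ (ZP.+-identityˡ a) (zipL-0ˡ l)

 zipL-0ʳ : ∀ l → zipL l (replicate (length l) +0) ≡ l
 zipL-0ʳ [] = P.refl
 zipL-0ʳ (a ∷ l) = cong₂ _∷_ (ZP.+-identityʳ a) (zipL-0ʳ l)

 o-zip : ∀ l → length l ≡ n → zipL oL l ≡ l
 o-zip l e = cong (λ k → zipL (replicate k +0) l) (P.sym e) ∙ zipL-0ˡ l

 zip-o : ∀ l → length l ≡ n → zipL l oL ≡ l
 zip-o l e = cong (λ k → zipL l (replicate k +0)) (P.sym e) ∙ zipL-0ʳ l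

 zipL-iv-dn : ∀ k m l → zipL (iv (+ k) (length l)) (map (λ a → + m Z.- + a) l) ≡ dn (m N.+ k) l
 zipL-iv-dn k m [] = P.refl
 zipL-iv-dn k m (a ∷ l) = cong₂ _∷_ (ring49 (+ k) (+ m) (+ a)) (cong (λ x → zipL (iv (+ x) (length l)) (map (λ a → + m Z.- + a) l)) (NP.+-comm k 1) ∙ zipL-iv-dn (suc k) m l ∙ cong (λ x → dn x l) (NP.+-suc m k))

 zipL-iv-up : ∀ k l → zipL (iv (+ k) (length l)) (map +_ l) ≡ up k l
 zipL-iv-up k [] = P.refl
 zipL-iv-up k (a ∷ l) = cong (+ (k N.+ a) ∷_) (cong (λ x → zipL (iv (+ x) (length l)) (map +_ l)) (NP.+-comm k 1) ∙ zipL-iv-up (suc k) l)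

 length-≡n : ∀ (α : Vec ℕ n) → length (toList α) ≡ n
 length-≡n α = VP.length-toList α

 -- `hE α` is the exponent of y^(n-α). The subtraction from n keeps exponents nonnegative, and x^ρ
 -- y^ρ y^(n-α) is x̄^(ρ-α') up to sign, because the second half of ρ starts at n.
 hE xβE : Vec ℕ n → E
 hE α = mkX +0 +0 (0V V.++ V.map (λ a → + n Z.- + a) α)
 xβE β = mkX +0 +0 (V.map +_ β V.++ 0V)

 rhoE : Vec ℕ n → E
 rhoE α = mkE (+0 ∷ +0 ∷ rhoMinus n α)

 exps-hE : ∀ α → exps (hE α) ≡ oL ++ map (λ a → + n Z.- + a) (toList α)
 exps-hE α = VP.toList-++ (0V {n}) (V.map (λ a → + n Z.- + a) α) ∙ cong₂ _++_ (toList-0V n) (VP.toList-map (λ a → + n Z.- + a) α)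

 exps-xβE : ∀ β → exps (xβE β) ≡ map +_ (toList β) ++ oL
 exps-xβE β = VP.toList-++ (V.map +_ β) (0V {n}) ∙ cong₂ _++_ (VP.toList-map +_ β) (toList-0V n)

 dn-tabulate : ∀ {k} s (v : Vec ℕ k) (g : Fin k → ℕ) → (∀ j → g j ≡ s N.+ toℕ j) → toList (V.zipWith Z._-_ (V.tabulate (λ j → + g j)) (V.map +_ v)) ≡ dn s (toList v)
 dn-tabulate s [] g h = P.refl
 dn-tabulate s (a ∷ v) g h = cong₂ _∷_ (cong (λ x → + x Z.- + a) (h Fin.zero ∙ NP.+-identityʳ s)) (dn-tabulate (suc s) v (g ∘ Fin.suc) (λ j → h (Fin.suc j) ∙ NP.+-suc s (toℕ j)))

 dn-zeros : ∀ k m l → dn k (replicate m 0 ++ l) ≡ iv (+ k) m ++ dn (k N.+ m) l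
 dn-zeros k zero l = cong (λ x → dn x l) (P.sym (NP.+-identityʳ k))
 dn-zeros k (suc m) l = cong₂ _∷_ (ZP.+-identityʳ (+ k)) (dn-zeros (suc k) m l ∙ cong₂ (λ x y → iv (+ x) m ++ dn y l) (NP.+-comm 1 k) (P.sym (NP.+-suc k m)))

 exps-rhoE : ∀ α → exps (rhoE α) ≡ iv +0 n ++ dn n (toList α)
 exps-rhoE α = dn-tabulate 0 (V.replicate n 0 V.++ α) toℕ (λ _ → P.refl) ∙ cong (dn 0) (VP.toList-++ (V.replicate n 0) α ∙ cong (_++ toList α) (zerosL n)) ∙ dn-zeros 0 n (toList α)
   where zerosL : ∀ k → toList (V.replicate k 0) ≡ replicate k 0
         zerosL zero = P.refl
         zerosL (suc k) = cong (0 ∷_) (zerosL k)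

 exps-rho-x : ∀ α β → exps (rhoE α ⊕ xβE β) ≡ up 0 (toList β) ++ dn n (toList α)
 exps-rho-x α β = exps-zip (rhoE α) (xβE β) ∙ cong₂ zipL (exps-rhoE α) (exps-xβE β) ∙ zipL-++ (iv +0 n) _ (map +_ (toList β)) _ (length-iv +0 n ∙ P.sym ((LP.length-map +_ (toList β)) ∙ length-≡n β)) ∙
   cong₂ _++_ (cong (λ k → zipL (iv +0 k) (map +_ (toList β))) (P.sym (length-≡n β)) ∙ zipL-iv-up 0 (toList β))
     (zip-o _ (length-dn n (toList α) ∙ length-≡n α))

 ρxE ρyE : E
 ρxE = BX.put zeroExp (iv +0 n)
 ρyE = BY.put zeroExp (iv +0 n)

 exps-ρx : exps ρxE ≡ iv +0 n ++ oL
 exps-ρx = BX.exps-put zeroExp (iv +0 n) (length-iv +0 n) ∙ cong (iv +0 n ++_) (cong (L.drop n) exps-0 ∙ drop-++ oL oL length-oL)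

 exps-ρy : exps ρyE ≡ oL ++ iv +0 n
 exps-ρy = BY.exps-put zeroExp (iv +0 n) (length-iv +0 n) ∙ cong₂ (λ a b → a ++ iv +0 n ++ b) (cong (L.take n) exps-0 ∙ take-++ oL oL length-oL)
   (cong (L.drop N) exps-0 ∙ LP.drop-all N (oL ++ oL) (NP.≤-reflexive (LP.length-++ oL ∙ cong₂ N._+_ length-oL length-oL))) ∙ cong (oL ++_) (LP.++-identityʳ _)

 exps-injective : ∀ a b → getE 0 a ≡ getE 0 b → getE 1 a ≡ getE 1 b → exps a ≡ exps b → a ≡ b
 exps-injective a b p q r = P.sym (mkX-η a) ∙ P.cong₂ (λ x f → f x) p (cong₂ (λ y v x → mkX x y v) q (P.sym (vl-toList (xs a)) ∙ cong (vl N) r ∙ vl-toList (xs b))) ∙ mkX-η b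

 ρ-factor : ∀ α → rhoE α ≡ ρxE ⊕ (ρyE ⊕ hE α)
 ρ-factor α = exps-injective _ _ P.refl P.refl (exps-rhoE α ∙ P.sym (exps-zip ρxE (ρyE ⊕ hE α) ∙ cong₂ zipL exps-ρx (exps-zip ρyE (hE α) ∙ cong₂ zipL exps-ρy (exps-hE α) ∙
     zipL-++ oL (iv +0 n) oL _ P.refl ∙ cong₂ _++_ (o-zip oL length-oL) (cong (λ k → zipL (iv +0 k) (map (λ a → + n Z.- + a) (toList α))) (P.sym (length-≡n α)) ∙ zipL-iv-dn 0 n (toList α))) ∙
   zipL-++ (iv +0 n) oL oL _ (length-iv +0 n ∙ P.sym length-oL) ∙ cong₂ _++_ (zip-o (iv +0 n) (length-iv +0 n)) (o-zip _ (length-dn (n N.+ 0) (toList α) ∙ length-≡n α) ∙ cong (λ k → dn k (toList α)) (NP.+-identityʳ n))))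

 swapV-++ˡ : ∀ {A : Set} {m} k (u : Vec A n) (v : Vec A m) → suc k N.< n → swapV k (u V.++ v) ≡ swapV k u V.++ v
 swapV-++ˡ {A} k u v = go k u
   where go : ∀ {l} k (u : Vec A l) → suc k N.< l → swapV k (u V.++ v) ≡ swapV k u V.++ v
         go zero (a ∷ b ∷ u) _ = P.refl
         go zero (a ∷ []) (s≤s ())
         go (suc k) (a ∷ u) (s≤s l) = cong (a ∷_) (go k u l)

 swapV-++ʳ : ∀ {A : Set} {m l} k (u : Vec A l) (v : Vec A m) → swapV (l N.+ k) (u V.++ v) ≡ u V.++ swapV k v
 swapV-++ʳ k [] v = P.refl
 swapV-++ʳ k (a ∷ u) v = cong (a ∷_) (swapV-++ʳ k u v)

 swapV-map : ∀ {A B : Set} {m} (f : A → B) k (v : Vec A m) → V.map f (swapV k v) ≡ swapV k (V.map f v)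
 swapV-map f zero [] = P.refl
 swapV-map f zero (a ∷ []) = P.refl
 swapV-map f zero (a ∷ b ∷ v) = P.refl
 swapV-map f (suc k) [] = P.refl
 swapV-map f (suc k) (a ∷ v) = cong (f a ∷_) (swapV-map f k v)

 swapV-↭ : ∀ {m} k (v : Vec ℕ m) → toList (swapV k v) ↭ toList v
 swapV-↭ zero [] = Perm.refl
 swapV-↭ zero (a ∷ []) = Perm.refl
 swapV-↭ zero (a ∷ b ∷ v) = Perm.swap b a Perm.refl
 swapV-↭ (suc k) [] = Perm.refl
 swapV-↭ (suc k) (a ∷ v) = Perm.prep a (swapV-↭ k v)

 ΣL-↭ : {A : Set} {l m : List A} (f : A → Poly n) → l ↭ m → ΣL l f ≈ ΣL m f
 ΣL-↭ f Perm.refl = refl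
 ΣL-↭ f (Perm.prep x p) = +-congˡ (ΣL-↭ f p)
 ΣL-↭ f (Perm.swap x y p) = +-congˡ (+-congˡ (ΣL-↭ f p)) ◦ solveR 3 (λ a b c → a :+ (b :+ c) := b :+ (a :+ c)) refl (f x) (f y) _
 ΣL-↭ f (Perm.trans p q) = ΣL-↭ f p ◦ ΣL-↭ f q

 ΣL-map : {A B : Set} (g : A → B) (f : B → Poly n) (l : List A) → ΣL (map g l) f ≈ ΣL l (f ∘ g)
 ΣL-map g f l = reflexive (cong (foldr _+_ 0#) (P.sym (LP.map-∘ l)))

 perms-swap : ∀ k (ν : Vec ℕ n) (f : Vec ℕ n → Poly n) → ΣL (perms ν) (f ∘ swapV k) ≈ ΣL (perms ν) f
 perms-swap k ν f = sym (ΣL-map (swapV k) f (perms ν)) ◦ ΣL-↭ f (involution-↭ (swapV k) (swapV-invol k) (perms-unique ν)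
   (λ {a} m → ∈-perms⁺ {ν = ν} {α = swapV k a} (Perm.↭-trans (swapV-↭ k a) (∈-perms⁻ {ν = ν} {α = a} m))))

 hP : Vec ℕ n → Poly n
 hP ν = ΣL (perms ν) (λ α → mono (hE α) (+ 1))

 entries : ∀ {ν α : Vec ℕ n} {b} → All (N._≤ b) (toList ν) → α ∈ perms ν → All (N._≤ b) (toList α)
 entries {ν} {α} h m = PermP.All-resp-↭ (Perm.↭-sym (∈-perms⁻ {ν = ν} {α = α} m)) h

 all-getV : ∀ {Q : ℤ → Set} → Q +0 → ∀ {k} (v : Vec ℤ k) → All Q (toList v) → ∀ i → Q (getV i v)
 all-getV q [] _ i = q
 all-getV q (a ∷ v) (h ∷ hs) zero = h
 all-getV q (a ∷ v) (h ∷ hs) (suc i) = all-getV q v hs i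

 mono-all : ∀ {P : E → Set} {e c} → P e → All (λ t → P (proj₁ t)) (mono e c)
 mono-all h = h ∷ []

 getE-xs : ∀ i e → getE (2 N.+ i) e ≡ getV i (xs e)
 getE-xs i (mkE (_ ∷ _ ∷ v)) = P.refl

 h-symmetrical : ∀ ν → All (N._≤ n) (toList ν) → Symmetrical n (hP ν)
 h-symmetrical ν b = record
   { symmetric = λ k l → σH.hom-ΣL (n N.+ k) _ (perms ν) ◦ ΣL-cong (perms ν) (λ α → reflexive (mapE-mono (σ (n N.+ k)) (hE α) (+ 1) ∙ cong (λ v → mono (mkX +0 +0 v) (+ 1))
       (swapV-++ʳ k (0V {n}) _ ∙ cong (0V V.++_) (P.sym (swapV-map (λ a → + n Z.- + a) k α))))) ◦ perms-swap k ν (λ α → mono (hE α) (+ 1))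
   ; nonneg = all-ΣL (perms ν) (λ α m → mono-all {NonNeg} (bounds (λ a≤n → ZP.i≤j⇒0≤j-i (Z.+≤+ a≤n)) ZP.≤-refl α m))
   ; bounded = λ i → all-ΣL (perms ν) (λ α m → mono-all {λ e → getE (2 N.+ i) e Z.≤ + n} (P.subst (Z._≤ + n) (P.sym (getE-xs i (hE α)))
       (all-getV (Z.+≤+ z≤n) (xs (hE α)) (bounds {λ z → z Z.≤ + n} (λ {a} _ → ZP.i-j≤i (+ n) (+ a)) (Z.+≤+ z≤n) α m) i))) }
   where
   bounds : ∀ {Q : ℤ → Set} → (∀ {a} → a N.≤ n → Q (+ n Z.- + a)) → Q +0 → ∀ α → α ∈ perms ν → All Q (exps (hE α))
   bounds {Q} f z α m = P.subst (All Q) (P.sym (exps-hE α)) (AllP.++⁺ (AllP.replicate⁺ n z) (AllP.map⁺ (All.map f (entries {ν} {α} b m))))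

 h-y : ∀ ν → AllY (hP ν)
 h-y ν = all-ΣL (perms ν) (λ α _ → mono-all {YOnly} (go n (V.map (λ a → + n Z.- + a) α)))
   where go : ∀ {k} m (v : Vec ℤ k) → maskY m (0V {m} V.++ v) ≡ 0V {m} V.++ v
         go zero [] = P.refl
         go zero (_ ∷ _) = P.refl
         go (suc m) v = cong (+0 ∷_) (go m v)

 brk-Σ : ∀ {k} (α : Vec ℕ k) → brk {n} α ≈ ΣL (upTo k) (λ i → qtm (+ (k N.∸ suc i)) (+ nth i (toList α)))
 brk-Σ [] = refl
 brk-Σ {suc k} (b ∷ bs) = reflexive (P.sym (addP-def (qt k b) (brk bs))) ◦ +-congˡ (brk-Σ bs ◦ reflexive (cong (foldr _+_ 0#) (LP.map-upTo _ k ∙ P.sym (LP.map-applyUpTo suc _ k))))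

 upTo-suc : ∀ m (f : ℕ → Poly n) → ΣL (upTo (suc m)) f ≈ f 0 + ΣL (upTo m) (f ∘ suc)
 upTo-suc m f = +-congˡ (reflexive (cong (foldr _+_ 0#) (LP.map-applyUpTo suc f m ∙ P.sym (LP.map-upTo (f ∘ suc) m))))

 qtm-≡ : ∀ {a b c d} → a ≡ c → b ≡ d → qtm a b ≈ qtm c d
 qtm-≡ p q = reflexive (cong₂ qtm p q)

 sub-1 : ∀ a b → (a - 1#) * b ≈ a * b - b
 sub-1 a b = solveR 3 (λ a b o → (a :- o) :* b := a :* b :- o :* b) refl a b 1# ◦ +-congˡ (-‿cong (*-identityˡ b))

 -- Eigenvalues by rows and by columns of a diagram

 colSum : ℕ → ℕ → List ℕ → Poly n
 colSum k zero l = 0#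
 colSum k (suc w) l = qtm (Z.- + k) (+ conjAt l (suc k)) + colSum (suc k) w l

 colSum-++ : ∀ k w w' l → colSum k (w N.+ w') l ≈ colSum k w l + colSum (k N.+ w) w' l
 colSum-++ k zero w' l = reflexive (cong (λ x → colSum x w' l) (P.sym (NP.+-identityʳ k))) ◦ sym (+-identityˡ _)
 colSum-++ k (suc w) w' l = +-congˡ (colSum-++ (suc k) w w' l ◦ +-congˡ (reflexive (cong (λ x → colSum x w' l) (P.sym (NP.+-suc k w))))) ◦ sym (+-assoc _ _ _)

 colSum-above : ∀ k w l → All (N._≤ k) l → (q⁻ - 1#) * colSum k w l ≈ qtm (Z.- + (k N.+ w)) +0 - qtm (Z.- + k) +0
 colSum-above k zero l h = zeroʳ _ ◦ sym (sub-zero (qtm-≡ (cong (λ x → Z.- + x) (NP.+-identityʳ k)) P.refl))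
 colSum-above k (suc w) l h = begin
   (q⁻ - 1#) * (qtm (Z.- + k) (+ conjAt l (suc k)) + colSum (suc k) w l) ≈⟨ distribˡ (q⁻ - 1#) _ _ ◦ +-congʳ (sub-1 q⁻ _) ⟩
   (q⁻ * qtm (Z.- + k) (+ conjAt l (suc k)) - qtm (Z.- + k) (+ conjAt l (suc k))) + (q⁻ - 1#) * colSum (suc k) w l
     ≈⟨ +-cong (+-cong (qtm-* _ _ _ _ ◦ qtm-≡ (step k) c0) (-‿cong (qtm-≡ P.refl c0))) (colSum-above (suc k) w l (All.map NP.m≤n⇒m≤1+n h)) ⟩
   (qtm (Z.- + suc k) +0 - qtm (Z.- + k) +0) + (qtm (Z.- + (suc k N.+ w)) +0 - qtm (Z.- + suc k) +0) ≈⟨ solveR 3 (λ a b c → (a :- b) :+ (c :- a) := c :- b) refl _ _ _ ⟩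
   qtm (Z.- + (suc k N.+ w)) +0 - qtm (Z.- + k) +0 ≈⟨ +-congʳ (qtm-≡ (cong (λ x → Z.- + x) (P.sym (NP.+-suc k w))) P.refl) ⟩
   qtm (Z.- + (k N.+ suc w)) +0 - qtm (Z.- + k) +0 ∎
   where
   c0 : + conjAt l (suc k) ≡ +0
   c0 = cong +_ (conjAt-above l k h)
   step : ∀ k → Z.- + 1 Z.+ Z.- + k ≡ Z.- + suc k
   step k = P.sym (ZP.neg-distrib-+ (+ 1) (+ k))

 colSum-row : ∀ k w a l → k N.+ w N.≤ a → colSum k w (a ∷ l) ≈ tᵘ * colSum k w l
 colSum-row k zero a l h = sym (zeroʳ _)
 colSum-row k (suc w) a l h = +-cong (qtm-≡ P.refl (cong +_ (conjAt-cons-≤ a l (suc k) (NP.≤-trans (NP.m<m+n k (s≤s z≤n)) h))) ◦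
     sym (qtm-* _ _ _ _ ◦ qtm-≡ (ZP.+-identityˡ (Z.- + k)) P.refl)) (colSum-row (suc k) w a l (P.subst (N._≤ a) (NP.+-suc k w) h)) ◦ sym (distribˡ tᵘ _ _)

 rowSum : List ℕ → Poly n
 rowSum [] = 0#
 rowSum (a ∷ l) = qtm (Z.- + a) +0 + tᵘ * rowSum l

 -- Induction on the rows. A new first row of length a lengthens the first a columns by one, which
 -- multiplies their sum by t; the columns to the right are empty, and their geometric sum
 -- telescopes.
 columns-rows : ∀ m l → Sorted l → All (N._≤ m) l → (q⁻ - 1#) * colSum 0 m l ≈ (qtm (Z.- + m) +0 - qtm +0 (+ length l)) + (tᵘ - 1#) * rowSum l
 columns-rows m [] _ _ = colSum-above 0 m [] [] ◦ solveR 3 (λ a b t → a :- b := (a :- b) :+ t :* (b :- b)) refl (qtm (Z.- + m) +0) (qtm +0 +0) (tᵘ - 1#) ◦ +-congˡ (*-congˡ (-‿inverseʳ _))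
 columns-rows m (a ∷ l) (h ∷ s) (a≤m ∷ b) = begin
   k * colSum 0 m (a ∷ l) ≈⟨ *-congˡ (split (a ∷ l) ◦ +-congʳ (colSum-row 0 a a l NP.≤-refl)) ⟩
   k * (tᵘ * C₁ + colSum a w (a ∷ l)) ≈⟨ solveR 5 (λ k t c d e → k :* (t :* c :+ d) := (t :* (k :* (c :+ e)) :+ k :* d) :- t :* (k :* e)) refl k tᵘ C₁ _ C₂ ⟩
   (tᵘ * (k * (C₁ + C₂)) + k * colSum a w (a ∷ l)) - tᵘ * (k * C₂) ≈⟨ +-cong (+-cong (*-congˡ (*-congˡ (sym (split l)) ◦ columns-rows m l s b)) (tail (a ∷ l) (NP.≤-refl ∷ h))) (-‿cong (*-congˡ (tail l h))) ⟩
   (tᵘ * ((M - qtm +0 (+ length l)) + (tᵘ - 1#) * rowSum l) + (M - A)) - tᵘ * (M - A)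
     ≈⟨ solveR 6 (λ t m r p a k → (t :* ((m :- r) :+ k :* p) :+ (m :- a)) :- t :* (m :- a) := (m :- t :* r) :+ ((t :* a :- a) :+ k :* (t :* p))) refl tᵘ M (qtm +0 (+ length l)) (rowSum l) A (tᵘ - 1#) ◦ +-congˡ (+-congʳ (sym (sub-1 tᵘ A)) ◦ sym (distribˡ (tᵘ - 1#) A _)) ⟩
   (M - tᵘ * qtm +0 (+ length l)) + (tᵘ - 1#) * (A + tᵘ * rowSum l) ≈⟨ +-congʳ (+-congˡ (-‿cong (qtm-* +0 (+ 1) +0 (+ length l)))) ⟩
   (M - qtm +0 (+ suc (length l))) + (tᵘ - 1#) * (A + tᵘ * rowSum l) ∎
   where
   k = q⁻ - 1#
   w = m N.∸ a
   a+w : a N.+ w ≡ m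
   a+w = NP.m+[n∸m]≡n a≤m
   M A C₁ C₂ : Poly n
   M = qtm (Z.- + m) +0
   A = qtm (Z.- + a) +0
   C₁ = colSum 0 a l
   C₂ = colSum a w l
   split : ∀ l → colSum 0 m l ≈ colSum 0 a l + colSum a w l
   split l = reflexive (cong (λ x → colSum 0 x l) (P.sym a+w)) ◦ colSum-++ 0 a w l
   tail : ∀ l → All (N._≤ a) l → k * colSum a w l ≈ M - A
   tail l h = colSum-above a w l h ◦ +-congʳ (qtm-≡ (cong (λ x → Z.- + x) a+w) P.refl)

 rowSum-Σ : ∀ l → ΣL (upTo (length l)) (λ i → qtm (Z.- + nth i l) (Z.- + (length l N.∸ suc i))) ≈ qtm +0 (+ 1 Z.- + length l) * rowSum l
 rowSum-Σ [] = sym (zeroʳ _)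
 rowSum-Σ (a ∷ l) = upTo-suc (length l) (λ i → qtm (Z.- + nth i (a ∷ l)) (Z.- + (suc (length l) N.∸ suc i))) ◦ +-cong
     (sym (qtm-* +0 (+ 1 Z.- + suc (length l)) (Z.- + a) +0 ◦ qtm-≡ (ZP.+-identityˡ (Z.- + a)) (aux₁ (+ length l))))
     (rowSum-Σ l ◦ *-congʳ (sym (qtm-* +0 (+ 1 Z.- + suc (length l)) +0 (+ 1) ◦ qtm-≡ P.refl (aux₂ (+ length l)))) ◦ *-assoc _ _ _) ◦
   sym (distribˡ _ _ _)
   where aux₁ = ring50
         aux₂ = ring51

 colSum-Σ : ∀ k w l → colSum k w l ≈ ΣL (upTo w) (λ i → qtm (Z.- + (k N.+ i)) (+ conjAt l (suc (k N.+ i))))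
 colSum-Σ k zero l = refl
 colSum-Σ k (suc w) l = sym (upTo-suc w (λ i → qtm (Z.- + (k N.+ i)) (+ conjAt l (suc (k N.+ i)))) ◦ +-cong (at* (NP.+-identityʳ k))
   (ΣL-cong (upTo w) (λ i → at* (NP.+-suc k i)) ◦ sym (colSum-Σ (suc k) w l)))
   where at* : ∀ {x y} → x ≡ y → qtm (Z.- + x) (+ conjAt l (suc x)) ≈ qtm (Z.- + y) (+ conjAt l (suc y))
         at* e = reflexive (cong (λ x → qtm (Z.- + x) (+ conjAt l (suc x))) e)

 Π-qtm : ∀ {A : Set} a b (l : List A) → Π (map (λ _ → qtm a b) l) ≈ qtm (a Z.* + length l) (b Z.* + length l)
 Π-qtm a b [] = sym (qtm-≡ (ZP.*-zeroʳ a) (ZP.*-zeroʳ b))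
 Π-qtm a b (x ∷ l) = *-congˡ (Π-qtm a b l) ◦ qtm-* a b _ _ ◦ qtm-≡ (P.sym (ZP.*-suc a (+ length l))) (P.sym (ZP.*-suc b (+ length l)))

 nth-applyUpTo : ∀ (g : ℕ → ℕ) i m → i N.< m → nth i (applyUpTo g m) ≡ g i
 nth-applyUpTo g zero (suc m) _ = P.refl
 nth-applyUpTo g (suc i) (suc m) (s≤s l) = nth-applyUpTo (g ∘ suc) i m l

 -- On y^ρ y^(n-α) the y operator has the eigenvalue with terms q^(-i) t^(αᵢ - n), i from 0, whereas
 -- [|α|] has the terms q^(n-1-i) t^(αᵢ); this monomial is the ratio.
 corner : Poly n
 corner = qtm (+ 1 Z.- + n) (Z.- + n)

 corner-brk : ∀ (α : Vec ℕ n) → ΣL (upTo n) (λ i → qtm (Z.- + i) (Z.- + n Z.+ + nth i (toList α))) ≈ corner * brk α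
 corner-brk α = sym (*-congˡ (brk-Σ α) ◦ sym (ΣL-*ˡ corner _ (upTo n)) ◦ ΣL-cong' (upTo n) (λ i m → qtm-* _ _ _ _ ◦
   qtm-≡ (cong (λ k → (+ 1 Z.- + k) Z.+ + (n N.∸ suc i)) (P.sym (NP.m+[n∸m]≡n (MemP.∈-upTo⁻ m))) ∙ ring52 (+ i) (+ (n N.∸ suc i))) P.refl))

 dualEig : List ℕ → Poly n
 dualEig l = ΣL xVars (λ i → qtm (Z.- + nth i l) (Z.- δ i))

 -- Here the conjugate partition enters. The scalar of `adjoint` is built from the rows of λ, and
 -- `columns-rows` rewrites it as the y eigenvalue that belongs to α = λ'.
 weight-columns : ∀ {d la} → Part n d la → (total - 1#) - (t⁻ - 1#) * dualEig (padL n la) ≈ (q⁻ - 1#) * (corner * brk (pad n (conj la)))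
 weight-columns {d} {la} p = begin
   (total - 1#) - (t⁻ - 1#) * dualEig l ≈⟨ +-cong (+-congʳ tot) (-‿cong (*-congˡ (reflexive (cong (λ m → ΣL (upTo m) (λ i → qtm (Z.- + nth i l) (Z.- + (m N.∸ suc i)))) (P.sym len)) ◦ rowSum-Σ l ◦ *-congʳ (qtm-≡ P.refl (cong (λ m → + 1 Z.- + m) len))))) ⟩
   (tn * M - 1#) - (t⁻ - 1#) * (B * rowSum l) ≈⟨ solveR 5 (λ z o t b r → (z :- o) :- (t :- o) :* (b :* r) := (z :- o) :+ (o :* b :- t :* b) :* r) refl (tn * M) 1# t⁻ B (rowSum l) ⟩
   (tn * M - 1#) + (1# * B - t⁻ * B) * rowSum l ≈⟨ +-cong (+-congˡ (-‿cong (sym (qtm-* +0 (Z.- + n) +0 (+ n) ◦ qtm-≡ P.refl (ZP.+-inverseˡ (+ n))))))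
       (*-congʳ (+-cong (*-identityˡ B ◦ sym (qtm-* +0 (Z.- + n) +0 (+ 1) ◦ qtm-≡ P.refl (aux₁ (+ n)))) (-‿cong (qtm-* +0 -1ℤ +0 (+ 1 Z.- + n) ◦ qtm-≡ P.refl (aux₂ (+ n)))))) ⟩
   (tn * M - tn * qtm +0 (+ n)) + (tn * tᵘ - tn) * rowSum l ≈⟨ solveR 5 (λ a m b t r → (a :* m :- a :* b) :+ (a :* t :- a) :* r := a :* ((m :- b) :+ (t :* r :- r))) refl tn M _ tᵘ (rowSum l) ◦ *-congˡ (+-congˡ (sym (sub-1 tᵘ (rowSum l)))) ⟩
   tn * ((M - qtm +0 (+ n)) + (tᵘ - 1#) * rowSum l) ≈⟨ *-congˡ (sym (columns-rows n l (PartP.sorted p) (PartP.bounded p) ◦ +-congʳ (+-congˡ (-‿cong (qtm-≡ P.refl (cong +_ len)))))) ⟩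
   tn * (k * colSum 0 n l) ≈⟨ x∙yz≈y∙xz tn k _ ⟩
   k * (tn * colSum 0 n l) ≈⟨ *-congˡ (*-congˡ (colSum-Σ 0 n l) ◦ sym (ΣL-*ˡ tn _ (upTo n)) ◦ ΣL-cong' (upTo n) (λ i m → qtm-* _ _ _ _ ◦ qtm-≡ (ZP.+-identityˡ (Z.- + i)) (cong (λ c → Z.- + n Z.+ + c) (column i m))) ◦
         corner-brk (pad n (conj la))) ⟩
   k * (corner * brk (pad n (conj la))) ∎
   where
   l = padL n la
   k = q⁻ - 1#
   len : length l ≡ n
   len = length-≡n (pad n la)
   M tn B : Poly n
   M = qtm (Z.- + n) +0
   tn = qtm +0 (Z.- + n)
   B = qtm +0 (+ 1 Z.- + n)
   tot : total ≈ tn * M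
   tot = *-cong (Π-qtm +0 -1ℤ xVars ◦ qtm-≡ P.refl (cong (λ m → Z.- + 1 Z.* + m) (LP.length-upTo n) ∙ ZP.-1*i≡-i (+ n)))
     (Π-qtm -1ℤ +0 yVars ◦ qtm-≡ (cong (λ m → Z.- + 1 Z.* + m) (LP.length-map (n N.+_) (upTo n) ∙ LP.length-upTo n) ∙ ZP.-1*i≡-i (+ n)) P.refl)
   aux₁ = ring53
   aux₂ = ring54
   column : ∀ i → i ∈ upTo n → conjAt l (suc i) ≡ nth i (padL n (conj la))
   column i m = ConjP.conjAt-padL p i ∙ P.sym (cong (nth i) (ConjP.columns p) ∙ nth-applyUpTo _ i n (MemP.∈-upTo⁻ m))

 module Annihilate {d : ℕ} {la : List ℕ} (pl : Part n d la) (J : Poly n) (symJ : Symmetrical 0 J) (J-x : AllX J)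
   (dual : ΣL xVars (λ j → Δt⁻ j * T -1ℤ j J) ≈ dualEig (padL n la) * (Δ * J)) where

   -- `adjoint-ρ` with h = `hP ν` equates two sums over the permutations α of ν, one weighted by the
   -- y eigenvalue of α and the other by that of λ'. Their difference is the claim times q⁻¹ - 1 and
   -- `corner`, both regular.
   annihilated : ∀ ν → All (N._≤ n) (toList ν) → ΣL (perms ν) (λ α → ψ (mono (rhoE α) (+ 1) * J) * (brk (pad n (conj la)) - brk α)) ≈ 0#
   annihilated ν bν = cancelR (regular-* (regular-1-qtm -1ℤ +0 (inj₁ (λ ()))) (regular-qtm _ _)) ((begin
     (k * corner) * ΣL (perms ν) (λ α → Φ α * (bλ - brk α)) ≈⟨ *-congˡ (ΣL-cong (perms ν) (λ α → solveR 3 (λ f a b → f :* (a :- b) := a :* f :+ (:- b) :* f) refl (Φ α) bλ (brk α)) ◦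
         ΣL-+ _ _ (perms ν) ◦ +-congʳ (ΣL-*ˡ bλ Φ (perms ν))) ⟩
     (k * corner) * (bλ * ΣL (perms ν) Φ + ΣL (perms ν) (λ α → - brk α * Φ α)) ≈⟨ solveR 5 (λ k c b s r → (k :* c) :* (b :* s :+ r) := (k :* (c :* b)) :* s :+ k :* (c :* r)) refl k corner bλ _ _ ⟩
     (k * (corner * bλ)) * ΣL (perms ν) Φ + k * (corner * ΣL (perms ν) (λ α → - brk α * Φ α))
       ≈⟨ +-cong (*-congʳ (sym (weight-columns pl)) ◦ *-congˡ (sym right*) ◦ sym adjoint-ρ ◦ *-congˡ left*) (*-congˡ (sym (ΣL-*ˡ corner _ (perms ν)) ◦ ΣL-cong (perms ν) (λ α → solveR 3 (λ c b f → c :* ((:- b) :* f) := (:- (c :* b)) :* f) refl corner (brk α) (Φ α)))) ⟩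
     k * ΣL (perms ν) (λ α → (corner * brk α) * Φ α) + k * ΣL (perms ν) (λ α → - (corner * brk α) * Φ α) ≈⟨ sym (distribˡ k _ _) ◦ *-congˡ (sym (ΣL-+ _ _ (perms ν)) ◦ ΣL-cong (perms ν) (λ α → solveR 2 (λ b f → b :* f :+ (:- b) :* f := (b :- b) :* f) refl (corner * brk α) (Φ α)) ◦ ΣL-cong (perms ν) (λ α → *-congʳ (-‿inverseʳ _) ◦ zeroˡ _)) ⟩
     k * ΣL (perms ν) (λ _ → 0#) ≈⟨ *-congˡ (ΣL-0 (perms ν)) ⟩
     k * 0# ≈⟨ zeroʳ k ⟩
     0# ∎) ◦ sym (zeroʳ _))
     where
     k = q⁻ - 1#
     bλ : Poly n
     bλ = brk (pad n (conj la))
     Φ : Vec ℕ n → Poly n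
     Φ α = ψ (mono (rhoE α) (+ 1) * J)
     h = hP ν
     open Adjoint J h symJ J-x (h-symmetrical ν bν) (h-y ν) (dualEig (padL n la)) (xf-ΣL xVars (λ i → xf-qtm _ _)) dual using (adjoint-ρ)
     ry : Poly n
     ry = mono ρyE (+ 1)
     assemble : ∀ α → mono ρxE (+ 1) * (J * (ry * mono (hE α) (+ 1))) ≈ mono (rhoE α) (+ 1) * J
     assemble α = solveR 3 (λ a b c → a :* (b :* c) := (a :* c) :* b) refl _ J _ ◦ *-congʳ (*-congˡ (mono-* _ _ (+ 1) (+ 1)) ◦ mono-* _ _ (+ 1) (+ 1) ◦ reflexive (cong (λ e → mono e (+ 1)) (P.sym (ρ-factor α))))
     expand : ∀ {A : Set} (l : List A) (w : A → Poly n) (m : A → Poly n) → (∀ a → XF (w a)) → ψ (mono ρxE (+ 1) * (J * ΣL l (λ a → w a * m a))) ≈ ΣL l (λ a → w a * ψ (mono ρxE (+ 1) * (J * m a)))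
     expand l w m xf = ψ-cong (*-congˡ (sym (ΣL-*ˡ J _ l)) ◦ sym (ΣL-*ˡ _ _ l) ◦ ΣL-cong l (λ a → solveR 4 (λ r j w m → r :* (j :* (w :* m)) := w :* (r :* (j :* m))) refl _ J (w a) (m a))) ◦
       ψ-ΣL _ l ◦ ΣL-cong l (λ a → ψ-XF (xf a) _)
     right* : ψ (mono ρxE (+ 1) * (J * (ry * h))) ≈ ΣL (perms ν) Φ
     right* = ψ-cong (*-congˡ (*-congˡ (sym (ΣL-*ˡ ry _ (perms ν)) ◦ ΣL-cong (perms ν) (λ α → sym (*-identityˡ _))))) ◦
       expand (perms ν) (λ _ → 1#) (λ α → ry * mono (hE α) (+ 1)) (λ _ → P.refl ∷ []) ◦ ΣL-cong (perms ν) (λ α → *-identityˡ _ ◦ ψ-cong (assemble α))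
     w : ℕ → Vec ℕ n → Poly n
     w i α = qtm (Z.- + i) (Z.- + n Z.+ + nth i (toList α))
     -- The q-shift acts on y^ρ alone and the t-shift on y^(n-α) alone. So each summand is only
     -- multiplied by q^(-i) t^(αᵢ - n).
     term : ∀ i → i ∈ upTo n → T -1ℤ (n N.+ i) ry * S -1ℤ (n N.+ i) h ≈ ΣL (perms ν) (λ α → w i α * (ry * mono (hE α) (+ 1)))
     term i m = *-congˡ (SH.hom-ΣL -1ℤ (n N.+ i) _ (perms ν)) ◦ sym (ΣL-*ˡ _ _ (perms ν)) ◦ ΣL-cong (perms ν) (λ α →
       *-cong (T-mono -1ℤ (n N.+ i) ρyE (+ 1)) (S-mono -1ℤ (n N.+ i) (hE α) (+ 1)) ◦ solveR 4 (λ a b c d → (a :* b) :* (c :* d) := (a :* c) :* (b :* d)) refl _ ry _ _ ◦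
         *-congʳ (qtm-* _ _ _ _ ◦ qtm-≡ (cong (λ z → Z.- + 1 Z.* z Z.+ +0) at-ρ ∙ aux₁ (+ i)) (cong (λ z → +0 Z.+ Z.- + 1 Z.* z) (at-h α) ∙ aux₂ (+ n) (+ nth i (toList α)))))
       where
       i<n = MemP.∈-upTo⁻ m
       skip : ∀ s → getL (n N.+ i) (oL ++ s) ≡ getL i s
       skip s = cong (λ k → getL (k N.+ i) (oL ++ s)) (P.sym length-oL) ∙ getL-skip i oL s
       at-ρ : getV (n N.+ i) (xs ρyE) ≡ + i
       at-ρ = getV-toList (n N.+ i) (xs ρyE) ∙ cong (getL (n N.+ i)) exps-ρy ∙ skip (iv +0 n) ∙ getL-iv 0 i n i<n
       at-h : ∀ α → getV (n N.+ i) (xs (hE α)) ≡ + n Z.- + nth i (toList α)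
       at-h α = getV-toList (n N.+ i) (xs (hE α)) ∙ cong (getL (n N.+ i)) (exps-hE α) ∙ skip _ ∙ getL-map (λ a → + n Z.- + a) i (toList α) (P.subst (i N.<_) (P.sym (length-≡n α)) i<n)
       aux₁ = ring55
       aux₂ = ring56
     left* : ψ (mono ρxE (+ 1) * (J * ΣL yVars (λ j → T -1ℤ j ry * S -1ℤ j h))) ≈ ΣL (perms ν) (λ α → (corner * brk α) * Φ α)
     left* = ψ-cong (*-congˡ (*-congˡ (ΣL-map (n N.+_) _ (upTo n) ◦ ΣL-cong' (upTo n) term ◦ ΣL-swap _ (upTo n) (perms ν) ◦ ΣL-cong (perms ν) (λ α → ΣL-*ʳ _ _ (upTo n))))) ◦
       expand (perms ν) (λ α → ΣL (upTo n) (λ i → w i α)) (λ α → ry * mono (hE α) (+ 1)) (λ α → xf-ΣL (upTo n) (λ i → xf-qtm _ _)) ◦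
         ΣL-cong (perms ν) (λ α → *-cong (corner-brk α) (ψ-cong (assemble α)))

 -- The defining conditions
 ΣL-zero : {A : Set} {f : A → Poly n} (l : List A) → (∀ a → a ∈ l → f a ≈ 0#) → ΣL l f ≈ 0#
 ΣL-zero l h = ΣL-cong' l h ◦ ΣL-0 l

 ΣL-single : {A : Set} {f : A → Poly n} {a : A} {l : List A} → Unique l → a ∈ l → (∀ b → b ∈ l → b ≢ a → f b ≈ 0#) → ΣL l f ≈ f a
 ΣL-single (u ∷ us) (here P.refl) h = +-congˡ (ΣL-zero _ (λ b m → h b (there m) (All.lookup u m ∘ P.sym))) ◦ +-identityʳ _
 ΣL-single (u ∷ us) (there m) h = +-cong (h _ (here P.refl) (All.lookup u m)) (ΣL-single us m (λ b m' → h b (there m'))) ◦ +-identityˡ _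

 sumP-def : (ps : List (Poly n)) → foldr _+_ 0# ps ≡ sumP ps
 sumP-def [] = P.refl
 sumP-def (p ∷ ps) = addP-def p _ ∙ cong (p ++_) (sumP-def ps)

 prodP-def : (ps : List (Poly n)) → Π ps ≡ prodP ps
 prodP-def [] = P.refl
 prodP-def (p ∷ ps) = mulP-def p _ ∙ cong (p *P_) (prodP-def ps)

 sub-def : (p r : Poly n) → p - r ≡ p -P r
 sub-def p r = addP-def p (- r) ∙ cong (p ++_) (oppP-def r)

 mS : List ℕ → Poly n
 mS mu = ΣL (perms (pad n mu)) (λ β → mono (xβE β) (+ 1))

 mSym-def : ∀ mu → mS mu ≡ mSym n mu
 mSym-def mu = sumP-def (map (xMono n) (perms (pad n mu)))

 record Good (p : Poly n) : Set where
   field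
     sym' : Symmetrical 0 p
     only : AllX p
   open Symmetrical sym' public

 good-+ : ∀ {p r} → Good p → Good r → Good (p + r)
 good-+ {p} {r} g h = record { sym' = record
   { symmetric = λ k l → σH.hom-+ k p r ◦ +-cong (Good.symmetric g k l) (Good.symmetric h k l)
   ; nonneg = all-+ (Good.nonneg g) (Good.nonneg h) ; bounded = λ i → Coord.top-+ (2 N.+ i) (Good.bounded g i) (Good.bounded h i) }
   ; only = all-+ (Good.only g) (Good.only h) }

 good-*ˡ : ∀ {c p} → XF c → Good p → Good (c * p)
 good-*ˡ {c} {p} xf g = record { sym' = record
   { symmetric = λ k l → σH.hom-* k c p ◦ *-cong (σP-AllY k l (allY-XF xf)) (Good.symmetric g k l)
   ; nonneg = all-* {NonNeg} {NonNeg} {NonNeg} (λ {e} {e'} → nonneg-⊕ e e') (All.map (λ {t} h → P.subst (λ v → All (+0 Z.≤_) (toList v)) (P.sym h) (All.map (λ { P.refl → ZP.≤-refl }) (zeros N))) xf) (Good.nonneg g)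
   ; bounded = λ i → Coord.top-* (2 N.+ i) (All.map (λ {t} h → ZP.≤-reflexive (getE-xs i (proj₁ t) ∙ cong (getV i) h ∙ getV-0 N i)) xf) (Good.bounded g i) }
   ; only = allX-* (allX-XF xf) (Good.only g) }

 good-0 : Good 0#
 good-0 = record { sym' = record { symmetric = λ k l → σH.hom-0 k ; nonneg = [] ; bounded = λ i → [] } ; only = [] }

 good-ΣL : {A : Set} (l : List A) {f : A → Poly n} → All (Good ∘ f) l → Good (ΣL l f)
 good-ΣL [] h = good-0
 good-ΣL (a ∷ l) (h ∷ hs) = good-+ h (good-ΣL l hs)

 xβE-only : ∀ β → XOnly (xβE β)
 xβE-only β = go (V.map +_ β)
   where go : ∀ {m k} (v : Vec ℤ m) → maskX m (v V.++ 0V {k}) ≡ v V.++ 0V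
         go [] = maskX-0 0
         go (a ∷ v) = cong (a ∷_) (go v)

 -- The grading on x^β is the statistic that grows strictly in dominance order; for this reason the
 -- partitions below λ do not reach the leading form of J.
 gr-xβE : ∀ β → gr (xβE β) ≡ + wN (toList β)
 gr-xβE β = go β 0V
   where go : ∀ {m k} (β : Vec ℕ m) (w : Vec ℤ k) → sumW m (λ k → getV k (V.map +_ β V.++ w)) ≡ + wN (toList β)
         go [] w = P.refl
         go {suc m} (b ∷ β) w = cong₂ Z._+_ (P.sym (ZP.pos-* m b)) (go β w) ∙ cong (λ l → + (l N.* b N.+ wN (toList β))) (P.sym (VP.length-toList β))

 good-mS : ∀ {d mu} → Part n d mu → Good (mS mu)
 good-mS {d} {mu} p = record { sym' = record
   { symmetric = λ k l → σH.hom-ΣL k _ ps ◦ ΣL-cong ps (λ β → reflexive (mapE-mono (σ k) (xβE β) (+ 1) ∙ cong (λ v → mono (mkX +0 +0 v) (+ 1))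
       (swapV-++ˡ k (V.map +_ β) (0V {n}) l ∙ cong (V._++ 0V) (P.sym (swapV-map +_ k β))))) ◦ perms-swap k (pad n mu) (λ β → mono (xβE β) (+ 1))
   ; nonneg = all-ΣL ps (λ β m → mono-all {NonNeg} (bounds (λ _ → Z.+≤+ z≤n) ZP.≤-refl β m))
   ; bounded = λ i → all-ΣL ps (λ β m → mono-all {λ e → getE (2 N.+ i) e Z.≤ + n} (P.subst (Z._≤ + n) (P.sym (getE-xs i (xβE β)))
       (all-getV (Z.+≤+ z≤n) (xs (xβE β)) (bounds {λ z → z Z.≤ + n} Z.+≤+ (Z.+≤+ z≤n) β m) i))) }
   ; only = all-ΣL ps (λ β _ → mono-all {XOnly} (xβE-only β)) }
   where
   ps = perms (pad n mu)
   bounds : ∀ {Q : ℤ → Set} → (∀ {a} → a N.≤ n → Q (+ a)) → Q +0 → ∀ β → β ∈ ps → All Q (exps (xβE β))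
   bounds {Q} f z β m = P.subst (All Q) (P.sym (exps-xβE β)) (AllP.++⁺ (AllP.map⁺ (All.map f (entries {pad n mu} {β} (PartP.bounded p) m))) (AllP.replicate⁺ n z))

 top-mS : ∀ {d mu} → Part n d mu → Top (+ wN (padL n mu)) (mS mu)
 top-mS {d} {mu} p = all-ΣL (perms (pad n mu)) (λ β m → mono-all {λ e → gr e Z.≤ + wN (padL n mu)} (P.subst (Z._≤ + wN (padL n mu)) (P.sym (gr-xβE β)) (Z.+≤+ (rearrange (PartP.sorted p) (∈-perms⁻ {ν = pad n mu} {α = β} m)))))

 comp-below : ∀ {g p} → All (λ t → gr (proj₁ t) Z.< g) p → comp g p ≈ 0#
 comp-below {g} {p} h .app f = lin-keep (at g) f p ∙ lin-congAll h (λ e _ l → off e l) ∙ lin-0 p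
   where off : ∀ e → gr e Z.< g → (if at g e then f e else +0) ≡ +0
         off e l with gr e Z.≟ g
         ... | yes eq = ⊥-elim (ZP.<-irrefl eq l)
         ... | no _ = P.refl

 comp-at : ∀ e c → comp (gr e) (mono e c) ≈ mono e c
 comp-at e c .app f = lin-keep (at (gr e)) f (mono e c) ∙ lin-mono (λ a → if at (gr e) a then f a else +0) e c ∙ cong (c Z.*_) on ∙ P.sym (lin-mono f e c)
   where on : (if at (gr e) e then f e else +0) ≡ f e
         on with gr e Z.≟ gr e
         ... | yes _ = P.refl
         ... | no ne = ⊥-elim (ne P.refl)

 lamE : List ℕ → E
 lamE la = xβE (pad n la)

 -- Among the rearrangements of λ only λ itself, being sorted, attains the largest degree.
 comp-mS : ∀ {d la} → Part n d la → comp (gr (lamE la)) (mS la) ≈ mono (lamE la) (+ 1)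
 comp-mS {d} {la} p = comp-ΣL (gr (lamE la)) _ (perms (pad n la)) ◦ ΣL-single (perms-unique (pad n la)) (∈-perms⁺ {ν = pad n la} {α = pad n la} Perm.refl)
   (λ β m ne → comp-below (mono-all {λ e → gr e Z.< gr (lamE la)} (P.subst₂ Z._<_ (P.sym (gr-xβE β)) (P.sym (gr-xβE (pad n la))) (Z.+<+ (NP.≤∧≢⇒< (rearrange (PartP.sorted p) (∈-perms⁻ {ν = pad n la} {α = β} m))
     (λ e → ne (toList-≡ (rearrange-≡ (PartP.sorted p) (∈-perms⁻ {ν = pad n la} {α = β} m) e)))))))) ◦
   comp-at (lamE la) (+ 1)

 comp-mS-below : ∀ {d la mu} → Part n d la → Part n d mu → mu ◁ la → comp (gr (lamE la)) (mS mu) ≈ 0#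
 comp-mS-below {d} {la} {mu} p q b = comp-below (All.map (λ h → ZP.≤-<-trans h (P.subst (Z._<_ _) (P.sym (gr-xβE (pad n la))) (Z.+<+ (below-wN p q b)))) (top-mS q))

 XFree-XF : ∀ {p} → XFree p → XF p
 XFree-XF = All.map (λ {t} h → getV-ext _ 0V (λ j → P.sym (getE-xs j (proj₁ t)) ∙ h j ∙ P.sym (getV-0 N j)))

 xf-Πall : ∀ {ps} → All XF ps → XF (Π ps)
 xf-Πall [] = P.refl ∷ []
 xf-Πall (h ∷ hs) = xf-* h (xf-Πall hs)

 xf-cPoly : ∀ la → XF (cPoly n la)
 xf-cPoly la = P.subst XF (prodP-def (cFactors n la 1 la)) (xf-Πall (go la 1 la))
   where
   go : ∀ la i l → All XF (cFactors n la i l)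
   go la i [] = []
   go la i (a ∷ l) = AllP.++⁺ (AllP.map⁺ (All.universal (λ j → P.subst XF (sub-def 1P (qt (a N.∸ j) (suc (conjAt la j) N.∸ i))) (xf-+ (P.refl ∷ []) (xf-neg (xf-qtm (+ (a N.∸ j)) (+ (suc (conjAt la j) N.∸ i)))))) (oneTo a))) (go la (suc i) l)

 Tq-T : ∀ i p → Tq (suc i) p ≈ T (+ 1) i p
 Tq-T i p .app f = go p ∙ P.sym (lin-mapE (qScale (+ 1) i) f p)
   where
   same : ∀ e → setE 0 (getE 0 e Z.+ getE (2 N.+ i) e) e ≡ qScale (+ 1) i e
   same (mkE (q ∷ t ∷ v)) = cong (λ z → mkX (q Z.+ z) t v) (P.sym (ZP.*-identityˡ (getV i v)))
   go : ∀ p → lin f (Tq (suc i) p) ≡ lin (f ∘ qScale (+ 1) i) p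
   go [] = P.refl
   go ((e , c) ∷ p) = cong₂ (λ x y → c Z.* f x Z.+ y) (same e) (go p)

 indexed-Σ : ∀ (g : ℕ → ℕ → Poly n) k l → ΣL (indexed k l) (λ { (i , a) → g i a }) ≈ ΣL (upTo (length l)) (λ i → g (k N.+ i) (nth i l))
 indexed-Σ g k [] = refl
 indexed-Σ g k (a ∷ l) = sym (upTo-suc (length l) (λ i → g (k N.+ i) (nth i (a ∷ l))) ◦ +-cong (reflexive (cong (λ x → g x a) (NP.+-identityʳ k)))
   (ΣL-cong (upTo (length l)) (λ i → reflexive (cong (λ x → g x (nth i l)) (NP.+-suc k i))) ◦ sym (indexed-Σ g (suc k) l)))

 eigenvalue-tSum : ∀ la → eigenvalue n la ≈ tSum n (λ i → + nth i (padL n la))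
 eigenvalue-tSum la = reflexive (P.sym (sumP-def (map (λ { (i , a) → qt a (n N.∸ suc i) }) (indexed 0 (padL n la))))) ◦ indexed-Σ (λ i a → qt a (n N.∸ suc i)) 0 (padL n la) ◦ reflexive (cong (λ m → ΣL (upTo m) (λ i → qtm (+ nth i (padL n la)) (+ (n N.∸ suc i)))) (length-≡n (pad n la)))

 pairsOf : List ℕ → List (ℕ × ℕ)
 pairsOf [] = []
 pairsOf (a ∷ l) = map (a ,_) l ++ pairsOf l

 pairsIn-pairsOf : pairsIn n ≡ pairsOf (oneTo n)
 pairsIn-pairsOf = (cong (concatMap pairRow) (cong (map suc) (upFrom-applyUpTo 0 n)) ∙ go 0 n P.refl) ∙ cong (pairsOf ∘ map suc) (P.sym (upFrom-applyUpTo 0 n))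
   where
   pairRow : ℕ → List (ℕ × ℕ)
   pairRow i = map (λ j → (i , j)) (map (i N.+_) (oneTo (n N.∸ i)))
   shift : ∀ i m k → map (i N.+_) (map suc (upFrom k m)) ≡ map suc (upFrom (i N.+ k) m)
   shift i zero k = P.refl
   shift i (suc m) k = cong₂ _∷_ (NP.+-suc i k) (shift i m (suc k) ∙ cong (λ z → map suc (upFrom z m)) (NP.+-suc i k))
   go : ∀ k m → k N.+ m ≡ n → concatMap pairRow (map suc (upFrom k m)) ≡ pairsOf (map suc (upFrom k m))
   go k zero _ = P.refl
   go k (suc m) e = cong₂ _++_ (cong (map (suc k ,_)) (cong (λ z → map (suc k N.+_) (map suc z)) (cong upTo rest ∙ upFrom-applyUpTo 0 m) ∙ shift (suc k) m 0 ∙ cong (λ z → map suc (upFrom z m)) (NP.+-identityʳ (suc k))))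
     (go (suc k) m (P.sym (NP.+-suc k m) ∙ e))
     where rest : n N.∸ suc k ≡ m
           rest = cong (N._∸ suc k) (P.sym (P.sym (NP.+-suc k m) ∙ e)) ∙ NP.m+n∸m≡n (suc k) m

 diff : ℕ × ℕ → Poly n
 diff (i , j) = xP i -P xP j

 pairs-V : ∀ l → prodP (map diff (pairsOf (map suc l))) ≈ V l
 pairs-V l = reflexive (P.sym (prodP-def (map diff (pairsOf (map suc l))))) ◦ go l
   where
   go : ∀ l → Π (map diff (pairsOf (map suc l))) ≈ V l
   go [] = refl
   go (a ∷ l) = reflexive (cong Π (LP.map-++ diff (map (suc a ,_) (map suc l)) (pairsOf (map suc l)))) ◦ Π-++ (map diff (map (suc a ,_) (map suc l))) _ ◦
     *-cong (reflexive (cong Π (P.sym (LP.map-∘ (map suc l)) ∙ P.sym (LP.map-∘ l))) ◦ Π-cong l (λ b → reflexive (P.sym (sub-def (X a) (X b))))) (go l)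

 keeps : ℕ → ℕ → Bool
 keeps i j = not (j N.≡ᵇ i)

 keeps-≢ : ∀ i j → i ≢ j → keeps (suc i) (suc j) ≡ true
 keeps-≢ i j ne with j N.≡ᵇ i in eq
 ... | true = ⊥-elim (ne (P.sym (NP.≡ᵇ⇒≡ j i (P.subst Data.Bool.T (P.sym eq) tt))))
 ... | false = P.refl

 keeps-self : ∀ i → keeps (suc i) (suc i) ≡ false
 keeps-self i = cong not (≡ᵇ-refl i)

 filter-true : ∀ {A : Set} (f : A → Bool) x l → f x ≡ true → L.filterᵇ f (x ∷ l) ≡ x ∷ L.filterᵇ f l
 filter-true f x l h rewrite h = P.refl

 filter-false : ∀ {A : Set} (f : A → Bool) x l → f x ≡ false → L.filterᵇ f (x ∷ l) ≡ L.filterᵇ f l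
 filter-false f x l h rewrite h = P.refl

 filter-all : ∀ i l → All (i ≢_) l → L.filterᵇ (keeps (suc i)) (map suc l) ≡ map suc l
 filter-all i [] _ = P.refl
 filter-all i (a ∷ l) (h ∷ hs) = filter-true (keeps (suc i)) (suc a) (map suc l) (keeps-≢ i a h) ∙ cong (suc a ∷_) (filter-all i l hs)

 filter-one : ∀ i p s → All (i ≢_) (p ++ s) → L.filterᵇ (keeps (suc i)) (map suc (p ++ i ∷ s)) ≡ map suc (p ++ s)
 filter-one i [] s h = filter-false (keeps (suc i)) (suc i) (map suc s) (keeps-self i) ∙ filter-all i s h
 filter-one i (a ∷ p) s (h ∷ hs) = filter-true (keeps (suc i)) (suc a) (map suc (p ++ i ∷ s)) (keeps-≢ i a h) ∙ cong (suc a ∷_) (filter-one i p s hs)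

 filter-++ᵇ : ∀ {A : Set} (f : A → Bool) l m → L.filterᵇ f (l ++ m) ≡ L.filterᵇ f l ++ L.filterᵇ f m
 filter-++ᵇ f l m = LP.filter-++ _ l m

 filter-pairs : ∀ (f : ℕ → Bool) l → L.filterᵇ (λ { (j , k) → f j ∧ f k }) (pairsOf l) ≡ pairsOf (L.filterᵇ f l)
 filter-pairs f [] = P.refl
 filter-pairs f (a ∷ l) = filter-++ᵇ _ (map (a ,_) l) (pairsOf l) ∙ cong₂ _++_ (filterRow l) (filter-pairs f l) ∙ merge
   where
   filterRow : ∀ l → L.filterᵇ (λ { (j , k) → f j ∧ f k }) (map (a ,_) l) ≡ (if f a then map (a ,_) (L.filterᵇ f l) else [])
   filterRow [] with f a
   ... | true = P.refl
   ... | false = P.refl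
   filterRow (b ∷ l) with f a | filterRow l
   ... | false | e = e
   ... | true | e with f b
   ...   | true = cong ((a , b) ∷_) e
   ...   | false = e
   merge : (if f a then map (a ,_) (L.filterᵇ f l) else []) ++ pairsOf (L.filterᵇ f l) ≡ pairsOf (L.filterᵇ f (a ∷ l))
   merge with f a
   ... | true = P.refl
   ... | false = P.refl

 -- Splitting the variables at i turns Vᵢ into the Vandermonde product of the others, with one sign
 -- for each variable before i. Times the numerator of Aᵢ this is `S-V`, the expansion of Δ with xᵢ
 -- scaled by t.
 operator-Δt : ∀ i → i ∈ upTo n → numAi n (suc i) *P Vi n (suc i) ≈ Δt i
 operator-Δt i m with MemP.∈-∃++ m
 ... | p , s , e = reflexive (P.sym (mulP-def (numAi n (suc i)) (Vi n (suc i)))) ◦ *-cong num Vi≈ ◦ x∙yz≈y∙xz _ (sgn p) _ ◦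
     sym (reflexive (cong (S (+ 1) i ∘ V) e) ◦ S-V (+ 1) p i s uniq (NP.<-≤-trans (MemP.∈-upTo⁻ m) n≤N))
   where
   uniq : Unique (p ++ i ∷ s)
   uniq = P.subst Unique e xVars-unique
   others : All (i ≢_) (p ++ s)
   others = unique-split p i s uniq
   filtered : L.filterᵇ (keeps (suc i)) (oneTo n) ≡ map suc (p ++ s)
   filtered = cong (L.filterᵇ (keeps (suc i)) ∘ map suc) e ∙ filter-one i p s others
   num : numAi n (suc i) ≈ Π (map (λ j → qtm +0 (+ 1) * X i - X j) (p ++ s))
   num = reflexive (P.sym (prodP-def (map (λ j → tP *P xP (suc i) -P xP j) (L.filterᵇ (keeps (suc i)) (oneTo n))))) ◦ reflexive (cong (λ l → Π (map (λ j → tP *P xP (suc i) -P xP j) l)) filtered) ◦ reflexive (cong Π (P.sym (LP.map-∘ (p ++ s)))) ◦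
     Π-cong (p ++ s) (λ j → reflexive (P.sym (sub-def (tP *P X i) (X j)) ∙ cong (_- X j) (P.sym (mulP-def tP (X i)))))
   position : ∀ k m p → p ++ i ∷ s ≡ upFrom k m → k N.+ length p ≡ i
   position k (suc m) [] eq = NP.+-identityʳ k ∙ P.sym (LP.∷-injectiveˡ eq)
   position k (suc m) (x ∷ p) eq = NP.+-suc k (length p) ∙ position (suc k) m p (LP.∷-injectiveʳ eq)
   sgn-cst : ∀ {A : Set} (p : List A) → sgn p ≈ cst (negOnePow (length p))
   sgn-cst [] = refl
   sgn-cst (x ∷ p) = -‿cong (sgn-cst p) ◦ sym (cst-neg _)
   Vi≈ : Vi n (suc i) ≈ sgn p * V (p ++ s)
   Vi≈ = reflexive (P.sym (mulP-def (cst (negOnePow i)) _)) ◦ *-cong (sym (sgn-cst p ◦ reflexive (cong (cst ∘ negOnePow) (position 0 n p (P.sym e ∙ upFrom-applyUpTo 0 n)))))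
     (reflexive (cong (prodP ∘ map diff) (cong (L.filterᵇ (λ { (j , k) → keeps (suc i) j ∧ keeps (suc i) k })) pairsIn-pairsOf ∙ filter-pairs (keeps (suc i)) (oneTo n) ∙ cong pairsOf filtered)) ◦ pairs-V (p ++ s))

 vandermonde-Δ : vandermonde n ≈ Δ
 vandermonde-Δ = reflexive (cong (prodP ∘ map diff) pairsIn-pairsOf) ◦ pairs-V (upTo n)

 Terms : Set
 Terms = List (List ℕ × Poly n)

 combination : List ℕ → Terms → Poly n
 combination la L = cPoly n la * mS la + ΣL L (λ { (mu , a) → a * mS mu })

 combination-def : ∀ la L → combination la L ≡ cPoly n la *P mSym n la +P sumP (map (λ { (mu , a) → a *P mSym n mu }) L)
 combination-def la L = addP-def _ _ ∙ cong₂ _+P_ (mulP-def _ _ ∙ cong (cPoly n la *P_) (mSym-def la))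
   (sumP-def (map (λ { (mu , a) → a * mS mu }) L) ∙ cong sumP (LP.map-cong (λ { (mu , a) → mulP-def a (mS mu) ∙ cong (a *P_) (mSym-def mu) }) L))

 below-part : ∀ {la mu} → IsPartition la → size la N.≤ n → StrictlyBelow la mu → Part n (size la) mu
 below-part p l (q , e , _) = record { partition = q ; weight = e ; fits = l }

 module Expansion {la : List ℕ} (partition : IsPartition la) (fits : size la N.≤ n) (L : Terms)
   (terms : All (λ { (mu , a) → StrictlyBelow la mu × XFree a }) L) (J : Poly n) (J≈ : J ≈P combination la L)
   (eigen : sumP (map (λ i → numAi n i *P Vi n i *P Tq i J) (oneTo n)) ≈P eigenvalue n la *P vandermonde n *P J) where

   part : Part n (size la) la
   part = record { partition = partition ; weight = P.refl ; fits = fits }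

   J₀ c : Poly n
   J₀ = combination la L
   c = cPoly n la

   J≈J₀ : J ≈ J₀
   J≈J₀ = ≈P⇒≋ J≈

   good : Good J₀
   good = good-+ (good-*ˡ (xf-cPoly la) (good-mS part)) (good-ΣL L (All.map (λ { (b , xf) → good-*ˡ (XFree-XF xf) (good-mS (below-part partition fits b)) }) terms))

   private
     g : ℤ
     g = gr (lamE la)
     g≡ : g ≡ + wN (padL n la)
     g≡ = gr-xβE (pad n la)

     topJ : Top g J₀
     topJ = top-+ (top-* (top-XF (xf-cPoly la)) (P.subst (λ z → Top z (mS la)) (P.sym g≡) (top-mS part)) ⟨to⟩ ZP.+-identityˡ g)
       (top-Σ L terms)
       where
       _⟨to⟩_ : ∀ {z z' p} → Top z p → z ≡ z' → Top z' p
       h ⟨to⟩ P.refl = h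
       top-Σ : ∀ L → All (λ { (mu , a) → StrictlyBelow la mu × XFree a }) L → Top g (ΣL L (λ { (mu , a) → a * mS mu }))
       top-Σ [] [] = []
       top-Σ ((mu , a) ∷ L) ((b , xf) ∷ h) = top-+ (top-* (top-XF (XFree-XF xf)) (top-weaken (P.subst (+ wN (padL n mu) Z.≤_) (P.sym g≡) (Z.+≤+ (NP.<⇒≤ (below-wN part q (proj₂ (proj₂ b)))))) (top-mS q)) ⟨to⟩ ZP.+-identityˡ g) (top-Σ L h)
         where q = below-part partition fits b

     comp-scaled : ∀ {a p r} → XF a → Top g p → comp g p ≈ r → comp g (a * p) ≈ a * r
     comp-scaled {a} {p} xf tp h = reflexive (cong (λ z → comp z (a * p)) (P.sym (ZP.+-identityˡ g))) ◦ comp-* (top-XF xf) tp ◦ *-cong (comp-XF xf) h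

     compJ : comp g J₀ ≈ c * mono (lamE la) (+ 1)
     compJ = comp-+ g _ _ ◦ +-cong (comp-scaled (xf-cPoly la) (P.subst (λ z → Top z (mS la)) (P.sym g≡) (top-mS part)) (comp-mS part))
       (comp-ΣL g _ L ◦ zero-Σ L terms) ◦ +-identityʳ _
       where
       zero-Σ : ∀ L → All (λ { (mu , a) → StrictlyBelow la mu × XFree a }) L → ΣL L (comp g ∘ (λ { (mu , a) → a * mS mu })) ≈ 0#
       zero-Σ [] [] = refl
       zero-Σ ((mu , a) ∷ L) ((b , xf) ∷ h) = +-cong (comp-scaled (XFree-XF xf) (top-weaken (P.subst (+ wN (padL n mu) Z.≤_) (P.sym g≡) (Z.+≤+ (NP.<⇒≤ (below-wN part q (proj₂ (proj₂ b)))))) (top-mS q)) (comp-mS-below part q (proj₂ (proj₂ b))) ◦ zeroʳ a) (zero-Σ L h) ◦ +-identityˡ _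
         where q = below-part partition fits b

     lam : ℕ → ℤ
     lam i = + nth i (padL n la)

     lamE-x : ∀ i → i N.< n → getV i (xs (lamE la)) ≡ lam i
     lamE-x i l = getV-toList i (xs (lamE la)) ∙ cong (getL i) (exps-xβE (pad n la)) ∙ go i (padL n la) (P.subst (i N.<_) (P.sym (length-≡n (pad n la))) l)
       where go : ∀ i l → i N.< length l → getL i (map +_ l ++ oL) ≡ + nth i l
             go zero (a ∷ l) _ = P.refl
             go (suc i) (a ∷ l) (s≤s h) = go i l h

     eigenJ : ΣL xVars (λ i → Δt i * T (+ 1) i J₀) ≈ tSum n lam * (Δ * J₀)
     eigenJ = (ΣL-cong' xVars (λ i m → sym (reflexive (P.sym (mulP-def _ _)) ◦ *-cong (operator-Δt i m) (Tq-T i J ◦ TH.hom-cong (+ 1) i J≈J₀))) ◦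
         reflexive (sumP-def (map (λ i → numAi n (suc i) *P Vi n (suc i) *P Tq (suc i) J) (upTo n)) ∙ cong sumP (LP.map-∘ (upTo n)))) ◦
       ≈P⇒≋ eigen ◦ reflexive (P.sym (mulP-def _ J ∙ cong (_*P J) (mulP-def (eigenvalue n la) (vandermonde n)))) ◦ *-cong (*-cong (eigenvalue-tSum la) vandermonde-Δ) J≈J₀ ◦ *-assoc _ _ _

     module DE = DualEigen lam (lamE la) lamE-x J₀ c (xf-cPoly la) topJ compJ eigenJ

   annihilated : ∀ ν → All (N._≤ n) (toList ν) → ΣL (perms ν) (λ α → ψ (mono (rhoE α) (+ 1) * J₀) * (brk (pad n (conj la)) - brk α)) ≈ 0#
   annihilated = Annihilate.annihilated part J₀ (Good.sym' good) (Good.only good) DE.dual-eigen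

 -- Triangularity of the matrix
 module Entries {d : ℕ} {mu nu : List ℕ} (pm : Part n d mu) (pn : Part n d nu) where
   private
     module Pm = PartP pm
     module Pn = PartP pn
     module Cn = ConjP pn
     module Tri = Triangular pm pn
     ps = perms (pad n mu)
     qs = perms (pad n (conj nu))

   word : Vec ℕ n → Vec ℕ n → List ℤ
   word α β = up 0 (toList β) ++ dn n (toList α)

   ↭μ : ∀ {β} → β ∈ ps → toList β ↭ padL n mu
   ↭μ {β} m = ∈-perms⁻ {ν = pad n mu} {α = β} m

   ↭ν : ∀ {α} → α ∈ qs → toList α ↭ padL n (conj nu)
   ↭ν {α} m = ∈-perms⁻ {ν = pad n (conj nu)} {α = α} m

   sum-β : ∀ {β} → β ∈ ps → sum (toList β) ≡ d
   sum-β {β} m = SumP.sum-↭ (↭μ {β} m) ∙ Pm.sum-pad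

   sum-α : ∀ {α} → α ∈ qs → sum (toList α) ≡ d
   sum-α {α} m = SumP.sum-↭ (↭ν {α} m) ∙ Cn.conj-sum

   Σ-dnα : ∀ {α} → α ∈ qs → Σℤ (dn n (toList α)) ≡ Σℤ (iv (+ n) n) Z.- + d
   Σ-dnα {α} m = Σ-dn n (toList α) ∙ cong₂ (λ k s → Σℤ (iv (+ n) k) Z.- + s) (length-≡n α) (sum-α {α} m)

   Σ-whole : Σℤ (iv +0 N) ≡ Σℤ (iv +0 n) Z.+ Σℤ (iv (+ n) n)
   Σ-whole = cong Σℤ (iv-++ 0 n n) ∙ Σℤ-++ (iv +0 n) (iv (+ n) n)

   Σ-word : ∀ {α β} → α ∈ qs → β ∈ ps → Σℤ (word α β) ≡ Σℤ (iv +0 N)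
   Σ-word {α} {β} mα mβ = Σℤ-++ (up 0 (toList β)) _ ∙ cong₂ Z._+_ (Σ-up 0 (toList β) ∙ cong₂ (λ k s → Σℤ (iv +0 k) Z.+ + s) (length-≡n β) (sum-β {β} mβ)) (Σ-dnα {α} mα) ∙
     ring57 (Σℤ (iv +0 n)) (Σℤ (iv (+ n) n)) (+ d) ∙ P.sym Σ-whole

   up-nonneg : ∀ k l → All (+0 Z.≤_) (up k l)
   up-nonneg k [] = []
   up-nonneg k (a ∷ l) = Z.+≤+ z≤n ∷ up-nonneg (suc k) l

   dn-nonneg : ∀ k l → All (N._≤ k) l → All (+0 Z.≤_) (dn k l)
   dn-nonneg k [] [] = []
   dn-nonneg k (a ∷ l) (h ∷ hs) = ZP.i≤j⇒0≤j-i (Z.+≤+ h) ∷ dn-nonneg (suc k) l (All.map NP.m≤n⇒m≤1+n hs)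

   dnα-nonneg : ∀ {α} → α ∈ qs → All (+0 Z.≤_) (dn n (toList α))
   dnα-nonneg {α} m = dn-nonneg n (toList α) (entries {pad n (conj nu)} {α} Cn.conj-bounded m)

   staircase-word : ∀ {α β} → α ∈ qs → β ∈ ps → Staircase N (word α β)
   staircase-word {α} {β} mα mβ = (LP.length-++ (up 0 (toList β)) ∙ cong₂ N._+_ (length-up 0 (toList β) ∙ length-≡n β) (length-dn n (toList α) ∙ length-≡n α)) ,
     AllP.++⁺ (up-nonneg 0 (toList β)) (dnα-nonneg {α} mα) , Σ-word {α} {β} mα mβ

   value : Vec ℕ n → Poly n
   value α = ψ (mono (rhoE α) (+ 1) * mS mu)

   value-Σ : ∀ α → value α ≈ ΣL ps (λ β → cst (sgS (word α β)))
   value-Σ α = ψ-cong (sym (ΣL-*ˡ _ _ ps)) ◦ ψ-ΣL _ ps ◦ ΣL-cong ps (λ β → ψ-cong (mono-* _ _ (+ 1) (+ 1)) ◦ ψ-mono (rhoE α ⊕ xβE β) β)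
     where
     ψ-mono : ∀ e β → ψ (mono (rhoE α ⊕ xβE β) (+ 1)) ≈ cst (sgS (word α β))
     ψ-mono e β .app f = lin-ψ f (mono (rhoE α ⊕ xβE β) (+ 1)) ∙ lin-mono1 (λ e → sgS (exps e) Z.* f (qtE e)) (rhoE α ⊕ xβE β) ∙
       cong (λ l → sgS l Z.* f zeroExp) (exps-rho-x α β) ∙ P.sym (lin-mono f zeroExp (sgS (word α β)))

   -- The factors -xᵢ contribute (-1)^(|ρ| - d) and ∂_ω contributes (-1)^|ρ|, so (-1)^d remains, the
   -- same sign for every α.
   scalar : ∀ {α} → α ∈ qs → scal n (xbar n (rhoMinus n α)) (mSym n mu) ≈ cst (negOnePow d) * value α
   scalar {α} mα = reflexive (cong (∂ω n) (P.sym (mulP-def (mono (rhoE α) s) (mS mu) ∙ cong (mono (rhoE α) s *P_) (mSym-def mu)))) ◦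
     ∂ω-ψ staircases ◦ *-congˡ (ψ-cong (*-congʳ scaled ◦ *-assoc (cst s) (mono (rhoE α) (+ 1)) (mS mu)) ◦ ψ-XF (P.refl ∷ []) _) ◦
       sym (*-assoc _ _ _) ◦ *-congʳ (sym (cst-* staircaseSign s) ◦ reflexive (cong cst signs≡))
     where
     total' = V.foldr _ Z._+_ +0 (rhoMinus n α)
     s = negOnePow Z.∣ total' ∣
     scaled : mono (rhoE α) s ≈ cst s * mono (rhoE α) (+ 1)
     scaled = sym (mono-* zeroExp (rhoE α) s (+ 1) ◦ reflexive (cong₂ mono (⊕-identityˡ (rhoE α)) (ZP.*-identityʳ s)))
     staircases : All (λ t → Staircase N (exps (proj₁ t))) (mono (rhoE α) s * mS mu)
     staircases = all-* {_≡ rhoE α} {λ e → ∃ λ β → β ∈ ps × e ≡ xβE β} {λ e → Staircase N (exps e)}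
       (λ { {_} {_} P.refl (β , m , P.refl) → P.subst (Staircase N) (P.sym (exps-rho-x α β)) (staircase-word {α} {β} mα m) }) (P.refl ∷ []) (all-ΣL ps (λ β m → (β , m , P.refl) ∷ []))
     foldr-Σ : ∀ {k} (v : Vec ℤ k) → V.foldr _ Z._+_ +0 v ≡ Σℤ (toList v)
     foldr-Σ [] = P.refl
     foldr-Σ (a ∷ v) = +ˡ a (foldr-Σ v)
     Σ-nonneg : ∀ {l} → All (+0 Z.≤_) l → +0 Z.≤ Σℤ l
     Σ-nonneg [] = ZP.≤-refl
     Σ-nonneg (h ∷ hs) = ZP.+-mono-≤ h (Σ-nonneg hs)
     total-dn : total' ≡ Σℤ (iv +0 n ++ dn n (toList α))
     total-dn = foldr-Σ (rhoMinus n α) ∙ cong Σℤ (exps-rhoE α)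
     total-nonneg : + Z.∣ total' ∣ ≡ total'
     total-nonneg = ZP.0≤i⇒+∣i∣≡i (P.subst (+0 Z.≤_) (P.sym total-dn) (Σ-nonneg (AllP.++⁺ (iv-nonneg 0 n) (dnα-nonneg {α} mα))))
       where iv-nonneg : ∀ k m → All (+0 Z.≤_) (iv (+ k) m)
             iv-nonneg k zero = []
             iv-nonneg k (suc m) = Z.+≤+ z≤n ∷ iv-nonneg (k N.+ 1) m
     degrees : Z.∣ total' ∣ N.+ d ≡ drops (N N.∸ 1)
     degrees = ZP.+-injective (cong (Z._+ + d) (total-nonneg ∙ total-dn ∙ Σℤ-++ (iv +0 n) _ ∙ +ˡ (Σℤ (iv +0 n)) (Σ-dnα {α} mα)) ∙
       aux (Σℤ (iv +0 n)) (Σℤ (iv (+ n) n)) (+ d) ∙ P.sym Σ-whole ∙ Σℤ-iv-N)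
       where aux = ring58
     signs≡ : staircaseSign Z.* s ≡ negOnePow d
     signs≡ = cong (λ k → negOnePow k Z.* s) (P.sym degrees) ∙ cong (Z._* s) (negOnePow-+ Z.∣ total' ∣ d) ∙ aux s (negOnePow d) ∙ cong (Z._* negOnePow d) (negOnePow-sq Z.∣ total' ∣) ∙ ZP.*-identityˡ _
       where aux = ring59

   -- A nonzero sign means that the exponents fill the staircase, as `triangular` assumes. Its list
   -- b is the reversal of β, since `up` runs through increasing exponents while partitions
   -- decrease.
   filled : ∀ {α β} → α ∈ qs → β ∈ ps → sgS (word α β) ≢ +0 → statP n nu N.< statP n mu ⊎ (nu ≡ mu × L.reverse (toList β) ≡ padL n mu × toList α ≡ padL n (conj nu))
   filled {α} {β} mα mβ ne = Tri.triangular (L.reverse (toList β)) (toList α) (Perm.↭-trans (PermP.↭-reverse _) (↭μ {β} mβ)) (↭ν {α} mα)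
     (P.subst (λ l → up 0 l ++ dn n (toList α) ↭ iv +0 N) (P.sym (LP.reverse-involutive (toList β)))
       (sg-↭ (staircase-word {α} {β} mα mβ) (ne ∘ P.trans (sgS-staircase {word α β} (Σ-word {α} {β} mα mβ)))))

   cst-zero : ∀ {z} → z ≡ +0 → cst z ≈ 0#
   cst-zero e = reflexive (cong cst e) ◦ cst-0

   cst-≢ : ∀ z → ¬ (z ≢ +0) → cst z ≈ 0#
   cst-≢ z h with z Z.≟ +0
   ... | yes e = cst-zero e
   ... | no e = ⊥-elim (h e)

   off : ∀ {α} → α ∈ qs → ¬ (statP n nu N.< statP n mu) → (nu ≡ mu → toList α ≢ padL n (conj nu)) → value α ≈ 0#
   off {α} mα nl ne = value-Σ α ◦ ΣL-zero ps zero-β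
     where
     zero-β : ∀ β → β ∈ ps → cst (sgS (word α β)) ≈ 0#
     zero-β β mβ = cst-≢ _ (λ e → Sum.[ nl , (λ { (x , _ , y) → ne x y }) ]′ (filled {α} {β} mα mβ e))

   module _ (la : List ℕ) where
     entry : Poly n
     entry = ΣL qs (λ α → value α * (brk (pad n (conj la)) - brk α))

     angle-entry : angle n (mSym n mu) (conj la) (conj nu) ≈ cst (negOnePow d) * entry
     angle-entry = reflexive (P.sym (sumP-def (map (λ α → scal n (xbar n (rhoMinus n α)) (mSym n mu) *P (brk (pad n (conj la)) -P brk α)) qs))) ◦
       ΣL-cong' qs (λ α m → reflexive (P.sym (mulP-def _ _ ∙ cong (scal n (xbar n (rhoMinus n α)) (mSym n mu) *P_) (sub-def (brk (pad n (conj la))) (brk α)))) ◦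
         *-congʳ (scalar {α} m) ◦ *-assoc _ _ _) ◦ ΣL-*ˡ _ _ qs

     entry-zero : nu ≢ mu → ¬ (statP n nu N.< statP n mu) → angle n (mSym n mu) (conj la) (conj nu) ≈ 0#
     entry-zero ne nl = angle-entry ◦ *-congˡ (ΣL-zero qs (λ α m → *-congʳ (off {α} m nl (⊥-elim ∘ ne)) ◦ zeroˡ _)) ◦ zeroʳ _

 module Diagonal {d : ℕ} {mu : List ℕ} (pm : Part n d mu) (la : List ℕ) where
   open Entries pm pm

   private
     module Cm = ConjP pm
     α₀ : Vec ℕ n
     α₀ = pad n (conj mu)
     reversed : ∃ λ (v : Vec ℕ n) → toList v ≡ L.reverse (padL n mu)
     reversed = go n (L.reverse (padL n mu)) (LP.length-reverse (padL n mu) ∙ length-≡n (pad n mu))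
       where go : ∀ k (l : List ℕ) → length l ≡ k → ∃ λ (v : Vec ℕ k) → toList v ≡ l
             go zero [] _ = [] , P.refl
             go (suc k) (a ∷ l) e with go k l (NP.suc-injective e)
             ... | v , h = a ∷ v , cong (a ∷_) h
     β₀ : Vec ℕ n
     β₀ = proj₁ reversed
     α₀∈ : α₀ ∈ perms α₀
     α₀∈ = ∈-perms⁺ {ν = α₀} {α = α₀} Perm.refl
     β₀∈ : β₀ ∈ perms (pad n mu)
     β₀∈ = ∈-perms⁺ {ν = pad n mu} {α = β₀} (Perm.↭-trans (Perm.↭-reflexive (proj₂ reversed)) (PermP.↭-reverse _))

     value₀ : value α₀ ≈ cst (negOnePow d)
     value₀ = value-Σ α₀ ◦ ΣL-single {f = λ β → cst (sgS (word α₀ β))} (perms-unique (pad n mu)) β₀∈ others ◦ reflexive (cong cst (sgS-staircase {word α₀ β₀} (Σ-word {α₀} {β₀} α₀∈ β₀∈) ∙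
         cong (λ l → sg (up 0 l ++ dn n (padL n (conj mu)))) (proj₂ reversed) ∙ Cm.full-sign))
       where
       others : ∀ β → β ∈ perms (pad n mu) → β ≢ β₀ → cst (sgS (word α₀ β)) ≈ 0#
       others β m ne = cst-≢ _ (λ e → Sum.[ NP.<-irrefl P.refl , (λ { (_ , x , _) → ne (toList-≡ (P.sym (LP.reverse-involutive (toList β)) ∙ cong L.reverse x ∙ P.sym (proj₂ reversed))) }) ]′ (filled {α₀} {β} α₀∈ m e))

   -- A single pair contributes, μ' against the reversed μ. Its sign (-1)^d comes from `full-sign`
   -- and cancels the one in `angle-entry`.
   entry-diagonal : angle n (mSym n mu) (conj la) (conj mu) ≈ brk (pad n (conj la)) - brk (pad n (conj mu))
   entry-diagonal = angle-entry la ◦ *-congˡ (ΣL-single {f = λ α → value α * (brk (pad n (conj la)) - brk α)} (perms-unique α₀) α₀∈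
       (λ α m ne → *-congʳ (off {α} m (NP.<-irrefl P.refl) (λ _ e → ne (toList-≡ e))) ◦ zeroˡ _) ◦ *-congʳ value₀) ◦
     sym (*-assoc _ _ _) ◦ *-congʳ (sym (cst-* (negOnePow d) (negOnePow d)) ◦ reflexive (cong cst (negOnePow-sq d))) ◦ *-identityˡ _

 -- Determinants
 Σs-zero : {A : Set} {F : List A → A → List A → Poly n} (l : List A) → (∀ p c s → p ++ c ∷ s ≡ l → F p c s ≈ 0#) → Σs F l ≈ 0#
 Σs-zero [] h = refl
 Σs-zero (x ∷ l) h = +-cong (h [] x l P.refl) (Σs-zero l (λ p c s e → h (x ∷ p) c s (cong (x ∷_) e))) ◦ +-identityˡ _

 Σs-ΣL : {A B : Set} (H : B → List A → A → List A → Poly n) (zs : List B) (l : List A) → Σs (λ p c s → ΣL zs (λ z → H z p c s)) l ≈ ΣL zs (λ z → Σs (H z) l)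
 Σs-ΣL H zs [] = sym (ΣL-0 zs)
 Σs-ΣL H zs (x ∷ l) = +-congˡ (Σs-ΣL (λ z p → H z (x ∷ p)) zs l) ◦ sym (ΣL-+ _ _ zs)

 -- The hypotheses treat in turn an entry before the pair, x, y, and an entry after the pair.
 -- Removing x from the two orders leaves the same list, but with prefixes whose lengths differ by
 -- one, hence the sign.
 Σs-swap : {A : Set} (F : List A → A → List A → Poly n) (o : List A) (x y : A) (s : List A) →
   (∀ o₁ c o₂ → o₁ ++ c ∷ o₂ ≡ o → F o₁ c (o₂ ++ x ∷ y ∷ s) ≈ - F o₁ c (o₂ ++ y ∷ x ∷ s)) →
   F o x (y ∷ s) ≈ - F (o ++ y ∷ []) x s → F (o ++ x ∷ []) y s ≈ - F o y (x ∷ s) →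
   (∀ p c s' → p ++ c ∷ s' ≡ s → F (o ++ x ∷ y ∷ p) c s' ≈ - F (o ++ y ∷ x ∷ p) c s') →
   Σs F (o ++ x ∷ y ∷ s) ≈ - Σs F (o ++ y ∷ x ∷ s)
 Σs-swap F [] x y s h₁ h₂ h₃ h₄ = +-cong h₂ (+-cong h₃ (tails s (λ p → F (x ∷ y ∷ p)) (λ p → F (y ∷ x ∷ p)) h₄)) ◦ solveR 3 (λ a b c → :- a :+ (:- b :+ :- c) := :- (b :+ (a :+ c))) refl _ _ _
   where
   tails : ∀ s (G H : List _ → _ → List _ → Poly n) → (∀ p c s' → p ++ c ∷ s' ≡ s → G p c s' ≈ - H p c s') → Σs G s ≈ - Σs H s
   tails [] G H h = sym -0#≈0#
   tails (z ∷ s) G H h = +-cong (h [] z s P.refl) (tails s (λ p → G (z ∷ p)) (λ p → H (z ∷ p)) (λ p c s' e → h (z ∷ p) c s' (cong (z ∷_) e))) ◦ solveR 2 (λ a b → :- a :+ :- b := :- (a :+ b)) refl _ _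
 Σs-swap F (o ∷ os) x y s h₁ h₂ h₃ h₄ = +-cong (h₁ [] o os P.refl) (Σs-swap (λ p → F (o ∷ p)) os x y s (λ o₁ c o₂ e → h₁ (o ∷ o₁) c o₂ (cong (o ∷_) e)) h₂ h₃ h₄) ◦ solveR 2 (λ a b → :- a :+ :- b := :- (a :+ b)) refl _ _

 -- Pairings are integers, where x = -x forces x = 0; this takes the place of division by 2.
 neg-self-zero : ∀ {p : Poly n} → p ≈ - p → p ≈ 0#
 neg-self-zero {p} h .app f = neg-self (app h f ∙ lin-oppP f p)

 module _ {R C : Set} (M : R → C → Poly n) where

   -- Expansion along the first row, with rows and columns given by labels. Removing a column
   -- shortens the list of labels and leaves M untouched, whereas `detN` deletes positions in every
   -- row.
   detF : List R → List C → Poly n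
   detF [] [] = 1#
   detF [] (_ ∷ _) = 0#
   detF (a ∷ as) cs = Σs (λ p c s → sgn p * M a c * detF as (p ++ s)) cs

   det-swap : ∀ as o x y s → detF as (o ++ x ∷ y ∷ s) ≈ - detF as (o ++ y ∷ x ∷ s)
   det-swap [] [] x y s = sym -0#≈0#
   det-swap [] (_ ∷ o) x y s = sym -0#≈0#
   det-swap (a ∷ as) o x y s = Σs-swap _ o x y s
     (λ o₁ c o₂ _ → *-congˡ (reflexive (cong (detF as) (P.sym (LP.++-assoc o₁ o₂ _))) ◦ det-swap as (o₁ ++ o₂) x y s ◦ -‿cong (reflexive (cong (detF as) (LP.++-assoc o₁ o₂ _)))) ◦
        solveR 2 (λ a b → a :* :- b := :- (a :* b)) refl _ _)
     (*-congˡ (reflexive (cong (detF as) (P.sym (LP.++-assoc o (y ∷ []) s)))) ◦ turn (sgn o) (sgn-snoc o y))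
     (*-cong (*-congʳ (sgn-snoc o x)) (reflexive (cong (detF as) (LP.++-assoc o (x ∷ []) s))) ◦ solveR 3 (λ a b c → (:- a :* b) :* c := :- ((a :* b) :* c)) refl _ _ _)
     (λ p c s' _ → *-cong (*-congʳ (sgn-++ o (x ∷ y ∷ p) ◦ sym (sgn-++ o (y ∷ x ∷ p))))
          (reflexive (cong (detF as) (LP.++-assoc o (x ∷ y ∷ p) s')) ◦ det-swap as o x y (p ++ s') ◦ -‿cong (reflexive (cong (detF as) (P.sym (LP.++-assoc o (y ∷ x ∷ p) s'))))) ◦
        solveR 2 (λ a b → a :* :- b := :- (a :* b)) refl _ _)
     where
     sgn-snoc : ∀ o (x : C) → sgn (o ++ x ∷ []) ≈ - sgn o
     sgn-snoc o x = sgn-++ o (x ∷ []) ◦ solveR 2 (λ a b → a :* :- b := :- (b :* a)) refl (sgn o) 1# ◦ -‿cong (*-identityˡ _)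
     turn : ∀ {g m e} g' → g ≈ - g' → g' * m * e ≈ - (g * m * e)
     turn {g} {m} {e} g' h = sym (-‿cong (*-congʳ (*-congʳ h)) ◦ solveR 3 (λ a b c → :- ((:- a :* b) :* c) := (a :* b) :* c) refl g' m e)

   det-repeat : ∀ as o x p s → detF as (o ++ x ∷ p ++ x ∷ s) ≈ 0#
   det-repeat as o x [] s = neg-self-zero (det-swap as o x x s)
   det-repeat as o x (y ∷ p) s = det-swap as o x y (p ++ x ∷ s) ◦ -‿cong (reflexive (cong (detF as) (P.sym (LP.++-assoc o (y ∷ []) _))) ◦ det-repeat as (o ++ y ∷ []) x p s) ◦ -0#≈0#

   det-linear : {Z : Set} (zs : List Z) (k : Z → Poly n) (col : Z → C) (w : C) (as : List R) → All (λ a → M a w ≈ ΣL zs (λ z → k z * M a (col z))) as →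
     ∀ cs → detF as (w ∷ cs) ≈ ΣL zs (λ z → k z * detF as (col z ∷ cs))
   det-linear zs k col w [] [] cs = sym (ΣL-cong zs (λ z → zeroʳ (k z)) ◦ ΣL-0 zs)
   det-linear zs k col w (a ∷ as) (h ∷ hs) cs = begin
     1# * M a w * detF as cs + Σs (λ p c s → - sgn p * M a c * detF as (w ∷ (p ++ s))) cs
       ≈⟨ +-cong (*-congʳ (*-congˡ h ◦ sym (ΣL-*ˡ 1# _ zs)) ◦ sym (ΣL-*ʳ _ _ zs)) (Σs-cong cs (λ p c s _ → *-congˡ (det-linear zs k col w as hs (p ++ s)) ◦ sym (ΣL-*ˡ _ _ zs)) ◦ Σs-ΣL _ zs cs) ⟩
     ΣL zs (λ z → 1# * (k z * M a (col z)) * detF as cs) + ΣL zs (λ z → Σs (λ p c s → - sgn p * M a c * (k z * detF as (col z ∷ (p ++ s)))) cs) ≈⟨ sym (ΣL-+ _ _ zs) ⟩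
     ΣL zs (λ z → 1# * (k z * M a (col z)) * detF as cs + Σs (λ p c s → - sgn p * M a c * (k z * detF as (col z ∷ (p ++ s)))) cs)
       ≈⟨ ΣL-cong zs (λ z → +-cong (solveR 4 (λ o k m d → (o :* (k :* m)) :* d := k :* ((o :* m) :* d)) refl 1# (k z) _ _)
            (Σs-cong cs (λ p c s _ → solveR 3 (λ a k d → a :* (k :* d) := k :* (a :* d)) refl _ (k z) _) ◦ Σs-*ˡ (k z) _ cs) ◦ sym (distribˡ (k z) _ _)) ⟩
     ΣL zs (λ z → k z * detF (a ∷ as) (col z ∷ cs)) ∎

   det-zero-column : ∀ w as → All (λ a → M a w ≈ 0#) as → ∀ cs → detF as (w ∷ cs) ≈ 0#
   det-zero-column w as h = det-linear {Z = C} [] (λ _ → 0#) id w as h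

   detN-detF : ∀ as cs → length as ≡ length cs → detN (length as) (map (λ a → map (M a) cs) as) ≈ detF as cs
   detN-detF [] [] _ = refl
   detN-detF (a ∷ as) cs len = reflexive (cong sumP (LP.map-cong (λ { (j , x) → P.sym (mulP-def _ _ ∙ cong (_*P detN (length as) (map (deleteAt j) rows)) (mulP-def (cst (negOnePow j)) x)) }) (indexed 0 (map (M a) cs)))) ◦
     reflexive (P.sym (sumP-≡ (map (λ { (j , x) → cst (negOnePow j) * x * detN (length as) (map (deleteAt j) rows) }) (indexed 0 (map (M a) cs))))) ◦ go [] cs P.refl
     where
     rows = map (λ r → map (M r) cs) as
     sumP-≡ : (ps : List (Poly n)) → foldr _+_ 0# ps ≡ sumP ps
     sumP-≡ [] = P.refl
     sumP-≡ (p ∷ ps) = addP-def p _ ∙ cong (p ++_) (sumP-≡ ps)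
     delete-mid : ∀ r p c s → deleteAt (length p) (map (M r) (p ++ c ∷ s)) ≡ map (M r) (p ++ s)
     delete-mid r [] c s = P.refl
     delete-mid r (x ∷ p) c s = cong (M r x ∷_) (delete-mid r p c s)
     sgn-cst : (p : List C) → cst (negOnePow (length p)) ≈ sgn p
     sgn-cst [] = refl
     sgn-cst (x ∷ p) = cst-neg _ ◦ -‿cong (sgn-cst p)
     len-mid : ∀ (p : List C) c s → length (p ++ c ∷ s) ≡ suc (length (p ++ s))
     len-mid [] c s = P.refl
     len-mid (_ ∷ p) c s = cong suc (len-mid p c s)
     go : ∀ p₀ s₀ → p₀ ++ s₀ ≡ cs → ΣL (indexed (length p₀) (map (M a) s₀)) (λ { (j , x) → cst (negOnePow j) * x * detN (length as) (map (deleteAt j) rows) }) ≈ Σs (λ p c s → sgn (p₀ ++ p) * M a c * detF as ((p₀ ++ p) ++ s)) s₀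
     go p₀ [] e = refl
     go p₀ (c ∷ s₀) e = +-cong (*-cong (*-congʳ (sgn-cst p₀ ◦ reflexive (cong sgn (P.sym (LP.++-identityʳ p₀)))))
         (reflexive (cong (detN (length as)) (P.sym (LP.map-∘ as) ∙ LP.map-cong (λ r → cong (deleteAt (length p₀) ∘ map (M r)) (P.sym e) ∙ delete-mid r p₀ c s₀) as)) ◦
           detN-detF as (p₀ ++ s₀) (NP.suc-injective (len ∙ cong length (P.sym e) ∙ len-mid p₀ c s₀)) ◦ reflexive (cong (λ z → detF as (z ++ s₀)) (P.sym (LP.++-identityʳ p₀)))))
       (reflexive (cong (λ k → ΣL (indexed k (map (M a) s₀)) (λ { (j , x) → cst (negOnePow j) * x * detN (length as) (map (deleteAt j) rows) })) (P.sym (LP.length-++ p₀ ∙ NP.+-comm (length p₀) 1))) ◦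
         go (p₀ ++ c ∷ []) s₀ (LP.++-assoc p₀ (c ∷ []) s₀ ∙ e) ◦
           Σs-cong s₀ (λ p d s _ → *-cong (*-congʳ (reflexive (cong sgn (LP.++-assoc p₀ (c ∷ []) p)))) (reflexive (cong (λ z → detF as (z ++ s)) (LP.++-assoc p₀ (c ∷ []) p)))))

 detF-map : {R C R' C' : Set} (M : R → C → Poly n) (f : R' → R) (g : C' → C) → ∀ as cs → detF M (map f as) (map g cs) ≈ detF (λ a c → M (f a) (g c)) as cs
 detF-map M f g [] [] = refl
 detF-map M f g [] (_ ∷ _) = refl
 detF-map M f g (a ∷ as) cs = Σs-map g _ cs ◦ Σs-cong cs (λ p c s _ → *-cong (*-congʳ (sgn-map p)) (reflexive (cong (detF M (map f as)) (P.sym (LP.map-++ g p s))) ◦ detF-map M f g as (p ++ s)))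
   where sgn-map : ∀ p → sgn (map g p) ≈ sgn p
         sgn-map [] = refl
         sgn-map (x ∷ p) = -‿cong (sgn-map p)

 -- A matrix whose entry at (a, c) vanishes unless st a < st c or a = c is triangular for any ordering by st.
 module TriangularDet {A : Set} (M : A → A → Poly n) (Q : A → Set) (st : A → ℕ) (zero-entry : ∀ {a c} → Q a → Q c → a ≢ c → ¬ (st a N.< st c) → M a c ≈ 0#) where

   Σst : List A → ℕ
   Σst = foldr (λ a k → st a N.+ k) 0

   Σst-mid : ∀ p c s → Σst (p ++ c ∷ s) ≡ st c N.+ Σst (p ++ s)
   Σst-mid [] c s = P.refl
   Σst-mid (x ∷ p) c s = cong (λ k → st x N.+ k) (Σst-mid p c s) ∙ aux (st x) (st c) (Σst (p ++ s))
     where aux : ∀ a b c → a N.+ (b N.+ c) ≡ b N.+ (a N.+ c)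
           aux a b c = P.sym (NP.+-assoc a b c) ∙ cong (N._+ c) (NP.+-comm a b) ∙ NP.+-assoc b a c

   drop-mid : ∀ p {c s} → All Q (p ++ c ∷ s) → Q c × All Q (p ++ s)
   drop-mid [] (h ∷ hs) = h , hs
   drop-mid (x ∷ p) (h ∷ hs) = proj₁ (drop-mid p hs) , h ∷ proj₂ (drop-mid p hs)

   -- A nonzero entry at (a, c) requires st a ≤ st c. Removing such a row and column keeps the total
   -- of the columns below that of the rows, so no product of nonzero entries can be completed.
   det-zero : ∀ as cs → All Q as → All Q cs → Σst cs N.< Σst as → detF M as cs ≈ 0#
   det-zero (a ∷ as) cs (qa ∷ qas) qcs l = Σs-zero cs term
     where
     term : ∀ p c s → p ++ c ∷ s ≡ cs → sgn p * M a c * detF M as (p ++ s) ≈ 0#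
     term p c s P.refl with st c N.<? st a
     ... | yes c<a = *-congʳ (*-congˡ (zero-entry qa (proj₁ (drop-mid p qcs)) (λ { P.refl → NP.<-irrefl P.refl c<a }) (NP.<-asym c<a)) ◦ zeroʳ _) ◦ zeroˡ _
     ... | no c≮a = *-congˡ (det-zero as (p ++ s) qas (proj₂ (drop-mid p qcs)) (NP.+-cancelˡ-< (st a) _ _ (NP.≤-<-trans (NP.+-monoˡ-≤ (Σst (p ++ s)) (NP.≮⇒≥ c≮a)) (P.subst (N._< st a N.+ Σst as) (Σst-mid p c s) l)))) ◦ zeroʳ _

   -- In the row of a, a nonzero entry off the diagonal sits at some c with st a < st c. Its minor
   -- keeps the column a in exchange for c, so its columns have a smaller total than its rows, and
   -- `det-zero` applies.
   det-diagonal : ∀ as → Unique as → All Q as → detF M as as ≈ Π (map (λ a → M a a) as)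
   det-diagonal [] _ _ = refl
   det-diagonal (a ∷ as) (u ∷ us) (qa ∷ qas) = +-cong (*-cong (*-identityˡ _) (det-diagonal as us qas)) (Σs-zero as term) ◦ +-identityʳ _
     where
     mem : ∀ p {c : A} {s} → c ∈ p ++ c ∷ s
     mem [] = here P.refl
     mem (x ∷ p) = there (mem p)
     term : ∀ p c s → p ++ c ∷ s ≡ as → - sgn p * M a c * detF M as (a ∷ (p ++ s)) ≈ 0#
     term p c s P.refl with st a N.<? st c
     ... | yes a<c = *-congˡ (det-zero as (a ∷ (p ++ s)) qas (qa ∷ proj₂ (drop-mid p qas)) (P.subst (st a N.+ Σst (p ++ s) N.<_) (P.sym (Σst-mid p c s)) (NP.+-monoˡ-< (Σst (p ++ s)) a<c))) ◦ zeroʳ _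
     ... | no a≮c = *-congʳ (*-congˡ (zero-entry qa (proj₁ (drop-mid p qas)) (All.lookup u (mem p)) a≮c) ◦ zeroʳ _) ◦ zeroˡ _

 -- Cramer's rule
 module Cramer {la : List ℕ} (partition : IsPartition la) (fits : size la N.≤ n) (ms : List (List ℕ)) (unique : Unique ms)
   (below : ∀ {mu} → mu ∈ ms → StrictlyBelow la mu) (all-below : ∀ {mu} → StrictlyBelow la mu → mu ∈ ms)
   (L : Terms) (terms : All (λ { (mu , a) → StrictlyBelow la mu × XFree a }) L) (J : Poly n) (J≈ : J ≈P combination la L)
   (eigen : sumP (map (λ i → numAi n i *P Vi n i *P Tq i J) (oneTo n)) ≈P eigenvalue n la *P vandermonde n *P J) where

   open Expansion partition fits L terms J J≈ eigen

   Below : List ℕ → Set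
   Below mu = Part n (size la) mu

   ms-below : ∀ {mu} → mu ∈ ms → Below mu
   ms-below m = below-part partition fits (below m)

   Mat : List ℕ → List ℕ → Poly n
   Mat nu mu = angle n (mSym n mu) (conj la) (conj nu)

   Row : Set
   Row = List ℕ → Poly n

   -- Columns are functionals on rows, so a combination of columns such as `combined` is again a
   -- column.
   entryAt : Row → (Row → Poly n) → Poly n
   entryAt r c = c r

   column : List ℕ → Row → Poly n
   column mu r = r mu

   rows : List Row
   rows = map Mat ms

   combined : Row → Poly n
   combined r = c * r la + ΣL L (λ { (mu , a) → a * r mu })

   -- The left side of `annihilated` is a linear functional A of the polynomial. On monomial
   -- symmetric polynomials it gives the entries of the row up to the common sign s, so A J₀ = 0 is
   -- the relation between them.
   annihilated-row : ∀ {nu} → nu ∈ ms → combined (Mat nu) ≈ 0#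
   annihilated-row {nu} m = +-cong (step part c) (terms-entry L terms) ◦ sym (distribˡ s _ _) ◦ *-congˡ (sym A-J₀ ◦ annihilated (pad n (conj nu)) (ConjP.conj-bounded pn)) ◦ zeroʳ s
     where
     pn = ms-below m
     s = cst (negOnePow (size la))
     qs = perms (pad n (conj nu))
     Φ : Poly n → Vec ℕ n → Poly n
     Φ f α = ψ (mono (rhoE α) (+ 1) * f) * (brk (pad n (conj la)) - brk α)
     A : Poly n → Poly n
     A f = ΣL qs (Φ f)
     A-+ : ∀ f h → A (f + h) ≈ A f + A h
     A-+ f h = ΣL-cong qs (λ α → *-congʳ (ψ-cong (distribˡ _ f h) ◦ ψ-+ _ _) ◦ distribʳ _ _ _) ◦ ΣL-+ (Φ f) (Φ h) qs
     A-* : ∀ {a} f → XF a → A (a * f) ≈ a * A f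
     A-* {a} f xf = ΣL-cong qs (λ α → *-congʳ (ψ-cong (solveR 3 (λ m a f → m :* (a :* f) := a :* (m :* f)) refl _ a f) ◦ ψ-XF xf _) ◦ *-assoc a _ _) ◦ ΣL-*ˡ a (Φ f) qs
     A-0 : A 0# ≈ 0#
     A-0 = ΣL-zero qs (λ α _ → *-congʳ (ψ-cong (zeroʳ _) ◦ (λ-0)) ◦ zeroˡ _)
       where λ-0 : ψ 0# ≈ 0#
             λ-0 = ψ-ΣL {A = ℕ} (λ _ → 0#) []
     step : ∀ {mu} → Below mu → ∀ a → a * Mat nu mu ≈ s * (a * A (mS mu))
     step {mu} pm a = *-congˡ (Entries.angle-entry pm pn la) ◦ solveR 3 (λ a s x → a :* (s :* x) := s :* (a :* x)) refl a s _
     terms-entry : ∀ L → All (λ { (mu , a) → StrictlyBelow la mu × XFree a }) L → ΣL L (λ { (mu , a) → a * Mat nu mu }) ≈ s * ΣL L (λ { (mu , a) → a * A (mS mu) })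
     terms-entry [] [] = sym (zeroʳ s)
     terms-entry ((mu , a) ∷ L) ((b , xf) ∷ h) = +-cong (step (below-part partition fits b) a) (terms-entry L h) ◦ sym (distribˡ s _ _)
     terms-A : ∀ L → All (λ { (mu , a) → StrictlyBelow la mu × XFree a }) L → A (ΣL L (λ { (mu , a) → a * mS mu })) ≈ ΣL L (λ { (mu , a) → a * A (mS mu) })
     terms-A [] [] = A-0
     terms-A ((mu , a) ∷ L) ((b , xf) ∷ h) = A-+ _ _ ◦ +-cong (A-* (mS mu) (XFree-XF xf)) (terms-A L h)
     A-J₀ : A J₀ ≈ c * A (mS la) + ΣL L (λ { (mu , a) → a * A (mS mu) })
     A-J₀ = A-+ _ _ ◦ +-cong (A-* (mS la) (xf-cPoly la)) (terms-A L terms)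

   combined-mSym : combined (mSym n) ≈ J
   combined-mSym = +-cong (*-congˡ (reflexive (P.sym (mSym-def la)))) (ΣL-cong L (λ { (mu , a) → *-congˡ (reflexive (P.sym (mSym-def mu))) })) ◦ sym J≈J₀

   -- Without the first row and column the labels are the partitions below λ on both sides. The
   -- matrix is triangular for `statP`, and the factors of `uPoly` stand on its diagonal.
   minor : detF entryAt rows (map column ms) ≈ uPoly n la ms
   minor = detF-map entryAt Mat column ms ms ◦ TriangularDet.det-diagonal Mat Below (statP n) (λ pa pc ne nl → Entries.entry-zero pc pa la ne nl) ms unique (All.tabulate ms-below) ◦
     diagonal ms (All.tabulate ms-below) ◦ reflexive (prodP-def (map (λ mu → brk (pad n (conj la)) -P brk (pad n (conj mu))) ms))
     where
     diagonal : ∀ l → All Below l → Π (map (λ mu → Mat mu mu) l) ≈ Π (map (λ mu → brk (pad n (conj la)) -P brk (pad n (conj mu))) l)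
     diagonal [] [] = refl
     diagonal (mu ∷ l) (p ∷ ps) = *-cong (Diagonal.entry-diagonal p la ◦ reflexive (sub-def _ _)) (diagonal l ps)

   Ddet-detF : Ddet n la ms ≈ detF entryAt (mSym n ∷ rows) (map column (la ∷ ms))
   Ddet-detF = reflexive (cong det matrix ∙ cong (λ k → detN k (map (λ r → map (entryAt r) (map column (la ∷ ms))) (mSym n ∷ rows))) (LP.length-map _ (mSym n ∷ rows))) ◦
     detN-detF entryAt (mSym n ∷ rows) (map column (la ∷ ms)) (cong suc (LP.length-map Mat ms ∙ P.sym (LP.length-map column ms)))
     where
     matrix : Dmat n la ms ≡ map (λ r → map (entryAt r) (map column (la ∷ ms))) (mSym n ∷ rows)
     matrix = cong₂ _∷_ (LP.map-∘ (la ∷ ms)) (LP.map-cong (λ mu → LP.map-∘ (la ∷ ms)) ms ∙ LP.map-∘ ms)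

   repeated : ∀ {mu} → mu ∈ ms → detF entryAt (mSym n ∷ rows) (map column (mu ∷ ms)) ≈ 0#
   repeated {mu} m with MemP.∈-∃++ m
   ... | p , s , P.refl = reflexive (cong (λ l → detF entryAt (mSym n ∷ rows) (column mu ∷ l)) (LP.map-++ column p (mu ∷ s))) ◦ det-repeat entryAt (mSym n ∷ rows) [] (column mu) (map column p) (map column s)

   -- Replacing the first column by the combination of all columns that gives J leaves only its top entry.
   cramer : uPoly n la ms * J ≈ c * Ddet n la ms
   cramer = sym (begin
     c * Ddet n la ms ≈⟨ *-congˡ Ddet-detF ⟩
     c * D la ≈⟨ sym (+-congˡ (others L terms) ◦ +-identityʳ _) ⟩
     c * D la + ΣL L (λ { (mu , a) → a * D mu }) ≈⟨ sym (det-linear entryAt ((la , c) ∷ L) proj₂ (column ∘ proj₁) combined (mSym n ∷ rows) (All.universal (λ _ → refl) _) (map column ms)) ⟩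
     detF entryAt (mSym n ∷ rows) (combined ∷ map column ms) ≈⟨ +-cong (*-cong (*-identityˡ _ ◦ combined-mSym) minor) (Σs-zero (map column ms) (λ p k s _ → *-congˡ (det-zero-column entryAt combined rows zeros-below (p ++ s)) ◦ zeroʳ _)) ◦ +-identityʳ _ ⟩
     J * uPoly n la ms ≈⟨ *-comm J _ ⟩
     uPoly n la ms * J ∎)
     where
     D : List ℕ → Poly n
     D mu = detF entryAt (mSym n ∷ rows) (map column (mu ∷ ms))
     zeros-below : All (λ r → combined r ≈ 0#) rows
     zeros-below = AllP.map⁺ (All.tabulate annihilated-row)
     others : ∀ L → All (λ { (mu , a) → StrictlyBelow la mu × XFree a }) L → ΣL L (λ { (mu , a) → a * D mu }) ≈ 0#
     others [] [] = refl
     others ((mu , a) ∷ L) ((b , xf) ∷ h) = +-cong (*-congˡ (repeated (all-below b)) ◦ zeroʳ a) (others L h) ◦ +-identityˡ _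

theorem3p3 : (n : ℕ) (la : List ℕ) → IsPartition la → size la ≤ n →
    (ms : List (List ℕ)) → Unique ms →
    (∀ mu → (mu ∈ ms → StrictlyBelow la mu) × (StrictlyBelow la mu → mu ∈ ms)) →
    (J : Poly n) → IsIntegralMacdonald n la J →
    uPoly n la ms *P J ≈P cPoly n la *P Ddet n la ms
theorem3p3 n la partition fits ms unique char J ((L , terms , J≈) , eigen) = P.subst₂ _≈P_ (mulP-def (uPoly n la ms) J) (mulP-def (cPoly n la) (Ddet n la ms))
  (≋⇒≈P (Main.Cramer.cramer n partition fits ms unique (λ {mu} → proj₁ (char mu)) (λ {mu} → proj₂ (char mu)) L terms J
    (P.subst (J ≈P_) (P.sym (Main.combination-def n la L)) J≈) eigen))
  where open Polynomials
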